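{- Let $\mathcal{M}$ be the family of $3$-graphs defined in the context. For every $\delta>0$ there exist $\epsilon>0$ and $n_0$ such that for all $n\ge n_0$ the following holds: every $\mathcal{M}$-free $3$-graph on $n$ vertices with at least $2n^3/27-\epsilon n^3$ edges can be transformed into a $3$-graph that is either semibipartite or $\mathcal{G}^2_6$-colorable by removing at most $\delta n$ vertices. Moreover, $\xi(\mathcal{M})=2$.
   Context: A $3$-graph is a set of $3$-element subsets (edges) of a finite vertex set; removing a vertex deletes it together with all edges containing it. $F\subset\mathcal{H}$ means $\mathcal{H}$ has a subgraph isomorphic to $F$; $\mathcal{H}$ is $\mathcal{M}$-free if it contains no member of $\mathcal{M}$. $F[S]$ is the induced subgraph on $S$. The transversal number $\tau(\mathcal{H})$ is the minimum size of a vertex set meeting every edge ($0$ for the empty $3$-graph). $K_5^{3- }$ is the $3$-graph on $5$ vertices with all but one of the $10$ triples. For $\ell\ge2$, $\mathcal{K}^3_{\ell+1}$ is the collection of all $3$-graphs $F$ on at most $(\ell+1)+\binom{\ell+1}{2}$ vertices having an $(\ell+1)$-set $S$ (a core) every pair of which lies in an edge of $F$. $\mathcal{G}^1_n$: vertex set $A\cup B$ disjoint, $|A|=\lfloor n/3\rfloor$, $|B|=\lceil 2n/3\rceil$, edges all triples with exactly one vertex in $A$. $\mathcal{G}^2_6$: vertex set $[6]$, edges all triples except $\{1,2,3\},\{1,2,6\},\{3,4,5\},\{4,5,6\}$. A blowup of a $3$-graph $\mathcal{T}$ on $[s]$ replaces each vertex $i$ by a nonempty set $V_i$ (pairwise disjoint)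 and each edge $\{i,j,k\}$ by all triples with one vertex in each of $V_i,V_j,V_k$. For $n>6$, $\mathcal{G}^2_n$ is a blowup of $\mathcal{G}^2_6$ on $n$ vertices with the maximum number of edges. $\mathcal{M}=M_1\cup M_2\cup M_3$: $M_1=\{K_5^{3- }\}$; $M_2$ = all $F\in\mathcal{K}^3_7$ having a core $S$ with $\tau(F[S])\ge2$; $M_3$ = all $F\in\mathcal{K}^3_6$ with $F\not\subset\mathcal{G}^1_n$ and $F\not\subset\mathcal{G}^2_n$ for all $n$. A $3$-graph $\mathcal{H}$ is semibipartite if $V(\mathcal{H})$ has a partition $A\cup B$ with $|E\cap A|=1$, $|E\cap B|=2$ for all $E\in\mathcal{H}$; it is $\mathcal{G}^2_6$-colorable if it is a subgraph of a blowup of $\mathcal{G}^2_6$. With $\mathrm{ex}(n,\mathcal{F})$ the maximum number of edges of an $\mathcal{F}$-free $3$-graph on $n$ vertices: $\mathcal{F}$ is $t$-stable if there exist $m_0$ and $3$-graphs $\mathcal{H}^1_m,\dots,\mathcal{H}^t_m$ on $m$ vertices for each $m\ge m_0$ such that for every $\delta>0$ there are $\epsilon>0$, $n_0$ with: for $n\ge n_0$ every $\mathcal{F}$-free $\mathcal{H}$ on $n$ vertices with $|\mathcal{H}|>(1-\epsilon)\mathrm{ex}(n,\mathcal{F})$ can be transformed into some $\mathcal{H}^i_n$ by adding and removing at most $\delta|\mathcal{H}|$ edges. $\xi(\mathcal{F})$ is the minimum $t$ for which $\mathcal{F}$ is $t$-stable ($\infty$ if none). -}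

module Defs where

open import Data.Nat using (ℕ; zero; suc; _≤_; _<ᵇ_; _≡ᵇ_; _+_; _^_; _∸_; _/_)
open import Data.Nat.Combinatorics using (_C_)
open import Data.Bool using (Bool; true; false; _∧_; _∨_; _xor_; if_then_else_; not)
open import Data.Fin using (Fin; toℕ) renaming (zero to f0; suc to fs)
open import Data.List using (List; map; allFin)
open import Data.Nat.ListAction using (sum)
open import Data.Product using (Σ; ∃; _×_; _,_)
open import Data.Sum using (_⊎_)
open import Data.Empty using (⊥)
open import Relation.Binary.PropositionalEquality using (_≡_; _≢_)
open import Relation.Nullary using (¬_)
open import Function.Definitions using (Injective)
open import Data.Integer using (+_)
open import Data.Rational as ℚ using (ℚ)

-- 3-graphs on the vertex set Fin n.
-- A 3-graph is given by a Bool-valued function that is only consulted on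
-- strictly increasing triples a < b < c; the edge {a,b,c} is present iff
-- H evaluated at the sorted triple is true (see edge?).

Graph3 : ℕ → Set
Graph3 n = Fin n → Fin n → Fin n → Bool

_<F_ : ∀ {n} → Fin n → Fin n → Bool
a <F b = toℕ a <ᵇ toℕ b

inc : ∀ {n} → Graph3 n → Fin n → Fin n → Fin n → Bool
inc H x y z = (x <F y) ∧ ((y <F z) ∧ H x y z)

edge? : ∀ {n} → Graph3 n → Fin n → Fin n → Fin n → Bool
edge? H a b c = inc H a b c ∨ inc H a c b ∨ inc H b a c
              ∨ inc H b c a ∨ inc H c a b ∨ inc H c b a

sumFin : (n : ℕ) → (Fin n → ℕ) → ℕ
sumFin n f = sum (map f (allFin n))

b2n : Bool → ℕ
b2n true = 1
b2n false = 0

countTriples : (n : ℕ) → (Fin n → Fin n → Fin n → Bool) → ℕ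
countTriples n P = sumFin n λ a → sumFin n λ b → sumFin n λ c →
  b2n ((a <F b) ∧ ((b <F c) ∧ P a b c))

∣_∣E : ∀ {n} → Graph3 n → ℕ
∣_∣E {n} H = countTriples n (edge? H)

card : ∀ {n} → (Fin n → Bool) → ℕ
card {n} T = sumFin n λ x → b2n (T x)

_⊂G_ : ∀ {m n} → Graph3 m → Graph3 n → Set
_⊂G_ {m} {n} F H = Σ (Fin m → Fin n) λ φ → Injective _≡_ _≡_ φ ×
  (∀ a b c → edge? F a b c ≡ true → edge? H (φ a) (φ b) (φ c) ≡ true)

-- induced subgraph on the image of an injective map ι : Fin k → Fin n
-- (i.e. F[S] for S = image of ι, relabelled by Fin k)
pull : ∀ {k n} → Graph3 n → (Fin k → Fin n) → Graph3 k
pull H ι a b c = edge? H (ι a) (ι b) (ι c)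

Family : Set₁
Family = (m : ℕ) → Graph3 m → Set

Free : Family → ∀ {n} → Graph3 n → Set
Free 𝓕 H = ∀ m (F : Graph3 m) → 𝓕 m F → ¬ (F ⊂G H)

Transversal : ∀ {k} → Graph3 k → (Fin k → Bool) → Set
Transversal G T = ∀ a b c → edge? G a b c ≡ true → (T a ∨ T b ∨ T c) ≡ true

τ≥2 : ∀ {k} → Graph3 k → Set
τ≥2 G = ∀ T → Transversal G T → 2 ≤ card T

IsCore : ∀ {m} (ℓ : ℕ) → Graph3 m → (Fin (suc ℓ) → Fin m) → Set
IsCore {m} ℓ F s = Injective _≡_ _≡_ s ×
  (∀ i j → i ≢ j → ∃ λ z → edge? F (s i) (s j) z ≡ true)

InK : (ℓ : ℕ) → Family
InK ℓ m F = (m ≤ suc ℓ + (suc ℓ C 2)) × ∃ λ s → IsCore ℓ F s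

K5⁻ : Graph3 5
K5⁻ a b c = not ((toℕ a ≡ᵇ 0) ∧ (toℕ b ≡ᵇ 1) ∧ (toℕ c ≡ᵇ 2))

exactlyOne : Bool → Bool → Bool → Bool
exactlyOne x y z = (b2n x + b2n y + b2n z) ≡ᵇ 1

G1 : (n : ℕ) → Graph3 n
G1 n a b c = exactlyOne (inA a) (inA b) (inA c)
  where
  inA : Fin n → Bool
  inA x = toℕ x <ᵇ (n / 3)

-- 𝒢^2_6 on Fin 6 (vertex i+1 of the paper is Fin element i):
-- all triples except {1,2,3},{1,2,6},{3,4,5},{4,5,6}
tripleIs : Fin 6 → Fin 6 → Fin 6 → ℕ → ℕ → ℕ → Bool
tripleIs a b c x y z = (toℕ a ≡ᵇ x) ∧ (toℕ b ≡ᵇ y) ∧ (toℕ c ≡ᵇ z)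

G26 : Graph3 6
G26 a b c = not (tripleIs a b c 0 1 2 ∨ tripleIs a b c 0 1 5
               ∨ tripleIs a b c 2 3 4 ∨ tripleIs a b c 3 4 5)

Surjective6 : ∀ {N} → (Fin N → Fin 6) → Set
Surjective6 {N} π = ∀ i → ∃ λ x → π x ≡ i

-- the blowup of 𝒢^2_6 with parts V_i = π⁻¹(i) (π surjective)
Blow : ∀ {N} → (Fin N → Fin 6) → Graph3 N
Blow π a b c = edge? G26 (π a) (π b) (π c)

MaxBlow : ∀ {N} → (Fin N → Fin 6) → Set
MaxBlow {N} π = Surjective6 π ×
  (∀ (ρ : Fin N → Fin 6) → Surjective6 ρ → ∣ Blow ρ ∣E ≤ ∣ Blow π ∣E)

M₁ : Family
M₁ 5 F = ∀ a b c → edge? F a b c ≡ edge? K5⁻ a b c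
M₁ _ F = ⊥

M₂ : Family
M₂ m F = (m ≤ 7 + (7 C 2)) × ∃ λ s → IsCore 6 F s × τ≥2 (pull F s)

M₃ : Family
M₃ m F = InK 5 m F × (∀ n → ¬ (F ⊂G G1 n))
  × (∀ n (π : Fin n → Fin 6) → 6 ≤ n → MaxBlow π → ¬ (F ⊂G Blow π))

𝓜 : Family
𝓜 m F = M₁ m F ⊎ M₂ m F ⊎ M₃ m F

Semibipartite : ∀ {k} → Graph3 k → Set
Semibipartite G = Σ (Fin _ → Bool) λ A →
  ∀ a b c → edge? G a b c ≡ true → exactlyOne (A a) (A b) (A c) ≡ true

G26Colorable : ∀ {k} → Graph3 k → Set
G26Colorable G = ∃ λ N → Σ (Fin N → Fin 6) λ π →
  Surjective6 π × (G ⊂G Blow π)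

ℕ→ℚ : ℕ → ℚ
ℕ→ℚ n = (+ n) ℚ./ 1

IsEx : Family → ℕ → ℕ → Set
IsEx 𝓕 n e = (Σ (Graph3 n) λ H → Free 𝓕 H × ∣ H ∣E ≡ e)
           × (∀ (H : Graph3 n) → Free 𝓕 H → ∣ H ∣E ≤ e)

open import Data.Fin.Permutation using (Permutation′; _⟨$⟩ʳ_)

editDist : ∀ {n} → Graph3 n → Graph3 n → Permutation′ n → ℕ
editDist {n} H K σ = countTriples n λ a b c →
  edge? H a b c xor edge? K (σ ⟨$⟩ʳ a) (σ ⟨$⟩ʳ b) (σ ⟨$⟩ʳ c)

Stable : Family → ℕ → Set
Stable 𝓕 t = Σ ℕ λ m₀ → Σ (Fin t → (m : ℕ) → Graph3 m) λ 𝓗 →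
  ∀ (δ : ℚ) → ℚ.0ℚ ℚ.< δ → Σ ℚ λ ε → ℚ.0ℚ ℚ.< ε × Σ ℕ λ n₀ →
    ∀ n → n₀ ≤ n → m₀ ≤ n → ∀ e → IsEx 𝓕 n e →
    ∀ (H : Graph3 n) → Free 𝓕 H →
      (ℚ.1ℚ ℚ.- ε) ℚ.* ℕ→ℚ e ℚ.< ℕ→ℚ ∣ H ∣E →
      Σ (Fin t) λ i → Σ (Permutation′ n) λ σ →
        ℕ→ℚ (editDist H (𝓗 i n) σ) ℚ.≤ δ ℚ.* ℕ→ℚ ∣ H ∣E

ξ≡ : Family → ℕ → Set
ξ≡ 𝓕 t = Stable 𝓕 t × (∀ s → s Data.Nat.< t → ¬ Stable 𝓕 s)

{-# OPTIONS --safe #-}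
module Submission where

-- Let T(w) be the sum of w(a)w(b)w(c) over the ordered edges of H.  If u and v lie in no common edge
-- and have positive weight, moving weight from the one of smaller degree to the other does not decrease
-- T; this ends with a support whose pairs are all covered.  There 𝓜-freeness leaves only a star or a
-- subgraph of G26, and sum-of-squares identities for the two Lagrangian polynomials give 9T ≤ 4(Σw)³.
-- Followed backwards one unit at a time, the moves preserve that the vertices of nearly maximal degree
-- are coloured by one of the two patterns: a new vertex v of large degree can be coloured, because an
-- edge at v violating every colour would, together with generic vertices of the colour classes, span a
-- covered set of 6 or 7 vertices excluded by 𝓜.  The same identities force nearly balanced classes,
-- hence small edit distance to one of two graphs; these are far apart, as G26 is not semibipartite.

-- The number of unit moves is unbounded, so no move may lose accuracy. The invariant is therefore
-- exact: all of `high? w Kτ` is coloured, and this set is recomputed from w at each move. A move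
-- lowers a degree by at most 2Σw, so the old and the new set both satisfy one slightly weaker
-- degree condition for the same weights; the new vertices join the coloured set one at a time while
-- the weights stay fixed, and the surplus is then discarded.
--
-- Weights are natural numbers and estimates are polynomial inequalities over ℕ with denominators
-- cleared; ℚ enters only at the end. The scales form a chain. `R` exceeds 57 · 100: 56 = 7 + 7²
-- pays for choosing up to seven generic vertices, from sets of relative weight at least 1/100. At
-- scale `R₁` = 4R² few bad edges at the new vertex make its missing degree small at scale `R`. `R₂`
-- = 100R₁ lets sets of relative weight 1/R₁ count as large. `τ` = 2R₂² makes coloured vertices
-- small at all these scales, and `L` = τ² compensates the square root lost between edge counts and
-- degrees.

open import Defs
open import Data.Nat using (ℕ; zero; suc; _+_; _*_; _∸_; _^_; _≤_; _<_; _≤?_; _<?_; _<ᵇ_; _≤ᵇ_; _≡ᵇ_; z≤n; s≤s; NonZero; nonZero; ∣_-_∣; _/_; _%_; >-nonZero; s≤s⁻¹)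
open import Data.Nat.Properties hiding (_≟_)
open import Data.Nat.Tactic.RingSolver using (solve-∀)
open import Data.Bool using (Bool; true; false; _∧_; _∨_; _xor_; if_then_else_; not; T)
open import Data.Fin using (Fin; zero; suc; toℕ; _≟_; inject≤; _↑ʳ_; punchIn)
open import Data.Fin.Permutation using (Permutation′; _⟨$⟩ʳ_; _⟨$⟩ˡ_; transpose; _∘ₚ_; inverseˡ; inverseʳ) renaming (id to idₚ; flip to invₚ)
open import Data.List using (List; []; _∷_; map; _++_; length; allFin; filterᵇ)
open import Data.Bool.ListAction using (any)
open import Data.List.Relation.Unary.All using (All; []; _∷_)
open import Data.Product using (Σ; ∃; _×_; _,_; proj₁; proj₂)
open import Data.Sum using (_⊎_; inj₁; inj₂; [_,_]′)
open import Data.Empty using (⊥; ⊥-elim)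
open import Data.Unit using (tt)
open import Function using (_∘_; id; case_of_)
open import Function.Definitions using (Injective)
open import Relation.Binary.PropositionalEquality using (_≡_; _≢_; refl; sym; trans; cong; cong₂; subst; subst₂; module ≡-Reasoning)
open import Relation.Nullary using (¬_; Dec; yes; no; does)
import Data.Nat.ListAction
open import Relation.Binary.Definitions using (tri<; tri≈; tri>)
open import Data.Bool.Solver using (module ∨-∧-Solver)
import Data.Fin.Properties as Finₚ
import Data.List.Properties as Listₚ
open import Data.List.Relation.Unary.Any using (here; there)
open import Data.List.Membership.Propositional using (_∈_)
open import Data.List.Membership.Propositional.Properties using (∈-map⁺; ∈-++⁺ˡ; ∈-++⁺ʳ; ∈-allFin)
open import Relation.Nullary.Decidable using (_×-dec_; _⊎-dec_; _→-dec_; ¬?)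
import Data.Bool.Properties as Boolₚ
open import Data.Nat.DivMod using (_mod_)
open import Data.Vec as Vec using (Vec; []; _∷_)
import Data.List.Relation.Unary.All as All
import Data.Vec.Properties as Vecₚ
import Data.Nat.DivMod
open import Data.Rational as ℚ using (ℚ; 0ℚ; 1ℚ; toℚᵘ)
import Data.Integer as ℤ
import Data.Integer.Properties as ℤₚ
import Data.Rational.Properties as ℚₚ
import Data.Rational.Unnormalised as ℚᵘ
import Data.Rational.Unnormalised.Properties as ℚᵘₚ
open import Data.Rational.Solver using (module +-*-Solver)

-- Booleans and inequalities

true≢false : true ≢ false
true≢false ()

bool-ext : ∀ {a b : Bool} → (a ≡ true → b ≡ true) → (b ≡ true → a ≡ true) → a ≡ b
bool-ext {false} {false} _ _ = refl
bool-ext {false} {true} _ g = g refl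
bool-ext {true} f _ = sym (f refl)

∧-true : ∀ {a b} → (a ∧ b) ≡ true → a ≡ true × b ≡ true
∧-true {true} {true} _ = refl , refl

∨-true : ∀ {a b} → (a ∨ b) ≡ true → (a ≡ true) ⊎ (b ≡ true)
∨-true {true} _ = inj₁ refl
∨-true {false} p = inj₂ p

∨-introʳ : ∀ a {b} → b ≡ true → (a ∨ b) ≡ true
∨-introʳ true _ = refl
∨-introʳ false p = p

∨-introˡ : ∀ {a} b → a ≡ true → (a ∨ b) ≡ true
∨-introˡ _ refl = refl

∧-intro : ∀ {a b} → a ≡ true → b ≡ true → (a ∧ b) ≡ true
∧-intro refl refl = refl

not-true : ∀ {a} → not a ≡ true → a ≡ false
not-true {false} _ = refl

¬true : ∀ {a} → ¬ (a ≡ true) → a ≡ false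
¬true {false} _ = refl
¬true {true} p = ⊥-elim (p refl)

true? : (a : Bool) → (a ≡ true) ⊎ (a ≡ false)
true? true = inj₁ refl
true? false = inj₂ refl

b2n≤1 : ∀ b → b2n b ≤ 1
b2n≤1 false = z≤n
b2n≤1 true = s≤s z≤n

b2n-mono : ∀ {a b} → (a ≡ true → b ≡ true) → b2n a ≤ b2n b
b2n-mono {false} _ = z≤n
b2n-mono {true} f rewrite f refl = s≤s z≤n

≤-by : ∀ {n m} → (n ≤ᵇ m) ≡ true → n ≤ m
≤-by p = ≤ᵇ⇒≤ _ _ (subst T (sym p) tt)

-- Linear arithmetic by certificate: A ≤ B is the combination of hypotheses, r the slack.
≤-cert : ∀ {x y A B} r → A ≤ B → y + A ≡ x + B + r → x ≤ y
≤-cert {x} {y} {A} {B} r A≤B eq = +-cancelʳ-≤ A x y (begin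
  x + A ≤⟨ +-monoʳ-≤ x A≤B ⟩
  x + B ≤⟨ m≤m+n _ r ⟩
  x + B + r ≡⟨ sym eq ⟩
  y + A ∎)
  where open ≤-Reasoning

infixr 6 _⊕_
_⊕_ : ∀ {a b c d} → a ≤ b → c ≤ d → a + c ≤ b + d
_⊕_ = +-mono-≤

infixr 7 _⊛_
_⊛_ : ∀ k {a b} → a ≤ b → k * a ≤ k * b
k ⊛ p = *-monoʳ-≤ k p

-- Termwise estimates of weighted sums are available only on the support of the weight; off the
-- support both sides vanish.
guarded : ∀ a {y z} → (a ≢ 0 → y ≤ z) → a * y ≤ a * z
guarded zero _ = z≤n
guarded (suc a) p = *-monoʳ-≤ (suc a) (p λ ())

-- Finite sums

opaque
  ∑ : ∀ {n} → (Fin n → ℕ) → ℕ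
  ∑ {zero} f = 0
  ∑ {suc n} f = f zero + ∑ (f ∘ suc)

  ∑-suc : ∀ {n} (f : Fin (suc n) → ℕ) → ∑ f ≡ f zero + ∑ (f ∘ suc)
  ∑-suc f = refl

  ∑-empty : (f : Fin 0 → ℕ) → ∑ f ≡ 0
  ∑-empty f = refl

  ∑-cong : ∀ {n} {f g : Fin n → ℕ} → (∀ x → f x ≡ g x) → ∑ f ≡ ∑ g
  ∑-cong {zero} h = refl
  ∑-cong {suc n} h = cong₂ _+_ (h zero) (∑-cong (h ∘ suc))

  ∑-mono : ∀ {n} {f g : Fin n → ℕ} → (∀ x → f x ≤ g x) → ∑ f ≤ ∑ g
  ∑-mono {zero} h = z≤n
  ∑-mono {suc n} h = +-mono-≤ (h zero) (∑-mono (h ∘ suc))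

  ∑-+ : ∀ {n} (f g : Fin n → ℕ) → ∑ (λ x → f x + g x) ≡ ∑ f + ∑ g
  ∑-+ {zero} f g = refl
  ∑-+ {suc n} f g rewrite ∑-+ (f ∘ suc) (g ∘ suc) = lem (f zero) (g zero) _ _
    where lem : ∀ a b c d → a + b + (c + d) ≡ a + c + (b + d)
          lem = solve-∀

  ∑-*ˡ : ∀ {n} k (f : Fin n → ℕ) → ∑ (λ x → k * f x) ≡ k * ∑ f
  ∑-*ˡ {zero} k f = sym (*-zeroʳ k)
  ∑-*ˡ {suc n} k f rewrite ∑-*ˡ k (f ∘ suc) = sym (*-distribˡ-+ k (f zero) _)

  ∑-const : ∀ {n} k → ∑ {n} (λ _ → k) ≡ n * k
  ∑-const {zero} k = refl
  ∑-const {suc n} k = cong (k +_) (∑-const {n} k)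

  -- Averaging, the main source of vertices in the proof: a cost whose total is below the total
  -- budget is below it somewhere.
  ∑-pick : ∀ {n} {f g : Fin n → ℕ} → ∑ f < ∑ g → ∃ λ x → f x < g x
  ∑-pick {suc n} {f} {g} lt with f zero <? g zero
  ... | yes p = zero , p
  ... | no ¬p with ∑-pick {n} (+-cancelˡ-< (f zero) _ _ (<-≤-trans lt (+-monoˡ-≤ (∑ (g ∘ suc)) (≮⇒≥ ¬p))))
  ...   | x , q = suc x , q

  term≤∑ : ∀ {n} (f : Fin n → ℕ) x → f x ≤ ∑ f
  term≤∑ {suc n} f zero = m≤m+n _ _
  term≤∑ {suc n} f (suc x) = ≤-trans (term≤∑ (f ∘ suc) x) (m≤n+m _ (f zero))

  sumFin≡∑ : ∀ n (f : Fin n → ℕ) → sumFin n f ≡ ∑ f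
  sumFin≡∑ zero f = refl
  sumFin≡∑ (suc n) f = cong (f zero +_) (trans (cong Data.Nat.ListAction.sum (Listₚ.map-tabulate suc f)) (trans (cong Data.Nat.ListAction.sum (sym (Listₚ.map-tabulate id (f ∘ suc)))) (sumFin≡∑ n (f ∘ suc))))

∑-zero : ∀ {n} → ∑ {n} (λ _ → 0) ≡ 0
∑-zero {n} = trans (∑-const {n} 0) (*-zeroʳ n)

∑-*ʳ : ∀ {n} (f : Fin n → ℕ) k → ∑ (λ x → f x * k) ≡ ∑ f * k
∑-*ʳ f k = trans (∑-cong λ x → *-comm (f x) k) (trans (∑-*ˡ k f) (*-comm k _))

opaque
  unfolding ∑
  ∑-swap : ∀ {m n} (f : Fin m → Fin n → ℕ) → ∑ (λ x → ∑ (λ y → f x y)) ≡ ∑ (λ y → ∑ (λ x → f x y))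
  ∑-swap {zero} {n} f = sym (∑-zero {n})
  ∑-swap {suc m} {n} f = trans (cong (∑ (f zero) +_) (∑-swap (f ∘ suc))) (sym (∑-+ (f zero) (λ y → ∑ λ x → f (suc x) y)))

  ∑-δ : ∀ {n} (x : Fin n) (f : Fin n → ℕ) → ∑ (λ y → b2n (does (x ≟ y)) * f y) ≡ f x
  ∑-δ {suc n} zero f = trans (cong₂ _+_ (*-identityˡ (f zero)) (∑-zero {n})) (+-identityʳ _)
  ∑-δ {suc n} (suc x) f = ∑-δ x (f ∘ suc)

-- Symmetric kernels and ordered counts

record Symmetric₃ {A B : Set} (k : A → A → A → B) : Set where
  constructor symmetric₃
  field
    swap₁₂ : ∀ a b c → k a b c ≡ k b a c
    swap₂₃ : ∀ a b c → k a b c ≡ k a c b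

open Symmetric₃ public

Irreflexive₃ : {A : Set} → (A → A → A → Bool) → Set
Irreflexive₃ k = ∀ a c → k a a c ≡ false

module _ {A B : Set} {k : A → A → A → B} (s : Symmetric₃ k) where
  rot : ∀ a b c → k a b c ≡ k b c a
  rot a b c = trans (swap₁₂ s a b c) (swap₂₃ s b a c)

  rot² : ∀ a b c → k a b c ≡ k c a b
  rot² a b c = trans (rot a b c) (rot b c a)

  swap₁₃ : ∀ a b c → k a b c ≡ k c b a
  swap₁₃ a b c = trans (rot a b c) (swap₁₂ s b c a)

symmetric₃-∘ : {A B C : Set} {k : A → A → A → B} (f : C → A) → Symmetric₃ k → Symmetric₃ (λ a b c → k (f a) (f b) (f c))
symmetric₃-∘ f s = symmetric₃ (λ a b c → swap₁₂ s (f a) (f b) (f c)) (λ a b c → swap₂₃ s (f a) (f b) (f c))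

symmetric₃-map : {A B C : Set} {k : A → A → A → B} (g : B → C) → Symmetric₃ k → Symmetric₃ (λ a b c → g (k a b c))
symmetric₃-map g s = symmetric₃ (λ a b c → cong g (swap₁₂ s a b c)) (λ a b c → cong g (swap₂₃ s a b c))

<F⇒< : ∀ {n} {a b : Fin n} → (a <F b) ≡ true → toℕ a < toℕ b
<F⇒< {a = a} {b} p = <ᵇ⇒< (toℕ a) (toℕ b) (subst T (sym p) tt)

<⇒<F : ∀ {n} {a b : Fin n} → toℕ a < toℕ b → (a <F b) ≡ true
<⇒<F {a = a} {b} p with a <F b | <⇒<ᵇ p
... | true | _ = refl

<F-irrefl : ∀ {n} (a : Fin n) → (a <F a) ≡ false
<F-irrefl a = ¬true λ p → <-irrefl refl (<F⇒< {a = a} {a} p)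

<F-total : ∀ {n} {a b : Fin n} → a ≢ b → (b <F a) ≡ not (a <F b)
<F-total {a = a} {b} a≢b with <-cmp (toℕ a) (toℕ b)
... | tri< p _ ¬q rewrite <⇒<F {a = a} {b} p = ¬true λ r → ¬q (<F⇒< {a = b} {a} r)
... | tri≈ _ p _ = ⊥-elim (a≢b (Finₚ.toℕ-injective p))
... | tri> ¬q _ p rewrite <⇒<F {a = b} {a} p | ¬true {a <F b} (λ r → ¬q (<F⇒< {a = a} {b} r)) = refl

<F-trans : ∀ {n} {a b c : Fin n} → (a <F b) ≡ true → (b <F c) ≡ true → (a <F c) ≡ true
<F-trans {a = a} {b} {c} p q = <⇒<F {a = a} {c} (<-trans (<F⇒< {a = a} {b} p) (<F⇒< {a = b} {c} q))

module _ {n : ℕ} (H : Graph3 n) where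
  private
    open ∨-∧-Solver using (solve; _:=_; _:+_)
    p₁ : ∀ a b c d e f → a ∨ b ∨ c ∨ d ∨ e ∨ f ≡ c ∨ d ∨ a ∨ b ∨ f ∨ e
    p₁ = solve 6 (λ a b c d e f → a :+ (b :+ (c :+ (d :+ (e :+ f)))) := c :+ (d :+ (a :+ (b :+ (f :+ e))))) refl
    p₂ : ∀ a b c d e f → a ∨ b ∨ c ∨ d ∨ e ∨ f ≡ b ∨ a ∨ e ∨ f ∨ c ∨ d
    p₂ = solve 6 (λ a b c d e f → a :+ (b :+ (c :+ (d :+ (e :+ f)))) := b :+ (a :+ (e :+ (f :+ (c :+ d))))) refl

  edge?-symmetric : Symmetric₃ (edge? H)
  edge?-symmetric .swap₁₂ a b c = p₁ (inc H a b c) (inc H a c b) (inc H b a c) (inc H b c a) (inc H c a b) (inc H c b a)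
  edge?-symmetric .swap₂₃ a b c = p₂ (inc H a b c) (inc H a c b) (inc H b a c) (inc H b c a) (inc H c a b) (inc H c b a)

  inc-sorted : ∀ a b c → inc H a b c ≡ true → (a <F b) ≡ true × (b <F c) ≡ true × H a b c ≡ true
  inc-sorted a b c p with ∧-true {a <F b} p
  ... | q , r = q , ∧-true {b <F c} r

  edge?-inc : ∀ a b c → edge? H a b c ≡ true → (inc H a b c ≡ true) ⊎ (inc H a c b ≡ true) ⊎ (inc H b a c ≡ true) ⊎ (inc H b c a ≡ true) ⊎ (inc H c a b ≡ true) ⊎ (inc H c b a ≡ true)
  edge?-inc a b c p with ∨-true {inc H a b c} p
  ... | inj₁ q = inj₁ q
  ... | inj₂ p with ∨-true {inc H a c b} p
  ... | inj₁ q = inj₂ (inj₁ q)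
  ... | inj₂ p with ∨-true {inc H b a c} p
  ... | inj₁ q = inj₂ (inj₂ (inj₁ q))
  ... | inj₂ p with ∨-true {inc H b c a} p
  ... | inj₁ q = inj₂ (inj₂ (inj₂ (inj₁ q)))
  ... | inj₂ p with ∨-true {inc H c a b} p
  ... | inj₁ q = inj₂ (inj₂ (inj₂ (inj₂ (inj₁ q))))
  ... | inj₂ q = inj₂ (inj₂ (inj₂ (inj₂ (inj₂ q))))

  edge?-irreflexive : Irreflexive₃ (edge? H)
  edge?-irreflexive a c = ¬true λ p → case edge?-inc a a c p of λ where
      (inj₁ q) → <⊥ (proj₁ (inc-sorted a a c q))
      (inj₂ (inj₁ q)) → let (u , v , _) = inc-sorted a c a q in <⊥ (<F-trans {a = a} {c} {a} u v)
      (inj₂ (inj₂ (inj₁ q))) → <⊥ (proj₁ (inc-sorted a a c q))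
      (inj₂ (inj₂ (inj₂ (inj₁ q)))) → let (u , v , _) = inc-sorted a c a q in <⊥ (<F-trans {a = a} {c} {a} u v)
      (inj₂ (inj₂ (inj₂ (inj₂ (inj₁ q))))) → <⊥ (proj₁ (proj₂ (inc-sorted c a a q)))
      (inj₂ (inj₂ (inj₂ (inj₂ (inj₂ q))))) → <⊥ (proj₁ (proj₂ (inc-sorted c a a q)))
    where
    <⊥ : (a <F a) ≡ true → ⊥
    <⊥ p = true≢false (trans (sym p) (<F-irrefl a))

  -- On a symmetric irreflexive function the sorting in edge? is invisible.
  edge?-collapse : Symmetric₃ H → Irreflexive₃ H → ∀ a b c → edge? H a b c ≡ H a b c
  edge?-collapse s i a b c = bool-ext to from
    where
    to : edge? H a b c ≡ true → H a b c ≡ true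
    to p with edge?-inc a b c p
    ... | inj₁ q = proj₂ (proj₂ (inc-sorted a b c q))
    ... | inj₂ (inj₁ q) = trans (swap₂₃ s a b c) (proj₂ (proj₂ (inc-sorted a c b q)))
    ... | inj₂ (inj₂ (inj₁ q)) = trans (swap₁₂ s a b c) (proj₂ (proj₂ (inc-sorted b a c q)))
    ... | inj₂ (inj₂ (inj₂ (inj₁ q))) = trans (rot s a b c) (proj₂ (proj₂ (inc-sorted b c a q)))
    ... | inj₂ (inj₂ (inj₂ (inj₂ (inj₁ q)))) = trans (rot² s a b c) (proj₂ (proj₂ (inc-sorted c a b q)))
    ... | inj₂ (inj₂ (inj₂ (inj₂ (inj₂ q)))) = trans (swap₁₃ s a b c) (proj₂ (proj₂ (inc-sorted c b a q)))
    up : ∀ x y z → H x y z ≡ true → (x <F y) ≡ true → (y <F z) ≡ true → edge? H x y z ≡ true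
    up x y z p q r = ∨-introˡ _ (∧-intro q (∧-intro r p))
    e = edge?-symmetric
    from : H a b c ≡ true → edge? H a b c ≡ true
    from p with <-cmp (toℕ a) (toℕ b) | <-cmp (toℕ b) (toℕ c) | <-cmp (toℕ a) (toℕ c)
    ... | tri≈ _ q _ | _ | _ rewrite Finₚ.toℕ-injective q = ⊥-elim (true≢false (trans (sym p) (i b c)))
    ... | _ | tri≈ _ q _ | _ rewrite Finₚ.toℕ-injective q = ⊥-elim (true≢false (trans (sym p) (trans (rot s a c c) (i c a))))
    ... | _ | _ | tri≈ _ q _ rewrite Finₚ.toℕ-injective q = ⊥-elim (true≢false (trans (sym p) (trans (swap₂₃ s c b c) (i c b))))
    ... | tri< q _ _ | tri< r _ _ | _ = up a b c p (<⇒<F {a = a} q) (<⇒<F {a = b} r)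
    ... | tri< q _ _ | tri> _ _ r | tri< t _ _ = trans (swap₂₃ e a b c) (up a c b (trans (sym (swap₂₃ s a b c)) p) (<⇒<F {a = a} t) (<⇒<F {a = c} r))
    ... | tri< q _ _ | tri> _ _ r | tri> _ _ t = trans (rot² e a b c) (up c a b (trans (sym (rot² s a b c)) p) (<⇒<F {a = c} t) (<⇒<F {a = a} q))
    ... | tri> _ _ q | tri< r _ _ | tri< t _ _ = trans (swap₁₂ e a b c) (up b a c (trans (sym (swap₁₂ s a b c)) p) (<⇒<F {a = b} q) (<⇒<F {a = a} t))
    ... | tri> _ _ q | tri< r _ _ | tri> _ _ t = trans (rot e a b c) (up b c a (trans (sym (rot s a b c)) p) (<⇒<F {a = b} r) (<⇒<F {a = c} t))
    ... | tri> _ _ q | tri> _ _ r | _ = trans (swap₁₃ e a b c) (up c b a (trans (sym (swap₁₃ s a b c)) p) (<⇒<F {a = c} r) (<⇒<F {a = b} q))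

∑³ : ∀ {n} → (Fin n → Fin n → Fin n → ℕ) → ℕ
∑³ f = ∑ λ a → ∑ λ b → ∑ λ c → f a b c

∑³-cong : ∀ {n} {f g : Fin n → Fin n → Fin n → ℕ} → (∀ a b c → f a b c ≡ g a b c) → ∑³ f ≡ ∑³ g
∑³-cong h = ∑-cong λ a → ∑-cong λ b → ∑-cong λ c → h a b c

∑³-mono : ∀ {n} {f g : Fin n → Fin n → Fin n → ℕ} → (∀ a b c → f a b c ≤ g a b c) → ∑³ f ≤ ∑³ g
∑³-mono h = ∑-mono λ a → ∑-mono λ b → ∑-mono λ c → h a b c

∑³-+ : ∀ {n} (f g : Fin n → Fin n → Fin n → ℕ) → ∑³ (λ a b c → f a b c + g a b c) ≡ ∑³ f + ∑³ g
∑³-+ f g = trans (∑-cong λ a → trans (∑-cong λ b → ∑-+ _ _) (∑-+ _ _)) (∑-+ _ _)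

∑³-+₆ : ∀ {n} (f g h i j k : Fin n → Fin n → Fin n → ℕ) → ∑³ (λ a b c → f a b c + g a b c + h a b c + i a b c + j a b c + k a b c) ≡ ∑³ f + ∑³ g + ∑³ h + ∑³ i + ∑³ j + ∑³ k
∑³-+₆ f g h i j k
  rewrite ∑³-+ (λ a b c → f a b c + g a b c + h a b c + i a b c + j a b c) k
        | ∑³-+ (λ a b c → f a b c + g a b c + h a b c + i a b c) j
        | ∑³-+ (λ a b c → f a b c + g a b c + h a b c) i
        | ∑³-+ (λ a b c → f a b c + g a b c) h
        | ∑³-+ f g = refl

∑³-swap₁₂ : ∀ {n} (f : Fin n → Fin n → Fin n → ℕ) → ∑³ f ≡ ∑³ (λ a b c → f b a c)
∑³-swap₁₂ f = ∑-swap _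

∑³-swap₂₃ : ∀ {n} (f : Fin n → Fin n → Fin n → ℕ) → ∑³ f ≡ ∑³ (λ a b c → f a c b)
∑³-swap₂₃ f = ∑-cong λ a → ∑-swap _

countTriples≡∑³ : ∀ n (P : Fin n → Fin n → Fin n → Bool) → countTriples n P ≡ ∑³ (λ a b c → b2n ((a <F b) ∧ ((b <F c) ∧ P a b c)))
countTriples≡∑³ n P = trans (sumFin≡∑ n _) (∑-cong λ a → trans (sumFin≡∑ n _) (∑-cong λ b → sumFin≡∑ n _))

private
  -- `p`, `q`, `r` stand for a < b, b < c, a < c. The hypotheses are transitivity and exclude the
  -- two cyclic truth assignments; each of the other six turns on exactly one summand.
  six-orders : ∀ p q r → (p ≡ true → q ≡ true → r ≡ true) → (p ≡ false → q ≡ false → r ≡ false) →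
    b2n (p ∧ (q ∧ true)) + b2n (r ∧ (not q ∧ true)) + b2n (not p ∧ (r ∧ true)) + b2n (q ∧ (not r ∧ true)) + b2n (not r ∧ (p ∧ true)) + b2n (not q ∧ (not p ∧ true)) ≡ 1
  six-orders true true true _ _ = refl
  six-orders true true false h _ = case h refl refl of λ ()
  six-orders true false true _ _ = refl
  six-orders true false false _ _ = refl
  six-orders false true true _ _ = refl
  six-orders false true false _ _ = refl
  six-orders false false true _ h = case h refl refl of λ ()
  six-orders false false false _ _ = refl

  kill : ∀ p q → b2n (p ∧ (q ∧ false)) ≡ 0
  kill true true = refl
  kill true false = refl
  kill false _ = refl

module _ {n : ℕ} (P : Fin n → Fin n → Fin n → Bool) (s : Symmetric₃ P) (i : Irreflexive₃ P) where
  private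
    t : Fin n → Fin n → Fin n → ℕ
    t a b c = b2n ((a <F b) ∧ ((b <F c) ∧ P a b c))

    orders : ∀ a b c → t a b c + t a c b + t b a c + t b c a + t c a b + t c b a ≡ b2n (P a b c)
    orders a b c rewrite sym (swap₂₃ s a b c) | sym (swap₁₂ s a b c) | sym (rot s a b c) | sym (rot² s a b c) | sym (swap₁₃ s a b c) with true? (P a b c)
    ... | inj₂ e rewrite e | kill (a <F b) (b <F c) | kill (a <F c) (c <F b) | kill (b <F a) (a <F c) | kill (b <F c) (c <F a) | kill (c <F a) (a <F b) | kill (c <F b) (b <F a) = refl
    ... | inj₁ e rewrite e
          | <F-total {a = a} {b} (λ { refl → true≢false (trans (sym e) (i a c)) })
          | <F-total {a = b} {c} (λ { refl → true≢false (trans (sym e) (trans (rot s a b b) (i b a))) })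
          | <F-total {a = a} {c} (λ { refl → true≢false (trans (sym e) (trans (swap₂₃ s a b a) (i a b))) })
          = six-orders (a <F b) (b <F c) (a <F c) (<F-trans {a = a} {b} {c}) λ p q → ¬true λ r → case <F-total {a = a} {b} (λ { refl → true≢false (trans (sym e) (i a c)) }) of λ eq → true≢false (trans (sym (<F-trans {a = a} {c} {b} r (trans (<F-total {a = b} {c} (λ { refl → true≢false (trans (sym e) (trans (rot s a b b) (i b a))) })) (cong not q)))) p)

  -- All later counting runs over ordered triples, where symmetric kernels need no sorting. The
  -- factor 6 is the price: a triple is increasing in exactly one of its orders.
  6*countTriples : 6 * countTriples n P ≡ ∑³ (λ a b c → b2n (P a b c))
  6*countTriples = begin
    6 * countTriples n P ≡⟨ cong (6 *_) (countTriples≡∑³ n P) ⟩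
    6 * ∑³ t ≡⟨ lem (∑³ t) ⟩
    ∑³ t + ∑³ t + ∑³ t + ∑³ t + ∑³ t + ∑³ t
      ≡⟨ cong₂ _+_ (cong₂ _+_ (cong₂ _+_ (cong₂ _+_ (cong (∑³ t +_) (∑³-swap₂₃ t)) (∑³-swap₁₂ t)) e₄) e₅) e₆ ⟩
    ∑³ t + ∑³ (λ a b c → t a c b) + ∑³ (λ a b c → t b a c) + ∑³ (λ a b c → t b c a) + ∑³ (λ a b c → t c a b) + ∑³ (λ a b c → t c b a)
      ≡⟨ sym (∑³-+₆ _ _ _ _ _ _) ⟩
    ∑³ (λ a b c → t a b c + t a c b + t b a c + t b c a + t c a b + t c b a) ≡⟨ ∑³-cong orders ⟩
    ∑³ (λ a b c → b2n (P a b c)) ∎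
    where
    open ≡-Reasoning
    lem : ∀ x → 6 * x ≡ x + x + x + x + x + x
    lem = solve-∀
    e₄ : ∑³ t ≡ ∑³ (λ a b c → t b c a)
    e₄ = trans (∑³-swap₂₃ t) (∑³-swap₁₂ _)
    e₅ : ∑³ t ≡ ∑³ (λ a b c → t c a b)
    e₅ = trans (∑³-swap₁₂ t) (∑³-swap₂₃ _)
    e₆ : ∑³ t ≡ ∑³ (λ a b c → t c b a)
    e₆ = trans e₅ (∑³-swap₁₂ _)

-- Trilinear forms

infixl 6 _⊞_
_⊞_ : ∀ {n} → (Fin n → ℕ) → (Fin n → ℕ) → Fin n → ℕ
(f ⊞ g) x = f x + g x

infixl 7 _⊡_
_⊡_ : ∀ {n} → ℕ → (Fin n → ℕ) → Fin n → ℕ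
(s ⊡ f) x = s * f x

Kernel : ℕ → Set
Kernel n = Fin n → Fin n → Fin n → ℕ

opaque
  -- Nested partial evaluations of a trilinear form. For a symmetric edge indicator `k`, `cube k w`
  -- is T(w) and `deg k w w x` is a third of its partial derivative at x, that is, the weighted
  -- number of ordered pairs forming an edge with x.
  codeg : ∀ {n} → Kernel n → (Fin n → ℕ) → Fin n → Fin n → ℕ
  codeg k g x b = ∑ λ c → g c * k x b c

  deg : ∀ {n} → Kernel n → (Fin n → ℕ) → (Fin n → ℕ) → Fin n → ℕ
  deg k f g x = ∑ λ b → f b * codeg k g x b

  form : ∀ {n} → Kernel n → (Fin n → ℕ) → (Fin n → ℕ) → (Fin n → ℕ) → ℕ
  form k f g h = ∑ λ a → f a * deg k g h a

  codeg≡ : ∀ {n} (k : Kernel n) g x b → codeg k g x b ≡ ∑ (λ c → g c * k x b c)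
  codeg≡ k g x b = refl

  deg≡ : ∀ {n} (k : Kernel n) f g x → deg k f g x ≡ ∑ (λ b → f b * codeg k g x b)
  deg≡ k f g x = refl

  form≡ : ∀ {n} (k : Kernel n) f g h → form k f g h ≡ ∑ (λ a → f a * deg k g h a)
  form≡ k f g h = refl

cube : ∀ {n} → Kernel n → (Fin n → ℕ) → ℕ
cube k f = form k f f f

⟦_⟧ : ∀ {n} → Fin n → Fin n → ℕ
⟦ x ⟧ y = b2n (does (x ≟ y))

∑-⟦⟧ : ∀ {n} (x : Fin n) → ∑ ⟦ x ⟧ ≡ 1
∑-⟦⟧ x = trans (∑-cong λ y → sym (*-identityʳ _)) (∑-δ x (λ _ → 1))

⟦⟧-self : ∀ {n} (x : Fin n) → ⟦ x ⟧ x ≡ 1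
⟦⟧-self x with x ≟ x
... | yes _ = refl
... | no p = ⊥-elim (p refl)

⟦⟧-other : ∀ {n} {x y : Fin n} → x ≢ y → ⟦ x ⟧ y ≡ 0
⟦⟧-other {x = x} {y} x≢y with x ≟ y
... | yes p = ⊥-elim (x≢y p)
... | no _ = refl

∑-scale : ∀ {n} s (f : Fin n → ℕ) → ∑ (s ⊡ f) ≡ s * ∑ f
∑-scale s f = ∑-*ˡ s f

∑-dist-swap : ∀ {m n} (f : Fin m → ℕ) (g : Fin n → ℕ) (F : Fin m → Fin n → ℕ) →
  ∑ (λ x → f x * ∑ (λ y → g y * F x y)) ≡ ∑ (λ y → g y * ∑ (λ x → f x * F x y))
∑-dist-swap f g F = begin
  ∑ (λ x → f x * ∑ (λ y → g y * F x y)) ≡⟨ ∑-cong (λ x → sym (∑-*ˡ (f x) _)) ⟩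
  ∑ (λ x → ∑ (λ y → f x * (g y * F x y))) ≡⟨ ∑-swap _ ⟩
  ∑ (λ y → ∑ (λ x → f x * (g y * F x y))) ≡⟨ ∑-cong (λ y → trans (∑-cong λ x → lem (f x) (g y) (F x y)) (∑-*ˡ (g y) _)) ⟩
  ∑ (λ y → g y * ∑ (λ x → f x * F x y)) ∎
  where
  open ≡-Reasoning
  lem : ∀ a b c → a * (b * c) ≡ b * (a * c)
  lem = solve-∀

private
  distrib : ∀ {n} (f g F : Fin n → ℕ) → ∑ (λ x → (f x + g x) * F x) ≡ ∑ (λ x → f x * F x) + ∑ (λ x → g x * F x)
  distrib f g F = trans (∑-cong λ x → *-distribʳ-+ (F x) (f x) (g x)) (∑-+ _ _)

  distribʳ : ∀ {n} (f F G : Fin n → ℕ) → ∑ (λ x → f x * (F x + G x)) ≡ ∑ (λ x → f x * F x) + ∑ (λ x → f x * G x)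
  distribʳ f F G = trans (∑-cong λ x → *-distribˡ-+ (f x) (F x) (G x)) (∑-+ _ _)

  scaleˡ : ∀ {n} s (f F : Fin n → ℕ) → ∑ (λ x → s * f x * F x) ≡ s * ∑ (λ x → f x * F x)
  scaleˡ s f F = trans (∑-cong λ x → *-assoc s (f x) (F x)) (∑-*ˡ s _)

opaque
  unfolding form
  codeg-cong : ∀ {n} {k k′ : Kernel n} {g g′} → (∀ a b c → k a b c ≡ k′ a b c) → (∀ x → g x ≡ g′ x) → ∀ x b → codeg k g x b ≡ codeg k′ g′ x b
  codeg-cong e eg x b = ∑-cong λ c → cong₂ _*_ (eg c) (e x b c)

  deg-cong : ∀ {n} {k k′ : Kernel n} {f f′ g g′} → (∀ a b c → k a b c ≡ k′ a b c) → (∀ x → f x ≡ f′ x) → (∀ x → g x ≡ g′ x) → ∀ x → deg k f g x ≡ deg k′ f′ g′ x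
  deg-cong e ef eg x = ∑-cong λ b → cong₂ _*_ (ef b) (codeg-cong e eg x b)

  form-cong : ∀ {n} {k k′ : Kernel n} {f f′ g g′ h h′} → (∀ a b c → k a b c ≡ k′ a b c) → (∀ x → f x ≡ f′ x) → (∀ x → g x ≡ g′ x) → (∀ x → h x ≡ h′ x) → form k f g h ≡ form k′ f′ g′ h′
  form-cong e ef eg eh = ∑-cong λ a → cong₂ _*_ (ef a) (deg-cong e eg eh a)

  codeg-mono : ∀ {n} {k k′ : Kernel n} {g g′} → (∀ a b c → k a b c ≤ k′ a b c) → (∀ x → g x ≤ g′ x) → ∀ x b → codeg k g x b ≤ codeg k′ g′ x b
  codeg-mono e eg x b = ∑-mono λ c → *-mono-≤ (eg c) (e x b c)

  deg-mono : ∀ {n} {k k′ : Kernel n} {f f′ g g′} → (∀ a b c → k a b c ≤ k′ a b c) → (∀ x → f x ≤ f′ x) → (∀ x → g x ≤ g′ x) → ∀ x → deg k f g x ≤ deg k′ f′ g′ x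
  deg-mono e ef eg x = ∑-mono λ b → *-mono-≤ (ef b) (codeg-mono e eg x b)

  deg-⊞ˡ : ∀ {n} (k : Kernel n) f f′ g x → deg k (f ⊞ f′) g x ≡ deg k f g x + deg k f′ g x
  deg-⊞ˡ k f f′ g x = distrib f f′ _

  deg-kernel-+ : ∀ {n} (k k′ : Kernel n) f g x → deg (λ a b c → k a b c + k′ a b c) f g x ≡ deg k f g x + deg k′ f g x
  deg-kernel-+ k k′ f g x = trans (∑-cong λ b → cong (f b *_) (distribʳ g (k x b) (k′ x b))) (distribʳ f _ _)

  form-⊞₁ : ∀ {n} (k : Kernel n) f f′ g h → form k (f ⊞ f′) g h ≡ form k f g h + form k f′ g h
  form-⊞₁ k f f′ g h = distrib f f′ _

  form-⊡₁ : ∀ {n} (k : Kernel n) s f g h → form k (s ⊡ f) g h ≡ s * form k f g h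
  form-⊡₁ k s f g h = scaleˡ s f _

  form-⟦⟧ : ∀ {n} (k : Kernel n) x g h → form k ⟦ x ⟧ g h ≡ deg k g h x
  form-⟦⟧ k x g h = ∑-δ x _

  deg-⟦⟧ : ∀ {n} (k : Kernel n) u g x → deg k ⟦ u ⟧ g x ≡ codeg k g x u
  deg-⟦⟧ k u g x = ∑-δ u _

  codeg-≤ : ∀ {n} {k : Kernel n} → (∀ a b c → k a b c ≤ 1) → ∀ g x b → codeg k g x b ≤ ∑ g
  codeg-≤ k≤1 g x b = ∑-mono λ c → ≤-trans (*-monoʳ-≤ (g c) (k≤1 x b c)) (≤-reflexive (*-identityʳ _))

  deg-≤ : ∀ {n} {k : Kernel n} → (∀ a b c → k a b c ≤ 1) → ∀ f g x → deg k f g x ≤ ∑ f * ∑ g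
  deg-≤ k≤1 f g x = ≤-trans (∑-mono λ b → *-monoʳ-≤ (f b) (codeg-≤ k≤1 g x b)) (≤-reflexive (∑-*ʳ f (∑ g)))

module _ {n : ℕ} (k : Kernel n) (s : Symmetric₃ k) where
  opaque
    unfolding form
    codeg-comm : ∀ g x b → codeg k g x b ≡ codeg k g b x
    codeg-comm g x b = ∑-cong λ c → cong (g c *_) (swap₁₂ s x b c)

    deg-comm : ∀ f g x → deg k f g x ≡ deg k g f x
    deg-comm f g x = trans (∑-dist-swap f g (k x)) (∑-cong λ c → cong (g c *_) (∑-cong λ b → cong (f b *_) (swap₂₃ s x b c)))

    form-comm₂₃ : ∀ f g h → form k f g h ≡ form k f h g
    form-comm₂₃ f g h = ∑-cong λ a → cong (f a *_) (deg-comm g h a)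

    form-comm₁₂ : ∀ f g h → form k f g h ≡ form k g f h
    form-comm₁₂ f g h = trans (∑-dist-swap f g (λ a b → ∑ λ c → h c * k a b c)) (∑-cong λ b → cong (g b *_) (∑-cong λ a → cong (f a *_) (∑-cong λ c → cong (h c *_) (swap₁₂ s a b c))))

  form-comm₁₃ : ∀ f g h → form k f g h ≡ form k h g f
  form-comm₁₃ f g h = trans (form-comm₁₂ f g h) (trans (form-comm₂₃ g f h) (form-comm₁₂ g h f))

  deg-⊞ʳ : ∀ f g g′ x → deg k f (g ⊞ g′) x ≡ deg k f g x + deg k f g′ x
  deg-⊞ʳ f g g′ x = trans (deg-comm f (g ⊞ g′) x) (trans (deg-⊞ˡ k g g′ f x) (cong₂ _+_ (deg-comm g f x) (deg-comm g′ f x)))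

  deg-square : ∀ f g x → deg k (f ⊞ g) (f ⊞ g) x ≡ deg k f f x + 2 * deg k f g x + deg k g g x
  deg-square f g x
    rewrite deg-⊞ˡ k f g (f ⊞ g) x | deg-⊞ʳ f f g x | deg-⊞ʳ g f g x | deg-comm g f x = lem (deg k f f x) (deg k f g x) (deg k g g x)
    where lem : ∀ a b c → a + b + (b + c) ≡ a + 2 * b + c
          lem = solve-∀

  form-⊞₂ : ∀ f g g′ h → form k f (g ⊞ g′) h ≡ form k f g h + form k f g′ h
  form-⊞₂ f g g′ h = trans (form-comm₁₂ f (g ⊞ g′) h) (trans (form-⊞₁ k g g′ f h) (cong₂ _+_ (form-comm₁₂ g f h) (form-comm₁₂ g′ f h)))

  form-⊞₃ : ∀ f g h h′ → form k f g (h ⊞ h′) ≡ form k f g h + form k f g h′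
  form-⊞₃ f g h h′ = trans (form-comm₂₃ f g (h ⊞ h′)) (trans (form-⊞₂ f h h′ g) (cong₂ _+_ (form-comm₂₃ f h g) (form-comm₂₃ f h′ g)))

  form-⊡₂ : ∀ t f g h → form k f (t ⊡ g) h ≡ t * form k f g h
  form-⊡₂ t f g h = trans (form-comm₁₂ f (t ⊡ g) h) (trans (form-⊡₁ k t g f h) (cong (t *_) (form-comm₁₂ g f h)))

  form-⊡₃ : ∀ t f g h → form k f g (t ⊡ h) ≡ t * form k f g h
  form-⊡₃ t f g h = trans (form-comm₂₃ f g (t ⊡ h)) (trans (form-⊡₂ t f h g) (cong (t *_) (form-comm₂₃ f h g)))

  cube-⊞ : ∀ f g → cube k (f ⊞ g) ≡ cube k f + 3 * form k g f f + 3 * form k g g f + cube k g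
  cube-⊞ f g
    rewrite form-⊞₁ k f g (f ⊞ g) (f ⊞ g) | form-⊞₂ f f g (f ⊞ g) | form-⊞₂ g f g (f ⊞ g)
          | form-⊞₃ f f f g | form-⊞₃ f g f g | form-⊞₃ g f f g | form-⊞₃ g g f g
          | form-comm₁₃ f f g | form-comm₁₂ f g f | form-comm₁₃ f g g | form-comm₂₃ g f g = lem (cube k f) (form k g f f) (form k g g f) (cube k g)
    where lem : ∀ a b c d → a + b + (b + c) + (b + c + (c + d)) ≡ a + 3 * b + 3 * c + d
          lem = solve-∀

  cube-⊡ : ∀ t f → cube k (t ⊡ f) ≡ t * t * t * cube k f
  cube-⊡ t f rewrite form-⊡₁ k t f (t ⊡ f) (t ⊡ f) | form-⊡₂ t f f (t ⊡ f) | form-⊡₃ t f f f = lem t (cube k f)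
    where lem : ∀ t x → t * (t * (t * x)) ≡ t * t * t * x
          lem = solve-∀

-- Weights of colour classes

weight : ∀ {n r} → (Fin n → Fin r) → (Fin n → ℕ) → Fin r → ℕ
weight c f i = ∑ λ a → f a * b2n (does (c a ≟ i))

∑-push : ∀ {n r} (c : Fin n → Fin r) (f : Fin n → ℕ) (F : Fin r → ℕ) → ∑ (λ a → f a * F (c a)) ≡ ∑ (λ i → weight c f i * F i)
∑-push c f F = begin
  ∑ (λ a → f a * F (c a)) ≡⟨ ∑-cong (λ a → cong (f a *_) (sym (∑-δ (c a) F))) ⟩
  ∑ (λ a → f a * ∑ (λ i → b2n (does (c a ≟ i)) * F i)) ≡⟨ ∑-cong (λ a → cong (f a *_) (∑-cong λ i → *-comm _ (F i))) ⟩
  ∑ (λ a → f a * ∑ (λ i → F i * b2n (does (c a ≟ i)))) ≡⟨ ∑-dist-swap f F _ ⟩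
  ∑ (λ i → F i * weight c f i) ≡⟨ ∑-cong (λ i → *-comm (F i) _) ⟩
  ∑ (λ i → weight c f i * F i) ∎
  where open ≡-Reasoning

∑-weight : ∀ {n r} (c : Fin n → Fin r) (f : Fin n → ℕ) → ∑ (weight c f) ≡ ∑ f
∑-weight c f = trans (∑-cong λ i → sym (*-identityʳ _)) (trans (sym (∑-push c f (λ _ → 1))) (∑-cong λ a → *-identityʳ _))

pullback : ∀ {n r} → (Fin n → Fin r) → Kernel r → Kernel n
pullback c k a b d = k (c a) (c b) (c d)

opaque
  unfolding form
  codeg-push : ∀ {n r} (c : Fin n → Fin r) (k : Kernel r) g x b → codeg (pullback c k) g x b ≡ codeg k (weight c g) (c x) (c b)
  codeg-push c k g x b = ∑-push c g (k (c x) (c b))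

  deg-push : ∀ {n r} (c : Fin n → Fin r) (k : Kernel r) f g x → deg (pullback c k) f g x ≡ deg k (weight c f) (weight c g) (c x)
  deg-push c k f g x = trans (∑-cong λ b → cong (f b *_) (codeg-push c k g x b)) (∑-push c f (codeg k (weight c g) (c x)))

  -- This turns the number of pattern triples of a coloured vertex set into the Lagrangian
  -- polynomial of the pattern, evaluated at the class weights.
  cube-push : ∀ {n r} (c : Fin n → Fin r) (k : Kernel r) f → cube (pullback c k) f ≡ cube k (weight c f)
  cube-push c k f = trans (∑-cong λ a → cong (f a *_) (deg-push c k f f a)) (∑-push c f (deg k (weight c f) (weight c f)))

-- Restriction of weights to a set

infixl 7 _∣ʷ_
_∣ʷ_ : ∀ {n} → (Fin n → ℕ) → (Fin n → Bool) → Fin n → ℕ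
(f ∣ʷ p) x = f x * b2n (p x)

mass : ∀ {n} → (Fin n → ℕ) → (Fin n → Bool) → ℕ
mass f p = ∑ (f ∣ʷ p)

∣ʷ-split : ∀ {n} (f : Fin n → ℕ) p x → f x ≡ (f ∣ʷ p ⊞ f ∣ʷ (not ∘ p)) x
∣ʷ-split f p x with p x
... | true = lem (f x)
  where lem : ∀ a → a ≡ a * 1 + a * 0
        lem = solve-∀
... | false = lem (f x)
  where lem : ∀ a → a ≡ a * 0 + a * 1
        lem = solve-∀

mass-split : ∀ {n} (f : Fin n → ℕ) p → ∑ f ≡ mass f p + mass f (not ∘ p)
mass-split f p = trans (∑-cong (∣ʷ-split f p)) (∑-+ _ _)

∣ʷ≤ : ∀ {n} (f : Fin n → ℕ) p x → (f ∣ʷ p) x ≤ f x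
∣ʷ≤ f p x = ≤-trans (*-monoʳ-≤ (f x) (b2n≤1 (p x))) (≤-reflexive (*-identityʳ _))

markov : ∀ {n} (f F : Fin n → ℕ) (p : Fin n → Bool) t → (∀ x → p x ≡ true → t ≤ F x) → t * mass f p ≤ ∑ (λ x → f x * F x)
markov f F p t h = ≤-trans (≤-reflexive (sym (∑-*ˡ t (f ∣ʷ p)))) (∑-mono pt)
  where
  pt : ∀ x → t * (f x * b2n (p x)) ≤ f x * F x
  pt x with p x | h x
  ... | true | q rewrite *-identityʳ (f x) | *-comm t (f x) = *-monoʳ-≤ (f x) (q refl)
  ... | false | _ rewrite *-zeroʳ (f x) | *-zeroʳ t = z≤n

-- Boolean quantifiers and finite sets

infix 4 _==_
_==_ : ∀ {n} → Fin n → Fin n → Bool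
x == y = does (x ≟ y)

==⇒≡ : ∀ {n} {x y : Fin n} → (x == y) ≡ true → x ≡ y
==⇒≡ {x = x} {y} p with x ≟ y
... | yes q = q
==⇒≡ () | no _

==-refl : ∀ {n} (x : Fin n) → (x == x) ≡ true
==-refl x with x ≟ x
... | yes _ = refl
... | no p = ⊥-elim (p refl)

≢⇒== : ∀ {n} {x y : Fin n} → x ≢ y → (x == y) ≡ false
≢⇒== x≢y = ¬true (x≢y ∘ ==⇒≡)

opaque
  ∀ᵇ : ∀ {n} → (Fin n → Bool) → Bool
  ∀ᵇ {zero} p = true
  ∀ᵇ {suc n} p = p zero ∧ ∀ᵇ (p ∘ suc)

  ∀ᵇ-sound : ∀ {n} {p : Fin n → Bool} → ∀ᵇ p ≡ true → ∀ x → p x ≡ true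
  ∀ᵇ-sound {suc n} {p} h zero = proj₁ (∧-true {p zero} h)
  ∀ᵇ-sound {suc n} {p} h (suc x) = ∀ᵇ-sound (proj₂ (∧-true {p zero} h)) x

  ∀ᵇ-complete : ∀ {n} {p : Fin n → Bool} → (∀ x → p x ≡ true) → ∀ᵇ p ≡ true
  ∀ᵇ-complete {zero} h = refl
  ∀ᵇ-complete {suc n} h = ∧-intro (h zero) (∀ᵇ-complete (h ∘ suc))

  ∃ᵇ : ∀ {n} → (Fin n → Bool) → Bool
  ∃ᵇ {zero} p = false
  ∃ᵇ {suc n} p = p zero ∨ ∃ᵇ (p ∘ suc)

  ∃ᵇ-sound : ∀ {n} {p : Fin n → Bool} → ∃ᵇ p ≡ true → ∃ λ x → p x ≡ true
  ∃ᵇ-sound {suc n} {p} h with ∨-true {p zero} h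
  ... | inj₁ q = zero , q
  ... | inj₂ q = let (x , r) = ∃ᵇ-sound q in suc x , r

  ∃ᵇ-complete : ∀ {n} (p : Fin n → Bool) x → p x ≡ true → ∃ᵇ p ≡ true
  ∃ᵇ-complete p zero h = ∨-introˡ _ h
  ∃ᵇ-complete p (suc x) h = ∨-introʳ (p zero) (∃ᵇ-complete (p ∘ suc) x h)

∀-or-∃ : ∀ {n} (p : Fin n → Bool) → (∀ x → p x ≡ true) ⊎ (∃ λ x → p x ≡ false)
∀-or-∃ p with true? (∃ᵇ (not ∘ p))
... | inj₁ e = let (x , h) = ∃ᵇ-sound e in inj₂ (x , not-true h)
... | inj₂ e = inj₁ λ x → case true? (p x) of λ where
  (inj₁ h) → h
  (inj₂ h) → ⊥-elim (true≢false (trans (sym (∃ᵇ-complete (not ∘ p) x (cong not h))) e))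

cons : ∀ {n} {A : Set} → A → (Fin n → A) → Fin (suc n) → A
cons a f zero = a
cons a f (suc x) = f x

-- A function agrees only pointwise with the one rebuilt from its first value and its tail, so `P`
-- has to respect pointwise equality. The decision is needed because a six-vertex core must either
-- deliver a homomorphism or refute its existence.
∃-function? : ∀ k {m} (P : (Fin k → Fin m) → Set) → (∀ f → Dec (P f)) → (∀ {f g} → (∀ x → f x ≡ g x) → P f → P g) → Dec (∃ P)
∃-function? zero P P? resp with P? (λ ())
... | yes p = yes (_ , p)
... | no ¬p = no λ (f , p) → ¬p (resp (λ ()) p)
∃-function? (suc k) {m} P P? resp with Finₚ.any? (λ a → ∃-function? k (P ∘ cons a) (P? ∘ cons a) (λ e → resp λ { zero → refl ; (suc x) → e x }))
... | yes (a , f , p) = yes (_ , p)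
... | no ¬p = no λ (f , p) → ¬p (f zero , f ∘ suc , resp (λ { zero → refl ; (suc x) → refl }) p)

record Enumeration {n} (U : Fin n → Bool) : Set where
  constructor enumeration
  field
    size : ℕ
    elem : Fin size → Fin n
    elem-injective : Injective _≡_ _≡_ elem
    elem-∈ : ∀ i → U (elem i) ≡ true
    index : ∀ x → U x ≡ true → ∃ λ i → elem i ≡ x
    size≡ : size ≡ ∑ (b2n ∘ U)

enumerate : ∀ {n} (U : Fin n → Bool) → Enumeration U
enumerate {zero} U = enumeration 0 (λ ()) (λ { {()} }) (λ ()) (λ ()) (sym (∑-empty _))
enumerate {suc n} U with enumerate (U ∘ suc) | true? (U zero)
... | enumeration k e inj in-U ix eq | inj₁ u = enumeration (suc k) e′ inj′ in′ ix′ (trans (cong₂ (λ b r → b2n b + r) (sym u) eq) (sym (∑-suc (b2n ∘ U))))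
  where
  e′ = cons zero (suc ∘ e)
  inj′ : Injective _≡_ _≡_ e′
  inj′ {zero} {zero} _ = refl
  inj′ {suc i} {suc j} p = cong suc (inj (Finₚ.suc-injective p))
  in′ : ∀ i → U (e′ i) ≡ true
  in′ zero = u
  in′ (suc i) = in-U i
  ix′ : ∀ x → U x ≡ true → ∃ λ i → e′ i ≡ x
  ix′ zero _ = zero , refl
  ix′ (suc x) p = let (i , q) = ix x p in suc i , cong suc q
... | enumeration k e inj in-U ix eq | inj₂ u = enumeration k (suc ∘ e) (inj ∘ Finₚ.suc-injective) in-U ix′ (trans (cong₂ (λ b r → b2n b + r) (sym u) eq) (sym (∑-suc (b2n ∘ U))))
  where
  ix′ : ∀ x → U x ≡ true → ∃ λ i → suc (e i) ≡ x
  ix′ zero p = ⊥-elim (true≢false (trans (sym p) u))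
  ix′ (suc x) p = let (i , q) = ix x p in i , cong suc q

setOf : ∀ {n} → List (Fin n) → Fin n → Bool
setOf L x = any (_== x) L

setOf-complete : ∀ {n} {L : List (Fin n)} {x} → x ∈ L → setOf L x ≡ true
setOf-complete {x = x} (here refl) = ∨-introˡ _ (==-refl x)
setOf-complete {L = y ∷ L} {x} (there p) = ∨-introʳ (y == x) (setOf-complete p)

setOf-sound : ∀ {n} (L : List (Fin n)) {x} → setOf L x ≡ true → x ∈ L
setOf-sound (y ∷ L) {x} p with ∨-true {y == x} p
... | inj₁ q = here (sym (==⇒≡ q))
... | inj₂ q = there (setOf-sound L q)

card-setOf : ∀ {n} (L : List (Fin n)) → ∑ (b2n ∘ setOf L) ≤ length L
card-setOf {n} [] = ≤-reflexive (∑-zero {n})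
card-setOf (y ∷ L) = ≤-trans (∑-mono λ x → sub (y == x) (setOf L x)) (≤-trans (≤-reflexive (trans (∑-+ ⟦ y ⟧ _) (cong (_+ _) (∑-⟦⟧ y)))) (s≤s (card-setOf L)))
  where
  sub : ∀ a b → b2n (a ∨ b) ≤ b2n a + b2n b
  sub true _ = s≤s z≤n
  sub false _ = ≤-refl

add : ∀ {n} → (Fin n → Bool) → Fin n → Fin n → Bool
add S v x = S x ∨ (v == x)

-- The seven-vertex rule speaks of exactly seven vertices; smaller configurations inside a covered
-- set are padded to that size within the set.
enlarge : ∀ {n} (S U : Fin n → Bool) → (∀ x → S x ≡ true → U x ≡ true) → ∀ d → ∑ (b2n ∘ S) + d ≤ ∑ (b2n ∘ U) →
  Σ (Fin n → Bool) λ S′ → (∀ x → S x ≡ true → S′ x ≡ true) × (∀ x → S′ x ≡ true → U x ≡ true) × ∑ (b2n ∘ S′) ≡ ∑ (b2n ∘ S) + d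
enlarge S U S⊆U zero h = S , (λ _ p → p) , S⊆U , sym (+-identityʳ _)
enlarge S U S⊆U (suc d) h with ∑-pick {f = b2n ∘ S} {b2n ∘ U} (≤-trans (m≤m+n _ d) (≤-trans (≤-reflexive (sym (+-suc _ d))) h))
... | v , lt with S v in sv | U v in uv
...   | false | true = let (S′ , p , q , r) = enlarge (add S v) U sub d (≤-trans (≤-reflexive eq) h) in
                        S′ , (λ x s → p x (∨-introˡ _ s)) , q , trans r eq
  where
  sub : ∀ x → add S v x ≡ true → U x ≡ true
  sub x p with ∨-true {S x} p
  ... | inj₁ s = S⊆U x s
  ... | inj₂ e = subst (λ x → U x ≡ true) (==⇒≡ e) uv
  pt : ∀ x → b2n (add S v x) ≡ b2n (S x) + ⟦ v ⟧ x
  pt x with v ≟ x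
  ... | yes refl rewrite sv = refl
  ... | no _ with S x
  ...   | true = refl
  ...   | false = refl
  eq : ∑ (b2n ∘ add S v) + d ≡ ∑ (b2n ∘ S) + suc d
  eq = trans (cong (_+ d) (trans (∑-cong pt) (trans (∑-+ _ _) (cong (∑ (b2n ∘ S) +_) (∑-⟦⟧ v))))) (+-assoc _ 1 d)
enlarge S U S⊆U (suc d) h | v , s≤s () | true | true

-- Consequences of 𝓜-freeness

_∈₃_,_,_ : ∀ {A : Set} → A → A → A → A → Set
x ∈₃ a , b , c = (x ≡ a) ⊎ (x ≡ b) ⊎ (x ≡ c)

Covered : ∀ {n k} → (Fin n → Fin n → Fin n → Bool) → (Fin k → Fin n) → Set
Covered E s = ∀ i j → i ≢ j → ∃ λ z → E (s i) (s j) z ≡ true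

opaque
  edges : ∀ {n} → Graph3 n → Fin n → Fin n → Fin n → Bool
  edges = edge?

  edges≡ : ∀ {n} (H : Graph3 n) a b c → edges H a b c ≡ edge? H a b c
  edges≡ H a b c = refl

  edges-symmetric : ∀ {n} (H : Graph3 n) → Symmetric₃ (edges H)
  edges-symmetric = edge?-symmetric

  edges-irreflexive : ∀ {n} (H : Graph3 n) → Irreflexive₃ (edges H)
  edges-irreflexive = edge?-irreflexive

  edges-collapse : ∀ {n} (H : Graph3 n) → Symmetric₃ H → Irreflexive₃ H → ∀ a b c → edges H a b c ≡ H a b c
  edges-collapse = edge?-collapse

-- The contrapositives of membership in the three parts of `𝓜`. Transversal number at most 1 becomes
-- a vertex common to all edges inside the core. For six vertices the first alternative stands for
-- embeddability in a semibipartite graph, the second for embeddability in a blowup of `G26`.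
record Rules {n} (E : Fin n → Fin n → Fin n → Bool) : Set where
  field
    symm : Symmetric₃ E
    irr : Irreflexive₃ E
    no-K5⁻ : ∀ (s : Fin 5 → Fin n) → Injective _≡_ _≡_ s → ¬ (∀ a b c → edge? K5⁻ a b c ≡ true → E (s a) (s b) (s c) ≡ true)
    core₇ : ∀ (s : Fin 7 → Fin n) → Covered E s → ∃ λ x → ∀ a b c → E (s a) (s b) (s c) ≡ true → x ∈₃ a , b , c
    core₆ : ∀ (s : Fin 6 → Fin n) → Covered E s →
      (∃ λ x → ∀ a b c → E (s a) (s b) (s c) ≡ true → x ∈₃ a , b , c) ⊎
      (Σ (Fin 6 → Fin 6) λ φ → (∀ i j → i ≢ j → φ i ≢ φ j) × (∀ a b c → E (s a) (s b) (s c) ≡ true → edges G26 (φ a) (φ b) (φ c) ≡ true))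

edge?⇒ : ∀ {n} (K : Graph3 n) → Symmetric₃ K → ∀ a b c → edge? K a b c ≡ true → K a b c ≡ true
edge?⇒ K s a b c p with edge?-inc K a b c p
... | inj₁ q = proj₂ (proj₂ (inc-sorted K a b c q))
... | inj₂ (inj₁ q) = trans (swap₂₃ s a b c) (proj₂ (proj₂ (inc-sorted K a c b q)))
... | inj₂ (inj₂ (inj₁ q)) = trans (swap₁₂ s a b c) (proj₂ (proj₂ (inc-sorted K b a c q)))
... | inj₂ (inj₂ (inj₂ (inj₁ q))) = trans (rot s a b c) (proj₂ (proj₂ (inc-sorted K b c a q)))
... | inj₂ (inj₂ (inj₂ (inj₂ (inj₁ q)))) = trans (rot² s a b c) (proj₂ (proj₂ (inc-sorted K c a b q)))
... | inj₂ (inj₂ (inj₂ (inj₂ (inj₂ q)))) = trans (swap₁₃ s a b c) (proj₂ (proj₂ (inc-sorted K c b a q)))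

exactlyOne-symmetric : Symmetric₃ exactlyOne
exactlyOne-symmetric .swap₁₂ a b c = cong (λ z → (z + b2n c) ≡ᵇ 1) (+-comm (b2n a) (b2n b))
exactlyOne-symmetric .swap₂₃ a b c = cong (_≡ᵇ 1) (lem (b2n a) (b2n b) (b2n c))
  where lem : ∀ x y z → x + y + z ≡ x + z + y
        lem = solve-∀

inA : ∀ n → Fin n → Bool
inA n x = toℕ x <ᵇ (n / 3)

G1-symmetric : ∀ n → Symmetric₃ (G1 n)
G1-symmetric n = symmetric₃-∘ (inA n) exactlyOne-symmetric

Blow-symmetric : ∀ {N} (π : Fin N → Fin 6) → Symmetric₃ (Blow π)
Blow-symmetric π = symmetric₃-∘ π (edge?-symmetric G26)

Blow-irreflexive : ∀ {N} (π : Fin N → Fin 6) → Irreflexive₃ (Blow π)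
Blow-irreflexive π a c = edge?-irreflexive G26 (π a) (π c)

exactlyOne-¬both : ∀ c → ¬ (exactlyOne true true c ≡ true)
exactlyOne-¬both true ()
exactlyOne-¬both false ()

exactlyOne-some : ∀ a b c → exactlyOne a b c ≡ true → (a ≡ true) ⊎ (b ≡ true) ⊎ (c ≡ true)
exactlyOne-some true b c _ = inj₁ refl
exactlyOne-some false true c _ = inj₂ (inj₁ refl)
exactlyOne-some false false true _ = inj₂ (inj₂ refl)

-- A covered set meets the A-side of a semibipartite graph in at most one vertex, the centre of the star.
covered-semibipartite⇒star : ∀ {k} (E : Fin (suc k) → Fin (suc k) → Fin (suc k) → Bool) (p : Fin (suc k) → Bool) →
  (∀ i j → i ≢ j → p i ≡ true → p j ≡ true → ⊥) → (∀ a b c → E a b c ≡ true → exactlyOne (p a) (p b) (p c) ≡ true) →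
  ∃ λ x → ∀ a b c → E a b c ≡ true → x ∈₃ a , b , c
covered-semibipartite⇒star E p sep one with true? (∃ᵇ p)
... | inj₁ h = let (x , px) = ∃ᵇ-sound {p = p} h in x , λ a b c e → case exactlyOne-some (p a) (p b) (p c) (one a b c e) of λ where
    (inj₁ q) → inj₁ (uniq x a px q)
    (inj₂ (inj₁ q)) → inj₂ (inj₁ (uniq x b px q))
    (inj₂ (inj₂ q)) → inj₂ (inj₂ (uniq x c px q))
  where
  uniq : ∀ i j → p i ≡ true → p j ≡ true → i ≡ j
  uniq i j pi pj with i ≟ j
  ... | yes q = q
  ... | no q = ⊥-elim (sep i j q pi pj)
... | inj₂ h = zero , λ a b c e → case exactlyOne-some (p a) (p b) (p c) (one a b c e) of λ where
    (inj₁ q) → no′ a q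
    (inj₂ (inj₁ q)) → no′ b q
    (inj₂ (inj₂ q)) → no′ c q
  where
  no′ : ∀ {A : Set} i → p i ≡ true → A
  no′ i q = ⊥-elim (true≢false (trans (sym (∃ᵇ-complete p i q)) h))

star? : ∀ {k} (E : Fin k → Fin k → Fin k → Bool) → Dec (∃ λ x → ∀ a b c → E a b c ≡ true → x ∈₃ a , b , c)
star? E = Finₚ.any? λ x → Finₚ.all? λ a → Finₚ.all? λ b → Finₚ.all? λ c → (E a b c Boolₚ.≟ true) →-dec ((x ≟ a) ⊎-dec ((x ≟ b) ⊎-dec (x ≟ c)))

card≤1 : ∀ {k} (T : Fin (suc k) → Bool) → card T < 2 → ∃ λ x → ∀ y → T y ≡ true → x ≡ y
card≤1 {k} T h with true? (∃ᵇ T)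
... | inj₂ e = zero , λ y q → ⊥-elim (true≢false (trans (sym (∃ᵇ-complete T y q)) e))
... | inj₁ e = let (x , tx) = ∃ᵇ-sound {p = T} e in x , λ y ty → case x ≟ y of λ where
    (yes q) → q
    (no q) → ⊥-elim (<⇒≱ h (≤-trans (≤-reflexive (sym (trans (∑-+ ⟦ x ⟧ ⟦ y ⟧) (cong₂ _+_ (∑-⟦⟧ x) (∑-⟦⟧ y))))) (≤-trans (∑-mono (pt x y q tx ty)) (≤-reflexive (sym (sumFin≡∑ (suc k) _))))))
  where
  pt : ∀ x y → x ≢ y → T x ≡ true → T y ≡ true → ∀ z → ⟦ x ⟧ z + ⟦ y ⟧ z ≤ b2n (T z)
  pt x y x≢y tx ty z with x ≟ z | y ≟ z
  ... | yes refl | yes refl = ⊥-elim (x≢y refl)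
  ... | yes refl | no _ rewrite tx = ≤-refl
  ... | no _ | yes refl rewrite ty = ≤-refl
  ... | no _ | no _ = z≤n

pairs : ∀ k → List (Fin k × Fin k)
pairs zero = []
pairs (suc k) = map (λ j → zero , suc j) (allFin k) ++ map (λ (i , j) → suc i , suc j) (pairs k)

pairs-complete : ∀ k (i j : Fin k) → i ≢ j → ((i , j) ∈ pairs k) ⊎ ((j , i) ∈ pairs k)
pairs-complete (suc k) zero zero p = ⊥-elim (p refl)
pairs-complete (suc k) zero (suc j) p = inj₁ (∈-++⁺ˡ (∈-map⁺ _ (∈-allFin j)))
pairs-complete (suc k) (suc i) zero p = inj₂ (∈-++⁺ˡ (∈-map⁺ _ (∈-allFin i)))
pairs-complete (suc k) (suc i) (suc j) p with pairs-complete k i j (p ∘ cong suc)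
... | inj₁ q = inj₁ (∈-++⁺ʳ _ (∈-map⁺ _ q))
... | inj₂ q = inj₂ (∈-++⁺ʳ _ (∈-map⁺ _ q))

-- The subgraph induced by a covered set together with one witness per pair.
module CoreGraph {n} (H : Graph3 n) (k : ℕ) (s : Fin k → Fin n) (cov : Covered (edges H) s) where
  private
    choose : ∀ i j → Dec (i ≡ j) → Fin n
    choose i j (yes _) = s i
    choose i j (no p) = proj₁ (cov i j p)

    w : Fin k × Fin k → Fin n
    w (i , j) = choose i j (i ≟ j)

    choose-covers : ∀ i j d → i ≢ j → edges H (s i) (s j) (choose i j d) ≡ true
    choose-covers i j (yes p) i≢j = ⊥-elim (i≢j p)
    choose-covers i j (no p) _ = proj₂ (cov i j p)

    w-covers : ∀ i j → i ≢ j → edges H (s i) (s j) (w (i , j)) ≡ true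
    w-covers i j = choose-covers i j (i ≟ j)

    L = map s (allFin k) ++ map w (pairs k)
    open Enumeration (enumerate (setOf L))

  order : ℕ
  order = size

  -- The list holds the core and one witness per unordered pair, so its length is k + (k choose 2),
  -- the vertex bound of the families; for concrete k both bounds reduce to the same numeral.
  order≤ : order ≤ length L
  order≤ = ≤-trans (≤-reflexive size≡) (card-setOf L)

  F : Graph3 order
  F a b c = edges H (elem a) (elem b) (elem c)

  F-edge : ∀ a b c → edges F a b c ≡ edges H (elem a) (elem b) (elem c)
  F-edge = edges-collapse F (symmetric₃-∘ elem (edges-symmetric H)) (λ a c → edges-irreflexive H (elem a) (elem c))

  F⊂H : F ⊂G H
  F⊂H = elem , elem-injective , λ a b c e → trans (sym (edges≡ H _ _ _)) (trans (sym (F-edge a b c)) (trans (edges≡ F a b c) e))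

  private
    at : ∀ i → ∃ λ t → elem t ≡ s i
    at i = index (s i) (setOf-complete {L = L} (∈-++⁺ˡ (∈-map⁺ s (∈-allFin i))))

    wat : ∀ p → p ∈ pairs k → ∃ λ t → elem t ≡ w p
    wat p q = index (w p) (setOf-complete {L = L} (∈-++⁺ʳ (map s (allFin k)) (∈-map⁺ w q)))

  t : Fin k → Fin order
  t i = proj₁ (at i)

  elem-t : ∀ i → elem (t i) ≡ s i
  elem-t i = proj₂ (at i)

  s-injective : Injective _≡_ _≡_ s
  s-injective {i} {j} p with i ≟ j
  ... | yes q = q
  ... | no q = ⊥-elim (true≢false (trans (sym (proj₂ (cov i j q))) (trans (cong (λ z → edges H (s i) z (proj₁ (cov i j q))) (sym p)) (edges-irreflexive H _ _))))

  t-injective : Injective _≡_ _≡_ t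
  t-injective {i} {j} p = s-injective (trans (sym (elem-t i)) (trans (cong elem p) (elem-t j)))

  private
    edge-at : ∀ i j z {x} → elem z ≡ x → edges H (s i) (s j) x ≡ true → edges F (t i) (t j) z ≡ true
    edge-at i j z refl h = trans (F-edge _ _ z) (trans (cong₂ (λ a b → edges H a b (elem z)) (elem-t i) (elem-t j)) h)

  t-covered : ∀ i j → i ≢ j → ∃ λ z → edges F (t i) (t j) z ≡ true
  t-covered i j i≢j with pairs-complete k i j i≢j
  ... | inj₁ q = let (z , e) = wat (i , j) q in z , edge-at i j z e (w-covers i j i≢j)
  ... | inj₂ q = let (z , e) = wat (j , i) q in z , edge-at i j z e (trans (swap₁₂ (edges-symmetric H) (s i) (s j) (w (j , i))) (w-covers j i (i≢j ∘ sym)))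

  t-core : ∀ i j → i ≢ j → ∃ λ z → edge? F (t i) (t j) z ≡ true
  t-core i j p = let (z , e) = t-covered i j p in z , trans (sym (edges≡ F _ _ _)) e

  t-edge : ∀ a b c → edges F (t a) (t b) (t c) ≡ edges H (s a) (s b) (s c)
  t-edge a b c = trans (F-edge (t a) (t b) (t c)) (trans (cong₂ (λ x y → edges H x y (elem (t c))) (elem-t a) (elem-t b)) (cong (edges H (s a) (s b)) (elem-t c)))

  ¬star⇒τ≥2 : ∀ {k′} → k ≡ suc k′ → ¬ (∃ λ x → ∀ a b c → edges H (s a) (s b) (s c) ≡ true → x ∈₃ a , b , c) → τ≥2 (pull F t)
  ¬star⇒τ≥2 refl ¬p T tr = decide (card T <? 2)
    where
    hit : ∀ x → (∀ y → T y ≡ true → x ≡ y) → ∀ a b c → (T a ∨ T b ∨ T c) ≡ true → x ∈₃ a , b , c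
    hit x u a b c h with ∨-true {T a} h
    ... | inj₁ r = inj₁ (u a r)
    ... | inj₂ r with ∨-true {T b} r
    ...   | inj₁ r = inj₂ (inj₁ (u b r))
    ...   | inj₂ r = inj₂ (inj₂ (u c r))
    F[t] : ∀ a b c → edges (pull F t) a b c ≡ edge? F (t a) (t b) (t c)
    F[t] = edges-collapse (pull F t) (symmetric₃-∘ t (edge?-symmetric F)) (λ a c → edge?-irreflexive F (t a) (t c))
    decide : Dec (card T < 2) → 2 ≤ card T
    decide (no q) = ≮⇒≥ q
    decide (yes q) = let (x , u) = card≤1 T q in ⊥-elim (¬p (x , λ a b c e → hit x u a b c
      (tr a b c (trans (sym (edges≡ (pull F t) a b c)) (trans (F[t] a b c) (trans (sym (edges≡ F _ _ _)) (trans (t-edge a b c) e)))))))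

private
  Hom₆ : (Fin 6 → Fin 6 → Fin 6 → Bool) → (Fin 6 → Fin 6) → Set
  Hom₆ K φ = (∀ i j → i ≢ j → φ i ≢ φ j) × (∀ a b c → K a b c ≡ true → edges G26 (φ a) (φ b) (φ c) ≡ true)

  hom₆? : ∀ K → Dec (∃ (Hom₆ K))
  hom₆? K = ∃-function? 6 (Hom₆ K)
    (λ φ → (Finₚ.all? λ i → Finₚ.all? λ j → ¬? (i ≟ j) →-dec ¬? (φ i ≟ φ j)) ×-dec (Finₚ.all? λ a → Finₚ.all? λ b → Finₚ.all? λ c → (K a b c Boolₚ.≟ true) →-dec (edges G26 (φ a) (φ b) (φ c) Boolₚ.≟ true)))
    (λ {f} {g} e (inj , h) → (λ i j p q → inj i j p (trans (e i) (trans q (sym (e j))))) , λ a b c p → subst₂ (λ x y → edges G26 x y (g c) ≡ true) (e a) (e b) (subst (λ z → edges G26 (f a) (f b) z ≡ true) (e c) (h a b c p)))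

module _ {n} (H : Graph3 n) (free : Free 𝓜 H) where
  private
    rule₇ : ∀ (s : Fin 7 → Fin n) → Covered (edges H) s → ∃ λ x → ∀ a b c → edges H (s a) (s b) (s c) ≡ true → x ∈₃ a , b , c
    rule₇ s cov = decide (star? (λ a b c → edges H (s a) (s b) (s c)))
      where
      open CoreGraph H 7 s cov
      decide : Dec (∃ λ x → ∀ a b c → edges H (s a) (s b) (s c) ≡ true → x ∈₃ a , b , c) → ∃ λ x → ∀ a b c → edges H (s a) (s b) (s c) ≡ true → x ∈₃ a , b , c
      decide (yes p) = p
      decide (no ¬p) = ⊥-elim (free order F (inj₂ (inj₁ (order≤ , t , (t-injective , t-core) , ¬star⇒τ≥2 refl ¬p))) F⊂H)

    -- Restricted to the core, an embedding into `G1` yields a star and an embedding into a blowup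
    -- yields an injective homomorphism to `G26`. Both outcomes are decidable; if both fail, the
    -- core graph belongs to `M₃` and is contained in H.
    rule₆ : ∀ (s : Fin 6 → Fin n) → Covered (edges H) s →
      (∃ λ x → ∀ a b c → edges H (s a) (s b) (s c) ≡ true → x ∈₃ a , b , c) ⊎ ∃ (Hom₆ λ a b c → edges H (s a) (s b) (s c))
    rule₆ s cov = decide (star? (λ a b c → edges H (s a) (s b) (s c))) (hom₆? _)
      where
      open CoreGraph H 6 s cov
      Star = ∃ λ x → ∀ a b c → edges H (s a) (s b) (s c) ≡ true → x ∈₃ a , b , c
      Hom = ∃ (Hom₆ λ a b c → edges H (s a) (s b) (s c))
      lift : ∀ {m} (K : Graph3 m) (f : Fin order → Fin m) → Symmetric₃ K → (∀ a b c → edge? F a b c ≡ true → edge? K (f a) (f b) (f c) ≡ true) → ∀ a b c → edges F a b c ≡ true → K (f a) (f b) (f c) ≡ true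
      lift K f sK hom a b c e = edge?⇒ K sK (f a) (f b) (f c) (hom a b c (trans (sym (edges≡ F a b c)) e))
      not-G1 : ¬ Star → ∀ m → ¬ (F ⊂G G1 m)
      not-G1 ¬p m (f , _ , hom) = ¬p (covered-semibipartite⇒star _ (λ i → inA m (f (t i))) sep (λ a b c e → lift (G1 m) f (G1-symmetric m) hom _ _ _ (trans (t-edge a b c) e)))
        where
        sep : ∀ i j → i ≢ j → inA m (f (t i)) ≡ true → inA m (f (t j)) ≡ true → ⊥
        sep i j i≢j x y = let (z , e) = t-covered i j i≢j in
          exactlyOne-¬both (inA m (f z)) (trans (cong₂ (λ u v → exactlyOne u v (inA m (f z))) (sym x) (sym y)) (lift (G1 m) f (G1-symmetric m) hom _ _ _ e))
      not-G2 : ¬ Hom → ∀ m (π : Fin m → Fin 6) → 6 ≤ m → MaxBlow π → ¬ (F ⊂G Blow π)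
      not-G2 ¬q m π _ _ (f , _ , hom) = ¬q ((λ i → π (f (t i))) , inj , λ a b c e → up (t a) (t b) (t c) (trans (t-edge a b c) e))
        where
        up : ∀ a b c → edges F a b c ≡ true → edges G26 (π (f a)) (π (f b)) (π (f c)) ≡ true
        up a b c e = trans (edges≡ G26 _ _ _) (lift (Blow π) f (Blow-symmetric π) hom a b c e)
        inj : ∀ i j → i ≢ j → π (f (t i)) ≢ π (f (t j))
        inj i j i≢j p = let (z , e) = t-covered i j i≢j in
          true≢false (trans (sym (up _ _ _ e)) (trans (cong (λ y → edges G26 (π (f (t i))) y (π (f z))) (sym p)) (edges-irreflexive G26 _ _)))
      decide : Dec Star → Dec Hom → Star ⊎ Hom
      decide (yes p) _ = inj₁ p
      decide (no _) (yes q) = inj₂ q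
      decide (no ¬p) (no ¬q) = ⊥-elim (free order F (inj₂ (inj₂ ((order≤ , t , t-injective , t-core) , not-G1 ¬p , not-G2 ¬q))) F⊂H)

  free-rules : Rules (edges H)
  free-rules = record
    { symm = edges-symmetric H
    ; irr = edges-irreflexive H
    ; no-K5⁻ = λ s inj hom → free 5 K5⁻ (inj₁ λ _ _ _ → refl) (s , inj , λ a b c e → trans (sym (edges≡ H _ _ _)) (hom a b c e))
    ; core₇ = rule₇
    ; core₆ = rule₆
    }

-- Colourings by the two extremal patterns

Pattern : ℕ → Set
Pattern r = Fin r → Fin r → Fin r → Bool

opaque
  P₂ : Pattern 2
  P₂ i j k = exactlyOne (i == zero) (j == zero) (k == zero)

  P₂≡ : ∀ i j k → P₂ i j k ≡ exactlyOne (i == zero) (j == zero) (k == zero)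
  P₂≡ i j k = refl

  P₂-symmetric : Symmetric₃ P₂
  P₂-symmetric = symmetric₃-∘ (_== zero) exactlyOne-symmetric

  P₆ : Pattern 6
  P₆ = edge? G26

  P₆≡ : ∀ i j k → P₆ i j k ≡ edge? G26 i j k
  P₆≡ i j k = refl

  P₆-symmetric : Symmetric₃ P₆
  P₆-symmetric = edge?-symmetric G26

-- A homomorphism to the pattern defined on U. The values of `c` off U are free, which later allows
-- a provisional colour for a vertex that is about to be added.
Colouring : ∀ {n r} → Pattern r → (Fin n → Fin n → Fin n → Bool) → (Fin n → Bool) → (Fin n → Fin r) → Set
Colouring P E U c = ∀ a b d → U a ≡ true → U b ≡ true → U d ≡ true → E a b d ≡ true → P (c a) (c b) (c d) ≡ true

Good : ∀ {n} → (Fin n → Fin n → Fin n → Bool) → (Fin n → Bool) → Set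
Good E U = ∃ (Colouring P₂ E U) ⊎ ∃ (Colouring P₆ E U)

Good-⊆ : ∀ {n} {E : Fin n → Fin n → Fin n → Bool} {U W} → (∀ x → W x ≡ true → U x ≡ true) → Good E U → Good E W
Good-⊆ s (inj₁ (c , h)) = inj₁ (c , λ a b d p q r → h a b d (s a p) (s b q) (s d r))
Good-⊆ s (inj₂ (c , h)) = inj₂ (c , λ a b d p q r → h a b d (s a p) (s b q) (s d r))

edge?-elim : ∀ {n} (K Q : Fin n → Fin n → Fin n → Bool) → Symmetric₃ Q →
  (∀ x y z → (x <F y) ≡ true → (y <F z) ≡ true → K x y z ≡ true → Q x y z ≡ true) →
  ∀ a b c → edge? K a b c ≡ true → Q a b c ≡ true
edge?-elim K Q s f a b c p with edge?-inc K a b c p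
... | inj₁ q = let (u , v , w) = inc-sorted K a b c q in f _ _ _ u v w
... | inj₂ (inj₁ q) = let (u , v , w) = inc-sorted K a c b q in trans (swap₂₃ s a b c) (f _ _ _ u v w)
... | inj₂ (inj₂ (inj₁ q)) = let (u , v , w) = inc-sorted K b a c q in trans (swap₁₂ s a b c) (f _ _ _ u v w)
... | inj₂ (inj₂ (inj₂ (inj₁ q))) = let (u , v , w) = inc-sorted K b c a q in trans (rot s a b c) (f _ _ _ u v w)
... | inj₂ (inj₂ (inj₂ (inj₂ (inj₁ q)))) = let (u , v , w) = inc-sorted K c a b q in trans (rot² s a b c) (f _ _ _ u v w)
... | inj₂ (inj₂ (inj₂ (inj₂ (inj₂ q)))) = let (u , v , w) = inc-sorted K c b a q in trans (swap₁₃ s a b c) (f _ _ _ u v w)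

-- Triples of a 5-set; maps are written as decimal numbers whose a-th digit is the image of a.

opaque
  digit : ℕ → ∀ {k} r .{{_ : NonZero r}} → Fin k → Fin r
  digit N r zero = (N % 10) mod r
  digit N r (suc a) = digit (N / 10) r a

  tri : Fin 10 → Fin 3 → Fin 5
  tri i = digit (Vec.lookup (210 ∷ 310 ∷ 410 ∷ 320 ∷ 420 ∷ 430 ∷ 321 ∷ 421 ∷ 431 ∷ 432 ∷ []) i) 5

  isTri : Fin 10 → Fin 5 → Fin 5 → Fin 5 → Bool
  isTri i a b c = (a == tri i zero) ∧ ((b == tri i (suc zero)) ∧ (c == tri i (suc (suc zero))))

  isTri-sound : ∀ i {a b c} → isTri i a b c ≡ true → a ≡ tri i zero × b ≡ tri i (suc zero) × c ≡ tri i (suc (suc zero))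
  isTri-sound i {a} {b} {c} h = let (p , q) = ∧-true {a == tri i zero} h ; (q , r) = ∧-true {b == tri i (suc zero)} q in ==⇒≡ p , ==⇒≡ q , ==⇒≡ r

  -- A permutation of the five vertices that carries the missing triple {0,1,2} of `K5⁻` to the i-th
  -- triple.
  K5⁻-map : Fin 10 → Fin 5 → Fin 5
  K5⁻-map i = digit (Vec.lookup (43210 ∷ 42310 ∷ 32410 ∷ 41320 ∷ 31420 ∷ 21430 ∷ 40321 ∷ 30421 ∷ 20431 ∷ 10432 ∷ []) i) 5

  -- A homomorphism to G26 of the 5-vertex graph missing the triples i and j.
  two-missing : Fin 10 → Fin 10 → Fin 5 → Fin 6
  two-missing i j = digit (Vec.lookup (Vec.lookup table i) j) 6
    where
    table : Vec (Vec ℕ 10) 10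
    table = (0 ∷ 35210 ∷ 53210 ∷ 35120 ∷ 53120 ∷ 43102 ∷ 35102 ∷ 53102 ∷ 43120 ∷ 43210 ∷ [])
      ∷ (35210 ∷ 0 ∷ 52310 ∷ 31520 ∷ 41302 ∷ 51320 ∷ 31502 ∷ 41320 ∷ 51302 ∷ 42310 ∷ [])
      ∷ (53210 ∷ 52310 ∷ 0 ∷ 14302 ∷ 13520 ∷ 15320 ∷ 14320 ∷ 13502 ∷ 15302 ∷ 24310 ∷ [])
      ∷ (35120 ∷ 31520 ∷ 14302 ∷ 0 ∷ 52130 ∷ 51230 ∷ 31052 ∷ 41230 ∷ 42130 ∷ 54302 ∷ [])
      ∷ (53120 ∷ 41302 ∷ 13520 ∷ 52130 ∷ 0 ∷ 15230 ∷ 14230 ∷ 13052 ∷ 24130 ∷ 45302 ∷ [])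
      ∷ (43102 ∷ 51320 ∷ 15320 ∷ 51230 ∷ 15230 ∷ 0 ∷ 12430 ∷ 21430 ∷ 43052 ∷ 43502 ∷ [])
      ∷ (35102 ∷ 31502 ∷ 14320 ∷ 31052 ∷ 14230 ∷ 12430 ∷ 0 ∷ 52430 ∷ 54230 ∷ 54320 ∷ [])
      ∷ (53102 ∷ 41320 ∷ 13502 ∷ 41230 ∷ 13052 ∷ 21430 ∷ 52430 ∷ 0 ∷ 45230 ∷ 45320 ∷ [])
      ∷ (43120 ∷ 51302 ∷ 15302 ∷ 42130 ∷ 24130 ∷ 43052 ∷ 54230 ∷ 45230 ∷ 0 ∷ 43520 ∷ [])
      ∷ (43210 ∷ 42310 ∷ 24310 ∷ 54302 ∷ 45302 ∷ 43502 ∷ 54320 ∷ 45320 ∷ 43520 ∷ 0 ∷ [])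
      ∷ []

infixr 4 _⇒ᵇ_
_⇒ᵇ_ : Bool → Bool → Bool
a ⇒ᵇ b = not a ∨ b

⇒ᵇ-mp : ∀ {a b} → (a ⇒ᵇ b) ≡ true → a ≡ true → b ≡ true
⇒ᵇ-mp h refl = h

opaque
  unfolding digit
  -- The vertices 0, 2, 3, 5 span a complete 3-graph in `G26`, so every graph on at most four
  -- vertices maps into it.
  injective-4 : Fin 4 → Fin 6
  injective-4 = digit 5320 6

∀³ᵇ : ∀ {i j k} → (Fin i → Fin j → Fin k → Bool) → Bool
∀³ᵇ p = ∀ᵇ λ x → ∀ᵇ λ y → ∀ᵇ λ z → p x y z

∀³ᵇ-sound : ∀ {i j k} (p : Fin i → Fin j → Fin k → Bool) → ∀³ᵇ p ≡ true → ∀ x y z → p x y z ≡ true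
∀³ᵇ-sound p h x y z = ∀ᵇ-sound {p = p x y} (∀ᵇ-sound {p = λ y → ∀ᵇ λ z → p x y z} (∀ᵇ-sound {p = λ x → ∀ᵇ λ y → ∀ᵇ λ z → p x y z} h x) y) z

private
  tri-check : Fin 5 → Fin 5 → Fin 5 → Bool
  tri-check a b c = (a <F b) ∧ (b <F c) ⇒ᵇ ∃ᵇ λ i → isTri i a b c

  two-check : Fin 10 → Fin 10 → Fin 5 → Fin 5 → Fin 5 → Bool
  two-check i j a b c = (a <F b) ∧ ((b <F c) ∧ (not (isTri i a b c) ∧ not (isTri j a b c))) ⇒ᵇ P₆ (two-missing i j a) (two-missing i j b) (two-missing i j c)

  K5⁻-check : Fin 10 → Fin 5 → Fin 5 → Fin 5 → Bool
  K5⁻-check i a b c = edge? K5⁻ a b c ⇒ᵇ edge? (λ x y z → not (isTri i x y z)) (K5⁻-map i a) (K5⁻-map i b) (K5⁻-map i c)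

  inj-check : Fin 10 → Fin 5 → Fin 5 → Bool
  inj-check i a b = (K5⁻-map i a == K5⁻-map i b) ⇒ᵇ (a == b)

  four-check : Fin 4 → Fin 4 → Fin 4 → Bool
  four-check a b c = (a <F b) ∧ (b <F c) ⇒ᵇ P₆ (injective-4 a) (injective-4 b) (injective-4 c)

opaque
  unfolding P₆ digit injective-4 ∀ᵇ ∃ᵇ
  tri-checked : ∀³ᵇ tri-check ≡ true
  tri-checked = refl

  two-checked : (∀ᵇ λ i → ∀ᵇ λ j → (i == j) ∨ ∀³ᵇ (two-check i j)) ≡ true
  two-checked = refl

  K5⁻-checked : (∀ᵇ λ i → ∀³ᵇ (K5⁻-check i)) ≡ true
  K5⁻-checked = refl

  inj-checked : ∀³ᵇ inj-check ≡ true
  inj-checked = refl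

  four-checked : ∀³ᵇ four-check ≡ true
  four-checked = refl

tri-complete : ∀ a b c → (a <F b) ≡ true → (b <F c) ≡ true → ∃ λ i → isTri i a b c ≡ true
tri-complete a b c p q = ∃ᵇ-sound {p = λ i → isTri i a b c} (⇒ᵇ-mp {(a <F b) ∧ (b <F c)} {∃ᵇ λ i → isTri i a b c} (∀³ᵇ-sound tri-check tri-checked a b c) (∧-intro p q))

two-missing-hom : ∀ i j → i ≢ j → ∀ a b c → (a <F b) ≡ true → (b <F c) ≡ true → isTri i a b c ≡ false → isTri j a b c ≡ false →
  P₆ (two-missing i j a) (two-missing i j b) (two-missing i j c) ≡ true
two-missing-hom i j i≢j a b c p q ni nj = ⇒ᵇ-mp {(a <F b) ∧ ((b <F c) ∧ (not (isTri i a b c) ∧ not (isTri j a b c)))} (∀³ᵇ-sound (two-check i j) at-ij a b c) (∧-intro p (∧-intro q (∧-intro (cong not ni) (cong not nj))))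
  where
  at-ij : ∀³ᵇ (two-check i j) ≡ true
  at-ij with ∨-true {i == j} (∀ᵇ-sound {p = λ j → (i == j) ∨ ∀³ᵇ (two-check i j)} (∀ᵇ-sound {p = λ i → ∀ᵇ λ j → (i == j) ∨ ∀³ᵇ (two-check i j)} two-checked i) j)
  ... | inj₁ e = ⊥-elim (i≢j (==⇒≡ e))
  ... | inj₂ h = h

K5⁻-map-hom : ∀ i a b c → edge? K5⁻ a b c ≡ true → edge? (λ x y z → not (isTri i x y z)) (K5⁻-map i a) (K5⁻-map i b) (K5⁻-map i c) ≡ true
K5⁻-map-hom i a b c = ⇒ᵇ-mp {edge? K5⁻ a b c} (∀³ᵇ-sound (K5⁻-check i) (∀ᵇ-sound {p = λ i → ∀³ᵇ (K5⁻-check i)} K5⁻-checked i) a b c)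

K5⁻-map-injective : ∀ i a b → K5⁻-map i a ≡ K5⁻-map i b → a ≡ b
K5⁻-map-injective i a b p = ==⇒≡ (⇒ᵇ-mp {K5⁻-map i a == K5⁻-map i b} (∀³ᵇ-sound inj-check inj-checked i a b) (subst (λ z → (K5⁻-map i a == z) ≡ true) p (==-refl (K5⁻-map i a))))

injective-4-hom : ∀ a b c → (a <F b) ≡ true → (b <F c) ≡ true → P₆ (injective-4 a) (injective-4 b) (injective-4 c) ≡ true
injective-4-hom a b c p q = ⇒ᵇ-mp {(a <F b) ∧ (b <F c)} (∀³ᵇ-sound four-check four-checked a b c) (∧-intro p q)

-- Covered sets are well coloured

module _ {n} (E : Fin n → Fin n → Fin n → Bool) (R : Rules E) where
  open Rules R

  private
    V = Fin n

    ∈₃-rest : ∀ {x a b c : V} → x ∈₃ a , b , c → ∃ λ y → ∃ λ z → ∀ w → w ∈₃ a , b , c → w ∈₃ x , y , z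
    ∈₃-rest {a = a} {b} {c} (inj₁ refl) = b , c , λ w p → p
    ∈₃-rest {a = a} {b} {c} (inj₂ (inj₁ refl)) = a , c , λ { w (inj₁ p) → inj₂ (inj₁ p) ; w (inj₂ (inj₁ p)) → inj₁ p ; w (inj₂ (inj₂ p)) → inj₂ (inj₂ p) }
    ∈₃-rest {a = a} {b} {c} (inj₂ (inj₂ refl)) = a , b , λ { w (inj₁ p) → inj₂ (inj₁ p) ; w (inj₂ (inj₁ p)) → inj₂ (inj₂ p) ; w (inj₂ (inj₂ p)) → inj₁ p }

  star⇒Good : ∀ U x → (∀ a b d → U a ≡ true → U b ≡ true → U d ≡ true → E a b d ≡ true → x ∈₃ a , b , d) → Good E U
  star⇒Good U x st = inj₁ (c , col)
    where
    c : V → Fin 2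
    c y = if x == y then zero else suc zero
    c0 : ∀ y → (c y == zero) ≡ (x == y)
    c0 y with x == y
    ... | true = refl
    ... | false = refl
    one : ∀ b d → E x b d ≡ true → exactlyOne (x == x) (x == b) (x == d) ≡ true
    one b d e rewrite ==-refl x | ≢⇒== {x = x} {b} (λ { refl → true≢false (trans (sym e) (irr x d)) }) | ≢⇒== {x = x} {d} (λ { refl → true≢false (trans (sym e) (trans (swap₂₃ symm x b x) (irr x b))) }) = refl
    col : Colouring P₂ E U c
    col a b d ua ub ud e rewrite P₂≡ (c a) (c b) (c d) | c0 a | c0 b | c0 d with st a b d ua ub ud e
    ... | inj₁ refl = one b d e
    ... | inj₂ (inj₁ refl) = trans (swap₁₂ exactlyOne-symmetric (x == a) (x == x) (x == d)) (one a d (trans (swap₁₂ symm x a d) e))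
    ... | inj₂ (inj₂ refl) = trans (rot² exactlyOne-symmetric (x == a) (x == b) (x == x)) (one a b (trans (sym (rot² symm a b x)) e))

  module _ (U : V → Bool) (cov : ∀ a b → U a ≡ true → U b ≡ true → a ≢ b → ∃ λ z → E a b z ≡ true) where
    private
      record UEdge : Set where
        constructor uedge
        field
          {p q r} : V
          up : U p ≡ true
          uq : U q ≡ true
          ur : U r ≡ true
          ed : E p q r ≡ true

      _∈ₑ_ : V → UEdge → Set
      x ∈ₑ e = x ∈₃ UEdge.p e , UEdge.q e , UEdge.r e

      module Large (7≤U : 7 ≤ ∑ (b2n ∘ U)) where
        -- Any list of at most seven vertices of U is padded to a seven-element subset of U; that
        -- subset is covered, so `core₇` gives its edges a common vertex.
        common : (L : List V) → length L ≤ 7 → All (λ x → U x ≡ true) L →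
          ∃ λ x → ∀ a b c → a ∈ L → b ∈ L → c ∈ L → E a b c ≡ true → x ∈₃ a , b , c
        common L L≤7 L⊆U with enlarge (setOf L) U (λ x p → All.lookup L⊆U (setOf-sound L p)) (7 ∸ ∑ (b2n ∘ setOf L)) (≤-trans (≤-reflexive (m+[n∸m]≡n (≤-trans (card-setOf L) L≤7))) 7≤U)
        ... | S , L⊆S , S⊆U , eq with enumerate S
        ...   | enumeration k e inj e∈ ix k≡ with trans k≡ (trans eq (m+[n∸m]≡n (≤-trans (card-setOf L) L≤7)))
        ...     | refl with core₇ e (λ i j i≢j → cov (e i) (e j) (S⊆U _ (e∈ i)) (S⊆U _ (e∈ j)) (i≢j ∘ inj))
        ...       | x , st = e x , λ a b c p q r ed → go (ix a (L⊆S a (setOf-complete p))) (ix b (L⊆S b (setOf-complete q))) (ix c (L⊆S c (setOf-complete r))) ed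
          where
          go : ∀ {a b c} → (∃ λ i → e i ≡ a) → (∃ λ i → e i ≡ b) → (∃ λ i → e i ≡ c) → E a b c ≡ true → e x ∈₃ a , b , c
          go (i , refl) (j , refl) (l , refl) ed with st i j l ed
          ... | inj₁ refl = inj₁ refl
          ... | inj₂ (inj₁ refl) = inj₂ (inj₁ refl)
          ... | inj₂ (inj₂ refl) = inj₂ (inj₂ refl)

        two-meet : ∀ e f → ∃ λ x → x ∈ₑ e × x ∈ₑ f
        two-meet e@(uedge {a} {b} {c} u₁ u₂ u₃ h) f@(uedge {a′} {b′} {c′} v₁ v₂ v₃ k) with common (a ∷ b ∷ c ∷ a′ ∷ b′ ∷ c′ ∷ []) (≤-by refl) (u₁ ∷ u₂ ∷ u₃ ∷ v₁ ∷ v₂ ∷ v₃ ∷ [])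
        ... | x , st = x , st _ _ _ (here refl) (there (here refl)) (there (there (here refl))) h
                         , st _ _ _ (there (there (there (here refl)))) (there (there (there (there (here refl))))) (there (there (there (there (there (here refl)))))) k

        U-of : ∀ e x → x ∈ₑ e → U x ≡ true
        U-of (uedge u₁ u₂ u₃ _) x (inj₁ refl) = u₁
        U-of (uedge u₁ u₂ u₃ _) x (inj₂ (inj₁ refl)) = u₂
        U-of (uedge u₁ u₂ u₃ _) x (inj₂ (inj₂ refl)) = u₃

        apply : ∀ L → ((∃ λ x → ∀ a b c → a ∈ L → b ∈ L → c ∈ L → E a b c ≡ true → x ∈₃ a , b , c)) → Σ V λ x → ∀ e → (∀ w → w ∈ₑ e → w ∈ L) → x ∈ₑ e
        apply L (x , st) = x , λ { (uedge _ _ _ h) s → st _ _ _ (s _ (inj₁ refl)) (s _ (inj₂ (inj₁ refl))) (s _ (inj₂ (inj₂ refl))) h }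

        rest : ∀ f {x} → x ∈ₑ f → ∃ λ y → ∃ λ z → y ∈ₑ f × z ∈ₑ f × (∀ w → w ∈ₑ f → w ∈₃ x , y , z)
        rest (uedge {a} {b} {c} _ _ _ _) (inj₁ refl) = b , c , inj₂ (inj₁ refl) , inj₂ (inj₂ refl) , proj₂ (proj₂ (∈₃-rest {a = a} {b} {c} (inj₁ refl)))
        rest (uedge {a} {b} {c} _ _ _ _) (inj₂ (inj₁ refl)) = a , c , inj₁ refl , inj₂ (inj₂ refl) , proj₂ (proj₂ (∈₃-rest {a = a} {b} {c} (inj₂ (inj₁ refl))))
        rest (uedge {a} {b} {c} _ _ _ _) (inj₂ (inj₂ refl)) = a , b , inj₁ refl , inj₂ (inj₁ refl) , proj₂ (proj₂ (∈₃-rest {a = a} {b} {c} (inj₂ (inj₂ refl))))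

        -- By `two-meet` both f and g share a vertex with e, so the three edges span at most 3 + 2 +
        -- 2 = 7 vertices and `common` applies.
        three-meet : ∀ e f g → ∃ λ x → x ∈ₑ e × x ∈ₑ f × x ∈ₑ g
        three-meet e@(uedge {a} {b} {c} u₁ u₂ u₃ h) f g with two-meet e f | two-meet e g
        ... | y , ye , yf | z , ze , zg with rest f yf | rest g zg
        ... | f₁ , f₂ , m₁ , m₂ , hf | g₁ , g₂ , m₃ , m₄ , hg with apply L (common L (≤-by refl) (u₁ ∷ u₂ ∷ u₃ ∷ U-of f _ m₁ ∷ U-of f _ m₂ ∷ U-of g _ m₃ ∷ U-of g _ m₄ ∷ []))
          where L = a ∷ b ∷ c ∷ f₁ ∷ f₂ ∷ g₁ ∷ g₂ ∷ []
        ... | x , st = x , st e in-e , st f in-f , st g in-g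
          where
          L = a ∷ b ∷ c ∷ f₁ ∷ f₂ ∷ g₁ ∷ g₂ ∷ []
          in-e : ∀ w → w ∈₃ a , b , c → w ∈ L
          in-e w (inj₁ p) = here p
          in-e w (inj₂ (inj₁ p)) = there (here p)
          in-e w (inj₂ (inj₂ p)) = there (there (here p))
          in-f : ∀ w → w ∈ₑ f → w ∈ L
          in-f w p with hf w p
          ... | inj₁ refl = in-e y ye
          ... | inj₂ (inj₁ q) = there (there (there (here q)))
          ... | inj₂ (inj₂ q) = there (there (there (there (here q))))
          in-g : ∀ w → w ∈ₑ g → w ∈ L
          in-g w p with hg w p
          ... | inj₁ refl = in-e z ze
          ... | inj₂ (inj₁ q) = there (there (there (there (there (here q)))))
          ... | inj₂ (inj₂ q) = there (there (there (there (there (there (here q))))))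

        missing? : ∀ x → (Σ UEdge λ e → ¬ (x ∈ₑ e)) ⊎ (∀ a b d → U a ≡ true → U b ≡ true → U d ≡ true → E a b d ≡ true → x ∈₃ a , b , d)
        missing? x with Finₚ.any? (λ a → Finₚ.any? λ b → Finₚ.any? λ d → (U a Boolₚ.≟ true) ×-dec ((U b Boolₚ.≟ true) ×-dec ((U d Boolₚ.≟ true) ×-dec ((E a b d Boolₚ.≟ true) ×-dec ¬? ((x ≟ a) ⊎-dec ((x ≟ b) ⊎-dec (x ≟ d)))))))
        ... | yes (a , b , d , ua , ub , ud , e , ¬m) = inj₁ (uedge ua ub ud e , ¬m)
        ... | no ¬p = inj₂ λ a b d ua ub ud e → case (x ≟ a) ⊎-dec ((x ≟ b) ⊎-dec (x ≟ d)) of λ where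
              (yes m) → m
              (no ¬m) → ⊥-elim (¬p (a , b , d , ua , ub , ud , e , ¬m))

        -- If some edge misses a, some b and some c, where abc is an edge, then any three of the four
        -- edges meet, so they span at most 6 vertices, although they have no common vertex.
        no-four : (e : UEdge) (f g h : UEdge) → ¬ (UEdge.p e ∈ₑ f) → ¬ (UEdge.q e ∈ₑ g) → ¬ (UEdge.r e ∈ₑ h) → ⊥
        no-four e@(uedge {a} {b} {c} u₁ u₂ u₃ ed) f g h a∉f b∉g c∉h = finish
          where
          a≢b : a ≢ b
          a≢b refl = true≢false (trans (sym ed) (irr a c))
          b≢c : b ≢ c
          b≢c refl = true≢false (trans (sym ed) (trans (rot symm a b b) (irr b a)))
          a≢c : a ≢ c
          a≢c refl = true≢false (trans (sym ed) (trans (swap₂₃ symm a b a) (irr a b)))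
          c∈ : c ∈ₑ f × c ∈ₑ g
          c∈ = sel (three-meet e f g)
            where
            sel : (∃ λ x → x ∈ₑ e × x ∈ₑ f × x ∈ₑ g) → c ∈ₑ f × c ∈ₑ g
            sel (x , inj₁ refl , xf , xg) = ⊥-elim (a∉f xf)
            sel (x , inj₂ (inj₁ refl) , xf , xg) = ⊥-elim (b∉g xg)
            sel (x , inj₂ (inj₂ refl) , xf , xg) = xf , xg
          b∈ : b ∈ₑ f × b ∈ₑ h
          b∈ = sel (three-meet e f h)
            where
            sel : (∃ λ x → x ∈ₑ e × x ∈ₑ f × x ∈ₑ h) → b ∈ₑ f × b ∈ₑ h
            sel (x , inj₁ refl , xf , xg) = ⊥-elim (a∉f xf)
            sel (x , inj₂ (inj₁ refl) , xf , xg) = xf , xg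
            sel (x , inj₂ (inj₂ refl) , xf , xg) = ⊥-elim (c∉h xg)
          a∈ : a ∈ₑ g × a ∈ₑ h
          a∈ = sel (three-meet e g h)
            where
            sel : (∃ λ x → x ∈ₑ e × x ∈ₑ g × x ∈ₑ h) → a ∈ₑ g × a ∈ₑ h
            sel (x , inj₁ refl , xf , xg) = xf , xg
            sel (x , inj₂ (inj₁ refl) , xf , xg) = ⊥-elim (b∉g xf)
            sel (x , inj₂ (inj₂ refl) , xf , xg) = ⊥-elim (c∉h xg)
          third : ∀ f {x y} → x ≢ y → x ∈ₑ f → y ∈ₑ f → ∃ λ z → U z ≡ true × (∀ w → w ∈ₑ f → w ∈₃ x , y , z)
          third f {x} {y} x≢y p q with rest f p
          ... | u , v , mu , mv , hh with hh y q
          ... | inj₁ e = ⊥-elim (x≢y (sym e))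
          ... | inj₂ (inj₁ refl) = v , U-of f v mv , hh
          ... | inj₂ (inj₂ refl) = u , U-of f u mu , λ w r → case hh w r of λ where
                (inj₁ e) → inj₁ e
                (inj₂ (inj₁ e)) → inj₂ (inj₂ e)
                (inj₂ (inj₂ e)) → inj₂ (inj₁ e)
          finish : ⊥
          finish = fin (third f b≢c (proj₁ b∈) (proj₁ c∈)) (third g a≢c (proj₁ a∈) (proj₂ c∈)) (third h a≢b (proj₂ a∈) (proj₂ b∈))
            where
            fin : (∃ λ z → U z ≡ true × (∀ w → w ∈ₑ f → w ∈₃ b , c , z)) → (∃ λ z → U z ≡ true × (∀ w → w ∈ₑ g → w ∈₃ a , c , z)) → (∃ λ z → U z ≡ true × (∀ w → w ∈ₑ h → w ∈₃ a , b , z)) → ⊥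
            fin (x , ux , hx) (y , uy , hy) (z , uz , hz) = end (apply (a ∷ b ∷ c ∷ x ∷ y ∷ z ∷ []) (common (a ∷ b ∷ c ∷ x ∷ y ∷ z ∷ []) (≤-by refl) (u₁ ∷ u₂ ∷ u₃ ∷ ux ∷ uy ∷ uz ∷ [])))
              where
              L = a ∷ b ∷ c ∷ x ∷ y ∷ z ∷ []
              in-e : ∀ w → w ∈₃ a , b , c → w ∈ L
              in-e w (inj₁ p) = here p
              in-e w (inj₂ (inj₁ p)) = there (here p)
              in-e w (inj₂ (inj₂ p)) = there (there (here p))
              in-f : ∀ w → w ∈ₑ f → w ∈ L
              in-f w p with hx w p
              ... | inj₁ q = there (here q)
              ... | inj₂ (inj₁ q) = there (there (here q))
              ... | inj₂ (inj₂ q) = there (there (there (here q)))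
              in-g : ∀ w → w ∈ₑ g → w ∈ L
              in-g w p with hy w p
              ... | inj₁ q = here q
              ... | inj₂ (inj₁ q) = there (there (here q))
              ... | inj₂ (inj₂ q) = there (there (there (there (here q))))
              in-h : ∀ w → w ∈ₑ h → w ∈ L
              in-h w p with hz w p
              ... | inj₁ q = here q
              ... | inj₂ (inj₁ q) = there (here q)
              ... | inj₂ (inj₂ q) = there (there (there (there (there (here q)))))
              contra : ∀ t → (∀ e → (∀ w → w ∈ₑ e → w ∈ L) → t ∈ₑ e) → t ∈₃ a , b , c → ⊥
              contra _ st (inj₁ refl) = a∉f (st f in-f)
              contra _ st (inj₂ (inj₁ refl)) = b∉g (st g in-g)
              contra _ st (inj₂ (inj₂ refl)) = c∉h (st h in-h)
              end : (Σ V λ x → ∀ e → (∀ w → w ∈ₑ e → w ∈ L) → x ∈ₑ e) → ⊥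
              end (t , st) = contra t st (st e in-e)

        -- If v is not a centre, some edge e misses v. Either a vertex of e is a centre, or each of
        -- its three vertices is missed by an edge, which `no-four` excludes.
        star : V → Good E U
        star v with missing? v
        ... | inj₂ st = star⇒Good U v st
        ... | inj₁ (e , _) with missing? (UEdge.p e) | missing? (UEdge.q e) | missing? (UEdge.r e)
        ...   | inj₂ st | _ | _ = star⇒Good U _ st
        ...   | _ | inj₂ st | _ = star⇒Good U _ st
        ...   | _ | _ | inj₂ st = star⇒Good U _ st
        ...   | inj₁ (f , p) | inj₁ (g , q) | inj₁ (h , r) = ⊥-elim (no-four e f g h p q r)

      index-colour : ∀ {r} (en : Enumeration U) (φ : Fin (Enumeration.size en) → Fin (suc r)) (P : Pattern (suc r)) →
        (∀ i j l → E (Enumeration.elem en i) (Enumeration.elem en j) (Enumeration.elem en l) ≡ true → P (φ i) (φ j) (φ l) ≡ true) → ∃ (Colouring P E U)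
      index-colour {r} en φ P hom = c , col
        where
        open Enumeration en
        c : V → Fin (suc r)
        c x = [ (λ h → φ (proj₁ (index x h))) , (λ _ → zero) ]′ (true? (U x))
        spec : ∀ x → U x ≡ true → ∃ λ i → elem i ≡ x × φ i ≡ c x
        spec x h with true? (U x)
        ... | inj₁ h′ = proj₁ (index x h′) , proj₂ (index x h′) , refl
        ... | inj₂ h′ = ⊥-elim (true≢false (trans (sym h) h′))
        col : Colouring P E U c
        col a b d ua ub ud e with spec a ua | spec b ub | spec d ud
        ... | i , refl , p | j , refl , q | l , refl , s = subst₂ (λ x y → P x y _ ≡ true) p q (subst (λ z → P (φ i) (φ j) z ≡ true) s (hom i j l e))

      sorted : ∀ {k} (s : Fin k → V) (Q : Fin k → Fin k → Fin k → Bool) → Symmetric₃ Q →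
        (∀ x y z → (x <F y) ≡ true → (y <F z) ≡ true → E (s x) (s y) (s z) ≡ true → Q x y z ≡ true) →
        ∀ a b c → E (s a) (s b) (s c) ≡ true → Q a b c ≡ true
      sorted s Q sQ f a b c e = edge?-elim (λ a b c → E (s a) (s b) (s c)) Q sQ f a b c
        (trans (edge?-collapse (λ a b c → E (s a) (s b) (s c)) (symmetric₃-∘ s symm) (λ a c → irr (s a) (s c)) a b c) e)

      -- At least two of the ten triples are missing, as otherwise `K5⁻` appears; and deleting any
      -- two triples from the complete graph on five vertices leaves a graph that maps to `G26`.
      five : (s : Fin 5 → V) → Injective _≡_ _≡_ s → Σ (Fin 5 → Fin 6) λ φ → ∀ a b c → E (s a) (s b) (s c) ≡ true → P₆ (φ a) (φ b) (φ c) ≡ true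
      five s inj = go
        where
        Et : Fin 10 → Bool
        Et i = E (s (tri i zero)) (s (tri i (suc zero))) (s (tri i (suc (suc zero))))
        Et≡ : ∀ i {x y z} → isTri i x y z ≡ true → E (s x) (s y) (s z) ≡ Et i
        Et≡ i h with isTri-sound i h
        ... | refl , refl , refl = refl
        one-missing : ∀ i → (∀ j → ((i == j) ∨ Et j) ≡ true) → ⊥
        one-missing i h = no-K5⁻ (s ∘ K5⁻-map i) (λ p → K5⁻-map-injective i _ _ (inj p)) λ a b c e →
          edge?-elim (λ x y z → not (isTri i x y z)) (λ x y z → E (s x) (s y) (s z)) (symmetric₃-∘ s symm) present (K5⁻-map i a) (K5⁻-map i b) (K5⁻-map i c) (K5⁻-map-hom i a b c e)
          where
          present : ∀ x y z → (x <F y) ≡ true → (y <F z) ≡ true → not (isTri i x y z) ≡ true → E (s x) (s y) (s z) ≡ true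
          present x y z p q r with tri-complete x y z p q
          ... | j , t with ∨-true {i == j} (h j)
          ...   | inj₂ u = trans (Et≡ j t) u
          ...   | inj₁ u with ==⇒≡ {x = i} u
          ...     | refl = ⊥-elim (true≢false (trans (sym t) (not-true r)))
        go : Σ (Fin 5 → Fin 6) λ φ → ∀ a b c → E (s a) (s b) (s c) ≡ true → P₆ (φ a) (φ b) (φ c) ≡ true
        go with ∀-or-∃ Et
        ... | inj₁ h = ⊥-elim (one-missing zero λ j → ∨-introʳ (zero == j) (h j))
        ... | inj₂ (i , hi) with ∀-or-∃ (λ j → (i == j) ∨ Et j)
        ...   | inj₁ h = ⊥-elim (one-missing i h)
        ...   | inj₂ (j , hj) = two-missing i j , sorted s _ (symmetric₃-∘ (two-missing i j) P₆-symmetric) λ x y z p q e →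
                  two-missing-hom i j i≢j x y z p q (¬true λ t → true≢false (trans (sym e) (trans (Et≡ i t) hi)))
                    (¬true λ t → true≢false (trans (sym e) (trans (Et≡ j t) (¬true λ u → true≢false (trans (sym (∨-introʳ (i == j) u)) hj)))))
          where
          i≢j : i ≢ j
          i≢j refl = true≢false (trans (sym (∨-introˡ (Et i) (==-refl i))) hj)

      embed : ∀ {k} (k≤4 : k ≤ 4) → ∀ (x y : Fin k) → (x <F y) ≡ true → (inject≤ x k≤4 <F inject≤ y k≤4) ≡ true
      embed k≤4 x y p = trans (cong₂ _<ᵇ_ (Finₚ.toℕ-inject≤ x k≤4) (Finₚ.toℕ-inject≤ y k≤4)) p

      small : (en : Enumeration U) → Enumeration.size en ≤ 4 → Good E U
      small en k≤4 = inj₂ (index-colour en (injective-4 ∘ g) P₆ (sorted elem _ (symmetric₃-∘ (injective-4 ∘ g) P₆-symmetric) λ x y z p q e → injective-4-hom (g x) (g y) (g z) (embed k≤4 x y p) (embed k≤4 y z q)))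
        where
        open Enumeration en
        g : Fin size → Fin 4
        g x = inject≤ x k≤4

      -- Each size has its own reason: up to four vertices map into a complete part of `G26`, five
      -- use the exclusion of `K5⁻`, six use `core₆`, and seven or more use `core₇`.
      base : Enumeration U → Good E U
      base en@(enumeration 0 _ _ _ _ _) = small en (≤-by {0} {4} refl)
      base en@(enumeration 1 _ _ _ _ _) = small en (≤-by {1} {4} refl)
      base en@(enumeration 2 _ _ _ _ _) = small en (≤-by {2} {4} refl)
      base en@(enumeration 3 _ _ _ _ _) = small en (≤-by {3} {4} refl)
      base en@(enumeration 4 _ _ _ _ _) = small en (≤-by {4} {4} refl)
      base en@(enumeration 5 s inj _ _ _) = let (φ , h) = five s inj in inj₂ (index-colour en φ P₆ h)
      base en@(enumeration 6 s inj s∈ ix _) with core₆ s (λ i j i≢j → cov (s i) (s j) (s∈ i) (s∈ j) (i≢j ∘ inj))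
      ... | inj₂ (φ , _ , h) = inj₂ (index-colour en φ P₆ λ a b c e → trans (P₆≡ (φ a) (φ b) (φ c)) (trans (sym (edges≡ G26 _ _ _)) (h a b c e)))
      ... | inj₁ (x , st) = star⇒Good U (s x) λ a b d ua ub ud e → go (ix a ua) (ix b ub) (ix d ud) e
        where
        go : ∀ {a b c} → (∃ λ i → s i ≡ a) → (∃ λ i → s i ≡ b) → (∃ λ i → s i ≡ c) → E a b c ≡ true → s x ∈₃ a , b , c
        go (i , refl) (j , refl) (l , refl) ed with st i j l ed
        ... | inj₁ refl = inj₁ refl
        ... | inj₂ (inj₁ refl) = inj₂ (inj₁ refl)
        ... | inj₂ (inj₂ refl) = inj₂ (inj₂ refl)
      base (enumeration (suc (suc (suc (suc (suc (suc (suc k))))))) s _ _ _ k≡) = Large.star (≤-trans (m≤m+n 7 k) (≤-reflexive k≡)) (s zero)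

    covered⇒Good : Good E U
    covered⇒Good = base (enumerate U)

-- The Lagrangian polynomials of the two patterns

kern : ∀ {n} → (Fin n → Fin n → Fin n → Bool) → Kernel n
kern P a b c = b2n (P a b c)

kern≤1 : ∀ {n} (P : Fin n → Fin n → Fin n → Bool) a b c → kern P a b c ≤ 1
kern≤1 P a b c = b2n≤1 (P a b c)

kern-symmetric : ∀ {n} {P : Fin n → Fin n → Fin n → Bool} → Symmetric₃ P → Symmetric₃ (kern P)
kern-symmetric = symmetric₃-map b2n

opaque
  unfolding ∑
  ∑₂ : (f : Fin 2 → ℕ) → ∑ f ≡ f zero + f (suc zero)
  ∑₂ f = cong (f zero +_) (+-identityʳ _)

  ∑₆ : (f : Fin 6 → ℕ) → ∑ f ≡ f zero + f (suc zero) + f (suc (suc zero)) + f (suc (suc (suc zero))) + f (suc (suc (suc (suc zero)))) + f (suc (suc (suc (suc (suc zero)))))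
  ∑₆ f = lem (f zero) _ _ _ _ _
    where lem : ∀ a b c d e f → a + (b + (c + (d + (e + (f + 0))))) ≡ a + b + c + d + e + f
          lem = solve-∀

-- The sum over the 16 edges of `G26`, grouped by the pairs {1,2}, {4,5}, {3,6}: a missing triple
-- consists of {1,2} or {4,5} together with 3 or 6. The grouping prepares the decomposition into
-- squares.
poly₆ : ℕ → ℕ → ℕ → ℕ → ℕ → ℕ → ℕ
poly₆ x₁ x₂ x₃ x₄ x₅ x₆ = x₁ * x₂ * (x₄ + x₅) + x₄ * x₅ * (x₁ + x₂) + x₃ * x₆ * (x₁ + x₂ + (x₄ + x₅)) + (x₁ + x₂) * (x₄ + x₅) * (x₃ + x₆)

opaque
  unfolding ∑ P₂ P₆ form
  cube-P₂ : ∀ X → cube (kern P₂) X ≡ 3 * (X zero * (X (suc zero) * X (suc zero)))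
  cube-P₂ X = lem (X zero) (X (suc zero))
    where
    lem : ∀ a b → a * (a * (a * 0 + (b * 0 + 0)) + (b * (a * 0 + (b * 1 + 0)) + 0)) + (b * (a * (a * 0 + (b * 1 + 0)) + (b * (a * 1 + (b * 0 + 0)) + 0)) + 0) ≡ 3 * (a * (b * b))
    lem = solve-∀

pattern 0F = zero
pattern 1F = suc zero
pattern 2F = suc 1F
pattern 3F = suc 2F
pattern 4F = suc 3F
pattern 5F = suc 4F

private
  -- The left sides here are what the nested sums of `deg (kern P₆) X X i` unfold to, so that
  -- `deg-P₆` needs nothing beyond unfolding.
  deg₆-0 : ∀ a b c d e f → (a * (a * 0 + (b * 0 + (c * 0 + (d * 0 + (e * 0 + (f * 0 + 0)))))) + (b * (a * 0 + (b * 0 + (c * 0 + (d * 1 + (e * 1 + (f * 0 + 0)))))) + (c * (a * 0 + (b * 0 + (c * 0 + (d * 1 + (e * 1 + (f * 1 + 0)))))) + (d * (a * 0 + (b * 1 + (c * 1 + (d * 0 + (e * 1 + (f * 1 + 0)))))) + (e * (a * 0 + (b * 1 + (c * 1 + (d * 1 + (e * 0 + (f * 1 + 0)))))) + (f * (a * 0 + (b * 0 + (c * 1 + (d * 1 + (e * 1 + (f * 0 + 0)))))) + 0)))))) ≡ 2 * (b * d + b * e + c * d + c * e + c * f + d * e + d * f + e * f)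
  deg₆-0 = solve-∀
  deg₆-1 : ∀ a b c d e f → (a * (a * 0 + (b * 0 + (c * 0 + (d * 1 + (e * 1 + (f * 0 + 0)))))) + (b * (a * 0 + (b * 0 + (c * 0 + (d * 0 + (e * 0 + (f * 0 + 0)))))) + (c * (a * 0 + (b * 0 + (c * 0 + (d * 1 + (e * 1 + (f * 1 + 0)))))) + (d * (a * 1 + (b * 0 + (c * 1 + (d * 0 + (e * 1 + (f * 1 + 0)))))) + (e * (a * 1 + (b * 0 + (c * 1 + (d * 1 + (e * 0 + (f * 1 + 0)))))) + (f * (a * 0 + (b * 0 + (c * 1 + (d * 1 + (e * 1 + (f * 0 + 0)))))) + 0)))))) ≡ 2 * (a * d + a * e + c * d + c * e + c * f + d * e + d * f + e * f)
  deg₆-1 = solve-∀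
  deg₆-2 : ∀ a b c d e f → (a * (a * 0 + (b * 0 + (c * 0 + (d * 1 + (e * 1 + (f * 1 + 0)))))) + (b * (a * 0 + (b * 0 + (c * 0 + (d * 1 + (e * 1 + (f * 1 + 0)))))) + (c * (a * 0 + (b * 0 + (c * 0 + (d * 0 + (e * 0 + (f * 0 + 0)))))) + (d * (a * 1 + (b * 1 + (c * 0 + (d * 0 + (e * 0 + (f * 1 + 0)))))) + (e * (a * 1 + (b * 1 + (c * 0 + (d * 0 + (e * 0 + (f * 1 + 0)))))) + (f * (a * 1 + (b * 1 + (c * 0 + (d * 1 + (e * 1 + (f * 0 + 0)))))) + 0)))))) ≡ 2 * (a * d + a * e + a * f + b * d + b * e + b * f + d * f + e * f)
  deg₆-2 = solve-∀
  deg₆-3 : ∀ a b c d e f → (a * (a * 0 + (b * 1 + (c * 1 + (d * 0 + (e * 1 + (f * 1 + 0)))))) + (b * (a * 1 + (b * 0 + (c * 1 + (d * 0 + (e * 1 + (f * 1 + 0)))))) + (c * (a * 1 + (b * 1 + (c * 0 + (d * 0 + (e * 0 + (f * 1 + 0)))))) + (d * (a * 0 + (b * 0 + (c * 0 + (d * 0 + (e * 0 + (f * 0 + 0)))))) + (e * (a * 1 + (b * 1 + (c * 0 + (d * 0 + (e * 0 + (f * 0 + 0)))))) + (f * (a * 1 + (b * 1 + (c * 1 + (d * 0 + (e * 0 + (f * 0 + 0)))))) + 0)))))) ≡ 2 * (a * b + a * c + a * e + a * f + b * c + b * e + b * f + c * f)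
  deg₆-3 = solve-∀
  deg₆-4 : ∀ a b c d e f → (a * (a * 0 + (b * 1 + (c * 1 + (d * 1 + (e * 0 + (f * 1 + 0)))))) + (b * (a * 1 + (b * 0 + (c * 1 + (d * 1 + (e * 0 + (f * 1 + 0)))))) + (c * (a * 1 + (b * 1 + (c * 0 + (d * 0 + (e * 0 + (f * 1 + 0)))))) + (d * (a * 1 + (b * 1 + (c * 0 + (d * 0 + (e * 0 + (f * 0 + 0)))))) + (e * (a * 0 + (b * 0 + (c * 0 + (d * 0 + (e * 0 + (f * 0 + 0)))))) + (f * (a * 1 + (b * 1 + (c * 1 + (d * 0 + (e * 0 + (f * 0 + 0)))))) + 0)))))) ≡ 2 * (a * b + a * c + a * d + a * f + b * c + b * d + b * f + c * f)
  deg₆-4 = solve-∀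
  deg₆-5 : ∀ a b c d e f → (a * (a * 0 + (b * 0 + (c * 1 + (d * 1 + (e * 1 + (f * 0 + 0)))))) + (b * (a * 0 + (b * 0 + (c * 1 + (d * 1 + (e * 1 + (f * 0 + 0)))))) + (c * (a * 1 + (b * 1 + (c * 0 + (d * 1 + (e * 1 + (f * 0 + 0)))))) + (d * (a * 1 + (b * 1 + (c * 1 + (d * 0 + (e * 0 + (f * 0 + 0)))))) + (e * (a * 1 + (b * 1 + (c * 1 + (d * 0 + (e * 0 + (f * 0 + 0)))))) + (f * (a * 0 + (b * 0 + (c * 0 + (d * 0 + (e * 0 + (f * 0 + 0)))))) + 0)))))) ≡ 2 * (a * c + a * d + a * e + b * c + b * d + b * e + c * d + c * e)
  deg₆-5 = solve-∀

deg₆ : (Fin 6 → ℕ) → Fin 6 → ℕ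
deg₆ X 0F = 2 * (X 1F * X 3F + X 1F * X 4F + X 2F * X 3F + X 2F * X 4F + X 2F * X 5F + X 3F * X 4F + X 3F * X 5F + X 4F * X 5F)
deg₆ X 1F = 2 * (X 0F * X 3F + X 0F * X 4F + X 2F * X 3F + X 2F * X 4F + X 2F * X 5F + X 3F * X 4F + X 3F * X 5F + X 4F * X 5F)
deg₆ X 2F = 2 * (X 0F * X 3F + X 0F * X 4F + X 0F * X 5F + X 1F * X 3F + X 1F * X 4F + X 1F * X 5F + X 3F * X 5F + X 4F * X 5F)
deg₆ X 3F = 2 * (X 0F * X 1F + X 0F * X 2F + X 0F * X 4F + X 0F * X 5F + X 1F * X 2F + X 1F * X 4F + X 1F * X 5F + X 2F * X 5F)
deg₆ X 4F = 2 * (X 0F * X 1F + X 0F * X 2F + X 0F * X 3F + X 0F * X 5F + X 1F * X 2F + X 1F * X 3F + X 1F * X 5F + X 2F * X 5F)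
deg₆ X 5F = 2 * (X 0F * X 2F + X 0F * X 3F + X 0F * X 4F + X 1F * X 2F + X 1F * X 3F + X 1F * X 4F + X 2F * X 3F + X 2F * X 4F)

opaque
  unfolding ∑ P₆ form
  deg-P₆ : ∀ (X : Fin 6 → ℕ) i → deg (kern P₆) X X i ≡ deg₆ X i
  deg-P₆ X 0F = deg₆-0 (X 0F) (X 1F) (X 2F) (X 3F) (X 4F) (X 5F)
  deg-P₆ X 1F = deg₆-1 (X 0F) (X 1F) (X 2F) (X 3F) (X 4F) (X 5F)
  deg-P₆ X 2F = deg₆-2 (X 0F) (X 1F) (X 2F) (X 3F) (X 4F) (X 5F)
  deg-P₆ X 3F = deg₆-3 (X 0F) (X 1F) (X 2F) (X 3F) (X 4F) (X 5F)
  deg-P₆ X 4F = deg₆-4 (X 0F) (X 1F) (X 2F) (X 3F) (X 4F) (X 5F)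
  deg-P₆ X 5F = deg₆-5 (X 0F) (X 1F) (X 2F) (X 3F) (X 4F) (X 5F)

cube-P₆ : ∀ X → cube (kern P₆) X ≡ 6 * poly₆ (X 0F) (X 1F) (X 2F) (X 3F) (X 4F) (X 5F)
cube-P₆ X = trans (form≡ (kern P₆) X X X) (trans (∑₆ _) (trans (cong₂ _+_ (cong₂ _+_ (cong₂ _+_ (cong₂ _+_ (cong₂ _+_ (c 0F) (c 1F)) (c 2F)) (c 3F)) (c 4F)) (c 5F)) (lem (X 0F) (X 1F) (X 2F) (X 3F) (X 4F) (X 5F))))
  where
  c : ∀ i → X i * deg (kern P₆) X X i ≡ X i * deg₆ X i
  c i = cong (X i *_) (deg-P₆ X i)
  lem : ∀ a b c d e f → a * (2 * (b * d + b * e + c * d + c * e + c * f + d * e + d * f + e * f)) + b * (2 * (a * d + a * e + c * d + c * e + c * f + d * e + d * f + e * f)) + c * (2 * (a * d + a * e + a * f + b * d + b * e + b * f + d * f + e * f)) + d * (2 * (a * b + a * c + a * e + a * f + b * c + b * e + b * f + c * f)) + e * (2 * (a * b + a * c + a * d + a * f + b * c + b * d + b * f + c * f)) + f * (2 * (a * c + a * d + a * e + b * c + b * d + b * e + c * d + c * e)) ≡ 6 * (a * b * (d + e) + d * e * (a + b) + c * f * (a + b + (d + e)) + (a + b) * (d + e) * (c + f))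
  lem = solve-∀

-- Quantitative stability of the two polynomials

dist : ℕ → ℕ → ℕ
dist x y = ∣ x - y ∣

dist² : ∀ x y → dist x y * dist x y + 2 * (x * y) ≡ x * x + y * y
dist² zero y = +-identityʳ (y * y)
dist² (suc x) zero = cong (suc x * suc x +_) (trans (cong (2 *_) (*-zeroʳ x)) refl)
dist² (suc x) (suc y) = trans (lem₁ (dist x y) x y) (trans (cong (_+ (2 * (x + y + 1))) (dist² x y)) (lem₂ x y))
  where
  lem₁ : ∀ d x y → d * d + 2 * (suc x * suc y) ≡ d * d + 2 * (x * y) + 2 * (x + y + 1)
  lem₁ = solve-∀
  lem₂ : ∀ x y → x * x + y * y + 2 * (x + y + 1) ≡ suc x * suc x + suc y * suc y
  lem₂ = solve-∀

Close : ℕ → ℕ → ℕ → ℕ → Set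
Close A x y e = A * x ≤ A * y + e × A * y ≤ A * x + e

dist⇒Close : ∀ A x y e → A * dist x y ≤ e → Close A x y e
dist⇒Close A x y e h = go x y (m≤n+∣m-n∣ x y) h , go y x (m≤n+∣n-m∣ y x) h
  where
  go : ∀ x y {d} → x ≤ y + d → A * d ≤ e → A * x ≤ A * y + e
  go x y p q = ≤-trans (*-monoʳ-≤ A p) (≤-trans (≤-reflexive (*-distribˡ-+ A y _)) (+-monoʳ-≤ (A * y) q))

sq-cancel-≤ : ∀ x y → x * x ≤ y * y → x ≤ y
sq-cancel-≤ x y h with x ≤? y
... | yes p = p
... | no p = ⊥-elim (<⇒≱ (*-mono-< (≰⇒> p) (≰⇒> p)) h)

*-cancel-pos : ∀ {M} → 1 ≤ M → ∀ a b → M * a ≤ M * b → a ≤ b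
*-cancel-pos {suc M} _ a b h = *-cancelˡ-≤ (suc M) h

-- The defect of T from its maximum 4M³/9 is at most M³/9K.
Defect : ℕ → ℕ → ℕ → Set
Defect K T M = 4 * K * (M * M * M) ≤ 9 * K * T + M * M * M

-- A summand m·d²·Z of the sum-of-squares identity with Z ≥ M / l bounds d.
summand-bound : ∀ {K A M} l q d Z → 1 ≤ M → l * A * A ≤ K → K * (d * d * Z) ≤ q * (M * M * M) → q * M ≤ l * Z → 1 ≤ q → A * d ≤ M
summand-bound {K} {A} {M} l q d Z M≥1 l≤K h qM≤lZ q≥1 = sq-cancel-≤ (A * d) M (*-cancel-pos M≥1 _ _ (*-cancel-pos q≥1 _ _ (begin
  q * (M * (A * d * (A * d))) ≡⟨ e₁ q M A d ⟩
  A * A * (d * d) * (q * M) ≤⟨ *-monoʳ-≤ (A * A * (d * d)) qM≤lZ ⟩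
  A * A * (d * d) * (l * Z) ≡⟨ e₂ l A d Z ⟩
  l * A * A * (d * d * Z) ≤⟨ *-monoˡ-≤ (d * d * Z) l≤K ⟩
  K * (d * d * Z) ≤⟨ h ⟩
  q * (M * M * M) ≡⟨ e₃ q M ⟩
  q * (M * (M * M)) ∎)))
  where
  open ≤-Reasoning
  e₁ : ∀ q M A d → q * (M * (A * d * (A * d))) ≡ A * A * (d * d) * (q * M)
  e₁ = solve-∀
  e₂ : ∀ l A d Z → A * A * (d * d) * (l * Z) ≡ l * A * A * (d * d * Z)
  e₂ = solve-∀
  e₃ : ∀ q M → q * (M * M * M) ≡ q * (M * (M * M))
  e₃ = solve-∀

-- The inequality of arithmetic and geometric means for a, b/2, b/2 with explicit remainder: 4(a +
-- b)³ - 27ab² = (b - 2a)²(4b + a). The cross term of the square is added to both sides, so no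
-- subtraction occurs.
identity₂ : ∀ a b → 4 * ((a + b) * (a + b) * (a + b)) ≡ 9 * (3 * (a * (b * b))) + dist b (2 * a) * dist b (2 * a) * (4 * b + a)
identity₂ a b = +-cancelʳ-≡ (4 * (a * b) * (4 * b + a)) _ _ (trans (e₁ a b) (trans (cong (λ z → 9 * (3 * (a * (b * b))) + z * (4 * b + a)) (sym (dist² b (2 * a)))) (e₂ a b (dist b (2 * a)))))
  where
  e₁ : ∀ a b → 4 * ((a + b) * (a + b) * (a + b)) + 4 * (a * b) * (4 * b + a) ≡ 9 * (3 * (a * (b * b))) + (b * b + 2 * a * (2 * a)) * (4 * b + a)
  e₁ = solve-∀
  e₂ : ∀ a b d → 9 * (3 * (a * (b * b))) + (d * d + 2 * (b * (2 * a))) * (4 * b + a) ≡ 9 * (3 * (a * (b * b))) + d * d * (4 * b + a) + 4 * (a * b) * (4 * b + a)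
  e₂ = solve-∀

-- One square for each level of the grouping: r against 2s, then p against q, then the two members
-- of each pair. All of them vanish only if the six weights coincide.
squares₆ : ℕ → ℕ → ℕ → ℕ → ℕ → ℕ → ℕ
squares₆ x₁ x₂ x₃ x₄ x₅ x₆ = D r (2 * s) * (5 * r + 8 * s) + 27 * (D p q * (r + 4 * s)) + 108 * (D x₁ x₂ * q + D x₄ x₅ * p + D x₃ x₆ * r)
  where
  D : ℕ → ℕ → ℕ
  D x y = dist x y * dist x y
  p = x₁ + x₂
  q = x₄ + x₅
  r = p + q
  s = x₃ + x₆

identity₆ : ∀ x₁ x₂ x₃ x₄ x₅ x₆ → let M = x₁ + x₂ + x₃ + x₄ + x₅ + x₆ in
  32 * (M * M * M) ≡ 72 * (6 * poly₆ x₁ x₂ x₃ x₄ x₅ x₆) + squares₆ x₁ x₂ x₃ x₄ x₅ x₆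
identity₆ x₁ x₂ x₃ x₄ x₅ x₆ = collect (32 * (M * M * M)) (x₁ + x₂) (x₄ + x₅) (x₃ + x₆) (72 * (6 * poly₆ x₁ x₂ x₃ x₄ x₅ x₆)) (D (x₁ + x₂ + (x₄ + x₅)) (2 * (x₃ + x₆))) (D (x₁ + x₂) (x₄ + x₅)) (D x₁ x₂) (D x₄ x₅) (D x₃ x₆) (x₁ * x₂) (x₄ * x₅) (x₃ * x₆)
  (dist² (x₁ + x₂ + (x₄ + x₅)) (2 * (x₃ + x₆))) (dist² (x₁ + x₂) (x₄ + x₅)) (dist² x₁ x₂) (dist² x₄ x₅) (dist² x₃ x₆) (e₁ x₁ x₂ x₃ x₄ x₅ x₆)
  where
  M = x₁ + x₂ + x₃ + x₄ + x₅ + x₆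
  D : ℕ → ℕ → ℕ
  D x y = dist x y * dist x y
  e₁ : ∀ a b c d e f → 32 * ((a + b + c + d + e + f) * (a + b + c + d + e + f) * (a + b + c + d + e + f)) +
       (2 * ((a + b + (d + e)) * (2 * (c + f))) * (5 * (a + b + (d + e)) + 8 * (c + f)) + 27 * (2 * ((a + b) * (d + e)) * (a + b + (d + e) + 4 * (c + f))) + 108 * (2 * (a * b) * (d + e) + 2 * (d * e) * (a + b) + 2 * (c * f) * (a + b + (d + e))))
     ≡ 72 * (6 * (a * b * (d + e) + d * e * (a + b) + c * f * (a + b + (d + e)) + (a + b) * (d + e) * (c + f))) +
       (((a + b + (d + e)) * (a + b + (d + e)) + (2 * (c + f)) * (2 * (c + f))) * (5 * (a + b + (d + e)) + 8 * (c + f)) + 27 * (((a + b) * (a + b) + (d + e) * (d + e)) * (a + b + (d + e) + 4 * (c + f))) + 108 * ((a * a + b * b) * (d + e) + (d * d + e * e) * (a + b) + (c * c + f * f) * (a + b + (d + e))))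
  e₁ = solve-∀
  e₂ : ∀ p q s t d₁ d₂ d₃ d₄ d₅ y z w → t + ((d₁ + 2 * ((p + q) * (2 * s))) * (5 * (p + q) + 8 * s) + 27 * ((d₂ + 2 * (p * q)) * (p + q + 4 * s)) + 108 * ((d₃ + 2 * y) * q + (d₄ + 2 * z) * p + (d₅ + 2 * w) * (p + q)))
     ≡ t + (d₁ * (5 * (p + q) + 8 * s) + 27 * (d₂ * (p + q + 4 * s)) + 108 * (d₃ * q + d₄ * p + d₅ * (p + q)))
       + (2 * ((p + q) * (2 * s)) * (5 * (p + q) + 8 * s) + 27 * (2 * (p * q) * (p + q + 4 * s)) + 108 * (2 * y * q + 2 * z * p + 2 * w * (p + q)))
  e₂ = solve-∀
  collect : ∀ L p q s t d₁ d₂ d₃ d₄ d₅ y z w {v₁ v₂ v₃ v₄ v₅} →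
    d₁ + 2 * ((p + q) * (2 * s)) ≡ v₁ → d₂ + 2 * (p * q) ≡ v₂ → d₃ + 2 * y ≡ v₃ → d₄ + 2 * z ≡ v₄ → d₅ + 2 * w ≡ v₅ →
    L + (2 * ((p + q) * (2 * s)) * (5 * (p + q) + 8 * s) + 27 * (2 * (p * q) * (p + q + 4 * s)) + 108 * (2 * y * q + 2 * z * p + 2 * w * (p + q)))
      ≡ t + (v₁ * (5 * (p + q) + 8 * s) + 27 * (v₂ * (p + q + 4 * s)) + 108 * (v₃ * q + v₄ * p + v₅ * (p + q))) →
    L ≡ t + (d₁ * (5 * (p + q) + 8 * s) + 27 * (d₂ * (p + q + 4 * s)) + 108 * (d₃ * q + d₄ * p + d₅ * (p + q)))
  collect L p q s t d₁ d₂ d₃ d₄ d₅ y z w refl refl refl refl refl h =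
    +-cancelʳ-≡ (2 * ((p + q) * (2 * s)) * (5 * (p + q) + 8 * s) + 27 * (2 * (p * q) * (p + q + 4 * s)) + 108 * (2 * y * q + 2 * z * p + 2 * w * (p + q))) L _ (trans h (e₂ p q s t d₁ d₂ d₃ d₄ d₅ y z w))

cube-bound₂ : ∀ X → 9 * cube (kern P₂) X ≤ 4 * (∑ X * ∑ X * ∑ X)
cube-bound₂ X rewrite cube-P₂ X | ∑₂ X | identity₂ (X 0F) (X 1F) = m≤m+n _ _

cube-bound₆ : ∀ X → 9 * cube (kern P₆) X ≤ 4 * (∑ X * ∑ X * ∑ X)
cube-bound₆ X = bound (cube (kern P₆) X) (∑ X * ∑ X * ∑ X) _ (trans (cong (λ z → 32 * (z * z * z)) (∑₆ X)) (trans (identity₆ (X 0F) (X 1F) (X 2F) (X 3F) (X 4F) (X 5F)) (cong (λ z → 72 * z + squares₆ (X 0F) (X 1F) (X 2F) (X 3F) (X 4F) (X 5F)) (sym (cube-P₆ X)))))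
  where
  bound : ∀ t m d → 32 * m ≡ 72 * t + d → 9 * t ≤ 4 * m
  bound t m d h = *-cancelˡ-≤ 8 (≤-cert d ≤-refl (trans (e₁ m) (trans h (e₂ t d))))
    where
    e₁ : ∀ m → 8 * (4 * m) + 0 ≡ 32 * m
    e₁ = solve-∀
    e₂ : ∀ t d → 72 * t + d ≡ 8 * (9 * t) + 0 + d
    e₂ = solve-∀

-- As 4b + a ≥ M, the remainder in `identity₂` bounds |b - 2a| by M/A; together with a + b = M this
-- fixes both classes.
stable₂ : ∀ {A K} X → 1 ≤ ∑ X → A * A ≤ K → Defect K (cube (kern P₂) X) (∑ X) → Close A (3 * X 0F) (∑ X) (∑ X) × Close A (3 * X 1F) (2 * ∑ X) (∑ X)
stable₂ {A} {K} X M≥1 A≤K def rewrite cube-P₂ X | ∑₂ X = (≤-cert 0 (proj₂ cl) (c₁ A a b) , ≤-cert 0 (proj₁ cl) (c₂ A a b)) , (≤-cert 0 (proj₁ cl) (c₃ A a b) , ≤-cert 0 (proj₂ cl) (c₄ A a b))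
  where
  a = X 0F
  b = X 1F
  M = a + b
  Kd : K * (dist b (2 * a) * dist b (2 * a) * (4 * b + a)) ≤ 1 * (M * M * M)
  Kd = ≤-cert 0 def (e K (M * M * M) (3 * (a * (b * b))) _ (identity₂ a b))
    where
    e : ∀ K m t d → 4 * m ≡ 9 * t + d → 1 * m + 4 * K * m ≡ K * d + (9 * K * t + m) + 0
    e K m t d h = trans (lem₁ K m) (trans (cong (λ z → m + K * z) h) (lem₂ K m t d))
      where
      lem₁ : ∀ K m → 1 * m + 4 * K * m ≡ m + K * (4 * m)
      lem₁ = solve-∀
      lem₂ : ∀ K m t d → m + K * (9 * t + d) ≡ K * d + (9 * K * t + m) + 0
      lem₂ = solve-∀
  cl : Close A b (2 * a) M
  cl = dist⇒Close A b (2 * a) M (summand-bound {K} {A} {M} 1 1 (dist b (2 * a)) (4 * b + a) M≥1 (≤-trans (≤-reflexive (cong (_* A) (*-identityˡ A))) A≤K) Kd (≤-cert (3 * b) ≤-refl (c a b)) ≤-refl)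
    where c : ∀ a b → 1 * (4 * b + a) + 0 ≡ 1 * (a + b) + 0 + 3 * b
          c = solve-∀
  c₁ : ∀ A a b → A * (a + b) + (a + b) + A * (2 * a) ≡ A * (3 * a) + (A * b + (a + b)) + 0
  c₁ = solve-∀
  c₂ : ∀ A a b → A * (3 * a) + (a + b) + A * b ≡ A * (a + b) + (A * (2 * a) + (a + b)) + 0
  c₂ = solve-∀
  c₃ : ∀ A a b → A * (2 * (a + b)) + (a + b) + A * b ≡ A * (3 * b) + (A * (2 * a) + (a + b)) + 0
  c₃ = solve-∀
  c₄ : ∀ A a b → A * (3 * b) + (a + b) + A * (2 * a) ≡ A * (2 * (a + b)) + (A * b + (a + b)) + 0
  c₄ = solve-∀

private
  -- 12x - 2M is 6 times the first difference plus 3 times the second plus the third, hence the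
  -- error (6 + 3 + 1)/2 = 5.
  class-close : ∀ A x y q s → let M = x + y + q + s in Close A x y M → Close A (x + y) q M → Close A (x + y + q) (2 * s) M → Close A (6 * x) M (5 * M)
  class-close A x y q s (h₁ , h₂) (k₁ , k₂) (l₁ , l₂) =
    *-cancelˡ-≤ 2 (≤-cert 0 (6 ⊛ h₁ ⊕ 3 ⊛ k₁ ⊕ l₁) (e₁ A x y q s)) , *-cancelˡ-≤ 2 (≤-cert 0 (6 ⊛ h₂ ⊕ 3 ⊛ k₂ ⊕ l₂) (e₂ A x y q s))
    where
    e₁ : ∀ A x y q s → 2 * (A * (x + y + q + s) + 5 * (x + y + q + s)) + (6 * (A * x) + (3 * (A * (x + y)) + A * (x + y + q)))
       ≡ 2 * (A * (6 * x)) + (6 * (A * y + (x + y + q + s)) + (3 * (A * q + (x + y + q + s)) + (A * (2 * s) + (x + y + q + s)))) + 0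
    e₁ = solve-∀
    e₂ : ∀ A x y q s → 2 * (A * (6 * x) + 5 * (x + y + q + s)) + (6 * (A * y) + (3 * (A * q) + A * (2 * s)))
       ≡ 2 * (A * (x + y + q + s)) + (6 * (A * x + (x + y + q + s)) + (3 * (A * (x + y) + (x + y + q + s)) + (A * (x + y + q) + (x + y + q + s)))) + 0
    e₂ = solve-∀

  central-close : ∀ A x y r → let M = r + (x + y) in Close A x y M → Close A r (2 * (x + y)) M → Close A (6 * x) M (5 * M)
  central-close A x y r (h₁ , h₂) (l₁ , l₂) =
    *-cancelˡ-≤ 2 (≤-cert (2 * (r + (x + y))) (6 ⊛ h₁ ⊕ 2 ⊛ l₂) (e₁ A x y r)) , *-cancelˡ-≤ 2 (≤-cert (2 * (r + (x + y))) (6 ⊛ h₂ ⊕ 2 ⊛ l₁) (e₂ A x y r))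
    where
    e₁ : ∀ A x y r → 2 * (A * (r + (x + y)) + 5 * (r + (x + y))) + (6 * (A * x) + 2 * (A * (2 * (x + y))))
       ≡ 2 * (A * (6 * x)) + (6 * (A * y + (r + (x + y))) + 2 * (A * r + (r + (x + y)))) + 2 * (r + (x + y))
    e₁ = solve-∀
    e₂ : ∀ A x y r → 2 * (A * (6 * x) + 5 * (r + (x + y))) + (6 * (A * y) + 2 * (A * r))
       ≡ 2 * (A * (r + (x + y))) + (6 * (A * x + (r + (x + y))) + 2 * (A * (2 * (x + y)) + (r + (x + y)))) + 2 * (r + (x + y))
    e₂ = solve-∀

  close-sym : ∀ A x y e → Close A x y e → Close A y x e
  close-sym _ _ _ _ (p , q) = q , p

  summands : ∀ K m a b c d e → K * (a + 27 * b + 108 * (c + d + e)) ≤ m →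
    K * a ≤ m × K * (27 * b) ≤ m × K * (108 * c) ≤ m × K * (108 * d) ≤ m × K * (108 * e) ≤ m
  summands K m a b c d e h = below a _ (e₁ a b c d e) , below (27 * b) _ (e₂ a b c d e) , below (108 * c) _ (e₃ a b c d e) , below (108 * d) _ (e₄ a b c d e) , below (108 * e) _ (e₅ a b c d e)
    where
    below : ∀ x y → x + y ≡ a + 27 * b + 108 * (c + d + e) → K * x ≤ m
    below x y eq = ≤-trans (*-monoʳ-≤ K (≤-trans (m≤m+n x y) (≤-reflexive eq))) h
    e₁ : ∀ a b c d e → a + (27 * b + 108 * (c + d + e)) ≡ a + 27 * b + 108 * (c + d + e)
    e₁ = solve-∀
    e₂ : ∀ a b c d e → 27 * b + (a + 108 * (c + d + e)) ≡ a + 27 * b + 108 * (c + d + e)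
    e₂ = solve-∀
    e₃ : ∀ a b c d e → 108 * c + (a + 27 * b + 108 * (d + e)) ≡ a + 27 * b + 108 * (c + d + e)
    e₃ = solve-∀
    e₄ : ∀ a b c d e → 108 * d + (a + 27 * b + 108 * (c + e)) ≡ a + 27 * b + 108 * (c + d + e)
    e₄ = solve-∀
    e₅ : ∀ a b c d e → 108 * e + (a + 27 * b + 108 * (c + d)) ≡ a + 27 * b + 108 * (c + d + e)
    e₅ = solve-∀

  r-lower : ∀ r s → 10 * (2 * s) ≤ 10 * r + (r + s) → 8 * (r + s) ≤ 2 * (108 * r)
  r-lower r s h = ≤-cert (197 * r + 11 * s) h (lem r s)
    where lem : ∀ r s → 2 * (108 * r) + 10 * (2 * s) ≡ 8 * (r + s) + (10 * r + (r + s)) + (197 * r + 11 * s)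
          lem = solve-∀

  q-lower : ∀ p q s → 10 * (2 * s) ≤ 10 * (p + q) + (p + q + s) → 10 * p ≤ 10 * q + (p + q + s) → 8 * (p + q + s) ≤ 2 * (108 * q)
  q-lower p q s h k = ≤-cert (8 * p + 8 * s + 164 * q) (h ⊕ 3 ⊛ k) (lem p q s)
    where lem : ∀ p q s → 2 * (108 * q) + (10 * (2 * s) + 3 * (10 * p)) ≡ 8 * (p + q + s) + (10 * (p + q) + (p + q + s) + 3 * (10 * q + (p + q + s))) + (8 * p + 8 * s + 164 * q)
          lem = solve-∀

  outer-lower₁ : ∀ r s → 8 * (r + s) ≤ 2 * (5 * r + 8 * s)
  outer-lower₁ r s = ≤-cert (2 * r + 8 * s) ≤-refl (lem r s)
    where lem : ∀ r s → 2 * (5 * r + 8 * s) + 0 ≡ 8 * (r + s) + 0 + (2 * r + 8 * s)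
          lem = solve-∀

  outer-lower₂ : ∀ r s → 8 * (r + s) ≤ 2 * (27 * (r + 4 * s))
  outer-lower₂ r s = ≤-cert (46 * r + 208 * s) ≤-refl (lem r s)
    where lem : ∀ r s → 2 * (27 * (r + 4 * s)) + 0 ≡ 8 * (r + s) + 0 + (46 * r + 208 * s)
          lem = solve-∀

  defect-squares : ∀ K m t d → 32 * m ≡ 72 * t + d → 4 * K * m ≤ 9 * K * t + m → K * d ≤ 8 * m
  defect-squares K m t d h def = ≤-cert 0 (8 ⊛ def) (trans (l₁ K m) (trans (cong (λ z → 8 * m + K * z) h) (l₂ K m t d)))
    where
    l₁ : ∀ K m → 8 * m + 8 * (4 * K * m) ≡ 8 * m + K * (32 * m)
    l₁ = solve-∀
    l₂ : ∀ K m t d → 8 * m + K * (72 * t + d) ≡ K * d + 8 * (9 * K * t + m) + 0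
    l₂ = solve-∀

  pull-out : ∀ l d z m K → K * (l * (d * z)) ≤ m → K * (d * (l * z)) ≤ m
  pull-out l d z m K h = subst (λ w → K * w ≤ m) (lem l d z) h
    where lem : ∀ l d z → l * (d * z) ≡ d * (l * z)
          lem = solve-∀

  -- The multipliers 5r + 8s and r + 4s are always proportional to M, so r ≈ 2s and p ≈ q come
  -- first. The inner squares are multiplied by q, p and r, which are bounded below only through
  -- these two relations; that is where A ≥ 10 enters.
  module Stable₆ (A K x₁ x₂ x₃ x₄ x₅ x₆ p q r s M t : ℕ) (p≡ : p ≡ x₁ + x₂) (q≡ : q ≡ x₄ + x₅) (r≡ : r ≡ p + q) (s≡ : s ≡ x₃ + x₆) (M≡ : M ≡ r + s)
    (identity : 32 * (M * M * M) ≡ 72 * t + (dist r (2 * s) * dist r (2 * s) * (5 * r + 8 * s) + 27 * (dist p q * dist p q * (r + 4 * s)) + 108 * (dist x₁ x₂ * dist x₁ x₂ * q + dist x₄ x₅ * dist x₄ x₅ * p + dist x₃ x₆ * dist x₃ x₆ * r)))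
    (M≥1 : 1 ≤ M) (A≥10 : 10 ≤ A) (A≤K : 2 * A * A ≤ K) (def : Defect K t M) where
    parts = summands K (8 * (M * M * M)) (dist r (2 * s) * dist r (2 * s) * (5 * r + 8 * s)) (dist p q * dist p q * (r + 4 * s)) (dist x₁ x₂ * dist x₁ x₂ * q) (dist x₄ x₅ * dist x₄ x₅ * p) (dist x₃ x₆ * dist x₃ x₆ * r) (defect-squares K (M * M * M) t _ identity def)
    inM : ∀ {y} → 8 * (r + s) ≤ y → 8 * M ≤ y
    inM {y} = subst (λ z → 8 * z ≤ y) (sym M≡)
    one≤8 : 1 ≤ 8
    one≤8 = s≤s z≤n
    d₁ : A * dist r (2 * s) ≤ M
    d₁ = summand-bound {K} {A} {M} 2 8 (dist r (2 * s)) (5 * r + 8 * s) M≥1 A≤K (proj₁ parts) (inM (outer-lower₁ r s)) one≤8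
    d₂ : A * dist p q ≤ M
    d₂ = summand-bound {K} {A} {M} 2 8 (dist p q) (27 * (r + 4 * s)) M≥1 A≤K (pull-out 27 (dist p q * dist p q) (r + 4 * s) (8 * (M * M * M)) K (proj₁ (proj₂ parts))) (inM (outer-lower₂ r s)) one≤8
    at10 : ∀ x y → A * dist x y ≤ M → Close 10 x y (r + s)
    at10 x y h = subst (Close 10 x y) M≡ (dist⇒Close 10 x y M (≤-trans (*-monoˡ-≤ (dist x y) A≥10) h))
    c₁ : Close 10 r (2 * s) (r + s)
    c₁ = at10 r (2 * s) d₁
    c₂ : Close 10 p q (r + s)
    c₂ = at10 p q d₂
    r≥ : 8 * M ≤ 2 * (108 * r)
    r≥ = inM (r-lower r s (proj₂ c₁))
    q≥ : 8 * M ≤ 2 * (108 * q)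
    q≥ = inM (subst (λ z → 8 * (z + s) ≤ 2 * (108 * q)) (sym r≡) (q-lower p q s (subst (λ z → 10 * (2 * s) ≤ 10 * z + (z + s)) r≡ (proj₂ c₁)) (subst (λ z → 10 * p ≤ 10 * q + (z + s)) r≡ (proj₁ c₂))))
    p≥ : 8 * M ≤ 2 * (108 * p)
    p≥ = inM (subst (λ z → 8 * (z + s) ≤ 2 * (108 * p)) r≡′ (q-lower q p s (subst (λ z → 10 * (2 * s) ≤ 10 * z + (z + s)) (sym r≡′) (proj₂ c₁)) (subst (λ z → 10 * q ≤ 10 * p + (z + s)) (sym r≡′) (proj₂ c₂))))
      where r≡′ : q + p ≡ r
            r≡′ = trans (+-comm q p) (sym r≡)
    inner : ∀ a b z → K * (108 * (dist a b * dist a b * z)) ≤ 8 * (M * M * M) → 8 * M ≤ 2 * (108 * z) → A * dist a b ≤ M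
    inner a b z e h = summand-bound {K} {A} {M} 2 8 (dist a b) (108 * z) M≥1 A≤K (pull-out 108 (dist a b * dist a b) z (8 * (M * M * M)) K e) h one≤8
    d₃ : A * dist x₁ x₂ ≤ M
    d₃ = inner x₁ x₂ q (proj₁ (proj₂ (proj₂ parts))) q≥
    d₄ : A * dist x₄ x₅ ≤ M
    d₄ = inner x₄ x₅ p (proj₁ (proj₂ (proj₂ (proj₂ parts)))) p≥
    d₅ : A * dist x₃ x₆ ≤ M
    d₅ = inner x₃ x₆ r (proj₂ (proj₂ (proj₂ (proj₂ parts)))) r≥
    front : ∀ x y p q → p ≡ x + y → r ≡ p + q → A * dist x y ≤ M → Close A p q M → Close A (6 * x) M (5 * M)
    front x y p q refl e d k = subst (λ z → Close A (6 * x) z (5 * z)) (sym e′) (class-close A x y q s (subst (Close A x y) e′ (dist⇒Close A x y M d)) (subst (Close A (x + y) q) e′ k)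
      (subst₂ (λ z w → Close A z (2 * s) w) e e′ (dist⇒Close A r (2 * s) M d₁)))
      where e′ : M ≡ x + y + q + s
            e′ = trans M≡ (cong (_+ s) e)
    mid : ∀ x y → s ≡ x + y → A * dist x y ≤ M → Close A (6 * x) M (5 * M)
    mid x y e d = subst (λ z → Close A (6 * x) z (5 * z)) (sym e′) (central-close A x y r (subst (Close A x y) e′ (dist⇒Close A x y M d)) (subst₂ (λ w z → Close A r (2 * w) z) e e′ (dist⇒Close A r (2 * s) M d₁)))
      where e′ : M ≡ r + (x + y)
            e′ = trans M≡ (cong (r +_) e)
    pq : Close A p q M
    pq = dist⇒Close A p q M d₂
    swap : ∀ x y → A * dist x y ≤ M → A * dist y x ≤ M
    swap x y = subst (λ z → A * z ≤ M) (∣-∣-comm x y)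
    classes : ∀ (X : Fin 6 → ℕ) → X 0F ≡ x₁ → X 1F ≡ x₂ → X 2F ≡ x₃ → X 3F ≡ x₄ → X 4F ≡ x₅ → X 5F ≡ x₆ → ∀ i → Close A (6 * X i) M (5 * M)
    classes X refl _ _ _ _ _ 0F = front x₁ x₂ p q p≡ r≡ d₃ pq
    classes X _ refl _ _ _ _ 1F = front x₂ x₁ p q (trans p≡ (+-comm x₁ x₂)) r≡ (swap x₁ x₂ d₃) pq
    classes X _ _ refl _ _ _ 2F = mid x₃ x₆ s≡ d₅
    classes X _ _ _ refl _ _ 3F = front x₄ x₅ q p q≡ (trans r≡ (+-comm p q)) d₄ (close-sym A p q M pq)
    classes X _ _ _ _ refl _ 4F = front x₅ x₄ q p (trans q≡ (+-comm x₄ x₅)) (trans r≡ (+-comm p q)) (swap x₄ x₅ d₄) (close-sym A p q M pq)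
    classes X _ _ _ _ _ refl 5F = mid x₆ x₃ (trans s≡ (+-comm x₃ x₆)) (swap x₃ x₆ d₅)

stable₆ : ∀ {A K} X → 1 ≤ ∑ X → 10 ≤ A → 2 * A * A ≤ K → Defect K (cube (kern P₆) X) (∑ X) → ∀ i → Close A (6 * X i) (∑ X) (5 * ∑ X)
stable₆ {A} {K} X M≥1 A≥10 A≤K def = Stable₆.classes A K (X 0F) (X 1F) (X 2F) (X 3F) (X 4F) (X 5F) _ _ _ _ (∑ X) (cube (kern P₆) X) refl refl refl refl
  (trans (∑₆ X) (lem (X 0F) (X 1F) (X 2F) (X 3F) (X 4F) (X 5F)))
  (trans (cong (λ z → 32 * (z * z * z)) (∑₆ X)) (trans (identity₆ (X 0F) (X 1F) (X 2F) (X 3F) (X 4F) (X 5F)) (cong (λ z → 72 * z + squares₆ (X 0F) (X 1F) (X 2F) (X 3F) (X 4F) (X 5F)) (sym (cube-P₆ X)))))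
  M≥1 A≥10 A≤K def X refl refl refl refl refl refl
  where lem : ∀ a b c d e f → a + b + c + d + e + f ≡ a + b + (d + e) + (c + f)
        lem = solve-∀

-- Generic vertices in a nearly extremal coloured graph

-- The cube bound is applied to the weights τX + M·1ᵢ.
deg-upper : ∀ {r} (P : Pattern r) → Symmetric₃ P → (∀ X → 9 * cube (kern P) X ≤ 4 * (∑ X * ∑ X * ∑ X)) →
  ∀ τ X i → 1 ≤ ∑ X → 1 ≤ τ → Defect (τ * τ) (cube (kern P) X) (∑ X) →
  9 * τ * deg (kern P) X X i ≤ (4 * τ + 6) * (∑ X * ∑ X)
deg-upper {r} P Psym bound τ X i M≥1 τ≥1 def = *-cancelˡ-≤ 3 (*-cancel-pos τ≥1 _ _ (*-cancel-pos M≥1 _ _ (≤-cert 0 (up ⊕ lo ⊕ slack) (e τ M t d))))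
  where
  k = kern P
  ks = kern-symmetric Psym
  M = ∑ X
  t = cube k X
  d = deg k X X i
  f = τ ⊡ X
  g = M ⊡ ⟦ i ⟧
  ∑fg : ∑ (f ⊞ g) ≡ τ * M + M
  ∑fg = trans (∑-+ f g) (cong₂ _+_ (∑-scale τ X) (trans (∑-scale M ⟦ i ⟧) (trans (cong (M *_) (∑-⟦⟧ i)) (*-identityʳ M))))
  low : τ * τ * τ * t + 3 * (M * (τ * (τ * d))) ≤ cube k (f ⊞ g)
  low = begin
    τ * τ * τ * t + 3 * (M * (τ * (τ * d))) ≡⟨ cong₂ (λ a b → a + 3 * b) (sym (cube-⊡ k ks τ X)) (sym gff) ⟩
    cube k f + 3 * form k g f f ≤⟨ m≤m+n _ _ ⟩
    cube k f + 3 * form k g f f + (3 * form k g g f + cube k g) ≡⟨ sym (+-assoc (cube k f + 3 * form k g f f) _ _) ⟩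
    cube k f + 3 * form k g f f + 3 * form k g g f + cube k g ≡⟨ sym (cube-⊞ k ks f g) ⟩
    cube k (f ⊞ g) ∎
    where
    open ≤-Reasoning
    gff : form k g f f ≡ M * (τ * (τ * d))
    gff = trans (form-⊡₁ k M ⟦ i ⟧ f f) (cong (M *_) (trans (form-⊡₂ k ks τ ⟦ i ⟧ X f) (cong (τ *_) (trans (form-⊡₃ k ks τ ⟦ i ⟧ X X) (cong (τ *_) (form-⟦⟧ k i X X))))))
  up : 9 * (τ * τ * τ * t + 3 * (M * (τ * (τ * d)))) ≤ 4 * ((τ * M + M) * (τ * M + M) * (τ * M + M))
  up = ≤-trans (*-monoʳ-≤ 9 low) (≤-trans (bound (f ⊞ g)) (≤-reflexive (cong (λ z → 4 * (z * z * z)) ∑fg)))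
  lo : τ * (4 * (τ * τ) * (M * M * M)) ≤ τ * (9 * (τ * τ) * t + M * M * M)
  lo = *-monoʳ-≤ τ def
  slack : 4 * (M * M * M) * 1 ≤ 4 * (M * M * M) * τ + τ * (M * M * M)
  slack = ≤-trans (*-monoʳ-≤ (4 * (M * M * M)) τ≥1) (m≤m+n _ _)
  e : ∀ τ M t d → M * (τ * (3 * ((4 * τ + 6) * (M * M)))) + (9 * (τ * τ * τ * t + 3 * (M * (τ * (τ * d)))) + (τ * (4 * (τ * τ) * (M * M * M)) + 4 * (M * M * M) * 1))
    ≡ M * (τ * (3 * (9 * τ * d))) + (4 * ((τ * M + M) * (τ * M + M) * (τ * M + M)) + (τ * (9 * (τ * τ) * t + M * M * M) + (4 * (M * M * M) * τ + τ * (M * M * M)))) + 0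
  e = solve-∀

private
  -- Costs are natural numbers, so a cost below an indicator is zero: averaging thus produces a
  -- vertex with no defect at all.
  cheap : ∀ a k (b : Bool) → a * k < a * b2n b → b ≡ true × a ≢ 0 × k ≡ 0
  cheap a k false h = ⊥-elim (n≮0 (subst (a * k <_) (*-zeroʳ a) h))
  cheap a zero true h = refl , (λ { refl → n≮0 h }) , refl
  cheap a (suc k) true h = ⊥-elim (<⇒≱ h (*-monoʳ-≤ a (s≤s z≤n)))

pushAll : ∀ {A : Set} {m k} → Vec A k → (Fin m → A) → Fin (k + m) → A
pushAll [] s = s
pushAll (y ∷ ys) s = cons y (pushAll ys s)

-- bad i j marks the pairs of chosen vertices about which nothing is known.
Table : ℕ → Set
Table m = Fin m → Fin m → Bool

allBad : ∀ {m} → Table m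
allBad _ _ = true

-- For a vertex found by averaging: it forms a good pair with every vertex chosen before.
grow₁ : ∀ {m} → Table m → Table (suc m)
grow₁ bad zero zero = true
grow₁ bad zero (suc j) = false
grow₁ bad (suc i) zero = false
grow₁ bad (suc i) (suc j) = bad i j

grow : ∀ {m} k → Table m → Table (k + m)
grow zero bad = bad
grow (suc k) bad = grow₁ (grow k bad)

-- For the new vertex while its missing degree is still uncontrolled: none of its pairs may be
-- treated as good.
isolate : ∀ {m} → Table m → Table (suc m)
isolate bad zero j = true
isolate bad (suc i) zero = true
isolate bad (suc i) (suc j) = bad i j

module Generic {n r : ℕ} (E : Fin n → Fin n → Fin n → Bool) (E-sym : Symmetric₃ E)
  (P : Pattern r) (P-sym : Symmetric₃ P) (c : Fin n → Fin r) (u : Fin n → ℕ) (M≥1 : 1 ≤ ∑ u) where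

  private
    V = Fin n

  M : ℕ
  M = ∑ u

  PV MV OV : V → V → V → Bool
  PV a b d = P (c a) (c b) (c d)
  MV a b d = PV a b d ∧ not (E a b d)
  OV a b d = E a b d ∧ not (PV a b d)

  PV-sym : Symmetric₃ PV
  PV-sym = symmetric₃-∘ c P-sym

  MV-sym : Symmetric₃ MV
  MV-sym = symmetric₃ (λ a b d → cong₂ (λ x y → x ∧ not y) (swap₁₂ PV-sym a b d) (swap₁₂ E-sym a b d)) (λ a b d → cong₂ (λ x y → x ∧ not y) (swap₂₃ PV-sym a b d) (swap₂₃ E-sym a b d))

  D exp miss off : V → ℕ
  D = deg (kern E) u u
  exp = deg (kern PV) u u
  miss = deg (kern MV) u u
  off = deg (kern OV) u u

  -- Both sides count the pairs that form an edge or a pattern triple with x; `miss` counts pattern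
  -- triples absent from E, `off` counts edges outside the pattern.
  balance : ∀ x → D x + miss x ≡ exp x + off x
  balance x = trans (sym (deg-kernel-+ (kern E) (kern MV) u u x)) (trans (deg-cong (λ a b d → pt (E a b d) (PV a b d)) (λ _ → refl) (λ _ → refl) x) (deg-kernel-+ (kern PV) (kern OV) u u x))
    where
    pt : ∀ e p → b2n e + b2n (p ∧ not e) ≡ b2n p + b2n (e ∧ not p)
    pt true true = refl
    pt true false = refl
    pt false true = refl
    pt false false = refl

  OK : V → V → V → Set
  OK a b d = PV a b d ≡ true → E a b d ≡ true

  OK-swap₂₃ : ∀ {a b d} → OK a b d → OK a d b
  OK-swap₂₃ {a} {b} {d} h p = trans (swap₂₃ E-sym a d b) (h (trans (swap₂₃ PV-sym a b d) p))

  OK-rot : ∀ {a b d} → OK a b d → OK d a b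
  OK-rot {a} {b} {d} h p = trans (rot E-sym d a b) (h (trans (rot² PV-sym a b d) p))

  def : V → V → ℕ
  def = codeg (kern MV) u

  module Scale (ρ : ℕ) where
    -- Two applications of one threshold: missing degree at most (M/ρ)² leaves bad partners of
    -- weight at most M/ρ, and a good pair misses pattern triples on weight at most M/ρ.
    Small : V → Set
    Small x = ρ * ρ * miss x ≤ M * M

    good? : V → V → Bool
    good? x y = ρ * def x y ≤ᵇ M

    GoodPair : V → V → Set
    GoodPair x y = ρ * def x y ≤ M

    good-sym : ∀ {x y} → GoodPair x y → GoodPair y x
    good-sym {x} {y} = subst (λ z → ρ * z ≤ M) (codeg-comm (kern MV) (kern-symmetric MV-sym) u x y)

    good?-sound : ∀ {x y} → good? x y ≡ true → GoodPair x y
    good?-sound = ≤-by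

    good?-false : ∀ {x y} → good? x y ≡ false → M ≤ ρ * def x y
    good?-false {x} {y} h with ρ * def x y ≤? M
    ... | yes p = ⊥-elim (subst T h (≤⇒≤ᵇ p))
    ... | no p = <⇒≤ (≰⇒> p)

    few-bad-partners : ∀ x → Small x → ρ * mass u (λ y → not (good? x y)) ≤ M
    few-bad-partners x sm = *-cancel-pos M≥1 _ _ (begin
      M * (ρ * mass u (λ y → not (good? x y))) ≡⟨ e M ρ _ ⟩
      ρ * (M * mass u (λ y → not (good? x y))) ≤⟨ *-monoʳ-≤ ρ (markov u (λ y → ρ * def x y) _ M λ y h → good?-false {x} {y} (not-true h)) ⟩
      ρ * ∑ (λ y → u y * (ρ * def x y)) ≡⟨ cong (ρ *_) (trans (∑-cong λ y → e (u y) ρ (def x y)) (trans (∑-*ˡ ρ _) (cong (ρ *_) (sym (deg≡ (kern MV) u u x))))) ⟩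
      ρ * (ρ * miss x) ≡⟨ sym (*-assoc ρ ρ (miss x)) ⟩
      ρ * ρ * miss x ≤⟨ sm ⟩
      M * M ∎)
      where
      open ≤-Reasoning
      e : ∀ a b c → a * (b * c) ≡ b * (a * c)
      e = solve-∀

    record State {m} (s : Fin m → V) (bad : Table m) : Set where
      field
        pair : ∀ i j → bad i j ≡ false → GoodPair (s i) (s j)
        triple : ∀ i j k → bad i j ≡ false → bad i k ≡ false → bad j k ≡ false → OK (s i) (s j) (s k)

    open State public

    start : ∀ {m} (s : Fin m → V) → State s allBad
    start s = record { pair = λ _ _ () ; triple = λ _ _ _ () }

    append : ∀ {m} {s : Fin m → V} {bad} → State s bad → ∀ v → State (cons v s) (isolate bad)
    append {s = s} {bad} st v = record { pair = p ; triple = t }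
      where
      p : ∀ i j → isolate bad i j ≡ false → GoodPair (cons v s i) (cons v s j)
      p (suc i) (suc j) = pair st i j
      t : ∀ i j k → isolate bad i j ≡ false → isolate bad i k ≡ false → isolate bad j k ≡ false → OK (cons v s i) (cons v s j) (cons v s k)
      t (suc i) (suc j) (suc k) = triple st i j k

    module _ {m} {s : Fin m → V} {bad : Table m} (st : State s bad) (small : ∀ i → Small (s i)) where
      private
        cost₁ cost₂ cost : V → ℕ
        cost₁ y = ∑ λ i → b2n (not (good? (s i) y))
        cost₂ y = ∑ λ i → ∑ λ j → b2n (not (bad i j)) * kern MV (s i) (s j) y
        cost y = cost₁ y + cost₂ y

        ∑cost₁ : ρ * ∑ (λ y → u y * cost₁ y) ≤ m * M
        ∑cost₁ = begin
          ρ * ∑ (λ y → u y * cost₁ y) ≡⟨ cong (ρ *_) (trans (∑-cong λ y → sym (∑-*ˡ (u y) _)) (∑-swap _)) ⟩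
          ρ * ∑ (λ i → mass u (λ y → not (good? (s i) y))) ≡⟨ sym (∑-*ˡ ρ _) ⟩
          ∑ (λ i → ρ * mass u (λ y → not (good? (s i) y))) ≤⟨ ∑-mono (λ i → few-bad-partners (s i) (small i)) ⟩
          ∑ {m} (λ _ → M) ≡⟨ ∑-const {m} M ⟩
          m * M ∎
          where open ≤-Reasoning

        ∑cost₂ : ρ * ∑ (λ y → u y * cost₂ y) ≤ m * (m * M)
        ∑cost₂ = begin
          ρ * ∑ (λ y → u y * cost₂ y) ≡⟨ cong (ρ *_) (trans (∑-cong λ y → trans (sym (∑-*ˡ (u y) _)) (∑-cong λ i → sym (∑-*ˡ (u y) _))) (trans (∑-swap _) (∑-cong λ i → ∑-swap _))) ⟩
          ρ * ∑ (λ i → ∑ λ j → ∑ λ y → u y * (b2n (not (bad i j)) * kern MV (s i) (s j) y)) ≡⟨ trans (sym (∑-*ˡ ρ _)) (∑-cong λ i → sym (∑-*ˡ ρ _)) ⟩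
          ∑ (λ i → ∑ λ j → ρ * ∑ λ y → u y * (b2n (not (bad i j)) * kern MV (s i) (s j) y)) ≤⟨ ∑-mono (λ i → ∑-mono λ j → each i j) ⟩
          ∑ {m} (λ _ → ∑ {m} λ _ → M) ≡⟨ trans (∑-cong λ _ → ∑-const {m} M) (∑-const {m} (m * M)) ⟩
          m * (m * M) ∎
          where
          open ≤-Reasoning
          each : ∀ i j → ρ * ∑ (λ y → u y * (b2n (not (bad i j)) * kern MV (s i) (s j) y)) ≤ M
          each i j with bad i j in eq
          ... | true = ≤-trans (≤-reflexive (trans (cong (ρ *_) (trans (∑-cong λ y → *-zeroʳ (u y)) (∑-zero {n}))) (*-zeroʳ ρ))) z≤n
          ... | false = ≤-trans (≤-reflexive (cong (ρ *_) (trans (∑-cong λ y → cong (u y *_) (*-identityˡ _)) (sym (codeg≡ (kern MV) u (s i) (s j)))))) (pair st i j eq)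

      -- `cost y` counts the chosen vertices forming a bad pair with y and the good chosen pairs
      -- whose pattern triple with y is absent. Its weighted total is at most (m + m²)M/ρ, less than
      -- the weight of W, so some y in W and in the support costs nothing.
      pick : ∀ W → (m + m * m) * M < ρ * mass u W → ∃ λ y → W y ≡ true × u y ≢ 0 × State (cons y s) (grow₁ bad)
      pick W heavy with ∑-pick {f = λ y → u y * cost y} {u ∣ʷ W} (*-cancelˡ-< ρ _ _ (≤-<-trans total heavy))
        where
        total : ρ * ∑ (λ y → u y * cost y) ≤ (m + m * m) * M
        total = ≤-trans (≤-reflexive (trans (cong (ρ *_) (trans (∑-cong λ y → *-distribˡ-+ (u y) (cost₁ y) (cost₂ y)) (∑-+ _ _))) (*-distribˡ-+ ρ _ _))) (≤-trans (+-mono-≤ ∑cost₁ ∑cost₂) (≤-reflexive (e m M)))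
          where e : ∀ m M → m * M + m * (m * M) ≡ (m + m * m) * M
                e = solve-∀
      ... | y , lt = y , Wy , uy , record { pair = p ; triple = t }
        where
        Wy = proj₁ (cheap (u y) (cost y) (W y) lt)
        uy = proj₁ (proj₂ (cheap (u y) (cost y) (W y) lt))
        cost0 = proj₂ (proj₂ (cheap (u y) (cost y) (W y) lt))
        good : ∀ i → GoodPair (s i) y
        good i with good? (s i) y in eq
        ... | true = good?-sound eq
        ... | false = ⊥-elim (<⇒≱ (s≤s z≤n) (≤-trans (≤-reflexive (sym (cong (b2n ∘ not) eq))) (≤-trans (term≤∑ (λ i → b2n (not (good? (s i) y))) i) (≤-trans (m≤m+n _ (cost₂ y)) (≤-reflexive cost0)))))
        ok : ∀ i j → bad i j ≡ false → OK (s i) (s j) y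
        ok i j b pv with E (s i) (s j) y in eq
        ... | true = refl
        ... | false = ⊥-elim (<⇒≱ (s≤s z≤n) (≤-trans (≤-reflexive one) (≤-trans (term≤∑ (λ j → b2n (not (bad i j)) * kern MV (s i) (s j) y) j) (≤-trans (term≤∑ (λ i → ∑ λ j → b2n (not (bad i j)) * kern MV (s i) (s j) y) i) (≤-trans (m≤n+m (cost₂ y) (cost₁ y)) (≤-reflexive cost0))))))
          where
          one : 1 ≡ b2n (not (bad i j)) * kern MV (s i) (s j) y
          one rewrite b | pv | eq = refl
        p : ∀ i j → grow₁ bad i j ≡ false → GoodPair (cons y s i) (cons y s j)
        p zero (suc j) _ = good-sym (good j)
        p (suc i) zero _ = good i
        p (suc i) (suc j) h = pair st i j h
        t : ∀ i j k → grow₁ bad i j ≡ false → grow₁ bad i k ≡ false → grow₁ bad j k ≡ false → OK (cons y s i) (cons y s j) (cons y s k)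
        t zero (suc j) (suc k) _ _ h = OK-rot (ok j k h)
        t (suc i) zero (suc k) _ h _ = OK-swap₂₃ (ok i k h)
        t (suc i) (suc j) zero h _ _ = ok i j h
        t (suc i) (suc j) (suc k) = triple st i j k

    -- The bound m + m² of `pick`, taken at 7, the largest size of a configuration.
    Heavy : (V → Bool) → Set
    Heavy W = (7 + 7 * 7) * M < ρ * mass u W

    Picked : ∀ {m k} → (Fin m → V) → Table m → Vec (V → Bool) k → Set
    Picked {m} {k} s bad Ws = Σ (Vec V k) λ ys → (∀ i → Vec.lookup Ws i (Vec.lookup ys i) ≡ true) × (∀ i → Small (pushAll ys s i)) × State (pushAll ys s) (grow k bad)

    pickMany : ∀ {m} {s : Fin m → V} {bad : Table m} → State s bad → (∀ i → Small (s i)) → (∀ y → u y ≢ 0 → Small y) →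
      ∀ {k} (Ws : Vec (V → Bool) k) → k + m ≤ 7 → (∀ i → Heavy (Vec.lookup Ws i)) → Picked s bad Ws
    pickMany st sm smU [] _ _ = [] , (λ ()) , sm , st
    pickMany {m} {s} {bad} st sm smU {suc k} (W ∷ Ws) k≤ hv = next (pickMany st sm smU Ws k≤′ (hv ∘ suc))
      where
      k≤′ : k + m ≤ 7
      k≤′ = ≤-trans (n≤1+n _) k≤
      finish : ∀ ys → (∀ i → Vec.lookup Ws i (Vec.lookup ys i) ≡ true) → (∀ i → Small (pushAll ys s i)) →
        (∃ λ y → W y ≡ true × u y ≢ 0 × State (cons y (pushAll ys s)) (grow₁ (grow k bad))) → Picked s bad (W ∷ Ws)
      finish ys in-W sm′ (y , Wy , uy , st″) = y ∷ ys , (λ { zero → Wy ; (suc i) → in-W i }) , (λ { zero → smU y uy ; (suc i) → sm′ i }) , st″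
      next : Picked s bad Ws → Picked s bad (W ∷ Ws)
      next (ys , in-W , sm′ , st′) = finish ys in-W sm′ (pick st′ sm′ W (≤-<-trans (*-monoˡ-≤ M (+-mono-≤ k≤′ (*-mono-≤ k≤′ k≤′))) (hv zero)))

    -- The class l weighs more than M/ρ, while a good pair misses pattern triples on weight at most
    -- M/ρ; some vertex of the class therefore completes an edge.
    good-covered : (∀ l → M < ρ * weight c u l) → ∀ {x y} → GoodPair x y → ∀ l → P (c x) (c y) l ≡ true → ∃ λ z → E x y z ≡ true
    good-covered heavy {x} {y} g l pl with ∑-pick {f = λ z → u z * kern MV x y z} {λ z → u z * b2n (c z == l)} (*-cancelˡ-< ρ _ _ (≤-<-trans (≤-trans (≤-reflexive (cong (ρ *_) (sym (codeg≡ (kern MV) u x y)))) g) (heavy l)))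
    ... | z , lt with c z ≟ l | E x y z in eq
    ...   | no _ | w = ⊥-elim (n≮0 (subst (u z * b2n (PV x y z ∧ not w) <_) (*-zeroʳ (u z)) lt))
    ...   | yes refl | true = z , eq
    ...   | yes refl | false = ⊥-elim (<⇒≱ lt (≤-reflexive (cong (u z *_) (sym one))))
      where
      p-one : ∀ {a b} → a ≡ true → b ≡ false → b2n (a ∧ not b) ≡ 1
      p-one refl refl = refl
      one = p-one {PV x y z} {false} pl refl

-- Boolean certificates that a covered configuration contradicts 𝓜-freeness

∨-elim-false : ∀ {a b} → (a ∨ b) ≡ true → a ≡ false → b ≡ true
∨-elim-false h refl = h

∨-intro-false : ∀ {a b} → a ≡ false → b ≡ false → (a ∨ b) ≡ false
∨-intro-false refl refl = refl

module _ {m : ℕ} where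
  isPair : Fin m → Fin m → Fin m × Fin m → Bool
  isPair i j (a , b) = ((a == i) ∧ (b == j)) ∨ ((a == j) ∧ (b == i))

  isTriple : Fin m → Fin m → Fin m → Fin m × Fin m × Fin m → Bool
  isTriple i j k (a , b , c) = (a == i) ∧ ((b == j) ∧ (c == k))

  module _ {r : ℕ} (P : Pattern r) (κ : Fin m → Fin r) (bad : Table m) (exP : List (Fin m × Fin m)) (exE : List (Fin m × Fin m × Fin m)) where
    covers? : Fin m → Fin m → Bool
    covers? i j = (i == j) ∨ (any (isPair i j) exP ∨ (not (bad i j) ∧ ∃ᵇ λ l → P (κ i) (κ j) l))

    known : Fin m → Fin m → Fin m → Bool
    known a b c = any (isTriple a b c) exE ∨ (not (bad a b) ∧ (not (bad a c) ∧ (not (bad b c) ∧ P (κ a) (κ b) (κ c))))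

    avoids : Fin m → Fin m → Fin m → Fin m → Bool
    avoids x a b c = not (x == a) ∧ (not (x == b) ∧ (not (x == c) ∧ known a b c))

    -- Computed only from what is guaranteed: pairs that are listed, or good and in a pattern edge;
    -- triples that are listed, or pairwise good and in the pattern. If it holds, `core₇` is
    -- contradicted, and `core₆` keeps only its homomorphism alternative.
    starless-core : Bool
    starless-core = (∀ᵇ λ i → ∀ᵇ λ j → covers? i j) ∧ (∀ᵇ λ x → ∃ᵇ λ a → ∃ᵇ λ b → ∃ᵇ λ c → avoids x a b c)

module _ (g : Fin 6 → Fin 6 → Fin 6 → Bool) where
  private
    viol : Fin 6 → Fin 6 → Fin 6 → Fin 6 → Fin 6 → Fin 6 → Bool
    viol i j k x y z = g i j k ∧ not (P₆ x y z)

    -- A stage succeeds if the newest image repeats an earlier one, if an edge of `g` ending at the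
    -- newest vertex is violated, or, before the last stage, if all choices for the next image
    -- succeed. Success at the root refutes every injection.
    q₅ q₅′ : Fin 6 → Fin 6 → Fin 6 → Fin 6 → Fin 6 → Fin 6 → Bool
    q₅′ a b c d e f = viol 0F 1F 5F a b f ∨ (viol 0F 2F 5F a c f ∨ (viol 0F 3F 5F a d f ∨ (viol 0F 4F 5F a e f ∨ (viol 1F 2F 5F b c f ∨ (viol 1F 3F 5F b d f ∨ (viol 1F 4F 5F b e f ∨ (viol 2F 3F 5F c d f ∨ (viol 2F 4F 5F c e f ∨ viol 3F 4F 5F d e f))))))))
    q₅ a b c d e f = ((a == f) ∨ ((b == f) ∨ ((c == f) ∨ ((d == f) ∨ (e == f))))) ∨ q₅′ a b c d e f
    q₄ : Fin 6 → Fin 6 → Fin 6 → Fin 6 → Fin 6 → Bool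
    q₄ a b c d e = ((a == e) ∨ ((b == e) ∨ ((c == e) ∨ (d == e)))) ∨ ((viol 0F 1F 4F a b e ∨ (viol 0F 2F 4F a c e ∨ (viol 0F 3F 4F a d e ∨ (viol 1F 2F 4F b c e ∨ (viol 1F 3F 4F b d e ∨ viol 2F 3F 4F c d e))))) ∨ ∀ᵇ (q₅ a b c d e))
    q₃ : Fin 6 → Fin 6 → Fin 6 → Fin 6 → Bool
    q₃ a b c d = ((a == d) ∨ ((b == d) ∨ (c == d))) ∨ ((viol 0F 1F 3F a b d ∨ (viol 0F 2F 3F a c d ∨ viol 1F 2F 3F b c d)) ∨ ∀ᵇ (q₄ a b c d))
    q₂ : Fin 6 → Fin 6 → Fin 6 → Bool
    q₂ a b c = ((a == c) ∨ (b == c)) ∨ (viol 0F 1F 2F a b c ∨ ∀ᵇ (q₃ a b c))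
    q₁ : Fin 6 → Fin 6 → Bool
    q₁ a b = (a == b) ∨ ∀ᵇ (q₂ a b)

  -- Backtracking search for an injective homomorphism to the pattern P₆.
  noHom : Bool
  noHom = ∀ᵇ λ a → ∀ᵇ (q₁ a)

  noHom-sound : noHom ≡ true → (φ : Fin 6 → Fin 6) → (∀ i j → i ≢ j → φ i ≢ φ j) → (∀ i j k → g i j k ≡ true → P₆ (φ i) (φ j) (φ k) ≡ true) → ⊥
  noHom-sound h φ inj hom = true≢false (trans (sym s₅) (v (v5 0F 1F) (v (v5 0F 2F) (v (v5 0F 3F) (v (v5 0F 4F) (v (v5 1F 2F) (v (v5 1F 3F) (v (v5 1F 4F) (v (v5 2F 3F) (v (v5 2F 4F) (v5 3F 4F)))))))))))
    where
    v : ∀ {a b} → a ≡ false → b ≡ false → (a ∨ b) ≡ false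
    v = ∨-intro-false
    ok : ∀ i j k → viol i j k (φ i) (φ j) (φ k) ≡ false
    ok i j k with g i j k in e
    ... | false = refl
    ... | true = cong not (hom i j k e)
    v5 : ∀ i j → viol i j 5F (φ i) (φ j) (φ 5F) ≡ false
    v5 i j = ok i j 5F
    ne : ∀ i j → i ≢ j → (φ i == φ j) ≡ false
    ne i j p = ≢⇒== (inj i j p)
    s₁ : q₁ (φ 0F) (φ 1F) ≡ true
    s₁ = ∀ᵇ-sound {p = q₁ (φ 0F)} (∀ᵇ-sound {p = λ a → ∀ᵇ (q₁ a)} h (φ 0F)) (φ 1F)
    s₂ : q₂ (φ 0F) (φ 1F) (φ 2F) ≡ true
    s₂ = ∀ᵇ-sound {p = q₂ (φ 0F) (φ 1F)} (∨-elim-false s₁ (ne 0F 1F λ ())) (φ 2F)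
    s₃ : q₃ (φ 0F) (φ 1F) (φ 2F) (φ 3F) ≡ true
    s₃ = ∀ᵇ-sound {p = q₃ (φ 0F) (φ 1F) (φ 2F)} (∨-elim-false (∨-elim-false s₂ (v (ne 0F 2F λ ()) (ne 1F 2F λ ()))) (ok 0F 1F 2F)) (φ 3F)
    s₄ : q₄ (φ 0F) (φ 1F) (φ 2F) (φ 3F) (φ 4F) ≡ true
    s₄ = ∀ᵇ-sound {p = q₄ (φ 0F) (φ 1F) (φ 2F) (φ 3F)} (∨-elim-false (∨-elim-false s₃ (v (ne 0F 3F λ ()) (v (ne 1F 3F λ ()) (ne 2F 3F λ ())))) (v (ok 0F 1F 3F) (v (ok 0F 2F 3F) (ok 1F 2F 3F)))) (φ 4F)
    s₅′ : q₅ (φ 0F) (φ 1F) (φ 2F) (φ 3F) (φ 4F) (φ 5F) ≡ true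
    s₅′ = ∀ᵇ-sound {p = q₅ (φ 0F) (φ 1F) (φ 2F) (φ 3F) (φ 4F)} (∨-elim-false (∨-elim-false s₄ (v (ne 0F 4F λ ()) (v (ne 1F 4F λ ()) (v (ne 2F 4F λ ()) (ne 3F 4F λ ()))))) (v (ok 0F 1F 4F) (v (ok 0F 2F 4F) (v (ok 0F 3F 4F) (v (ok 1F 2F 4F) (v (ok 1F 3F 4F) (ok 2F 3F 4F))))))) (φ 5F)
    s₅ : q₅′ (φ 0F) (φ 1F) (φ 2F) (φ 3F) (φ 4F) (φ 5F) ≡ true
    s₅ = ∨-elim-false s₅′ (v (ne 0F 5F λ ()) (v (ne 1F 5F λ ()) (v (ne 2F 5F λ ()) (v (ne 3F 5F λ ()) (ne 4F 5F λ ())))))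

pushAll-colour : ∀ {A B : Set} (c : A → B) {m k} (ys : Vec A k) (κs : Vec B k) (s : Fin m → A) (κ : Fin m → B) →
  (∀ i → c (Vec.lookup ys i) ≡ Vec.lookup κs i) → (∀ i → c (s i) ≡ κ i) → ∀ i → c (pushAll ys s i) ≡ pushAll κs κ i
pushAll-colour c [] [] s κ h e = e
pushAll-colour c (y ∷ ys) (κ₀ ∷ κs) s κ h e zero = h zero
pushAll-colour c (y ∷ ys) (κ₀ ∷ κs) s κ h e (suc i) = pushAll-colour c ys κs s κ (h ∘ suc) e i

private
  any-∈ : ∀ {A : Set} (p : A → Bool) (Q : A → Set) (L : List A) → All Q L → any p L ≡ true → ∃ λ x → p x ≡ true × Q x
  any-∈ p Q (x ∷ L) (q ∷ qs) h with ∨-true {p x} h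
  ... | inj₁ e = x , e , q
  ... | inj₂ e = any-∈ p Q L qs e

module Reflect {n r : ℕ} (E : Fin n → Fin n → Fin n → Bool) (R : Rules E)
  (P : Pattern r) (P-sym : Symmetric₃ P) (c : Fin n → Fin r) (u : Fin n → ℕ) (M≥1 : 1 ≤ ∑ u) (ρ : ℕ) where
  open Rules R
  open Generic E symm P P-sym c u M≥1
  open Scale ρ

  Cov : Fin n → Fin n → Set
  Cov a b = ∃ λ z → E a b z ≡ true

  module _ (heavy : ∀ l → M < ρ * weight c u l) {m : ℕ} (s : Fin m → Fin n) (κ : Fin m → Fin r) (bad : Table m)
    (exP : List (Fin m × Fin m)) (exE : List (Fin m × Fin m × Fin m)) (st : State s bad) (κ≡ : ∀ i → c (s i) ≡ κ i)
    (covs : All (λ p → Cov (s (proj₁ p)) (s (proj₂ p))) exP) (eds : All (λ t → E (s (proj₁ t)) (s (proj₁ (proj₂ t))) (s (proj₂ (proj₂ t))) ≡ true) exE) where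
    private
      kn = known P κ bad exP exE

      P-at : ∀ {i j l} → P (κ i) (κ j) l ≡ true → P (c (s i)) (c (s j)) l ≡ true
      P-at {i} {j} {l} = subst₂ (λ x y → P x y l ≡ true) (sym (κ≡ i)) (sym (κ≡ j))

      covered : ∀ i j → i ≢ j → covers? P κ bad exP exE i j ≡ true → Cov (s i) (s j)
      covered i j i≢j h with ∨-true {i == j} h
      ... | inj₁ e = ⊥-elim (i≢j (==⇒≡ e))
      ... | inj₂ h′ with ∨-true {any (isPair i j) exP} h′
      ...   | inj₂ e = let (b , e′) = ∧-true {not (bad i j)} e ; (l , pl) = ∃ᵇ-sound {p = λ l → P (κ i) (κ j) l} e′ in good-covered heavy (pair st i j (not-true b)) l (P-at {i} {j} pl)
      ...   | inj₁ e = let (p , q , cv) = any-∈ (isPair i j) _ exP covs e in at p q cv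
        where
        at : ∀ p → isPair i j p ≡ true → Cov (s (proj₁ p)) (s (proj₂ p)) → Cov (s i) (s j)
        at (a , b) q (z , ez) with ∨-true {(a == i) ∧ (b == j)} q
        ... | inj₁ w = let (x , y) = ∧-true {a == i} w in z , subst₂ (λ x y → E (s x) (s y) z ≡ true) (==⇒≡ x) (==⇒≡ y) ez
        ... | inj₂ w = let (x , y) = ∧-true {a == j} w in z , trans (swap₁₂ symm (s i) (s j) z) (subst₂ (λ x y → E (s x) (s y) z ≡ true) (==⇒≡ x) (==⇒≡ y) ez)

      known-edge : ∀ i j k → kn i j k ≡ true → E (s i) (s j) (s k) ≡ true
      known-edge i j k h with ∨-true {any (isTriple i j k) exE} h
      ... | inj₁ e = let (p , q , ed) = any-∈ (isTriple i j k) _ exE eds e in at p q ed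
        where
        at : ∀ p → isTriple i j k p ≡ true → E (s (proj₁ p)) (s (proj₁ (proj₂ p))) (s (proj₂ (proj₂ p))) ≡ true → E (s i) (s j) (s k) ≡ true
        at (a , b , d) q ed with ∧-true {a == i} q
        ... | x , q′ with ∧-true {b == j} q′
        ...   | y , z with ==⇒≡ {x = a} x | ==⇒≡ {x = b} y | ==⇒≡ {x = d} z
        ...     | refl | refl | refl = ed
      ... | inj₂ e with ∧-true {not (bad i j)} e
      ...   | x , e₁ with ∧-true {not (bad i k)} e₁
      ...     | y , e₂ with ∧-true {not (bad j k)} e₂
      ...       | z , e₃ = triple st i j k (not-true x) (not-true y) (not-true z) (P-at {i} {j} (subst (λ w → P (κ i) (κ j) w ≡ true) (sym (κ≡ k)) e₃))

      unstar : (∀ᵇ λ x → ∃ᵇ λ a → ∃ᵇ λ b → ∃ᵇ λ d → avoids P κ bad exP exE x a b d) ≡ true → (∃ λ x → ∀ a b d → E (s a) (s b) (s d) ≡ true → x ∈₃ a , b , d) → ⊥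
      unstar h (x , star) with ∃ᵇ-sound {p = λ a → ∃ᵇ λ b → ∃ᵇ λ d → avoids P κ bad exP exE x a b d} (∀ᵇ-sound {p = λ x → ∃ᵇ λ a → ∃ᵇ λ b → ∃ᵇ λ d → avoids P κ bad exP exE x a b d} h x)
      ... | a , h₁ with ∃ᵇ-sound {p = λ b → ∃ᵇ λ d → avoids P κ bad exP exE x a b d} h₁
      ...   | b , h₂ with ∃ᵇ-sound {p = avoids P κ bad exP exE x a b} h₂
      ...     | d , h₃ with ∧-true {not (x == a)} h₃
      ...       | n₁ , h₄ with ∧-true {not (x == b)} h₄
      ...         | n₂ , h₅ with ∧-true {not (x == d)} h₅
      ...           | n₃ , kn′ with star a b d (known-edge a b d kn′)
      ...             | inj₁ refl = true≢false (trans (sym (==-refl x)) (not-true n₁))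
      ...             | inj₂ (inj₁ refl) = true≢false (trans (sym (==-refl x)) (not-true n₂))
      ...             | inj₂ (inj₂ refl) = true≢false (trans (sym (==-refl x)) (not-true n₃))

      all-covered : (∀ᵇ λ i → ∀ᵇ λ j → covers? P κ bad exP exE i j) ≡ true → Covered E s
      all-covered h i j i≢j = covered i j i≢j (∀ᵇ-sound {p = covers? P κ bad exP exE i} (∀ᵇ-sound {p = λ i → ∀ᵇ λ j → covers? P κ bad exP exE i j} h i) j)

    clash₇ : m ≡ 7 → starless-core P κ bad exP exE ≡ true → ⊥
    clash₇ refl h = let (p , q) = ∧-true {∀ᵇ λ i → ∀ᵇ λ j → covers? P κ bad exP exE i j} h in unstar q (core₇ s (all-covered p))

    clash₆ : (e : m ≡ 6) → starless-core P κ bad exP exE ≡ true → noHom (λ i j k → kn (subst Fin (sym e) i) (subst Fin (sym e) j) (subst Fin (sym e) k)) ≡ true → ⊥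
    clash₆ refl h none with ∧-true {∀ᵇ λ i → ∀ᵇ λ j → covers? P κ bad exP exE i j} h
    ... | p , q with core₆ s (all-covered p)
    ...   | inj₁ st = unstar q st
    ...   | inj₂ (φ , inj , hom) = noHom-sound kn none φ inj λ i j k e → trans (P₆≡ (φ i) (φ j) (φ k)) (trans (sym (edges≡ G26 _ _ _)) (hom i j k (known-edge i j k e)))

-- Extending a colouring to one more vertex

-- Scales of genericity; only the inequalities below matter.
opaque
  R R₁ R₂ τ : ℕ
  R = 10000
  R₁ = 4 * (R * R)
  R₂ = 100 * R₁
  τ = 2 * (R₂ * R₂)

  R≥ : 10000 ≤ R
  R≥ = ≤-refl

  R₁≡ : R₁ ≡ 4 * (R * R)
  R₁≡ = refl

  R₂≡ : R₂ ≡ 100 * R₁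
  R₂≡ = refl

  τ≡ : τ ≡ 2 * (R₂ * R₂)
  τ≡ = refl

R≤R₁ : R ≤ R₁
R≤R₁ = ≤-trans (≤-trans (m≤m*n R R {{>-nonZero (≤-trans (s≤s z≤n) R≥)}}) (m≤n*m (R * R) 4)) (≤-reflexive (sym R₁≡))

R₁≤R₂ : R₁ ≤ R₂
R₁≤R₂ = ≤-trans (m≤n*m R₁ 100) (≤-reflexive (sym R₂≡))

2R₂²≤τ : 2 * (R₂ * R₂) ≤ τ
2R₂²≤τ = ≤-reflexive (sym τ≡)

R≤R₂ : R ≤ R₂
R≤R₂ = ≤-trans R≤R₁ R₁≤R₂

R₂²≤τ : R₂ * R₂ ≤ τ
R₂²≤τ = ≤-trans (m≤n*m (R₂ * R₂) 2) 2R₂²≤τ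

R₁²≤τ : R₁ * R₁ ≤ τ
R₁²≤τ = ≤-trans (*-mono-≤ R₁≤R₂ R₁≤R₂) R₂²≤τ

2R²≤τ : 2 * (R * R) ≤ τ
2R²≤τ = ≤-trans (*-monoʳ-≤ 2 (*-mono-≤ R≤R₂ R≤R₂)) 2R₂²≤τ

R²≤τ : R * R ≤ τ
R²≤τ = ≤-trans (m≤n*m (R * R) 2) 2R²≤τ

R≤τ : R ≤ τ
R≤τ = ≤-trans (m≤m*n R R {{>-nonZero (≤-trans (s≤s z≤n) R≥)}}) R²≤τ

τ≥1 : 1 ≤ τ
τ≥1 = ≤-trans (s≤s z≤n) (≤-trans R≥ R≤τ)

-- By `deg-upper`, an accuracy of 1/τ² in the edge count controls degrees only up to order 1/τ,
-- hence the square.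
L : ℕ
L = τ * τ

L≥1 : 1 ≤ L
L≥1 = *-mono-≤ τ≥1 τ≥1

deg-mono-supp : ∀ {n} {k k′ : Kernel n} (f : Fin n → ℕ) x → (∀ b d → f b ≢ 0 → f d ≢ 0 → k x b d ≤ k′ x b d) → deg k f f x ≤ deg k′ f f x
deg-mono-supp {k = k} {k′} f x h = ≤-trans (≤-reflexive (deg≡ k f f x)) (≤-trans (∑-mono outer) (≤-reflexive (sym (deg≡ k′ f f x))))
  where
  outer : ∀ b → f b * codeg k f x b ≤ f b * codeg k′ f x b
  outer b = guarded (f b) λ fb → ≤-trans (≤-reflexive (codeg≡ k f x b)) (≤-trans (∑-mono λ d → guarded (f d) (h b d fb)) (≤-reflexive (sym (codeg≡ k′ f x b))))

deg-0 : ∀ {n} (f g : Fin n → ℕ) x → deg (λ _ _ _ → 0) f g x ≡ 0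
deg-0 {n} f g x = trans (deg≡ _ f g x) (trans (∑-cong λ b → trans (cong (f b *_) (trans (codeg≡ _ g x b) (trans (∑-cong λ d → *-zeroʳ (g d)) (∑-zero {n})))) (*-zeroʳ (f b))) (∑-zero {n}))

recolour : ∀ {n} {r} → (Fin n → Fin r) → Fin n → Fin r → Fin n → Fin r
recolour c v i x = if v == x then i else c x

recolour-at : ∀ {n r} (c : Fin n → Fin r) v i → recolour c v i v ≡ i
recolour-at c v i rewrite ==-refl v = refl

recolour-off : ∀ {n r} (c : Fin n → Fin r) {v} i {x} → v ≢ x → recolour c v i x ≡ c x
recolour-off c i p rewrite ≢⇒== p = refl

module _ {n r : ℕ} (E : Fin n → Fin n → Fin n → Bool) (E-sym : Symmetric₃ E) (E-irr : Irreflexive₃ E) (P : Pattern r) (P-sym : Symmetric₃ P)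
  (U : Fin n → Bool) (c : Fin n → Fin r) (col : Colouring P E U c) (v : Fin n) (v∉U : U v ≡ false) where

  ∈U⇒≢ : ∀ {x} → U x ≡ true → v ≢ x
  ∈U⇒≢ p refl = true≢false (trans (sym p) v∉U)

  -- As v lies outside U, it may carry a provisional colour before its edges are examined; missing
  -- and off-pattern degrees are then defined at v as well.
  recolour-colouring : ∀ i → Colouring P E U (recolour c v i)
  recolour-colouring i a b d ua ub ud e rewrite recolour-off c i (∈U⇒≢ ua) | recolour-off c i (∈U⇒≢ ub) | recolour-off c i (∈U⇒≢ ud) = col a b d ua ub ud e

  extend-colouring : ∀ i → (∀ b d → U b ≡ true → U d ≡ true → E v b d ≡ true → P i (c b) (c d) ≡ true) → Colouring P E (add U v) (recolour c v i)
  extend-colouring i h a b d ua ub ud e = go a b d (split a ua) (split b ub) (split d ud) e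
    where
    c′ = recolour c v i
    split : ∀ x → add U v x ≡ true → (U x ≡ true) ⊎ (v ≡ x)
    split x p with ∨-true {U x} p
    ... | inj₁ q = inj₁ q
    ... | inj₂ q = inj₂ (==⇒≡ q)
    at-v : ∀ b d → (U b ≡ true) ⊎ (v ≡ b) → (U d ≡ true) ⊎ (v ≡ d) → E v b d ≡ true → P (c′ v) (c′ b) (c′ d) ≡ true
    at-v b d (inj₂ refl) _ e = ⊥-elim (true≢false (trans (sym e) (E-irr v d)))
    at-v b d (inj₁ _) (inj₂ refl) e = ⊥-elim (true≢false (trans (sym e) (trans (swap₂₃ E-sym v b v) (E-irr v b))))
    at-v b d (inj₁ ub) (inj₁ ud) e rewrite recolour-at c v i | recolour-off c i (∈U⇒≢ ub) | recolour-off c i (∈U⇒≢ ud) = h b d ub ud e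
    go : ∀ a b d → (U a ≡ true) ⊎ (v ≡ a) → (U b ≡ true) ⊎ (v ≡ b) → (U d ≡ true) ⊎ (v ≡ d) → E a b d ≡ true → P (c′ a) (c′ b) (c′ d) ≡ true
    go a b d (inj₂ refl) ub ud e = at-v b d ub ud e
    go a b d ua (inj₂ refl) ud e = trans (swap₁₂ P-sym (c′ a) (c′ b) (c′ d)) (at-v a d ua ud (trans (swap₁₂ E-sym b a d) e))
    go a b d ua ub (inj₂ refl) e = trans (rot² P-sym (c′ a) (c′ b) (c′ d)) (at-v a b ua ub (trans (rot E-sym d a b) e))
    go a b d (inj₁ ua) (inj₁ ub) (inj₁ ud) e = recolour-colouring i a b d ua ub ud e

-- 4M²/9 is the weighted average degree when T reaches its maximum 4M³/9; the permitted shortfall is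
-- M²/9K.
High : ∀ {n} → (Fin n → Fin n → Fin n → Bool) → (Fin n → ℕ) → ℕ → Fin n → Set
High E u K x = 4 * K * (∑ u * ∑ u) ≤ 9 * K * deg (kern E) u u x + ∑ u * ∑ u

module Extremal {n r : ℕ} (E : Fin n → Fin n → Fin n → Bool) (R : Rules E) (P : Pattern r) (P-sym : Symmetric₃ P)
  (bound : ∀ X → 9 * cube (kern P) X ≤ 4 * (∑ X * ∑ X * ∑ X))
  (U : Fin n → Bool) (c : Fin n → Fin r) (col : Colouring P E U c)
  (u : Fin n → ℕ) (supp : ∀ x → u x ≢ 0 → U x ≡ true) (M≥1 : 1 ≤ ∑ u) (high : ∀ x → U x ≡ true → High E u L x) where
  open Rules R
  open Generic E symm P P-sym c u M≥1 public

  off≡0 : ∀ x → U x ≡ true → off x ≡ 0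
  off≡0 x ux = n≤0⇒n≡0 (≤-trans (deg-mono-supp {k = kern OV} {λ _ _ _ → 0} u x λ b d ub ud → ≤-reflexive (none b d ub ud)) (≤-reflexive (deg-0 u u x)))
    where
    none : ∀ b d → u b ≢ 0 → u d ≢ 0 → kern OV x b d ≡ 0
    none b d ub ud with E x b d in e
    ... | false = refl
    ... | true = cong (λ z → b2n (not z)) (col x b d ux (supp b ub) (supp d ud) e)

  private
    X = weight c u

    ∑X : ∑ X ≡ M
    ∑X = ∑-weight c u

    D≤exp : ∀ x → u x * D x ≤ u x * exp x
    D≤exp x = guarded (u x) (λ ux → ≤-trans (m≤m+n (D x) (miss x)) (≤-reflexive (trans (balance x) (trans (cong (exp x +_) (off≡0 x (supp x ux))) (+-identityʳ _)))))

    cube-lower : Defect L (cube (kern E) u) M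
    cube-lower = begin
      4 * L * (M * M * M) ≡⟨ e₁ (4 * L) M ⟩
      M * (4 * L * (M * M)) ≡⟨ sym (∑-*ʳ u (4 * L * (M * M))) ⟩
      ∑ (λ x → u x * (4 * L * (M * M))) ≤⟨ ∑-mono each ⟩
      ∑ (λ x → u x * (9 * L * D x + M * M)) ≡⟨ ∑-cong (λ x → e₂ (u x) (9 * L) (D x) (M * M)) ⟩
      ∑ (λ x → 9 * L * (u x * D x) + u x * (M * M)) ≡⟨ ∑-+ _ _ ⟩
      ∑ (λ x → 9 * L * (u x * D x)) + ∑ (λ x → u x * (M * M)) ≡⟨ cong₂ _+_ (trans (∑-*ˡ (9 * L) _) (cong (9 * L *_) (sym (form≡ (kern E) u u u)))) (trans (∑-*ʳ u (M * M)) (sym (*-assoc M M M))) ⟩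
      9 * L * cube (kern E) u + M * M * M ∎
      where
      open ≤-Reasoning
      e₁ : ∀ l m → l * (m * m * m) ≡ m * (l * (m * m))
      e₁ = solve-∀
      e₂ : ∀ a b c d → a * (b * c + d) ≡ b * (a * c) + a * d
      e₂ = solve-∀
      each : ∀ x → u x * (4 * L * (M * M)) ≤ u x * (9 * L * D x + M * M)
      each x = guarded (u x) λ ux → high x (supp x ux)

    cube≤ : cube (kern E) u ≤ cube (kern P) X
    cube≤ = ≤-trans (≤-reflexive (form≡ (kern E) u u u)) (≤-trans (∑-mono D≤exp) (≤-reflexive (trans (sym (form≡ (kern PV) u u u)) (cube-push c (kern P) u))))

  -- Averaging the high degrees bounds T of the graph from below, and edges inside the support obey
  -- the pattern, so the pattern polynomial at the class weights is at least as large.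
  defect : Defect L (cube (kern P) X) (∑ X)
  defect = subst (λ z → 4 * L * (z * z * z) ≤ 9 * L * cube (kern P) X + z * z * z) (sym ∑X) (≤-trans cube-lower (+-monoˡ-≤ (M * M * M) (*-monoʳ-≤ (9 * L) cube≤)))

  ∑X≥1 : 1 ≤ ∑ X
  ∑X≥1 = subst (1 ≤_) (sym ∑X) M≥1

  exp-upper : ∀ x → 9 * τ * exp x ≤ (4 * τ + 6) * (M * M)
  exp-upper x = subst₂ (λ d z → 9 * τ * d ≤ (4 * τ + 6) * (z * z)) (sym (deg-push c (kern P) u u x)) ∑X (deg-upper P P-sym bound τ X (c x) ∑X≥1 τ≥1 defect)

  -- In D + miss = exp + off, D is at least (4/9 - 1/9τ²)M² because x is high, and exp is at most
  -- (4/9 + 6/9τ)M² by `exp-upper`. This holds for vertices outside U as well, in particular for the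
  -- vertex to be added.
  miss-bound : ∀ x → High E u L x → τ * miss x ≤ M * M + τ * off x
  miss-bound x h = *-cancelˡ-≤ 9 (begin
    9 * (τ * miss x) ≤⟨ arith τ (M * M) (D x) (exp x) (miss x) (off x) τ≥1 h (exp-upper x) (balance x) ⟩
    9 * (M * M + τ * off x) ∎)
    where
    open ≤-Reasoning
    arith : ∀ t m d e s o → 1 ≤ t → 4 * (t * t) * m ≤ 9 * (t * t) * d + m → 9 * t * e ≤ (4 * t + 6) * m → d + s ≡ e + o → 9 * (t * s) ≤ 9 * (m + t * o)
    arith t m d e s o t≥1 h₁ h₂ bal = *-cancel-pos t≥1 _ _ (≤-cert (2 * t * m) (h₁ ⊕ t ⊛ h₂ ⊕ m ⊛ t≥1 ⊕ ≤-reflexive (cong (9 * (t * t) *_) bal)) (e₁ t m d e s o))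
      where
      e₁ : ∀ t m d e s o → t * (9 * (m + t * o)) + (4 * (t * t) * m + (t * (9 * t * e) + (m * 1 + 9 * (t * t) * (d + s)))) ≡ t * (9 * (t * s)) + (9 * (t * t) * d + m + (t * ((4 * t + 6) * m) + (m * t + 9 * (t * t) * (e + o)))) + (2 * t * m)
      e₁ = solve-∀

  small : ∀ ρ → ρ * ρ ≤ τ → ∀ x → U x ≡ true → Scale.Small ρ x
  small ρ ρ≤ x ux = ≤-trans (*-monoˡ-≤ (miss x) ρ≤) (≤-trans (miss-bound x (high x ux)) (≤-reflexive (trans (cong (λ z → M * M + τ * z) (off≡0 x ux)) (trans (cong (M * M +_) (*-zeroʳ τ)) (+-identityʳ _)))))

  small-supp : ∀ ρ → ρ * ρ ≤ τ → ∀ y → u y ≢ 0 → Scale.Small ρ y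
  small-supp ρ ρ≤ y uy = small ρ ρ≤ y (supp y uy)

pattern 6F = suc 5F

-- 57 instead of 56 leaves a spare M ≥ 1, which makes the inequality strict.
heavy-by : ∀ k {M ρ w} → 1 ≤ M → 57 * k ≤ ρ → M ≤ k * w → (7 + 7 * 7) * M < ρ * w
heavy-by k {M} {ρ} {w} M≥1 k≤ρ M≤ = ≤-trans (+-monoˡ-≤ (56 * M) M≥1) (≤-trans (*-monoʳ-≤ 57 M≤) (≤-trans (≤-reflexive (sym (*-assoc 57 k w))) (*-monoˡ-≤ w k≤ρ)))

heavy⇒< : ∀ {M x} → (7 + 7 * 7) * M < x → M < x
heavy⇒< {M} h = ≤-<-trans (m≤n*m M 56) h

57*k≤R : ∀ k → (57 * k ≤ᵇ 10000) ≡ true → 57 * k ≤ R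
57*k≤R k h = ≤-trans (≤-by h) R≥

100≤L : 10 * 10 ≤ L
100≤L = *-mono-≤ 10≤τ 10≤τ
  where 10≤τ : 10 ≤ τ
        10≤τ = ≤-trans (≤-by refl) (≤-trans R≥ R≤τ)

-- Adding a vertex to a semibipartite colouring

private
  κ-AB : Vec (Fin 2) 5
  κ-AB = 1F ∷ 1F ∷ 1F ∷ 1F ∷ 1F ∷ []

  κ-v : Fin 7 → Fin 2
  κ-v = cons 1F (pushAll (1F ∷ 1F ∷ 1F ∷ 1F ∷ []) (pushAll (1F ∷ []) (Vec.lookup (0F ∷ []))))

  exP-v : List (Fin 7 × Fin 7)
  exP-v = (0F , 1F) ∷ (0F , 2F) ∷ (0F , 3F) ∷ (0F , 4F) ∷ (0F , 5F) ∷ (0F , 6F) ∷ []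

  exP-B : List (Fin 7 × Fin 7)
  exP-B = (4F , 5F) ∷ (4F , 6F) ∷ (5F , 6F) ∷ []

  opaque
    unfolding P₂ ∀ᵇ
    check-AA : starless-core P₂ (pushAll κ-AB (Vec.lookup (0F ∷ 0F ∷ []))) (grow 5 allBad) ((5F , 6F) ∷ []) [] ≡ true
    check-AA = refl

    check-AB : starless-core P₂ κ-v (isolate (grow 4 (grow 1 allBad))) exP-v ((0F , 1F , 5F) ∷ []) ≡ true
    check-AB = refl

    check-BB : starless-core P₂ (pushAll (0F ∷ 1F ∷ 1F ∷ 1F ∷ []) (Vec.lookup (1F ∷ 1F ∷ 1F ∷ []))) (grow 4 allBad) exP-B ((4F , 5F , 6F) ∷ []) ≡ true
    check-BB = refl

    P₂-BAB : P₂ 1F 0F 1F ≡ true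
    P₂-BAB = refl

    P₂-BBA : P₂ 1F 1F 0F ≡ true
    P₂-BBA = refl

    P₂-ABB : P₂ 0F 1F 1F ≡ true
    P₂-ABB = refl

-- Colour 0 is the side A, colour 1 the side B, and v first receives B. Edges at v inside A are
-- excluded outright. If v has many edges inside B, it behaves like a vertex of A and is recoloured;
-- if it has few, its missing degree is small and edges inside B are excluded too.
module SemibipartiteStep {n : ℕ} (E : Fin n → Fin n → Fin n → Bool) (rules : Rules E)
  (U : Fin n → Bool) (c : Fin n → Fin 2) (col : Colouring P₂ E U c)
  (u : Fin n → ℕ) (supp : ∀ x → u x ≢ 0 → U x ≡ true) (M≥1 : 1 ≤ ∑ u) (high : ∀ x → U x ≡ true → High E u L x)
  (v : Fin n) (v∉U : U v ≡ false) (v-high : High E u L v) where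
  open Rules rules

  private
    V = Fin n
    c₁ : V → Fin 2
    c₁ = recolour c v 1F

    ≢v : ∀ {x} → U x ≡ true → v ≢ x
    ≢v = ∈U⇒≢ E symm irr P₂ P₂-symmetric U c col v v∉U

    c₁≡ : ∀ {x} → U x ≡ true → c₁ x ≡ c x
    c₁≡ ux = recolour-off c 1F (≢v ux)

    open Extremal E rules P₂ P₂-symmetric cube-bound₂ U c₁ (recolour-colouring E symm irr P₂ P₂-symmetric U c col v v∉U 1F) u supp M≥1 high

    X = weight c₁ u
    sizes = stable₂ {10} {L} X ∑X≥1 100≤L defect

    class≥ : ∀ l → M ≤ 4 * X l
    class≥ l = subst (_≤ 4 * X l) (∑-weight c₁ u) (lem l)
      where
      low : ∀ m w → 10 * m ≤ 10 * (3 * w) + m → m ≤ 4 * w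
      low m w h = *-cancelˡ-≤ 9 (≤-cert (6 * w) h (e m w))
        where e : ∀ m w → 9 * (4 * w) + 10 * m ≡ 9 * m + (10 * (3 * w) + m) + 6 * w
              e = solve-∀
      low₂ : ∀ m w → 10 * (2 * m) ≤ 10 * (3 * w) + m → m ≤ 4 * w
      low₂ m w h = low m w (≤-cert (10 * m) h (e m w))
        where e : ∀ m w → 10 * (3 * w) + m + 10 * (2 * m) ≡ 10 * m + (10 * (3 * w) + m) + 10 * m
              e = solve-∀
      lem : ∀ l → ∑ X ≤ 4 * X l
      lem 0F = low (∑ X) (X 0F) (proj₂ (proj₁ sizes))
      lem 1F = low₂ (∑ X) (X 1F) (proj₂ (proj₂ sizes))

    heavy-class : ∀ ρ → R ≤ ρ → ∀ l → (7 + 7 * 7) * M < ρ * X l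
    heavy-class ρ R≤ρ l = heavy-by 4 {M} {ρ} {X l} M≥1 (≤-trans (57*k≤R 4 refl) R≤ρ) (class≥ l)

    class : Fin 2 → V → Bool
    class l y = c₁ y == l

    -- The edge covers the pair a, b. With five generic vertices of B it forms a covered 7-set
    -- containing two disjoint edges, one at a and one at b.
    no-AA : ∀ a b → U a ≡ true → U b ≡ true → c a ≡ 0F → c b ≡ 0F → E v a b ≡ true → ⊥
    no-AA a b ua ub ca cb e = finish (pickMany (start s) sm (small-supp R R²≤τ) Ws ≤-refl hv)
      where
      open Scale R
      s = Vec.lookup (a ∷ b ∷ [])
      sm : ∀ i → Small (s i)
      sm 0F = small R R²≤τ a ua
      sm 1F = small R R²≤τ b ub
      Ws = class 1F ∷ class 1F ∷ class 1F ∷ class 1F ∷ class 1F ∷ []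
      hv : ∀ i → Heavy (Vec.lookup Ws i)
      hv 0F = heavy-class R ≤-refl 1F
      hv 1F = heavy-class R ≤-refl 1F
      hv 2F = heavy-class R ≤-refl 1F
      hv 3F = heavy-class R ≤-refl 1F
      hv 4F = heavy-class R ≤-refl 1F
      κs : ∀ i → c₁ (s i) ≡ Vec.lookup (0F ∷ 0F ∷ []) i
      κs 0F = trans (c₁≡ ua) ca
      κs 1F = trans (c₁≡ ub) cb
      finish : Picked s allBad Ws → ⊥
      finish (ys@(_ ∷ _ ∷ _ ∷ _ ∷ _ ∷ []) , in-W , _ , st) = Reflect.clash₇ E rules P₂ P₂-symmetric c₁ u M≥1 R (λ l → heavy⇒< {M} (heavy-class R ≤-refl l))
        (pushAll ys s) (pushAll κ-AB (Vec.lookup (0F ∷ 0F ∷ []))) (grow 5 allBad) ((5F , 6F) ∷ []) [] st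
        (pushAll-colour c₁ ys κ-AB s _ (λ { 0F → ==⇒≡ (in-W 0F) ; 1F → ==⇒≡ (in-W 1F) ; 2F → ==⇒≡ (in-W 2F) ; 3F → ==⇒≡ (in-W 3F) ; 4F → ==⇒≡ (in-W 4F) }) κs)
        ((v , trans (rot E-sym a b v) (trans (rot E-sym b v a) e)) ∷ []) [] refl check-AA
        where E-sym = symm

    OB : V → V → V → Bool
    OB x y z = E x y z ∧ (class 1F y ∧ class 1F z)

    OB-sound : ∀ {x y z} → OB x y z ≡ true → E x y z ≡ true × c₁ y ≡ 1F × c₁ z ≡ 1F
    OB-sound {x} {y} {z} h = let (e , h′) = ∧-true {E x y z} h ; (p , q) = ∧-true {class 1F y} h′ in e , ==⇒≡ p , ==⇒≡ q

    off≤ : off v ≤ deg (kern OB) u u v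
    off≤ = deg-mono-supp {k = kern OV} {kern OB} u v λ b d ub ud → b2n-mono (pt b d (supp b ub) (supp d ud))
      where
      colours : ∀ b d (x y : Fin 2) → c₁ b ≡ x → c₁ d ≡ y → U b ≡ true → U d ≡ true → E v b d ≡ true → not (P₂ 1F x y) ≡ true → x ≡ 1F × y ≡ 1F
      colours b d 0F 0F p q ub ud e h = ⊥-elim (no-AA b d ub ud (trans (sym (c₁≡ ub)) p) (trans (sym (c₁≡ ud)) q) e)
      colours b d 0F 1F p q ub ud e h = ⊥-elim (true≢false (trans (sym h) (cong not P₂-BAB)))
      colours b d 1F 0F p q ub ud e h = ⊥-elim (true≢false (trans (sym h) (cong not P₂-BBA)))
      colours b d 1F 1F p q ub ud e h = refl , refl
      pt : ∀ b d → U b ≡ true → U d ≡ true → OV v b d ≡ true → OB v b d ≡ true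
      pt b d ub ud h = let (e , h′) = ∧-true {E v b d} h ; (p , q) = colours b d (c₁ b) (c₁ d) refl refl ub ud e (subst (λ z → not (P₂ z (c₁ b) (c₁ d)) ≡ true) (recolour-at c v 1F) h′) in
        ∧-intro e (∧-intro (subst (λ z → (z == 1F) ≡ true) (sym p) refl) (subst (λ z → (z == 1F) ≡ true) (sym q) refl))

    module Large (large : M * M < 2 * (R * R) * deg (kern OB) u u v) where
      cd : V → ℕ
      cd = codeg (kern OB) u v

      W₁ : V → Bool
      W₁ y = M ≤ᵇ R₁ * cd y

      W₁-mass : M ≤ R₁ * mass u W₁
      W₁-mass = subst (λ z → M ≤ z * mass u W₁) (sym R₁≡) (*-cancel-pos M≥1 _ _ (arith M (R * R) (deg (kern OB) u u v) (mass u W₁) large total))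
        where
        total : 4 * (R * R) * deg (kern OB) u u v ≤ 4 * (R * R) * (M * mass u W₁) + M * M
        total = begin
          4 * (R * R) * deg (kern OB) u u v ≡⟨ cong (4 * (R * R) *_) (deg≡ (kern OB) u u v) ⟩
          4 * (R * R) * ∑ (λ y → u y * cd y) ≡⟨ sym (∑-*ˡ (4 * (R * R)) _) ⟩
          ∑ (λ y → 4 * (R * R) * (u y * cd y)) ≤⟨ ∑-mono pt ⟩
          ∑ (λ y → 4 * (R * R) * (M * (u y * b2n (W₁ y))) + u y * M) ≡⟨ ∑-+ _ _ ⟩
          ∑ (λ y → 4 * (R * R) * (M * (u y * b2n (W₁ y)))) + ∑ (λ y → u y * M) ≡⟨ cong₂ _+_ (trans (∑-*ˡ (4 * (R * R)) _) (cong (4 * (R * R) *_) (∑-*ˡ M _))) (∑-*ʳ u M) ⟩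
          4 * (R * R) * (M * mass u W₁) + M * M ∎
          where
          open ≤-Reasoning
          pt : ∀ y → 4 * (R * R) * (u y * cd y) ≤ 4 * (R * R) * (M * (u y * b2n (W₁ y))) + u y * M
          pt y with W₁ y in w
          ... | true = ≤-trans (*-monoʳ-≤ (4 * (R * R)) (≤-trans (*-monoʳ-≤ (u y) (codeg-≤ (kern≤1 OB) u v y)) (≤-reflexive (e (u y) M)))) (m≤m+n _ _)
            where e : ∀ a m → a * m ≡ m * (a * 1)
                  e = solve-∀
          ... | false = ≤-trans (≤-trans (≤-reflexive (e (4 * (R * R)) (u y) (cd y))) (*-monoʳ-≤ (u y) (≤-trans (≤-reflexive (cong (_* cd y) (sym R₁≡))) (<⇒≤ (≰⇒> λ q → subst T w (≤⇒≤ᵇ q)))))) (m≤n+m _ _)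
            where e : ∀ r a d → r * (a * d) ≡ a * (r * d)
                  e = solve-∀
        arith : ∀ M r d w → M * M < 2 * r * d → 4 * r * d ≤ 4 * r * (M * w) + M * M → M * M ≤ M * (4 * r * w)
        arith M r d w h₁ h₂ = ≤-cert 0 (2 ⊛ <⇒≤ h₁ ⊕ h₂) (e M r d w)
          where e : ∀ M r d w → M * (4 * r * w) + (2 * (M * M) + 4 * r * d) ≡ M * M + (2 * (2 * r * d) + (4 * r * (M * w) + M * M)) + 0
                e = solve-∀

      W₁-witness : ∀ y → W₁ y ≡ true → ∃ λ z → OB v y z ≡ true
      W₁-witness y h with ∑-pick {f = λ z → 0} {g = λ z → u z * kern OB v y z} (≤-<-trans (≤-reflexive (∑-zero {n})) (≤-trans (pos (cd y) (≤-trans M≥1 (≤-by h))) (≤-reflexive (codeg≡ (kern OB) u v y))))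
        where
        pos : ∀ d → 1 ≤ R₁ * d → 0 < d
        pos zero q = ⊥-elim (<⇒≱ q (≤-reflexive (*-zeroʳ R₁)))
        pos (suc d) _ = s≤s z≤n
      ... | z , lt with true? (OB v y z)
      ...   | inj₁ e = z , e
      ...   | inj₂ e = ⊥-elim (n≮0 (subst (0 <_) (trans (cong (λ b → u z * b2n b) e) (*-zeroʳ (u z))) lt))

      heavy-W₁ : (7 + 7 * 7) * M < R₂ * mass u W₁
      heavy-W₁ = heavy-by R₁ {M} {R₂} M≥1 57R₁≤R₂ W₁-mass
        where 57R₁≤R₂ : 57 * R₁ ≤ R₂
              57R₁≤R₂ = ≤-trans (*-monoˡ-≤ R₁ (≤-by {57} {100} refl)) (≤-reflexive (sym R₂≡))

      -- `b₁` comes first, so that `b₂` can be drawn from the B-vertices forming an edge with v and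
      -- `b₁`; those weigh at least M/R₁. The vertices v, `b₁`, `b₂`, three more of `W₁`, and a are
      -- covered, and the edge v b₁ b₂ is disjoint from an edge through a and two of the others.
      no-AB : ∀ a b → U a ≡ true → c a ≡ 0F → E v a b ≡ true → ⊥
      no-AB a b ua ca e = first (pickMany (start s) (λ { 0F → small R₂ R₂²≤τ a ua }) (small-supp R₂ R₂²≤τ) (W₁ ∷ []) (≤-by {2} {7} refl) (λ { 0F → heavy-W₁ }))
        where
        open Scale R₂
        s = Vec.lookup (a ∷ [])
        W₂ : V → V → Bool
        W₂ b₁ z = OB v b₁ z
        Ws : V → Vec (V → Bool) 4
        Ws b₁ = W₂ b₁ ∷ W₁ ∷ W₁ ∷ W₁ ∷ []
        hv : ∀ b₁ → W₁ b₁ ≡ true → ∀ i → Heavy (Vec.lookup (Ws b₁) i)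
        hv b₁ w 0F = heavy-by R₁ {M} {R₂} M≥1 (≤-trans (*-monoˡ-≤ R₁ (≤-by {57} {100} refl)) (≤-reflexive (sym R₂≡))) (≤-trans (≤-by w) (≤-reflexive (cong (R₁ *_) (codeg≡ (kern OB) u v b₁))))
        hv b₁ w 1F = heavy-W₁
        hv b₁ w 2F = heavy-W₁
        hv b₁ w 3F = heavy-W₁
        B-of : ∀ y → W₁ y ≡ true → c₁ y ≡ 1F
        B-of y w = proj₁ (proj₂ (OB-sound (proj₂ (W₁-witness y w))))
        cov : ∀ y → W₁ y ≡ true → ∃ λ z → E v y z ≡ true
        cov y w = let (z , o) = W₁-witness y w in z , proj₁ (OB-sound o)
        second : ∀ b₁ → W₁ b₁ ≡ true → Picked (pushAll (b₁ ∷ []) s) (grow 1 allBad) (Ws b₁) → ⊥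
        second b₁ w (ys@(b₂ ∷ y₁ ∷ y₂ ∷ y₃ ∷ []) , in-W , _ , st) = Reflect.clash₇ E rules P₂ P₂-symmetric c₁ u M≥1 R₂ (λ l → heavy⇒< {M} (heavy-class R₂ R≤R₂ l))
          (cons v (pushAll ys (pushAll (b₁ ∷ []) s))) κ-v (isolate (grow 4 (grow 1 allBad))) exP-v ((0F , 1F , 5F) ∷ []) (append st v) κ≡
          ((b₁ , trans (swap₂₃ symm v b₂ b₁) E-b₁b₂) ∷ cov y₁ (in-W 1F) ∷ cov y₂ (in-W 2F) ∷ cov y₃ (in-W 3F) ∷ (b₂ , E-b₁b₂) ∷ (b , e) ∷ [])
          (trans (swap₂₃ symm v b₂ b₁) E-b₁b₂ ∷ []) refl check-AB
          where
          E-b₁b₂ : E v b₁ b₂ ≡ true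
          E-b₁b₂ = proj₁ (OB-sound (in-W 0F))
          κ≡ : ∀ i → c₁ (cons v (pushAll ys (pushAll (b₁ ∷ []) s)) i) ≡ κ-v i
          κ≡ 0F = recolour-at c v 1F
          κ≡ 1F = proj₂ (proj₂ (OB-sound (in-W 0F)))
          κ≡ 2F = B-of y₁ (in-W 1F)
          κ≡ 3F = B-of y₂ (in-W 2F)
          κ≡ 4F = B-of y₃ (in-W 3F)
          κ≡ 5F = B-of b₁ w
          κ≡ 6F = trans (c₁≡ ua) ca
        first : Picked s allBad (W₁ ∷ []) → ⊥
        first (b₁ ∷ [] , in-W , sm , st) = second b₁ (in-W 0F) (pickMany st sm (small-supp R₂ R₂²≤τ) (Ws b₁) (≤-by {6} {7} refl) (hv b₁ (in-W 0F)))

    module Few (few : 2 * (R * R) * deg (kern OB) u u v ≤ M * M) where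
      -- Off-pattern edges at v all lie inside B by `off≤`, so few of them keep `off` small, and
      -- `miss-bound` transfers this to `miss`.
      v-small : Scale.Small R v
      v-small = *-cancelˡ-≤ 2 (*-cancel-pos τ≥1 _ _ (arith τ (R * R) (miss v) (off v) (M * M) 2R²≤τ (≤-trans (*-monoʳ-≤ (2 * (R * R)) off≤) few) (miss-bound v v-high)))
        where
        arith : ∀ t r s o m → 2 * r ≤ t → 2 * r * o ≤ m → t * s ≤ m + t * o → t * (2 * (r * s)) ≤ t * (2 * m)
        arith t r s o m h₁ h₂ h₃ = ≤-cert 0 ((2 * r) ⊛ h₃ ⊕ m ⊛ h₁ ⊕ t ⊛ h₂) (e t r s o m)
          where e : ∀ t r s o m → t * (2 * m) + (2 * r * (t * s) + (m * (2 * r) + t * (2 * r * o))) ≡ t * (2 * (r * s)) + (2 * r * (m + t * o) + (m * t + t * m)) + 0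
                e = solve-∀

      -- The generic vertex of A is the only vertex common to the pattern edges of this 7-set, and
      -- the edge v a b avoids it.
      no-BB : ∀ a b → U a ≡ true → U b ≡ true → c a ≡ 1F → c b ≡ 1F → E v a b ≡ true → ⊥
      no-BB a b ua ub ca cb e = finish (pickMany (start s) sm (small-supp R R²≤τ) Ws ≤-refl hv)
        where
        open Scale R
        s = Vec.lookup (v ∷ a ∷ b ∷ [])
        sm : ∀ i → Small (s i)
        sm 0F = v-small
        sm 1F = small R R²≤τ a ua
        sm 2F = small R R²≤τ b ub
        Ws = class 0F ∷ class 1F ∷ class 1F ∷ class 1F ∷ []
        hv : ∀ i → Heavy (Vec.lookup Ws i)
        hv 0F = heavy-class R ≤-refl 0F
        hv 1F = heavy-class R ≤-refl 1F
        hv 2F = heavy-class R ≤-refl 1F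
        hv 3F = heavy-class R ≤-refl 1F
        κs : ∀ i → c₁ (s i) ≡ Vec.lookup (1F ∷ 1F ∷ 1F ∷ []) i
        κs 0F = recolour-at c v 1F
        κs 1F = trans (c₁≡ ua) ca
        κs 2F = trans (c₁≡ ub) cb
        finish : Picked s allBad Ws → ⊥
        finish (ys@(_ ∷ _ ∷ _ ∷ _ ∷ []) , in-W , _ , st) = Reflect.clash₇ E rules P₂ P₂-symmetric c₁ u M≥1 R (λ l → heavy⇒< {M} (heavy-class R ≤-refl l))
          (pushAll ys s) _ (grow 4 allBad) exP-B ((4F , 5F , 6F) ∷ []) st
          (pushAll-colour c₁ ys (0F ∷ 1F ∷ 1F ∷ 1F ∷ []) s _ (λ { 0F → ==⇒≡ (in-W 0F) ; 1F → ==⇒≡ (in-W 1F) ; 2F → ==⇒≡ (in-W 2F) ; 3F → ==⇒≡ (in-W 3F) }) κs)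
          ((b , e) ∷ (a , trans (swap₂₃ symm v b a) e) ∷ (v , trans (rot² symm a b v) e) ∷ []) (e ∷ []) refl check-BB

    by-colours : ∀ i → (∀ b d (x y : Fin 2) → U b ≡ true → U d ≡ true → c b ≡ x → c d ≡ y → E v b d ≡ true → P₂ i x y ≡ true) → ∃ (Colouring P₂ E (add U v))
    by-colours i h = recolour c v i , extend-colouring E symm irr P₂ P₂-symmetric U c col v v∉U i λ b d ub ud e → h b d (c b) (c d) ub ud refl refl e

  extend : ∃ (Colouring P₂ E (add U v))
  extend with 2 * (R * R) * deg (kern OB) u u v ≤? M * M
  ... | yes few = by-colours 1F λ where
      b d 0F 0F ub ud p q e → ⊥-elim (no-AA b d ub ud p q e)
      b d 0F 1F ub ud p q e → P₂-BAB
      b d 1F 0F ub ud p q e → P₂-BBA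
      b d 1F 1F ub ud p q e → ⊥-elim (Few.no-BB few b d ub ud p q e)
  ... | no many = by-colours 0F λ where
      b d 0F y ub ud p q e → ⊥-elim (Large.no-AB (≰⇒> many) b d ub p e)
      b d 1F 0F ub ud p q e → ⊥-elim (Large.no-AB (≰⇒> many) d b ud q (trans (swap₂₃ symm v d b) e))
      b d 1F 1F ub ud p q e → P₂-ABB

-- Adding a vertex to a colouring by the six-class pattern

others : Fin 6 → Vec (Fin 6) 5
others i = Vec.tabulate (punchIn i)

others₃ : Fin 6 → Fin 6 → Fin 6 → Vec (Fin 6) 3
others₃ i j k = take₃ (filterᵇ (λ l → not ((l == i) ∨ ((l == j) ∨ (l == k)))) (allFin 6))
  where
  take₃ : List (Fin 6) → Vec (Fin 6) 3
  take₃ (a ∷ b ∷ c ∷ _) = a ∷ b ∷ c ∷ []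
  take₃ _ = 0F ∷ 0F ∷ 0F ∷ []

κ-same : Fin 6 → Fin 7 → Fin 6
κ-same i = pushAll (others i) (Vec.lookup (i ∷ i ∷ []))

κ-own : Fin 6 → Fin 7 → Fin 6
κ-own i = cons i (pushAll (others i) (Vec.lookup (i ∷ [])))

κ-pair κ-any : Fin 6 → Fin 6 → Fin 6 → Fin 6 → Fin 6
κ-pair i j k = cons i (pushAll (others₃ i j k) (Vec.lookup (j ∷ k ∷ [])))
κ-any i j k = pushAll (others₃ i j k) (Vec.lookup (i ∷ j ∷ k ∷ []))

exP-own : List (Fin 7 × Fin 7)
exP-own = (0F , 1F) ∷ (0F , 2F) ∷ (0F , 3F) ∷ (0F , 4F) ∷ (0F , 5F) ∷ (0F , 6F) ∷ []

exP-pair exP-any : List (Fin 6 × Fin 6)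
exP-pair = (0F , 1F) ∷ (0F , 2F) ∷ (0F , 3F) ∷ (0F , 4F) ∷ (0F , 5F) ∷ []
exP-any = (3F , 4F) ∷ (3F , 5F) ∷ (4F , 5F) ∷ []

exE-pair exE-any : List (Fin 6 × Fin 6 × Fin 6)
exE-pair = (0F , 4F , 5F) ∷ []
exE-any = (3F , 4F , 5F) ∷ []

bad-pair : Table 6
bad-pair = isolate (grow 3 (grow 2 (allBad {0})))

bad-any : Table 6
bad-any = grow 3 (allBad {3})

pattern-or : (Fin 6 → Fin 6 → Fin 6 → Bool) → Fin 6 → Fin 6 → Fin 6 → Bool
pattern-or q i j k = ((i == j) ∨ ((i == k) ∨ ((j == k) ∨ P₆ i j k))) ∨ q i j k

-- Six vertices carrying all six colours, plus the edge v x y on a non-edge of the pattern. In the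
-- first, nothing further is known about triples at v, but x, y is a good pair; in the second, v
-- takes part in the generic choice and only triples with two of v, x, y are unknown. Either way the
-- known edges admit neither a star nor an injection into `G26`.
pair-fails any-fails : Fin 6 → Fin 6 → Fin 6 → Bool
pair-fails i j k = starless-core P₆ (κ-pair i j k) bad-pair exP-pair exE-pair ∧ noHom (known P₆ (κ-pair i j k) bad-pair exP-pair exE-pair)
any-fails i j k = starless-core P₆ (κ-any i j k) bad-any exP-any exE-any ∧ noHom (known P₆ (κ-any i j k) bad-any exP-any exE-any)

private opaque
  unfolding P₆ ∀ᵇ
  others₃-checked : (∀ᵇ λ t → ∀³ᵇ λ i j k → ((i == j) ∨ ((i == k) ∨ (j == k))) ∨ not (i == Vec.lookup (others₃ i j k) t)) ≡ true
  others₃-checked = refl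

  same-checked : (∀ᵇ λ i → starless-core P₆ (κ-same i) (grow 5 allBad) ((5F , 6F) ∷ []) []) ≡ true
  same-checked = refl

  own-checked : (∀ᵇ λ i → starless-core P₆ (κ-own i) (isolate (grow 5 allBad)) exP-own []) ≡ true
  own-checked = refl

  pair-checked : ∀³ᵇ (pattern-or pair-fails) ≡ true
  pair-checked = refl

  any-checked : ∀³ᵇ (pattern-or any-fails) ≡ true
  any-checked = refl

same-check : ∀ i → starless-core P₆ (κ-same i) (grow 5 allBad) ((5F , 6F) ∷ []) [] ≡ true
same-check = ∀ᵇ-sound same-checked

own-check : ∀ i → starless-core P₆ (κ-own i) (isolate (grow 5 allBad)) exP-own [] ≡ true
own-check = ∀ᵇ-sound own-checked

private
  or-check : ∀ q → ∀³ᵇ (pattern-or q) ≡ true → ∀ i j k → i ≢ j → i ≢ k → j ≢ k → P₆ i j k ≡ false → q i j k ≡ true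
  or-check q h i j k p₁ p₂ p₃ p₄ = ∨-elim-false {(i == j) ∨ ((i == k) ∨ ((j == k) ∨ P₆ i j k))} {q i j k} (∀³ᵇ-sound (pattern-or q) h i j k) (∨-intro-false (≢⇒== p₁) (∨-intro-false (≢⇒== p₂) (∨-intro-false (≢⇒== p₃) p₄)))

pair-check : ∀ i j k → i ≢ j → i ≢ k → j ≢ k → P₆ i j k ≡ false → pair-fails i j k ≡ true
pair-check = or-check pair-fails pair-checked

any-check : ∀ i j k → i ≢ j → i ≢ k → j ≢ k → P₆ i j k ≡ false → any-fails i j k ≡ true
any-check = or-check any-fails any-checked

others₃-avoid : ∀ i j k t → i ≢ j → i ≢ k → j ≢ k → (i == Vec.lookup (others₃ i j k) t) ≡ false
others₃-avoid i j k t p q r = not-true (∨-elim-false {(i == j) ∨ ((i == k) ∨ (j == k))} (∀³ᵇ-sound (λ i j k → ((i == j) ∨ ((i == k) ∨ (j == k))) ∨ not (i == Vec.lookup (others₃ i j k) t)) (∀ᵇ-sound {p = λ t → ∀³ᵇ λ i j k → ((i == j) ∨ ((i == k) ∨ (j == k))) ∨ not (i == Vec.lookup (others₃ i j k) t)} others₃-checked t) i j k) (∨-intro-false (≢⇒== p) (∨-intro-false (≢⇒== q) (≢⇒== r))))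

module Extremal₆ {n : ℕ} (E : Fin n → Fin n → Fin n → Bool) (rules : Rules E)
  (U : Fin n → Bool) (c : Fin n → Fin 6) (col : Colouring P₆ E U c)
  (u : Fin n → ℕ) (supp : ∀ x → u x ≢ 0 → U x ≡ true) (M≥1 : 1 ≤ ∑ u) (high : ∀ x → U x ≡ true → High E u L x) where
  open Extremal E rules P₆ P₆-symmetric cube-bound₆ U c col u supp M≥1 high public

  class-lower : ∀ l → 4 * M ≤ 25 * weight c u l
  class-lower l = subst (λ z → 4 * z ≤ 25 * weight c u l) (∑-weight c u) (low (∑ (weight c u)) (weight c u l) (proj₂ (stable₆ {125} {L} (weight c u) ∑X≥1 (≤-by refl) big defect l)))
    where
    big : 2 * 125 * 125 ≤ L
    big = ≤-trans (≤-by {2 * 125 * 125} {200 * 200} refl) (*-mono-≤ 200≤τ 200≤τ)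
      where 200≤τ : 200 ≤ τ
            200≤τ = ≤-trans (≤-by {200} {10000} refl) (≤-trans R≥ R≤τ)
    low : ∀ m w → 125 * m ≤ 125 * (6 * w) + 5 * m → 4 * m ≤ 25 * w
    low m w h = *-cancelˡ-≤ 30 (≤-cert 0 h (e m w))
      where e : ∀ m w → 30 * (25 * w) + 125 * m ≡ 30 * (4 * m) + (125 * (6 * w) + 5 * m) + 0
            e = solve-∀

  heavy-class : ∀ ρ → R ≤ ρ → ∀ l → (7 + 7 * 7) * M < ρ * weight c u l
  heavy-class ρ R≤ρ l = heavy-by 25 {M} {ρ} {weight c u l} M≥1 (≤-trans (57*k≤R 25 refl) R≤ρ) (≤-trans (m≤n*m M 4) (class-lower l))

private
  b2n-≤ : ∀ b {x} → (b ≡ true → 1 ≤ x) → b2n b ≤ x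
  b2n-≤ true h = h refl
  b2n-≤ false _ = z≤n

  guard-≤ : ∀ g {S B} → (g ≡ true → 25 * S ≤ B) → 25 * (b2n g * S) ≤ b2n g * B
  guard-≤ true {S} {B} h = subst₂ _≤_ (cong (25 *_) (sym (*-identityˡ S))) (sym (*-identityˡ B)) (h refl)
  guard-≤ false _ = z≤n

  all-apart : ∀ {p q r t s} → p ≡ false → q ≡ false → r ≡ false → t ≡ false → s ≡ false → b2n (not p ∧ not q) * (b2n (not r ∧ not t) * b2n (not s)) ≡ 1
  all-apart refl refl refl refl refl = refl

  disjoint₃ : ∀ a b → (a ≡ true → b ≡ true → ⊥) → b2n (not a ∧ not b) + b2n a + b2n b ≤ 1
  disjoint₃ true true h = ⊥-elim (h refl refl)
  disjoint₃ true false _ = ≤-refl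
  disjoint₃ false true _ = ≤-refl
  disjoint₃ false false _ = ≤-refl

  disjoint₄ : ∀ a b d s → (a ≡ true → b ≡ true → ⊥) → (a ≡ true → d ≡ true → ⊥) → (b ≡ true → d ≡ true → ⊥) → (d ≡ true → s ≡ true) →
    b2n (not a ∧ not b) * b2n (not s) + b2n a + b2n b + b2n d ≤ 1
  disjoint₄ true true d s h _ _ _ = ⊥-elim (h refl refl)
  disjoint₄ true false true s _ h _ _ = ⊥-elim (h refl refl)
  disjoint₄ true false false s _ _ _ _ = ≤-refl
  disjoint₄ false true true s _ _ h _ = ⊥-elim (h refl refl)
  disjoint₄ false true false s _ _ _ _ = ≤-refl
  disjoint₄ false false true true _ _ _ _ = ≤-refl
  disjoint₄ false false true false _ _ _ h = case h refl of λ ()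
  disjoint₄ false false false true _ _ _ _ = z≤n
  disjoint₄ false false false false _ _ _ _ = ≤-refl

module BlowupStep {n : ℕ} (E : Fin n → Fin n → Fin n → Bool) (rules : Rules E)
  (U : Fin n → Bool) (c : Fin n → Fin 6) (col : Colouring P₆ E U c)
  (u : Fin n → ℕ) (supp : ∀ x → u x ≢ 0 → U x ≡ true) (M≥1 : 1 ≤ ∑ u) (high : ∀ x → U x ≡ true → High E u L x)
  (v : Fin n) (v∉U : U v ≡ false) (v-high : High E u L v) where
  open Rules rules

  private
    V = Fin n
    module X = Extremal₆ E rules U c col u supp M≥1 high
    M = ∑ u

    class : Fin 6 → V → Bool
    class l y = c y == l

    -- The edge covers the pair x, y of one colour, and one generic vertex of each other colour
    -- completes a covered 7-set. Its pattern edges have no common vertex.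
    no-same : ∀ x y → U x ≡ true → U y ≡ true → c x ≡ c y → E v x y ≡ true → ⊥
    no-same x y ux uy cxy e = finish (pickMany (start s) sm (X.small-supp R R²≤τ) Ws ≤-refl hv)
      where
      open X.Scale R
      i = c x
      s = Vec.lookup (x ∷ y ∷ [])
      sm : ∀ i → Small (s i)
      sm 0F = X.small R R²≤τ x ux
      sm 1F = X.small R R²≤τ y uy
      Ws = Vec.map class (others i)
      hv : ∀ t → Heavy (Vec.lookup Ws t)
      hv t = subst Heavy (sym (Vecₚ.lookup-map t class (others i))) (X.heavy-class R ≤-refl (Vec.lookup (others i) t))
      κs : ∀ t → c (s t) ≡ Vec.lookup (i ∷ i ∷ []) t
      κs 0F = refl
      κs 1F = sym cxy
      finish : X.Scale.Picked R s allBad Ws → ⊥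
      finish (ys@(_ ∷ _ ∷ _ ∷ _ ∷ _ ∷ []) , in-W , _ , st) = Reflect.clash₇ E rules P₆ P₆-symmetric c u M≥1 R (λ l → heavy⇒< {M} (X.heavy-class R ≤-refl l))
        (pushAll ys s) (κ-same i) (grow 5 allBad) ((5F , 6F) ∷ []) [] st
        (pushAll-colour c ys (others i) s _ (λ t → ==⇒≡ (subst (λ W → W (Vec.lookup ys t) ≡ true) (Vecₚ.lookup-map t class (others i)) (in-W t))) κs)
        ((v , trans (rot² symm x y v) e) ∷ []) [] refl (same-check i)

    -- The vertices of class j covered together with v. Drawing generic vertices from here covers
    -- their pairs with v although the missing degree of v is unknown.
    N : Fin 6 → V → Bool
    N j y = class j y ∧ ∃ᵇ (E v y)

    N-sound : ∀ {j y} → N j y ≡ true → c y ≡ j × ∃ λ z → E v y z ≡ true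
    N-sound {j} {y} h = let (p , q) = ∧-true {class j y} h in ==⇒≡ p , ∃ᵇ-sound {p = E v y} q

    N⇒≢v : ∀ {j y} → N j y ≡ true → v ≢ y
    N⇒≢v h refl = let (_ , z , e) = N-sound h in true≢false (trans (sym e) (irr v z))

    HeavyN : Fin 6 → Set
    HeavyN j = M ≤ 100 * mass u (N j)

    heavyN : ∀ ρ → R ≤ ρ → ∀ {j} → HeavyN j → (7 + 7 * 7) * M < ρ * mass u (N j)
    heavyN ρ R≤ρ {j} h = heavy-by 100 {M} {ρ} {mass u (N j)} M≥1 (≤-trans (57*k≤R 100 refl) R≤ρ) h

    -- Apart from light vertices, the edges at v lie in the four other classes and join different
    -- classes by `no-same`. With class weights at least 4M/25 this leaves at most (17/25)(13/25) +
    -- 4/100 < 2/5 of all ordered pairs, whereas a high vertex has nearly 4/9.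
    module TwoLight (i j : Fin 6) (i≢j : i ≢ j) (li : 100 * mass u (N i) ≤ M) (lj : 100 * mass u (N j) ≤ M) where
      light γ : V → ℕ
      light y = b2n (N i y) + b2n (N j y)
      γ y = b2n (not (class i y) ∧ not (class j y))

      apart : V → V → ℕ
      apart y z = b2n (not (c y == c z))

      k′ : Kernel n
      k′ _ y z = light y + light z + γ y * (γ z * apart y z)

      pt : ∀ y z → u y ≢ 0 → u z ≢ 0 → kern E v y z ≤ k′ v y z
      pt y z uy uz = b2n-≤ (E v y z) λ e → cases e (true? (class i y)) (true? (class j y)) (true? (class i z)) (true? (class j z))
        where
        Ny : E v y z ≡ true → ∀ l → class l y ≡ true → N l y ≡ true
        Ny e l p = ∧-intro p (∃ᵇ-complete (E v y) z e)
        Nz : E v y z ≡ true → ∀ l → class l z ≡ true → N l z ≡ true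
        Nz e l p = ∧-intro p (∃ᵇ-complete (E v z) y (trans (swap₂₃ symm v z y) e))
        one : ∀ {b} → b ≡ true → 1 ≤ b2n b
        one refl = ≤-refl
        cases : E v y z ≡ true → (class i y ≡ true) ⊎ (class i y ≡ false) → (class j y ≡ true) ⊎ (class j y ≡ false) → (class i z ≡ true) ⊎ (class i z ≡ false) → (class j z ≡ true) ⊎ (class j z ≡ false) → 1 ≤ k′ v y z
        cases e (inj₁ p) _ _ _ = ≤-trans (≤-trans (one (Ny e i p)) (m≤m+n _ (b2n (N j y)))) (≤-trans (m≤m+n (light y) (light z)) (m≤m+n (light y + light z) _))
        cases e _ (inj₁ p) _ _ = ≤-trans (≤-trans (one (Ny e j p)) (m≤n+m _ (b2n (N i y)))) (≤-trans (m≤m+n (light y) (light z)) (m≤m+n (light y + light z) _))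
        cases e _ _ (inj₁ p) _ = ≤-trans (≤-trans (one (Nz e i p)) (m≤m+n _ (b2n (N j z)))) (≤-trans (m≤n+m (light z) (light y)) (m≤m+n (light y + light z) _))
        cases e _ _ _ (inj₁ p) = ≤-trans (≤-trans (one (Nz e j p)) (m≤n+m _ (b2n (N i z)))) (≤-trans (m≤n+m (light z) (light y)) (m≤m+n (light y + light z) _))
        cases e (inj₂ p) (inj₂ q) (inj₂ r) (inj₂ t) = ≤-trans (≤-reflexive (sym (all-apart p q r t (≢⇒== {x = c y} {c z} (λ q → no-same y z (supp y uy) (supp z uz) q e))))) (m≤n+m _ (light y + light z))

      inner : ∀ y → 25 * (γ y * ∑ (λ z → u z * (γ z * apart y z))) ≤ γ y * (13 * M)
      inner y = guard-≤ (not (class i y) ∧ not (class j y)) λ h → arith (∑ (λ z → u z * (γ z * apart y z))) (w i) (w j) (w (c y)) M (total (not-true (proj₁ (∧-true {not (class i y)} h))) (not-true (proj₂ (∧-true {not (class i y)} h)))) (X.class-lower i) (X.class-lower j) (X.class-lower (c y))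
        where
        w : Fin 6 → ℕ
        w = weight c u
        disjoint : class i y ≡ false → class j y ≡ false → ∀ z → γ z * apart y z + b2n (c z == i) + b2n (c z == j) + b2n (c z == c y) ≤ 1
        disjoint p q z = disjoint₄ (c z == i) (c z == j) (c z == c y) (c y == c z) (λ r t → i≢j (trans (sym (==⇒≡ {x = c z} {i} r)) (==⇒≡ {x = c z} {j} t)))
          (λ r t → true≢false (trans (sym (at i r t)) p)) (λ r t → true≢false (trans (sym (at j r t)) q))
          (λ t → subst (λ l → (l == c z) ≡ true) (==⇒≡ {x = c z} {c y} t) (==-refl (c z)))
          where
          at : ∀ l → (c z == l) ≡ true → (c z == c y) ≡ true → (c y == l) ≡ true
          at l r t = subst₂ (λ a b → (a == b) ≡ true) (==⇒≡ {x = c z} {c y} t) (==⇒≡ {x = c z} {l} r) (==-refl (c z))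
        total : class i y ≡ false → class j y ≡ false → ∑ (λ z → u z * (γ z * apart y z)) + w i + w j + w (c y) ≤ M
        total p q = begin
          ∑ (λ z → u z * (γ z * apart y z)) + w i + w j + w (c y) ≡⟨ sym (trans (∑-+ _ _) (cong (_+ w (c y)) (trans (∑-+ _ _) (cong (_+ w j) (∑-+ _ _))))) ⟩
          ∑ (λ z → u z * (γ z * apart y z) + u z * b2n (c z == i) + u z * b2n (c z == j) + u z * b2n (c z == c y)) ≤⟨ ∑-mono (λ z → ≤-trans (≤-reflexive (e (u z) (γ z * apart y z) _ _ _)) (≤-trans (*-monoʳ-≤ (u z) (disjoint p q z)) (≤-reflexive (*-identityʳ (u z))))) ⟩
          M ∎
          where
          open ≤-Reasoning
          e : ∀ a b c d f → a * b + a * c + a * d + a * f ≡ a * (b + c + d + f)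
          e = solve-∀
        arith : ∀ a x y z m → a + x + y + z ≤ m → 4 * m ≤ 25 * x → 4 * m ≤ 25 * y → 4 * m ≤ 25 * z → 25 * a ≤ 13 * m
        arith a x y z m h h₁ h₂ h₃ = ≤-cert 0 (25 ⊛ h ⊕ h₁ ⊕ h₂ ⊕ h₃) (e a x y z m)
          where e : ∀ a x y z m → 13 * m + (25 * (a + x + y + z) + (4 * m + (4 * m + 4 * m))) ≡ 25 * a + (25 * m + (25 * x + (25 * y + 25 * z))) + 0
                e = solve-∀

      outer : 25 * ∑ (λ y → u y * γ y) ≤ 17 * M
      outer = arith (∑ λ y → u y * γ y) (weight c u i) (weight c u j) M total (X.class-lower i) (X.class-lower j)
        where
        disjoint : ∀ z → γ z + b2n (c z == i) + b2n (c z == j) ≤ 1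
        disjoint z = disjoint₃ (c z == i) (c z == j) (λ r t → i≢j (trans (sym (==⇒≡ {x = c z} {i} r)) (==⇒≡ {x = c z} {j} t)))
        total : ∑ (λ z → u z * γ z) + weight c u i + weight c u j ≤ M
        total = begin
          ∑ (λ z → u z * γ z) + weight c u i + weight c u j ≡⟨ sym (trans (∑-+ _ _) (cong (_+ weight c u j) (∑-+ _ _))) ⟩
          ∑ (λ z → u z * γ z + u z * b2n (c z == i) + u z * b2n (c z == j)) ≤⟨ ∑-mono (λ z → ≤-trans (≤-reflexive (e (u z) (γ z) _ _)) (≤-trans (*-monoʳ-≤ (u z) (disjoint z)) (≤-reflexive (*-identityʳ (u z))))) ⟩
          M ∎
          where
          open ≤-Reasoning
          e : ∀ a b c d → a * b + a * c + a * d ≡ a * (b + c + d)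
          e = solve-∀
        arith : ∀ a x y m → a + x + y ≤ m → 4 * m ≤ 25 * x → 4 * m ≤ 25 * y → 25 * a ≤ 17 * m
        arith a x y m h h₁ h₂ = ≤-cert 0 (25 ⊛ h ⊕ h₁ ⊕ h₂) (e a x y m)
          where e : ∀ a x y m → 17 * m + (25 * (a + x + y) + (4 * m + 4 * m)) ≡ 25 * a + (25 * m + (25 * x + 25 * y)) + 0
                e = solve-∀

      ΣL ΣG : ℕ
      ΣL = ∑ (λ y → u y * light y)
      ΣG = ∑ (λ y → u y * (γ y * ∑ (λ z → u z * (γ z * apart y z))))

      D≤ : X.D v ≤ M * ΣL + M * ΣL + ΣG
      D≤ = ≤-trans (deg-mono-supp {k = kern E} {k′} u v pt) (≤-reflexive (begin
        deg k′ u u v ≡⟨ deg≡ k′ u u v ⟩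
        ∑ (λ y → u y * codeg k′ u v y) ≡⟨ ∑-cong (λ y → cong (u y *_) (codeg≡′ y)) ⟩
        ∑ (λ y → u y * (M * light y + ΣL + γ y * ∑ (λ z → u z * (γ z * apart y z)))) ≡⟨ ∑-cong (λ y → e (u y) M (light y) ΣL _) ⟩
        ∑ (λ y → M * (u y * light y) + u y * ΣL + u y * (γ y * ∑ (λ z → u z * (γ z * apart y z)))) ≡⟨ trans (∑-+ _ _) (cong (_+ ΣG) (trans (∑-+ _ _) (cong₂ _+_ (∑-*ˡ M _) (∑-*ʳ u ΣL)))) ⟩
        M * ΣL + M * ΣL + ΣG ∎))
        where
        open ≡-Reasoning
        e : ∀ a m l s g → a * (m * l + s + g) ≡ m * (a * l) + a * s + a * g
        e = solve-∀
        e′ : ∀ a l m g h → a * (l + m + g * h) ≡ a * l + a * m + g * (a * h)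
        e′ = solve-∀
        codeg≡′ : ∀ y → codeg k′ u v y ≡ M * light y + ΣL + γ y * ∑ (λ z → u z * (γ z * apart y z))
        codeg≡′ y = trans (codeg≡ k′ u v y) (trans (∑-cong λ z → e′ (u z) (light y) (light z) (γ y) (γ z * apart y z)) (trans (∑-+ _ _) (cong₂ _+_ (trans (∑-+ _ _) (cong (_+ ΣL) (∑-*ʳ u (light y)))) (∑-*ˡ (γ y) _))))

      ΣL≤ : 100 * ΣL ≤ 2 * M
      ΣL≤ = ≤-trans (≤-reflexive (trans (cong (100 *_) (trans (∑-cong λ y → *-distribˡ-+ (u y) (b2n (N i y)) (b2n (N j y))) (∑-+ _ _))) (*-distribˡ-+ 100 (mass u (N i)) _))) (≤-trans (li ⊕ lj) (≤-reflexive (cong (M +_) (sym (+-identityʳ M)))))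

      ΣG≤ : 625 * ΣG ≤ 221 * (M * M)
      ΣG≤ = begin
        625 * ΣG ≡⟨ *-assoc 25 25 ΣG ⟩
        25 * (25 * ΣG) ≡⟨ cong (25 *_) (sym (∑-*ˡ 25 _)) ⟩
        25 * ∑ (λ y → 25 * (u y * (γ y * ∑ (λ z → u z * (γ z * apart y z))))) ≤⟨ *-monoʳ-≤ 25 (∑-mono λ y → ≤-trans (≤-reflexive (e (u y) (γ y * ∑ (λ z → u z * (γ z * apart y z))))) (≤-trans (*-monoʳ-≤ (u y) (inner y)) (≤-reflexive (sym (*-assoc (u y) (γ y) _))))) ⟩
        25 * ∑ (λ y → u y * γ y * (13 * M)) ≡⟨ cong (25 *_) (∑-*ʳ _ (13 * M)) ⟩
        25 * (∑ (λ y → u y * γ y) * (13 * M)) ≡⟨ sym (*-assoc 25 (∑ λ y → u y * γ y) (13 * M)) ⟩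
        25 * ∑ (λ y → u y * γ y) * (13 * M) ≤⟨ *-monoˡ-≤ (13 * M) outer ⟩
        17 * M * (13 * M) ≡⟨ e₂ M ⟩
        221 * (M * M) ∎
        where
        open ≤-Reasoning
        e : ∀ a b → 25 * (a * b) ≡ a * (25 * b)
        e = solve-∀
        e₂ : ∀ m → 17 * m * (13 * m) ≡ 221 * (m * m)
        e₂ = solve-∀

      D-small : 5 * X.D v ≤ 2 * (M * M)
      D-small = *-cancelˡ-≤ 625 (≤-trans (arith M (X.D v) ΣL ΣG D≤ ΣL≤ ΣG≤) ≤-refl)
        where
        arith : ∀ m d l g → d ≤ m * l + m * l + g → 100 * l ≤ 2 * m → 625 * g ≤ 221 * (m * m) → 625 * (5 * d) ≤ 625 * (2 * (m * m))
        arith m d l g h₁ h₂ h₃ = *-cancelˡ-≤ 2 (≤-cert (40 * (m * m)) (2 ⊛ (3125 ⊛ h₁) ⊕ m ⊛ (125 ⊛ h₂) ⊕ 10 ⊛ h₃) (e m d l g))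
          where e : ∀ m d l g → 2 * (625 * (2 * (m * m))) + (2 * (3125 * d) + (m * (125 * (100 * l)) + 10 * (625 * g))) ≡ 2 * (625 * (5 * d)) + (2 * (3125 * (m * l + m * l + g)) + (m * (125 * (2 * m)) + 10 * (221 * (m * m)))) + 40 * (m * m)
                e = solve-∀

      absurd : ⊥
      absurd = arith L (M * M) (X.D v) 100≤L (*-mono-≤ M≥1 M≥1) D-small v-high
        where
        arith : ∀ l m d → 10 * 10 ≤ l → 1 ≤ m → 5 * d ≤ 2 * m → 4 * l * m ≤ 9 * l * d + m → ⊥
        arith l m d hl hm h₁ h₂ = <⇒≱ (s≤s z≤n) (≤-trans hm (*-cancelˡ-≤ 195 (≤-cert 0 (5 ⊛ h₂ ⊕ (9 * l) ⊛ h₁ ⊕ (2 * m) ⊛ hl) (e l m d))))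
          where e : ∀ l m d → 195 * 0 + (5 * (4 * l * m) + (9 * l * (5 * d) + 2 * m * 100)) ≡ 195 * m + (5 * (9 * l * d + m) + (9 * l * (2 * m) + 2 * m * l)) + 0
                e = solve-∀

    TwoOf : Set
    TwoOf = Σ (Fin 6) λ i → ∀ j → i ≢ j → HeavyN j

    light-class : TwoOf
    light-class = decide (∀-or-∃ heavy?)
      where
      heavy? : Fin 6 → Bool
      heavy? j = M ≤ᵇ 100 * mass u (N j)
      light : ∀ j → heavy? j ≡ false → 100 * mass u (N j) ≤ M
      light j h = <⇒≤ (≰⇒> λ q → subst T h (≤⇒≤ᵇ q))
      decide : (∀ j → heavy? j ≡ true) ⊎ (∃ λ j → heavy? j ≡ false) → TwoOf
      -- With every class heavy the colour 0 is merely a proposal; what follows requires only that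
      -- the classes of the other colours are heavy.
      decide (inj₁ h) = 0F , λ j _ → ≤-by (h j)
      decide (inj₂ (i , li)) = i , λ j i≢j → other j i≢j (true? (heavy? j))
        where
        other : ∀ j → i ≢ j → (heavy? j ≡ true) ⊎ (heavy? j ≡ false) → HeavyN j
        other j i≢j (inj₁ h) = ≤-by h
        other j i≢j (inj₂ h) = ⊥-elim (TwoLight.absurd i j i≢j (light i li) (light j h))

  module Coloured (i : Fin 6) (hN : ∀ j → i ≢ j → HeavyN j) where
    private
      in-others : ∀ t → i ≢ Vec.lookup (others i) t
      in-others t e = Finₚ.punchInᵢ≢i i t (sym (trans e (Vecₚ.lookup∘tabulate (punchIn i) t)))

      c′ : V → Fin 6
      c′ = recolour c v i

      module X′ = Extremal₆ E rules U c′ (recolour-colouring E symm irr P₆ P₆-symmetric U c col v v∉U i) u supp M≥1 high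

      c′≡ : ∀ {x} → U x ≡ true → c′ x ≡ c x
      c′≡ ux = recolour-off c i (∈U⇒≢ E symm irr P₆ P₆-symmetric U c col v v∉U ux)

      -- The vertex x and the generic vertices from the other five classes form a full copy of
      -- `G26`, whose edges have no common vertex. All six are covered with v, so a seventh core
      -- vertex is available.
      no-own : ∀ x y → U x ≡ true → c x ≡ i → E v x y ≡ true → ⊥
      no-own x y ux cx e = finish (pickMany (start s) (λ { 0F → X′.small R R²≤τ x ux }) (X′.small-supp R R²≤τ) Ws (≤-by {6} {7} refl) hv)
        where
        open X′.Scale R
        s = Vec.lookup (x ∷ [])
        Ws = Vec.map N (others i)
        hv : ∀ t → Heavy (Vec.lookup Ws t)
        hv t = subst Heavy (sym (Vecₚ.lookup-map t N (others i))) (heavyN R ≤-refl (hN _ (in-others t)))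
        finish : X′.Scale.Picked R s allBad Ws → ⊥
        finish (ys@(y₀ ∷ y₁ ∷ y₂ ∷ y₃ ∷ y₄ ∷ []) , in-W , _ , st) = Reflect.clash₇ E rules P₆ P₆-symmetric c′ u M≥1 R (λ l → heavy⇒< {M} (X′.heavy-class R ≤-refl l))
          (cons v (pushAll ys s)) (κ-own i) (isolate (grow 5 allBad)) exP-own [] (append st v) κ≡
          (cov 0F ∷ cov 1F ∷ cov 2F ∷ cov 3F ∷ cov 4F ∷ (y , e) ∷ []) [] refl (own-check i)
          where
          N-at : ∀ t → N (Vec.lookup (others i) t) (Vec.lookup ys t) ≡ true
          N-at t = subst (λ W → W (Vec.lookup ys t) ≡ true) (Vecₚ.lookup-map t N (others i)) (in-W t)
          cov : ∀ t → ∃ λ z → E v (Vec.lookup ys t) z ≡ true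
          cov t = proj₂ (N-sound (N-at t))
          κ≡ : ∀ t → c′ (cons v (pushAll ys s) t) ≡ κ-own i t
          κ≡ zero = recolour-at c v i
          κ≡ (suc t) = pushAll-colour c′ ys (others i) s (Vec.lookup (i ∷ [])) (λ t → trans (recolour-off c i (N⇒≢v (N-at t))) (proj₁ (N-sound (N-at t)))) (λ { 0F → trans (recolour-off c i (∈U⇒≢ E symm irr P₆ P₆-symmetric U c col v v∉U ux)) cx }) t

      not-i : ∀ {j k} t → i ≢ j → i ≢ k → j ≢ k → i ≢ Vec.lookup (others₃ i j k) t
      not-i {j} {k} t p q r e = true≢false (trans (sym (subst (λ l → (i == l) ≡ true) e (==-refl i))) (others₃-avoid i j k t p q r))

      N-at : ∀ {m} (κs : Vec (Fin 6) m) (ys : Vec V m) → (∀ t → Vec.lookup (Vec.map N κs) t (Vec.lookup ys t) ≡ true) → ∀ t → N (Vec.lookup κs t) (Vec.lookup ys t) ≡ true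
      N-at κs ys in-W t = subst (λ W → W (Vec.lookup ys t) ≡ true) (Vecₚ.lookup-map t N κs) (in-W t)

      N-colour : ∀ {j y} → N j y ≡ true → c′ y ≡ j
      N-colour h = trans (recolour-off c i (N⇒≢v h)) (proj₁ (N-sound h))

      -- First pass: nothing about the missing degree of v is known yet, so only off-pattern edges
      -- on good pairs x, y can be refuted.
      no-good-pair : ∀ x y → U x ≡ true → U y ≡ true → i ≢ c x → i ≢ c y → c x ≢ c y → P₆ i (c x) (c y) ≡ false → E v x y ≡ true → X′.Scale.GoodPair R₁ x y → ⊥
      no-good-pair x y ux uy ix iy xy np e good = finish (pickMany st₀ sm (X′.small-supp R₁ R₁²≤τ) Ws (≤-by {5} {7} refl) hv)
        where
        open X′.Scale R₁
        j = c x
        k = c y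
        s = Vec.lookup (x ∷ y ∷ [])
        sm : ∀ t → Small (s t)
        sm 0F = X′.small R₁ R₁²≤τ x ux
        sm 1F = X′.small R₁ R₁²≤τ y uy
        st₀ : State s (grow 2 allBad)
        st₀ = record { pair = p ; triple = t }
          where
          p : ∀ a b → grow 2 allBad a b ≡ false → GoodPair (s a) (s b)
          p 0F 1F _ = good
          p 1F 0F _ = good-sym {x} {y} good
          p 1F 1F ()
          t : ∀ a b d → grow 2 allBad a b ≡ false → grow 2 allBad a d ≡ false → grow 2 allBad b d ≡ false → X′.OK (s a) (s b) (s d)
          t 0F 0F _ ()
          t 0F 1F 0F _ ()
          t 0F 1F 1F _ _ ()
          t 1F 1F _ ()
          t 1F 0F 0F _ _ ()
          t 1F 0F 1F _ ()
        κs₃ = others₃ i j k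
        Ws = Vec.map N κs₃
        hv : ∀ t → Heavy (Vec.lookup Ws t)
        hv t = subst Heavy (sym (Vecₚ.lookup-map t N κs₃)) (heavyN R₁ R≤R₁ (hN _ (not-i t ix iy xy)))
        finish : X′.Scale.Picked R₁ s (grow 2 allBad) Ws → ⊥
        finish (ys@(y₀ ∷ y₁ ∷ y₂ ∷ []) , in-W , _ , st) = Reflect.clash₆ E rules P₆ P₆-symmetric c′ u M≥1 R₁ (λ l → heavy⇒< {M} (X′.heavy-class R₁ R≤R₁ l))
          (cons v (pushAll ys s)) (κ-pair i j k) bad-pair exP-pair exE-pair (append st v) κ≡
          (cov 0F ∷ cov 1F ∷ cov 2F ∷ (y , e) ∷ (x , trans (swap₂₃ symm v y x) e) ∷ []) (e ∷ []) refl (proj₁ chk) (proj₂ chk)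
          where
          chk = ∧-true {starless-core P₆ (κ-pair i j k) bad-pair exP-pair exE-pair} (pair-check i j k ix iy xy np)
          cov : ∀ t → ∃ λ z → E v (Vec.lookup ys t) z ≡ true
          cov t = proj₂ (N-sound (N-at κs₃ ys in-W t))
          κ≡ : ∀ t → c′ (cons v (pushAll ys s) t) ≡ κ-pair i j k t
          κ≡ zero = recolour-at c v i
          κ≡ (suc t) = pushAll-colour c′ ys κs₃ s (Vec.lookup (j ∷ k ∷ [])) (λ t → N-colour (N-at κs₃ ys in-W t)) (λ { 0F → c′≡ ux ; 1F → c′≡ uy }) t

      split-edge : ∀ x y → U x ≡ true → U y ≡ true → E v x y ≡ true → i ≢ c x × i ≢ c y × c x ≢ c y
      split-edge x y ux uy e = (λ p → no-own x y ux (sym p) e) , (λ p → no-own y x uy (sym p) (trans (swap₂₃ symm v y x) e)) , λ p → no-same x y ux uy p e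

      -- By `no-good-pair` the off-pattern edges at v sit on bad pairs, and at scale `R₁` every
      -- vertex of the support has bad partners of weight at most M/R₁.
      off-small : R₁ * X′.off v ≤ M * M
      off-small = begin
        R₁ * X′.off v ≤⟨ *-monoʳ-≤ R₁ (deg-mono-supp {k = kern X′.OV} {λ _ x y → b2n (not (good? x y))} u v λ x y ux uy → b2n-mono (pt x y (supp x ux) (supp y uy))) ⟩
        R₁ * deg (λ _ x y → b2n (not (good? x y))) u u v ≡⟨ cong (R₁ *_) (trans (deg≡ _ u u v) (∑-cong λ x → cong (u x *_) (codeg≡ _ u v x))) ⟩
        R₁ * ∑ (λ x → u x * mass u (λ y → not (good? x y))) ≡⟨ trans (sym (∑-*ˡ R₁ _)) (∑-cong λ x → swap (u x) R₁ _) ⟩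
        ∑ (λ x → u x * (R₁ * mass u (λ y → not (good? x y)))) ≤⟨ ∑-mono (λ x → guarded (u x) λ ux → few-bad-partners x (X′.small-supp R₁ R₁²≤τ x ux)) ⟩
        ∑ (λ x → u x * M) ≡⟨ ∑-*ʳ u M ⟩
        M * M ∎
        where
        open ≤-Reasoning
        open X′.Scale R₁ using (good?; good?-sound; few-bad-partners)
        swap : ∀ a r m → r * (a * m) ≡ a * (r * m)
        swap = solve-∀
        pt : ∀ x y → U x ≡ true → U y ≡ true → X′.OV v x y ≡ true → not (good? x y) ≡ true
        pt x y ux uy h = cong not (¬true λ g → let (e , np) = ∧-true {E v x y} h ; (p , q , r) = split-edge x y ux uy e in
          no-good-pair x y ux uy p q r (trans (cong₂ (P₆ i) (sym (c′≡ ux)) (sym (c′≡ uy))) (trans (cong (λ z → P₆ z (c′ x) (c′ y)) (sym (recolour-at c v i))) (not-true np))) e (good?-sound {x} {y} g))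

      v-small : X′.Scale.Small R v
      v-small = *-cancelˡ-≤ 4 (*-cancel-pos τ≥1 _ _ (arith τ (R * R) (X′.miss v) (X′.off v) (M * M) 2R²≤τ (subst (λ z → z * X′.off v ≤ M * M) R₁≡ off-small) (X′.miss-bound v v-high)))
        where
        arith : ∀ t r s o m → 2 * r ≤ t → 4 * r * o ≤ m → t * s ≤ m + t * o → t * (4 * (r * s)) ≤ t * (4 * m)
        arith t r s o m h₁ h₂ h₃ = ≤-cert (t * m) ((4 * r) ⊛ h₃ ⊕ (2 * m) ⊛ h₁ ⊕ t ⊛ h₂) (e t r s o m)
          where e : ∀ t r s o m → t * (4 * m) + (4 * r * (t * s) + (2 * m * (2 * r) + t * (4 * r * o))) ≡ t * (4 * (r * s)) + (4 * r * (m + t * o) + (2 * m * t + t * m)) + t * m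
                e = solve-∀

      -- Second pass: v is now small and joins the generic choice, which makes up for the lack of
      -- information about the pair x, y.
      no-bad-edge : ∀ x y → U x ≡ true → U y ≡ true → i ≢ c x → i ≢ c y → c x ≢ c y → P₆ i (c x) (c y) ≡ false → E v x y ≡ true → ⊥
      no-bad-edge x y ux uy ix iy xy np e = finish (pickMany (start s) sm (X′.small-supp R R²≤τ) Ws (≤-by {6} {7} refl) hv)
        where
        open X′.Scale R
        j = c x
        k = c y
        s = Vec.lookup (v ∷ x ∷ y ∷ [])
        sm : ∀ t → Small (s t)
        sm 0F = v-small
        sm 1F = X′.small R R²≤τ x ux
        sm 2F = X′.small R R²≤τ y uy
        κs₃ = others₃ i j k
        Ws = Vec.map N κs₃
        hv : ∀ t → Heavy (Vec.lookup Ws t)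
        hv t = subst Heavy (sym (Vecₚ.lookup-map t N κs₃)) (heavyN R ≤-refl (hN _ (not-i t ix iy xy)))
        finish : X′.Scale.Picked R s allBad Ws → ⊥
        finish (ys@(y₀ ∷ y₁ ∷ y₂ ∷ []) , in-W , _ , st) = Reflect.clash₆ E rules P₆ P₆-symmetric c′ u M≥1 R (λ l → heavy⇒< {M} (X′.heavy-class R ≤-refl l))
          (pushAll ys s) (κ-any i j k) bad-any exP-any exE-any st
          (pushAll-colour c′ ys κs₃ s (Vec.lookup (i ∷ j ∷ k ∷ [])) (λ t → N-colour (N-at κs₃ ys in-W t)) (λ { 0F → recolour-at c v i ; 1F → c′≡ ux ; 2F → c′≡ uy }))
          ((y , e) ∷ (x , trans (swap₂₃ symm v y x) e) ∷ (v , trans (rot² symm x y v) e) ∷ []) (e ∷ []) refl (proj₁ chk) (proj₂ chk)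
          where
          chk = ∧-true {starless-core P₆ (κ-any i j k) bad-any exP-any exE-any} (any-check i j k ix iy xy np)

    extend-by : ∃ (Colouring P₆ E (add U v))
    extend-by = recolour c v i , extend-colouring E symm irr P₆ P₆-symmetric U c col v v∉U i λ b d ub ud e → decide b d ub ud e (true? (P₆ i (c b) (c d)))
      where
      decide : ∀ b d → U b ≡ true → U d ≡ true → E v b d ≡ true → (P₆ i (c b) (c d) ≡ true) ⊎ (P₆ i (c b) (c d) ≡ false) → P₆ i (c b) (c d) ≡ true
      decide b d ub ud e (inj₁ p) = p
      decide b d ub ud e (inj₂ p) = let (q , r , s) = split-edge b d ub ud e in ⊥-elim (no-bad-edge b d ub ud q r s p e)

  extend : ∃ (Colouring P₆ E (add U v))
  extend = let (i , h) = light-class in Coloured.extend-by i h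

good-extends : ∀ {n} (E : Fin n → Fin n → Fin n → Bool) → Rules E → ∀ U u → (∀ x → u x ≢ 0 → U x ≡ true) → 1 ≤ ∑ u → (∀ x → U x ≡ true → High E u L x) →
  ∀ v → High E u L v → Good E U → Good E (add U v)
good-extends E rules U u supp M≥1 high v hv g = decide g (true? (U v))
  where
  decide : Good E U → (U v ≡ true) ⊎ (U v ≡ false) → Good E (add U v)
  decide g (inj₁ v∈U) = Good-⊆ (λ x p → case ∨-true {U x} p of λ where
    (inj₁ q) → q
    (inj₂ q) → subst (λ y → U y ≡ true) (==⇒≡ q) v∈U) g
  decide (inj₁ (c , col)) (inj₂ v∉U) = inj₁ (SemibipartiteStep.extend E rules U c col u supp M≥1 high v v∉U hv)
  decide (inj₂ (c , col)) (inj₂ v∉U) = inj₂ (BlowupStep.extend E rules U c col u supp M≥1 high v v∉U hv)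

-- Symmetrisation

nonzero : ℕ → Bool
nonzero zero = false
nonzero (suc _) = true

nonzero⇒≢ : ∀ {m} → nonzero m ≡ true → m ≢ 0
nonzero⇒≢ {zero} () _

≢⇒nonzero : ∀ {m} → m ≢ 0 → nonzero m ≡ true
≢⇒nonzero {zero} p = ⊥-elim (p refl)
≢⇒nonzero {suc m} _ = refl

cube-mono-supp : ∀ {n} {k k′ : Kernel n} (f : Fin n → ℕ) → (∀ a b d → f a ≢ 0 → f b ≢ 0 → f d ≢ 0 → k a b d ≤ k′ a b d) → cube k f ≤ cube k′ f
cube-mono-supp {k = k} {k′} f h = ≤-trans (≤-reflexive (form≡ k f f f)) (≤-trans (∑-mono λ a → guarded (f a) λ fa → deg-mono-supp {k = k} {k′} f a λ b d → h a b d fa) (≤-reflexive (sym (form≡ k′ f f f))))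

module _ {n : ℕ} (E : Fin n → Fin n → Fin n → Bool) where
  coloured-cube : ∀ {r} (P : Pattern r) (U : Fin n → Bool) (c : Fin n → Fin r) → Colouring P E U c → ∀ w → (∀ x → w x ≢ 0 → U x ≡ true) → cube (kern E) w ≤ cube (kern P) (weight c w)
  coloured-cube P U c col w supp = ≤-trans (cube-mono-supp {k = kern E} {pullback c (kern P)} w λ a b d wa wb wd → b2n-mono (col a b d (supp a wa) (supp b wb) (supp d wd))) (≤-reflexive (cube-push c (kern P) w))

  good-cube : ∀ U w → Good E U → (∀ x → w x ≢ 0 → U x ≡ true) → 9 * cube (kern E) w ≤ 4 * (∑ w * ∑ w * ∑ w)
  good-cube U w (inj₁ (c , col)) supp = ≤-trans (*-monoʳ-≤ 9 (coloured-cube P₂ U c col w supp)) (subst (λ z → 9 * cube (kern P₂) (weight c w) ≤ 4 * (z * z * z)) (∑-weight c w) (cube-bound₂ (weight c w)))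
  good-cube U w (inj₂ (c , col)) supp = ≤-trans (*-monoʳ-≤ 9 (coloured-cube P₆ U c col w supp)) (subst (λ z → 9 * cube (kern P₆) (weight c w) ≤ 4 * (z * z * z)) (∑-weight c w) (cube-bound₆ (weight c w)))

module Symmetrise {n : ℕ} (E : Fin n → Fin n → Fin n → Bool) (rules : Rules E) where
  open Rules rules

  private
    V = Fin n
    k = kern E
    ks : Symmetric₃ k
    ks = kern-symmetric symm

  codeg-vanish : ∀ h {x y} → (∀ z → E x y z ≡ false) → codeg k h x y ≡ 0
  codeg-vanish h {x} {y} e = trans (codeg≡ k h x y) (trans (∑-cong λ z → trans (cong (λ b → h z * b2n b) (e z)) (*-zeroʳ (h z))) (∑-zero {n}))

  deg-vanish : ∀ g {x y} → (∀ z → E x y z ≡ false) → deg k (g ⊞ ⟦ y ⟧) (g ⊞ ⟦ y ⟧) x ≡ deg k g g x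
  deg-vanish g {x} {y} e = trans (deg-square k ks g ⟦ y ⟧ x) (trans (cong₂ (λ a b → deg k g g x + 2 * a + b) (trans (deg-comm k ks g ⟦ y ⟧ x) (trans (deg-⟦⟧ k y g x) (codeg-vanish g e))) (trans (deg-⟦⟧ k y ⟦ y ⟧ x) (codeg-vanish ⟦ y ⟧ e))) (trans (+-identityʳ _) (+-identityʳ _)))

  -- No edge contains a twice, so T is affine in the weight of a single vertex.
  cube-point : ∀ g a → cube k (g ⊞ ⟦ a ⟧) ≡ cube k g + 3 * deg k g g a
  cube-point g a = trans (cube-⊞ k ks g ⟦ a ⟧) (trans (cong₂ (λ x y → cube k g + 3 * x + 3 * y + cube k ⟦ a ⟧) (form-⟦⟧ k a g g) (trans (form-⟦⟧ k a ⟦ a ⟧ g) (trans (deg-⟦⟧ k a g a) (codeg-vanish g (irr a))))) (trans (cong (cube k g + 3 * deg k g g a + 0 +_) (trans (form-⟦⟧ k a ⟦ a ⟧ ⟦ a ⟧) (trans (deg-⟦⟧ k a ⟦ a ⟧ a) (codeg-vanish ⟦ a ⟧ (irr a))))) (trans (+-identityʳ _) (+-identityʳ _))))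

  record Shift (w w′ : V → ℕ) : Set where
    field
      g : V → ℕ
      from to : V
      w≡ : ∀ x → w x ≡ (g ⊞ ⟦ from ⟧) x
      w′≡ : ∀ x → w′ x ≡ (g ⊞ ⟦ to ⟧) x
      from≤to : deg k g g from ≤ deg k g g to

    sum-w : ∑ w ≡ ∑ g + 1
    sum-w = trans (∑-cong w≡) (trans (∑-+ g ⟦ from ⟧) (cong (∑ g +_) (∑-⟦⟧ from)))

    sum-w′ : ∑ w′ ≡ ∑ g + 1
    sum-w′ = trans (∑-cong w′≡) (trans (∑-+ g ⟦ to ⟧) (cong (∑ g +_) (∑-⟦⟧ to)))

    cube-mono : cube k w ≤ cube k w′
    cube-mono = begin
      cube k w ≡⟨ form-cong (λ _ _ _ → refl) w≡ w≡ w≡ ⟩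
      cube k (g ⊞ ⟦ from ⟧) ≡⟨ cube-point g from ⟩
      cube k g + 3 * deg k g g from ≤⟨ +-monoʳ-≤ (cube k g) (*-monoʳ-≤ 3 from≤to) ⟩
      cube k g + 3 * deg k g g to ≡⟨ sym (cube-point g to) ⟩
      cube k (g ⊞ ⟦ to ⟧) ≡⟨ sym (form-cong (λ _ _ _ → refl) w′≡ w′≡ w′≡) ⟩
      cube k w′ ∎
      where open ≤-Reasoning

    -- Only the unit at `from` is lost, and it takes part in at most 2Σg + 1 weighted ordered pairs.
    deg-change : ∀ x → deg k w w x ≤ deg k w′ w′ x + 2 * ∑ w
    deg-change x = begin
      deg k w w x ≡⟨ deg-cong (λ _ _ _ → refl) w≡ w≡ x ⟩
      deg k (g ⊞ ⟦ from ⟧) (g ⊞ ⟦ from ⟧) x ≡⟨ deg-square k ks g ⟦ from ⟧ x ⟩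
      deg k g g x + 2 * deg k g ⟦ from ⟧ x + deg k ⟦ from ⟧ ⟦ from ⟧ x ≤⟨ (≤-refl {deg k g g x} ⊕ 2 ⊛ b₁) ⊕ b₂ ⟩
      deg k g g x + 2 * ∑ g + 1 ≤⟨ ≤-cert 1 (b₃ ⊕ ≤-reflexive (cong (2 *_) (sym sum-w))) (e (deg k g g x) (deg k w′ w′ x) (∑ w) (∑ g)) ⟩
      deg k w′ w′ x + 2 * ∑ w ∎
      where
      open ≤-Reasoning
      b₁ : deg k g ⟦ from ⟧ x ≤ ∑ g
      b₁ = ≤-trans (deg-≤ (kern≤1 E) g ⟦ from ⟧ x) (≤-reflexive (trans (cong (∑ g *_) (∑-⟦⟧ from)) (*-identityʳ _)))
      b₂ : deg k ⟦ from ⟧ ⟦ from ⟧ x ≤ 1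
      b₂ = ≤-trans (deg-≤ (kern≤1 E) ⟦ from ⟧ ⟦ from ⟧ x) (≤-reflexive (cong₂ _*_ (∑-⟦⟧ from) (∑-⟦⟧ from)))
      b₃ : deg k g g x ≤ deg k w′ w′ x
      b₃ = deg-mono (λ _ _ _ → ≤-refl) (λ y → ≤-trans (m≤m+n (g y) _) (≤-reflexive (sym (w′≡ y)))) (λ y → ≤-trans (m≤m+n (g y) _) (≤-reflexive (sym (w′≡ y)))) x
      e : ∀ d d′ s t → d′ + 2 * s + (d + 2 * (t + 1)) ≡ d + 2 * t + 1 + (d′ + 2 * s) + 1
      e = solve-∀

  CoveredSupport : (V → ℕ) → Set
  CoveredSupport w = ∀ a b → w a ≢ 0 → w b ≢ 0 → a ≢ b → ∃ λ z → E a b z ≡ true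

  -- Moving one unit at a time between two uncovered vertices, towards the one of larger degree,
  -- until one of them leaves the support.
  module _ (Q : (V → ℕ) → Set) (base : ∀ w → CoveredSupport w → Q w) (step : ∀ w w′ → Shift w w′ → Q w′ → Q w) where
    private
      size : (V → ℕ) → ℕ
      size w = ∑ λ x → b2n (nonzero (w x))

      ok? : (V → ℕ) → V → V → Bool
      ok? w a b = not (nonzero (w a)) ∨ (not (nonzero (w b)) ∨ ((a == b) ∨ ∃ᵇ (E a b)))

      record Uncovered (w : V → ℕ) : Set where
        constructor uncovered
        field
          {a b} : V
          wa : w a ≢ 0
          wb : w b ≢ 0
          a≢b : a ≢ b
          none : ∀ z → E a b z ≡ false

      search : ∀ w → CoveredSupport w ⊎ Uncovered w
      search w = decide (∀-or-∃ λ a → ∀ᵇ (ok? w a))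
        where
        ∨-false : ∀ {a b} → (a ∨ b) ≡ false → a ≡ false × b ≡ false
        ∨-false {false} {false} _ = refl , refl
        nz : ∀ {m} → not (nonzero m) ≡ false → m ≢ 0
        nz {zero} () _
        found : ∀ a b → ok? w a b ≡ false → Uncovered w
        found a b h = let (p , h₁) = ∨-false {not (nonzero (w a))} h ; (q , h₂) = ∨-false {not (nonzero (w b))} h₁ ; (r , h₃) = ∨-false {a == b} h₂ in
          uncovered (nz p) (nz q) (λ { refl → true≢false (trans (sym (==-refl a)) r) }) λ z → ¬true λ e → true≢false (trans (sym (∃ᵇ-complete (E a b) z e)) h₃)
        row : ∀ a → ∀ᵇ (ok? w a) ≡ false → Uncovered w
        row a h with ∀-or-∃ (ok? w a)
        ... | inj₂ (b , q) = found a b q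
        ... | inj₁ all = ⊥-elim (true≢false (trans (sym (∀ᵇ-complete all)) h))
        cover : (∀ a → ∀ᵇ (ok? w a) ≡ true) → CoveredSupport w
        cover h a b wa wb a≢b = ∃ᵇ-sound {p = E a b} (∨-elim-false (∨-elim-false (∨-elim-false (∀ᵇ-sound {p = ok? w a} (h a) b) (cong not (≢⇒nonzero wa))) (cong not (≢⇒nonzero wb))) (≢⇒== a≢b))
        decide : (∀ a → ∀ᵇ (ok? w a) ≡ true) ⊎ (∃ λ a → ∀ᵇ (ok? w a) ≡ false) → CoveredSupport w ⊎ Uncovered w
        decide (inj₁ h) = inj₁ (cover h)
        decide (inj₂ (a , h)) = inj₂ (row a h)

      -- No edge contains both a and b, so moving weight between them changes neither degree and the
      -- comparison survives all m moves. At m = 0 the vertex a has left the support, and the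
      -- induction on the size of the support takes over.
      reduce : ∀ s → (∀ w → size w ≤ s → Q w) → ∀ w → size w ≤ suc s → ∀ a b → w a ≢ 0 → w b ≢ 0 → a ≢ b → (∀ z → E a b z ≡ false) →
        ∀ m w′ → w′ a ≡ m → (∀ x → a ≢ x → w′ x ≢ 0 → w x ≢ 0) → deg k w′ w′ a ≤ deg k w′ w′ b → Q w′
      reduce s ih w sz a b wa wb a≢b none zero w′ w′a off le = ih w′ (s≤s⁻¹ (≤-trans smaller sz))
        where
        pt : ∀ x → ⟦ a ⟧ x + b2n (nonzero (w′ x)) ≤ b2n (nonzero (w x))
        pt x with a ≟ x
        ... | yes refl rewrite w′a | ≢⇒nonzero wa = ≤-refl
        ... | no p = b2n-mono λ h → ≢⇒nonzero (off x p (nonzero⇒≢ h))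
        smaller : suc (size w′) ≤ size w
        smaller = ≤-trans (≤-reflexive (sym (trans (∑-+ ⟦ a ⟧ _) (cong (_+ size w′) (∑-⟦⟧ a))))) (∑-mono pt)
      reduce s ih w sz a b wa wb a≢b none (suc m) w′ w′a off le = step w′ w″ shift (reduce s ih w sz a b wa wb a≢b none m w″ w″a off′ le′)
        where
        g w″ : V → ℕ
        g x = w′ x ∸ ⟦ a ⟧ x
        w″ = g ⊞ ⟦ b ⟧
        none′ : ∀ z → E b a z ≡ false
        none′ z = trans (swap₁₂ symm b a z) (none z)
        w′≡ : ∀ x → w′ x ≡ (g ⊞ ⟦ a ⟧) x
        w′≡ x with a ≟ x
        ... | yes refl = sym (m∸n+n≡m (subst (1 ≤_) (sym w′a) (s≤s z≤n)))
        ... | no _ = sym (+-identityʳ _)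
        deg-at : ∀ x → (∀ z → E x a z ≡ false) → deg k w′ w′ x ≡ deg k g g x
        deg-at x e = trans (deg-cong (λ _ _ _ → refl) w′≡ w′≡ x) (deg-vanish g e)
        le-g : deg k g g a ≤ deg k g g b
        le-g = subst₂ _≤_ (deg-at a (irr a)) (deg-at b none′) le
        shift : Shift w′ w″
        shift = record { g = g ; from = a ; to = b ; w≡ = w′≡ ; w′≡ = λ _ → refl ; from≤to = le-g }
        w″a : w″ a ≡ m
        w″a = trans (cong₂ (λ x y → w′ a ∸ x + y) (⟦⟧-self a) (⟦⟧-other (a≢b ∘ sym))) (trans (+-identityʳ _) (cong (_∸ 1) w′a))
        off′ : ∀ x → a ≢ x → w″ x ≢ 0 → w x ≢ 0
        off′ x a≢x nz with b ≟ x
        ... | yes refl = wb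
        ... | no b≢x = off x a≢x λ e → nz (trans (cong₂ (λ p q → p ∸ q + 0) e (⟦⟧-other a≢x)) refl)
        le′ : deg k w″ w″ a ≤ deg k w″ w″ b
        le′ = subst₂ _≤_ (sym (deg-vanish g none)) (sym (deg-vanish g (irr b))) le-g

      size-pos : ∀ w {a} → w a ≢ 0 → 1 ≤ size w
      size-pos w {a} wa = ≤-trans (≤-reflexive (sym (cong b2n (≢⇒nonzero wa)))) (term≤∑ (λ x → b2n (nonzero (w x))) a)

      go : ∀ s w → size w ≤ s → Q w
      go s w sz = decide s sz (search w)
        where
        decide : ∀ s → size w ≤ s → CoveredSupport w ⊎ Uncovered w → Q w
        decide s sz (inj₁ cov) = base w cov
        decide zero sz (inj₂ (uncovered wa _ _ _)) = ⊥-elim (<⇒≱ (size-pos w wa) sz)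
        decide (suc s) sz (inj₂ (uncovered {a} {b} wa wb a≢b none)) = orient (≤-total (deg k w w a) (deg k w w b))
          where
          orient : (deg k w w a ≤ deg k w w b) ⊎ (deg k w w b ≤ deg k w w a) → Q w
          orient (inj₁ h) = reduce s (go s) w sz a b wa wb a≢b none (w a) w refl (λ _ _ p → p) h
          orient (inj₂ h) = reduce s (go s) w sz b a wb wa (a≢b ∘ sym) (λ z → trans (swap₁₂ symm b a z) (none z)) (w b) w refl (λ _ _ p → p) h

    symmetrise : ∀ w → Q w
    symmetrise w = go (size w) w ≤-refl

  support-good : ∀ w → CoveredSupport w → Good E (λ x → nonzero (w x))
  support-good w cov = covered⇒Good E rules _ λ a b p q → cov a b (nonzero⇒≢ p) (nonzero⇒≢ q)

  -- T does not decrease along a shift while the total weight stays fixed, so the bound for covered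
  -- supports passes back to all weights.
  cube-bound : ∀ w → 9 * cube k w ≤ 4 * (∑ w * ∑ w * ∑ w)
  cube-bound = symmetrise _ (λ w cov → good-cube E _ w (support-good w cov) (λ x → ≢⇒nonzero)) λ w w′ sh q →
    ≤-trans (*-monoʳ-≤ 9 (Shift.cube-mono sh)) (≤-trans q (≤-reflexive (cong (λ z → 4 * (z * z * z)) (trans (Shift.sum-w′ sh) (sym (Shift.sum-w sh))))))

-- The set of vertices of nearly maximal degree

private
  low-weight-arith : ∀ K N Z n t tz Y → 1 ≤ K → 1 ≤ N → 8 * K * N ≡ n + Z → Z ≤ N →
    9 * (8 * K * (8 * K) * (8 * K) * t) ≤ 4 * (n * n * n) + 27 * (8 * K * (8 * K) * tz) → 9 * K * tz + Z * (N * N) ≤ Z * (4 * K * (N * N)) →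
    4 * Y * (N * N * N) ≤ 9 * Y * t + N * N * N → Y * Z ≤ 6 * (K * K) * N
  low-weight-arith K N Z n t tz Y K≥1 N≥1 eq Z≤N h₁ h₂ h₃ = final
    where
    cubes : n * n * n + 3 * (8 * K * N * (8 * K * N) * Z) ≤ 8 * K * N * (8 * K * N) * (8 * K * N) + 3 * (8 * K * N * (Z * Z))
    cubes = subst (λ s → n * n * n + 3 * (s * s * Z) ≤ s * s * s + 3 * (s * (Z * Z))) (sym eq) (≤-cert (Z * Z * Z) ≤-refl (e n Z))
      where e : ∀ n Z → (n + Z) * (n + Z) * (n + Z) + 3 * ((n + Z) * (Z * Z)) + 0 ≡ n * n * n + 3 * ((n + Z) * (n + Z) * Z) + 0 + Z * Z * Z
            e = solve-∀
    quad : N * (Z * Z) ≤ N * (N * Z)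
    quad = *-monoʳ-≤ N (*-monoˡ-≤ Z Z≤N)
    main : 144 * (K * K) * t + 3 * (N * N * Z) ≤ 64 * (K * K) * (N * N * N)
    main = *-cancel-pos K≥1 _ _ (*-cancel-pos K≥1 _ _ (*-cancelˡ-≤ 32 (≤-cert 0 (K ⊛ h₁ ⊕ (192 * (K * K)) ⊛ h₂ ⊕ (4 * K) ⊛ cubes ⊕ (96 * (K * K)) ⊛ quad) (e K N Z n t tz))))
      where
      e : ∀ K N Z n t tz → 32 * (K * (K * (64 * (K * K) * (N * N * N)))) +
          (K * (9 * (8 * K * (8 * K) * (8 * K) * t)) + (192 * (K * K) * (9 * K * tz + Z * (N * N)) + (4 * K * (n * n * n + 3 * (8 * K * N * (8 * K * N) * Z)) + 96 * (K * K) * (N * (Z * Z)))))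
        ≡ 32 * (K * (K * (144 * (K * K) * t + 3 * (N * N * Z)))) +
          (K * (4 * (n * n * n) + 27 * (8 * K * (8 * K) * tz)) + (192 * (K * K) * (Z * (4 * K * (N * N))) + (4 * K * (8 * K * N * (8 * K * N) * (8 * K * N) + 3 * (8 * K * N * (Z * Z))) + 96 * (K * K) * (N * (N * Z))))) + 0
      e = solve-∀
    final : Y * Z ≤ 6 * (K * K) * N
    final = *-cancel-pos N≥1 _ _ (*-cancel-pos N≥1 _ _ (*-cancelˡ-≤ 3 (≤-cert (2 * (K * K) * (N * N * N)) (Y ⊛ main ⊕ (16 * (K * K)) ⊛ h₃) (e K N Z t Y))))
      where e : ∀ K N Z t Y → 3 * (N * (N * (6 * (K * K) * N))) + (Y * (144 * (K * K) * t + 3 * (N * N * Z)) + 16 * (K * K) * (4 * Y * (N * N * N)))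
              ≡ 3 * (N * (N * (Y * Z))) + (Y * (64 * (K * K) * (N * N * N)) + 16 * (K * K) * (9 * Y * t + N * N * N)) + 2 * (K * K) * (N * N * N)
            e = solve-∀

  -- The budget in units of 1/216L: threshold 4L costs 6, the 2N of a unit move costs 1 as N ≥ 432L,
  -- and deleting weight z ≤ N/144L costs 3. The total 10 stays below the 24 allowed by threshold L,
  -- even after passing from N² to M².
  absorb-arith : ∀ l M z D Du → 1 ≤ l → 144 * l * z ≤ M + z → 432 * l ≤ M + z → 4 * (4 * l) * ((M + z) * (M + z)) ≤ 9 * (4 * l) * (D + 2 * (M + z)) + (M + z) * (M + z) →
    D ≤ Du + 2 * z * (M + z) → 4 * l * (M * M) ≤ 9 * l * Du + M * M
  absorb-arith l M z D Du l≥1 hz hn h₀ hD = *-cancelˡ-≤ 24 (≤-cert (96 * l * (2 * M * z + z * z)) (6 ⊛ h₀ ⊕ (216 * l) ⊛ hD ⊕ (3 * (M + z)) ⊛ hz ⊕ (M + z) ⊛ hn ⊕ ten) (e l M z D Du))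
    where
    143z≤M : 143 * z ≤ M
    143z≤M = ≤-cert 0 (≤-trans (*-monoˡ-≤ z (*-monoʳ-≤ 144 l≥1)) hz) (e M z)
      where e : ∀ M z → M + 144 * 1 * z ≡ 143 * z + (M + z) + 0
            e = solve-∀
    ten : 10 * ((M + z) * (M + z)) ≤ 24 * (M * M)
    ten = ≤-cert (12 * (M * M) + 265 * (M * z) + 133 * (z * z)) (M ⊛ 143z≤M ⊕ M ⊛ 143z≤M ⊕ z ⊛ 143z≤M) (e M z)
      where e : ∀ M z → 24 * (M * M) + (M * (143 * z) + (M * (143 * z) + z * (143 * z))) ≡ 10 * ((M + z) * (M + z)) + (M * M + (M * M + z * M)) + (12 * (M * M) + 265 * (M * z) + 133 * (z * z))
            e = solve-∀
    e : ∀ l M z D Du → 24 * (9 * l * Du + M * M) + (6 * (4 * (4 * l) * ((M + z) * (M + z))) + (216 * l * D + (3 * (M + z) * (144 * l * z) + ((M + z) * (432 * l) + 10 * ((M + z) * (M + z))))))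
      ≡ 24 * (4 * l * (M * M)) + (6 * (9 * (4 * l) * (D + 2 * (M + z)) + (M + z) * (M + z)) + (216 * l * (Du + 2 * z * (M + z)) + (3 * (M + z) * (M + z) + ((M + z) * (M + z) + 24 * (M * M))))) + 96 * l * (2 * M * z + z * z)
    e = solve-∀

-- `Kτ` = 4L leaves slack above the threshold L used in extensions. For K = 4L, `low-weight` gives Y
-- · Z ≤ 96L²N, so `Yτ` is the defect accuracy that makes 144L · Z ≤ N.
Kτ Yτ : ℕ
Kτ = 4 * L
Yτ = 96 * (L * L) * (144 * L)

Yτ≥1 : 1 ≤ Yτ
Yτ≥1 = *-mono-≤ {1} {96 * (L * L)} (*-mono-≤ {1} {96} (s≤s z≤n) (*-mono-≤ L≥1 L≥1)) (*-mono-≤ {1} {144} (s≤s z≤n) L≥1)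

module Structure {n : ℕ} (E : Fin n → Fin n → Fin n → Bool) (rules : Rules E) where
  open Rules rules
  open Symmetrise E rules public

  private
    V = Fin n
    k = kern E
    ks : Symmetric₃ k
    ks = kern-symmetric symm

  high? : (V → ℕ) → ℕ → V → Bool
  high? w K x = 4 * K * (∑ w * ∑ w) ≤ᵇ 9 * K * deg k w w x + ∑ w * ∑ w

  -- Thinning the low vertices: the scaled weights sw lose one unit z there, and `cube-bound` is
  -- applied to sw - z. Low degrees make the loss in T smaller than the drop of 4(Σw)³/9 by a
  -- first-order gain, and s = 8K keeps the second-order term below half of that gain. A large Z
  -- would therefore contradict the small defect.
  low-weight : ∀ w K Y → 1 ≤ K → 1 ≤ ∑ w → Defect Y (cube k w) (∑ w) → Y * mass w (not ∘ high? w K) ≤ 6 * (K * K) * ∑ w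
  low-weight w K Y K≥1 N≥1 def = low-weight-arith K N Z (∑ w″) (cube k w) (form k z w w) Y K≥1 N≥1 sums Z≤N up lo def
    where
    N = ∑ w
    low = not ∘ high? w K
    y z w″ : V → ℕ
    y = w ∣ʷ high? w K
    z = w ∣ʷ low
    s = 8 * K
    w″ = (s ⊡ y) ⊞ ((s ∸ 1) ⊡ z)
    Z = ∑ z
    Z≤N : Z ≤ N
    Z≤N = ∑-mono (∣ʷ≤ w low)
    s≥1 : 1 ≤ s
    s≥1 = ≤-trans K≥1 (m≤n*m K 8)
    sw≡ : ∀ x → (s ⊡ w) x ≡ (w″ ⊞ z) x
    sw≡ x = trans (cong (s *_) (∣ʷ-split w (high? w K) x)) (trans (*-distribˡ-+ s (y x) (z x)) (trans (cong (s * y x +_) (trans (cong (_* z x) (sym (m∸n+n≡m s≥1))) (trans (*-distribʳ-+ (z x) (s ∸ 1) 1) (cong ((s ∸ 1) * z x +_) (*-identityˡ (z x)))))) (sym (+-assoc (s * y x) _ _))))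
    sums : 8 * K * N ≡ ∑ w″ + Z
    sums = trans (sym (∑-scale s w)) (trans (∑-cong sw≡) (∑-+ w″ z))
    T₁ T₂ : ℕ
    T₁ = form k z w″ w″
    T₂ = form k z z w″
    zsw : form k z (s ⊡ w) (s ⊡ w) ≡ s * s * form k z w w
    zsw = trans (form-⊡₂ k ks s z w (s ⊡ w)) (trans (cong (s *_) (form-⊡₃ k ks s z w w)) (sym (*-assoc s s _)))
    lower : T₁ + 2 * T₂ + cube k z ≤ s * s * form k z w w
    lower = ≤-reflexive (trans (sym (trans (form-cong (λ _ _ _ → refl) (λ _ → refl) sw≡ sw≡) (trans (form-⊞₂ k ks z w″ z (w″ ⊞ z)) (trans (cong₂ _+_ (form-⊞₃ k ks z w″ w″ z) (form-⊞₃ k ks z z w″ z)) (trans (cong (λ q → T₁ + q + (T₂ + cube k z)) (form-comm₂₃ k ks z w″ z)) (e T₁ T₂ (cube k z))))))) zsw)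
      where e : ∀ a b c → a + b + (b + c) ≡ a + 2 * b + c
            e = solve-∀
    expand : s * s * s * cube k w ≡ cube k w″ + 3 * T₁ + 3 * T₂ + cube k z
    expand = trans (sym (cube-⊡ k ks s w)) (trans (form-cong (λ _ _ _ → refl) sw≡ sw≡ sw≡) (cube-⊞ k ks w″ z))
    up : 9 * (8 * K * (8 * K) * (8 * K) * cube k w) ≤ 4 * (∑ w″ * ∑ w″ * ∑ w″) + 27 * (8 * K * (8 * K) * form k z w w)
    up = ≤-trans (*-monoʳ-≤ 9 (≤-reflexive expand)) (≤-cert (27 * T₂ + 18 * cube k z) (cube-bound w″ ⊕ 27 ⊛ lower) (e (∑ w″ * ∑ w″ * ∑ w″) (8 * K * (8 * K) * form k z w w) (cube k w″) T₁ T₂ (cube k z)))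
      where e : ∀ n q c a b d → 4 * n + 27 * q + (9 * c + 27 * (a + 2 * b + d)) ≡ 9 * (c + 3 * a + 3 * b + d) + (4 * n + 27 * q) + (27 * b + 18 * d)
            e = solve-∀
    lo : 9 * K * form k z w w + Z * (N * N) ≤ Z * (4 * K * (N * N))
    lo = begin
      9 * K * form k z w w + Z * (N * N) ≡⟨ cong₂ _+_ (trans (cong (9 * K *_) (form≡ k z w w)) (sym (∑-*ˡ (9 * K) _))) (sym (∑-*ʳ z (N * N))) ⟩
      ∑ (λ x → 9 * K * (z x * deg k w w x)) + ∑ (λ x → z x * (N * N)) ≡⟨ sym (∑-+ _ _) ⟩
      ∑ (λ x → 9 * K * (z x * deg k w w x) + z x * (N * N)) ≤⟨ ∑-mono each ⟩
      ∑ (λ x → z x * (4 * K * (N * N))) ≡⟨ ∑-*ʳ z _ ⟩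
      Z * (4 * K * (N * N)) ∎
      where
      open ≤-Reasoning
      e : ∀ a z d m → a * (z * d) + z * m ≡ z * (a * d + m)
      e = solve-∀
      at : ∀ x (b : Bool) → high? w K x ≡ b → w x * b2n (not b) ≢ 0 → 9 * K * deg k w w x + N * N ≤ 4 * K * (N * N)
      at x true _ p = ⊥-elim (p (*-zeroʳ (w x)))
      at x false h _ = <⇒≤ (≰⇒> λ q → subst T h (≤⇒≤ᵇ q))
      each : ∀ x → 9 * K * (z x * deg k w w x) + z x * (N * N) ≤ z x * (4 * K * (N * N))
      each x = ≤-trans (≤-reflexive (e (9 * K) (z x) (deg k w w x) (N * N))) (guarded (z x) (at x (high? w K x) refl))

  private
    addAll : ∀ (G : V → Bool) u → 1 ≤ ∑ u → (∀ x → G x ≡ true → High E u L x) → (xs : List V) → ∀ U → (∀ x → u x ≢ 0 → U x ≡ true) → (∀ x → U x ≡ true → High E u L x) → Good E U →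
      Σ (V → Bool) λ U′ → Good E U′ × (∀ x → U x ≡ true → U′ x ≡ true) × (∀ x → x ∈ xs → G x ≡ true → U′ x ≡ true)
    addAll G u M≥1 hG [] U supp hU good = U , good , (λ _ p → p) , λ _ ()
    addAll G u M≥1 hG (v ∷ xs) U supp hU good = decide (true? (G v))
      where
      Goal = Σ (V → Bool) λ U′ → Good E U′ × (∀ x → U x ≡ true → U′ x ≡ true) × (∀ x → x ∈ v ∷ xs → G x ≡ true → U′ x ≡ true)
      decide : (G v ≡ true) ⊎ (G v ≡ false) → Goal
      decide (inj₂ p) = let (U′ , g , s , t) = addAll G u M≥1 hG xs U supp hU good in U′ , g , s , λ where
        x (here refl) q → ⊥-elim (true≢false (trans (sym q) p))
        x (there m) q → t x m q
      decide (inj₁ p) = let (U′ , g , s , t) = addAll G u M≥1 hG xs (add U v) (λ x q → ∨-introˡ _ (supp x q)) hU′ (good-extends E rules U u supp M≥1 hU v (hG v p) good) in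
        U′ , g , (λ x q → s x (∨-introˡ _ q)) , λ where
          x (here refl) q → s x (∨-introʳ (U x) (==-refl x))
          x (there m) q → t x m q
        where
        hU′ : ∀ x → add U v x ≡ true → High E u L x
        hU′ x q with ∨-true {U x} q
        ... | inj₁ r = hU x r
        ... | inj₂ r = subst (High E u L) (==⇒≡ r) (hG v p)

  NearHigh : (V → ℕ) → V → Set
  NearHigh w x = 4 * (4 * L) * (∑ w * ∑ w) ≤ 9 * (4 * L) * (deg k w w x + 2 * ∑ w) + ∑ w * ∑ w

  -- The weight u, which is w restricted to U, is fixed once. Every vertex of U and of G is high for
  -- it, so the vertices of G join one after another without loss, and everything outside G is
  -- dropped at the end.
  absorb : ∀ w U G → 432 * L ≤ ∑ w → 144 * L * mass w (not ∘ U) ≤ ∑ w → Good E U → (∀ x → U x ≡ true → NearHigh w x) → (∀ x → G x ≡ true → NearHigh w x) → Good E G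
  absorb w U G hn hz good hU hG = let (U′ , g , _ , t) = addAll G u M≥1 (λ x p → high x (hG x p)) (allFin n) U supp (λ x p → high x (hU x p)) good in Good-⊆ (λ x → t x (∈-allFin x)) g
    where
    u r : V → ℕ
    u = w ∣ʷ U
    r = w ∣ʷ (not ∘ U)
    M = ∑ u
    z = ∑ r
    N≡ : ∑ w ≡ M + z
    N≡ = mass-split w U
    supp : ∀ x → u x ≢ 0 → U x ≡ true
    supp x p with U x
    ... | true = refl
    ... | false = ⊥-elim (p (*-zeroʳ (w x)))
    M≥1 : 1 ≤ M
    M≥1 = pos M z L L≥1 (subst (432 * L ≤_) N≡ hn) (subst (144 * L * z ≤_) N≡ hz)
      where
      pos : ∀ M z l → 1 ≤ l → 432 * l ≤ M + z → 144 * l * z ≤ M + z → 1 ≤ M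
      pos (suc M) _ _ _ _ _ = s≤s z≤n
      pos zero z l l≥1 h₁ h₂ = ⊥-elim (<⇒≱ (≤-trans l≥1 (≤-trans (m≤n*m l 432) h₁)) (*-cancelˡ-≤ 143 (≤-cert 0 (≤-trans (*-monoˡ-≤ z (*-monoʳ-≤ 144 l≥1)) h₂) (e z))))
        where e : ∀ z → 143 * 0 + 144 * 1 * z ≡ 143 * z + z + 0
              e = solve-∀
    deg-loss : ∀ x → deg k w w x ≤ deg k u u x + 2 * z * (M + z)
    deg-loss x = begin
      deg k w w x ≡⟨ trans (deg-cong (λ _ _ _ → refl) (∣ʷ-split w U) (∣ʷ-split w U) x) (deg-square k ks u r x) ⟩
      deg k u u x + 2 * deg k u r x + deg k r r x ≤⟨ (≤-refl {deg k u u x} ⊕ 2 ⊛ deg-≤ (kern≤1 E) u r x) ⊕ deg-≤ (kern≤1 E) r r x ⟩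
      deg k u u x + 2 * (M * z) + z * z ≤⟨ ≤-cert (z * z) ≤-refl (e (deg k u u x) M z) ⟩
      deg k u u x + 2 * z * (M + z) ∎
      where
      open ≤-Reasoning
      e : ∀ d M z → d + 2 * z * (M + z) + 0 ≡ d + 2 * (M * z) + z * z + 0 + z * z
      e = solve-∀
    high : ∀ x → NearHigh w x → High E u L x
    high x h = absorb-arith L M z (deg k w w x) (deg k u u x) L≥1 (subst (144 * L * z ≤_) N≡ hz) (subst (432 * L ≤_) N≡ hn)
      (subst (λ N → 4 * (4 * L) * (N * N) ≤ 9 * (4 * L) * (deg k w w x + 2 * N) + N * N) N≡ h) (deg-loss x)

  high?⇒NearHigh : ∀ w x → high? w Kτ x ≡ true → NearHigh w x
  high?⇒NearHigh w x h = ≤-trans (≤-by h) (+-monoˡ-≤ (∑ w * ∑ w) (*-monoʳ-≤ (9 * Kτ) (m≤m+n _ _)))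

  private
    N≥1 : ∀ {N} → 432 * L ≤ N → 1 ≤ N
    N≥1 h = ≤-trans L≥1 (≤-trans (m≤n*m L 432) h)

    low-small : ∀ w → 432 * L ≤ ∑ w → Defect Yτ (cube k w) (∑ w) → 144 * L * mass w (not ∘ high? w Kτ) ≤ ∑ w
    low-small w hn def = *-cancel-pos (*-mono-≤ {1} {96} (s≤s z≤n) (*-mono-≤ L≥1 L≥1)) _ _ (≤-trans (≤-reflexive (sym (*-assoc (96 * (L * L)) (144 * L) _)))
      (≤-trans (low-weight w Kτ Yτ (≤-trans L≥1 (m≤n*m L 4)) (N≥1 hn) def) (≤-reflexive (e L (∑ w)))))
      where e : ∀ l N → 6 * (4 * l * (4 * l)) * N ≡ 96 * (l * l) * N
            e = solve-∀

  near-extremal : ∀ w → 432 * L ≤ ∑ w → Defect Yτ (cube k w) (∑ w) → Good E (high? w Kτ)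
  near-extremal = symmetrise (λ w → 432 * L ≤ ∑ w → Defect Yτ (cube k w) (∑ w) → Good E (high? w Kτ)) base step
    where
    base : ∀ w → CoveredSupport w → 432 * L ≤ ∑ w → Defect Yτ (cube k w) (∑ w) → Good E (high? w Kτ)
    base w cov hn def = absorb w U (high? w Kτ) hn (≤-trans (*-monoʳ-≤ (144 * L) (∑-mono pt)) (low-small w hn def))
        (Good-⊆ (λ x p → proj₁ (∧-true {nonzero (w x)} p)) (support-good w cov)) (λ x p → high?⇒NearHigh w x (proj₂ (∧-true {nonzero (w x)} p))) (high?⇒NearHigh w)
      where
      U : V → Bool
      U x = nonzero (w x) ∧ high? w Kτ x
      cut : ∀ m b → m * b2n (not (nonzero m ∧ b)) ≤ m * b2n (not b)
      cut zero b = z≤n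
      cut (suc m) b = ≤-refl
      pt : ∀ x → w x * b2n (not (U x)) ≤ w x * b2n (not (high? w Kτ x))
      pt x = cut (w x) (high? w Kτ x)
    step : ∀ w w′ → Shift w w′ → (432 * L ≤ ∑ w′ → Defect Yτ (cube k w′) (∑ w′) → Good E (high? w′ Kτ)) → 432 * L ≤ ∑ w → Defect Yτ (cube k w) (∑ w) → Good E (high? w Kτ)
    -- Both high sets are measured against w′: its own directly, that of w after allowing for the
    -- one unit moved.
    step w w′ sh ih hn def = absorb w′ (high? w′ Kτ) (high? w Kτ) hn′ (low-small w′ hn′ def′) (ih hn′ def′) (high?⇒NearHigh w′) near
      where
      N≡ : ∑ w ≡ ∑ w′
      N≡ = trans (Shift.sum-w sh) (sym (Shift.sum-w′ sh))
      hn′ : 432 * L ≤ ∑ w′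
      hn′ = subst (432 * L ≤_) N≡ hn
      def′ : Defect Yτ (cube k w′) (∑ w′)
      def′ = subst (Defect Yτ (cube k w′)) N≡ (≤-trans def (+-monoˡ-≤ (∑ w * ∑ w * ∑ w) (*-monoʳ-≤ (9 * Yτ) (Shift.cube-mono sh))))
      near : ∀ x → high? w Kτ x ≡ true → NearHigh w′ x
      near x p = subst (λ N → 4 * (4 * L) * (N * N) ≤ 9 * (4 * L) * (deg k w′ w′ x + 2 * N) + N * N) N≡
        (≤-trans (≤-by p) (+-monoˡ-≤ (∑ w * ∑ w) (*-monoʳ-≤ (9 * (4 * L)) (Shift.deg-change sh x))))

weaken : ∀ y a t m → 1 ≤ a → 4 * (y * a) * m ≤ 9 * (y * a) * t + m → 4 * y * m ≤ 9 * y * t + m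
weaken y a t m a≥1 h = *-cancel-pos a≥1 _ _ (≤-cert 0 (h ⊕ m ⊛ a≥1) (e y a t m))
  where e : ∀ y a t m → a * (9 * y * t + m) + (4 * (y * a) * m + m * 1) ≡ a * (4 * y * m) + (9 * (y * a) * t + m + m * a) + 0
        e = solve-∀

-- Edge counts of the two constructions

one : ∀ {n} → Fin n → ℕ
one _ = 1

∑-one : ∀ {n} → ∑ {n} one ≡ n
∑-one {n} = trans (∑-const {n} 1) (*-identityʳ n)

cube-one : ∀ {n} (k : Kernel n) → cube k one ≡ ∑³ k
cube-one k = trans (form≡ k one one one) (∑-cong λ a → trans (*-identityˡ _) (trans (deg≡ k one one a) (∑-cong λ b → trans (*-identityˡ _) (trans (codeg≡ k one a b) (∑-cong λ c → *-identityˡ _)))))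

6*edges : ∀ {n} (H : Graph3 n) → 6 * ∣ H ∣E ≡ cube (kern (edges H)) one
6*edges {n} H = trans (6*countTriples (edge? H) (edge?-symmetric H) (edge?-irreflexive H)) (trans (∑³-cong λ a b c → cong b2n (sym (edges≡ H a b c))) (sym (cube-one (kern (edges H)))))

54*edges : ∀ {n} (H : Graph3 n) → 54 * ∣ H ∣E ≡ 9 * cube (kern (edges H)) one
54*edges H = trans (*-assoc 9 6 ∣ H ∣E) (cong (9 *_) (6*edges H))

col₂ : ∀ n → Fin n → Fin 2
col₂ n x = if inA n x then 0F else 1F

residue : ℕ → Fin 6
residue 0 = 0F
residue 1 = 1F
residue 2 = 2F
residue 3 = 3F
residue 4 = 4F
residue 5 = 5F
residue (suc (suc (suc (suc (suc (suc n)))))) = residue n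

col₆ : ∀ n → Fin n → Fin 6
col₆ n x = residue (toℕ x)

Balanced : ∀ n → Graph3 n
Balanced n = Blow (col₆ n)

edges-Blow : ∀ {n} (π : Fin n → Fin 6) a b c → edges (Blow π) a b c ≡ P₆ (π a) (π b) (π c)
edges-Blow π a b c = trans (edges-collapse (Blow π) (Blow-symmetric π) (Blow-irreflexive π) a b c) (sym (P₆≡ (π a) (π b) (π c)))

col₂-zero : ∀ n x → (col₂ n x == 0F) ≡ inA n x
col₂-zero n x with inA n x
... | true = refl
... | false = refl

P₂-col₂ : ∀ n a b c → P₂ (col₂ n a) (col₂ n b) (col₂ n c) ≡ G1 n a b c
P₂-col₂ n a b c = trans (P₂≡ _ _ _) (trans (cong₂ (λ x y → exactlyOne x y (col₂ n c == 0F)) (col₂-zero n a) (col₂-zero n b)) (cong (exactlyOne (inA n a) (inA n b)) (col₂-zero n c)))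

edges-G1⇒ : ∀ n a b c → edges (G1 n) a b c ≡ true → P₂ (col₂ n a) (col₂ n b) (col₂ n c) ≡ true
edges-G1⇒ n a b c h = trans (P₂-col₂ n a b c) (edge?⇒ (G1 n) (G1-symmetric n) a b c (trans (sym (edges≡ (G1 n) a b c)) h))

-- As a Boolean function `G1` also holds at a, b, b with a in A and b not, so `edges-collapse` does
-- not apply and the vertices must be distinct.
⇒edges-G1 : ∀ n a b c → a ≢ b → b ≢ c → a ≢ c → P₂ (col₂ n a) (col₂ n b) (col₂ n c) ≡ true → edges (G1 n) a b c ≡ true
⇒edges-G1 n a b c p q r h = trans (sym same) distinct-true
  where
  -- the irreflexive part of G1, which has the same edges
  K : Graph3 n
  K a b c = not (a == b) ∧ (not (b == c) ∧ (not (a == c) ∧ G1 n a b c))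
  ==-comm : ∀ (x y : Fin n) → (x == y) ≡ (y == x)
  ==-comm x y = bool-ext (λ h → subst (λ z → (z == x) ≡ true) (==⇒≡ {x = x} h) (==-refl x)) (λ h → subst (λ z → (z == y) ≡ true) (==⇒≡ {x = y} h) (==-refl y))
  K-sym : Symmetric₃ K
  K-sym .swap₁₂ a b c rewrite ==-comm b a | swap₁₂ (G1-symmetric n) a b c = cong (not (a == b) ∧_) (comm (not (b == c)) (not (a == c)) _)
    where comm : ∀ x y z → x ∧ (y ∧ z) ≡ y ∧ (x ∧ z)
          comm true true z = refl
          comm true false z = refl
          comm false true z = refl
          comm false false z = refl
  K-sym .swap₂₃ a b c rewrite ==-comm c b | swap₂₃ (G1-symmetric n) a b c = comm (not (a == b)) (not (b == c)) (not (a == c)) _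
    where comm : ∀ x y z w → x ∧ (y ∧ (z ∧ w)) ≡ z ∧ (y ∧ (x ∧ w))
          comm true true true w = refl
          comm true true false w = refl
          comm true false true w = refl
          comm true false false w = refl
          comm false true true w = refl
          comm false true false w = refl
          comm false false true w = refl
          comm false false false w = refl
  K-irr : Irreflexive₃ K
  K-irr a c rewrite ==-refl a = refl
  K-true : K a b c ≡ true
  K-true = ∧-intro (cong not (≢⇒== p)) (∧-intro (cong not (≢⇒== q)) (∧-intro (cong not (≢⇒== r)) (trans (sym (P₂-col₂ n a b c)) h)))
  distinct-true : edge? K a b c ≡ true
  distinct-true = trans (edge?-collapse K K-sym K-irr a b c) K-true
  inc≡ : ∀ x y z → inc K x y z ≡ true → inc (G1 n) x y z ≡ true
  inc≡ x y z h with inc-sorted K x y z h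
  ... | u , v , w = ∧-intro u (∧-intro v (proj₂ (∧-true {not (x == z)} (proj₂ (∧-true {not (y == z)} (proj₂ (∧-true {not (x == y)} w)))))))
  same : edge? K a b c ≡ edges (G1 n) a b c
  same = trans distinct-true (sym (trans (edges≡ (G1 n) a b c) up))
    where
    up : edge? (G1 n) a b c ≡ true
    up = edge?-elim K (edge? (G1 n)) (edge?-symmetric (G1 n)) (λ x y z u v w → ∨-introˡ _ (inc≡ x y z (∧-intro u (∧-intro v w)))) a b c distinct-true

edges-Blow-count : ∀ {n} (π : Fin n → Fin 6) → 6 * ∣ Blow π ∣E ≡ cube (kern P₆) (weight π one)
edges-Blow-count π = trans (6*edges (Blow π)) (trans (form-cong (λ a b c → cong b2n (edges-Blow π a b c)) (λ _ → refl) (λ _ → refl) (λ _ → refl)) (cube-push π (kern P₆) one))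

Blow-bound : ∀ {n} (π : Fin n → Fin 6) → 54 * ∣ Blow π ∣E ≤ 4 * (n * n * n)
Blow-bound {n} π = ≤-trans (≤-reflexive (trans (*-assoc 9 6 ∣ Blow π ∣E) (cong (9 *_) (edges-Blow-count π)))) (subst (λ z → 9 * cube (kern P₆) (weight π one) ≤ 4 * (z * z * z)) (trans (∑-weight π one) (∑-one {n})) (cube-bound₆ (weight π one)))

private
  weight-residue : ∀ n i → weight (col₆ (6 + n)) one i ≡ 1 + weight (col₆ n) one i
  weight-residue n i = trans (six _) (cong (_+ weight (col₆ n) one i) (lem i))
    where
    six : (f : Fin (6 + n) → ℕ) → ∑ f ≡ f 0F + (f 1F + (f 2F + (f 3F + (f 4F + f 5F)))) + ∑ (λ x → f (suc (suc (suc (suc (suc (suc x)))))))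
    six f = trans (∑-suc f) (trans (cong (f 0F +_) (trans (∑-suc _) (cong (f 1F +_) (trans (∑-suc _) (cong (f 2F +_) (trans (∑-suc _) (cong (f 3F +_) (trans (∑-suc _) (cong (f 4F +_) (∑-suc _)))))))))) (assoc (f 0F) (f 1F) (f 2F) (f 3F) (f 4F) (f 5F) _))
      where assoc : ∀ a b c d e f g → a + (b + (c + (d + (e + (f + g))))) ≡ a + (b + (c + (d + (e + f)))) + g
            assoc = solve-∀
    b : Fin 6 → ℕ
    b j = 1 * b2n (does (j ≟ i))
    lem : ∀ i → let b = λ (j : Fin 6) → 1 * b2n (does (j ≟ i)) in b 0F + (b 1F + (b 2F + (b 3F + (b 4F + b 5F)))) ≡ 1
    lem 0F = refl
    lem 1F = refl
    lem 2F = refl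
    lem 3F = refl
    lem 4F = refl
    lem 5F = refl

weight-col₆-lower : ∀ n i → n ≤ 6 * weight (col₆ n) one i + 6
weight-col₆-lower 0 i = z≤n
weight-col₆-lower 1 i = ≤-trans (≤-by {1} {6} refl) (m≤n+m 6 _)
weight-col₆-lower 2 i = ≤-trans (≤-by {2} {6} refl) (m≤n+m 6 _)
weight-col₆-lower 3 i = ≤-trans (≤-by {3} {6} refl) (m≤n+m 6 _)
weight-col₆-lower 4 i = ≤-trans (≤-by {4} {6} refl) (m≤n+m 6 _)
weight-col₆-lower 5 i = ≤-trans (≤-by {5} {6} refl) (m≤n+m 6 _)
weight-col₆-lower (suc (suc (suc (suc (suc (suc n)))))) i = subst (λ z → 6 + n ≤ 6 * z + 6) (sym (weight-residue n i)) (≤-trans (+-monoʳ-≤ 6 (weight-col₆-lower n i)) (≤-reflexive (e (weight (col₆ n) one i))))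
  where e : ∀ w → 6 + (6 * w + 6) ≡ 6 * (1 + w) + 6
        e = solve-∀

weight-col₆-exact : ∀ k i → weight (col₆ (k * 6)) one i ≡ k
weight-col₆-exact zero i = ∑-empty _
weight-col₆-exact (suc k) i = trans (weight-residue (k * 6) i) (cong suc (weight-col₆-exact k i))

Balanced-count : ∀ k → ∣ Balanced (k * 6) ∣E ≡ 16 * (k * k * k)
Balanced-count k = *-cancelˡ-≡ _ _ 6 (trans (edges-Blow-count (col₆ (k * 6))) (trans (form-cong (λ _ _ _ → refl) (weight-col₆-exact k) (weight-col₆-exact k) (weight-col₆-exact k)) (trans (cube-P₆ (λ _ → k)) (e k))))
  where e : ∀ k → 6 * (k * k * (k + k) + k * k * (k + k) + k * k * (k + k + (k + k)) + (k + k) * (k + k) * (k + k)) ≡ 6 * (16 * (k * k * k))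
        e = solve-∀

∑-interval : ∀ n a → a ≤ n → ∑ {n} (λ x → b2n (toℕ x <ᵇ a)) ≡ a
∑-interval zero zero _ = ∑-empty _
∑-interval (suc n) zero _ = ∑-zero {suc n}
∑-interval (suc n) (suc a) (s≤s h) = trans (∑-suc _) (cong suc (∑-interval n a h))

weight-A : ∀ n → weight (col₂ n) one 0F ≡ n / 3
weight-A n = trans (∑-cong λ x → trans (*-identityˡ _) (cong b2n (col₂-zero n x))) (∑-interval n (n / 3) (Data.Nat.DivMod.m/n≤m n 3))

weight-AB : ∀ n → weight (col₂ n) one 0F + weight (col₂ n) one 1F ≡ n
weight-AB n = trans (sym (∑₂ (weight (col₂ n) one))) (trans (∑-weight (col₂ n) one) (∑-one {n}))

3*⌊n/3⌋ : ∀ n → n ≤ 3 * (n / 3) + 2 × 3 * (n / 3) ≤ n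
3*⌊n/3⌋ n = ≤-trans (≤-reflexive (Data.Nat.DivMod.m≡m%n+[m/n]*n n 3)) (≤-trans (+-monoˡ-≤ (n / 3 * 3) (s≤s⁻¹ (Data.Nat.DivMod.m%n<n n 3))) (≤-reflexive (trans (+-comm 2 _) (cong (_+ 2) (*-comm (n / 3) 3))))) ,
  ≤-trans (≤-reflexive (*-comm 3 (n / 3))) (Data.Nat.DivMod.m/n*n≤m n 3)

-- 43 = 27 + 16: at most 3n² degenerate triples, counted 9 times, and the remainder of `identity₂`,
-- where rounding n/3 gives |b - 2a| ≤ 2.
G1-lower : ∀ n → 4 * (n * n * n) ≤ 54 * ∣ G1 n ∣E + 43 * (n * n)
G1-lower n = ≤-trans poly (≤-cert 0 (9 ⊛ count) (e (cube (kern (edges (G1 n))) one) (54 * ∣ G1 n ∣E) (cube (kern P₂) (weight (col₂ n) one)) (n * n) (54*edges (G1 n))))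
  where
  w = weight (col₂ n) one
  a = w 0F
  b = w 1F
  e : ∀ g h p m → h ≡ 9 * g → h + 43 * m + 9 * p ≡ 9 * p + 16 * m + 9 * (g + 3 * m) + 0
  e g h p m refl = lem g p m
    where lem : ∀ g p m → 9 * g + 43 * m + 9 * p ≡ 9 * p + 16 * m + 9 * (g + 3 * m) + 0
          lem = solve-∀
  diag : Kernel n
  diag x y z = ⟦ x ⟧ y + ⟦ y ⟧ z + ⟦ x ⟧ z
  pt : ∀ x y z → kern P₂ (col₂ n x) (col₂ n y) (col₂ n z) ≤ kern (edges (G1 n)) x y z + diag x y z
  pt x y z with x ≟ y | y ≟ z | x ≟ z
  ... | yes _ | _ | _ = ≤-trans (b2n≤1 _) (≤-trans (s≤s z≤n) (m≤n+m _ (kern (edges (G1 n)) x y z)))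
  ... | no _ | yes _ | _ = ≤-trans (b2n≤1 _) (≤-trans (m≤m+n _ _) (m≤n+m _ (kern (edges (G1 n)) x y z)))
  ... | no _ | no _ | yes _ = ≤-trans (b2n≤1 _) (m≤n+m _ (kern (edges (G1 n)) x y z))
  ... | no p | no q | no r = ≤-trans (b2n-mono (⇒edges-G1 n x y z p q r)) (m≤m+n _ _)
  ∑diag : ∑³ diag ≡ 3 * (n * n)
  ∑diag = trans (∑³-+ _ _) (trans (cong (_+ ∑³ {n} (λ x y z → ⟦ x ⟧ z)) (∑³-+ _ _)) (trans (cong₂ _+_ (cong₂ _+_ d₁ d₂) d₃) (e′ (n * n))))
    where
    e′ : ∀ m → m + m + m ≡ 3 * m
    e′ = solve-∀
    d₁ : ∑³ {n} (λ x y z → ⟦ x ⟧ y) ≡ n * n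
    d₁ = trans (∑-cong λ x → trans (∑-cong λ y → ∑-const {n} (⟦ x ⟧ y)) (trans (∑-*ˡ n ⟦ x ⟧) (trans (cong (n *_) (∑-⟦⟧ x)) (*-identityʳ n)))) (∑-const {n} n)
    d₂ : ∑³ {n} (λ x y z → ⟦ y ⟧ z) ≡ n * n
    d₂ = trans (∑-cong λ x → trans (∑-cong λ y → ∑-⟦⟧ y) (∑-one {n})) (∑-const {n} n)
    d₃ : ∑³ {n} (λ x y z → ⟦ x ⟧ z) ≡ n * n
    d₃ = trans (∑-cong λ x → trans (∑-cong λ y → ∑-⟦⟧ x) (∑-one {n})) (∑-const {n} n)
  count : cube (kern P₂) w ≤ cube (kern (edges (G1 n))) one + 3 * (n * n)
  count = ≤-trans (≤-reflexive (trans (sym (cube-push (col₂ n) (kern P₂) one)) (cube-one _))) (≤-trans (∑³-mono pt) (≤-reflexive (trans (∑³-+ _ _) (cong₂ _+_ (sym (cube-one _)) ∑diag))))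
  poly : 4 * (n * n * n) ≤ 9 * cube (kern P₂) w + 16 * (n * n)
  poly = subst₂ (λ m p → 4 * (m * m * m) ≤ 9 * p + 16 * (m * m)) (weight-AB n) (sym (cube-P₂ w)) (≤-trans (≤-reflexive (identity₂ a b)) (+-monoʳ-≤ (9 * (3 * (a * (b * b)))) (≤-trans (*-monoˡ-≤ (4 * b + a) (*-mono-≤ d≤2 d≤2)) small)))
    where
    d≤2 : dist b (2 * a) ≤ 2
    d≤2 = ≤-trans (≤-reflexive (m≤n⇒∣n-m∣≡n∸m 2a≤b)) (≤-trans (∸-monoˡ-≤ (2 * a) b≤) (≤-reflexive (m+n∸m≡n (2 * a) 2)))
      where
      3a : 3 * a ≤ a + b × a + b ≤ 3 * a + 2
      3a = subst₂ (λ x m → 3 * x ≤ m × m ≤ 3 * x + 2) (sym (weight-A n)) (sym (weight-AB n)) (proj₂ (3*⌊n/3⌋ n) , proj₁ (3*⌊n/3⌋ n))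
      2a≤b : 2 * a ≤ b
      2a≤b = ≤-cert 0 (proj₁ 3a) (l a b)
        where l : ∀ a b → b + 3 * a ≡ 2 * a + (a + b) + 0
              l = solve-∀
      b≤ : b ≤ 2 * a + 2
      b≤ = ≤-cert 0 (proj₂ 3a) (l a b)
        where l : ∀ a b → 2 * a + 2 + (a + b) ≡ b + (3 * a + 2) + 0
              l = solve-∀
    small : 2 * 2 * (4 * b + a) ≤ 16 * ((a + b) * (a + b))
    small = ≤-trans (≤-cert (12 * a) ≤-refl (l a b)) (*-monoʳ-≤ 16 (sq (a + b)))
      where
      l : ∀ a b → 16 * (a + b) + 0 ≡ 4 * (4 * b + a) + 0 + 12 * a
      l = solve-∀
      sq : ∀ m → m ≤ m * m
      sq zero = z≤n
      sq (suc m) = m≤m*n (suc m) (suc m)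

-- 𝓜-freeness of the two constructions

∀ᵇ² : (Bool → Bool) → Bool
∀ᵇ² p = p true ∧ p false

∀ᵇ²-sound : ∀ (p : Bool → Bool) → ∀ᵇ² p ≡ true → ∀ b → p b ≡ true
∀ᵇ²-sound p h true = proj₁ (∧-true {p true} h)
∀ᵇ²-sound p h false = proj₂ (∧-true {p true} h)

private
  five : Bool → Bool → Bool → Bool → Bool → Fin 5 → Bool
  five a b c d e 0F = a
  five a b c d e 1F = b
  five a b c d e 2F = c
  five a b c d e 3F = d
  five a b c d e 4F = e

  K5⁻-bad : (Fin 5 → Bool) → Bool
  K5⁻-bad p = ∃ᵇ λ x → ∃ᵇ λ y → ∃ᵇ λ z → edges K5⁻ x y z ∧ not (exactlyOne (p x) (p y) (p z))

  -- Images are chosen for the vertices 2, 3, 4, then 1, then 0, and an assignment is discarded at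
  -- its first violated edge. The triple {0,1,2} is the one missing from `K5⁻`.
  k5 : Fin 6 → Fin 6 → Fin 6 → Bool
  k5-b : Fin 6 → Fin 6 → Fin 6 → Fin 6 → Bool
  k5-a : Fin 6 → Fin 6 → Fin 6 → Fin 6 → Fin 6 → Bool
  k5 c d e = not (P₆ c d e) ∨ ∀ᵇ (k5-b c d e)
  k5-b c d e b = (not (P₆ b c d) ∨ (not (P₆ b c e) ∨ not (P₆ b d e))) ∨ ∀ᵇ (k5-a c d e b)
  k5-a c d e b a = not (P₆ a b d) ∨ (not (P₆ a b e) ∨ (not (P₆ a c d) ∨ (not (P₆ a c e) ∨ not (P₆ a d e))))

  opaque
    unfolding ∀ᵇ edges P₆
    K5⁻-not-semibipartite : (∀ᵇ² λ a → ∀ᵇ² λ b → ∀ᵇ² λ c → ∀ᵇ² λ d → ∀ᵇ² λ e → K5⁻-bad (five a b c d e)) ≡ true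
    K5⁻-not-semibipartite = refl

    K5⁻-not-G26 : ∀³ᵇ k5 ≡ true
    K5⁻-not-G26 = refl

    K5⁻-edges : edges K5⁻ 2F 3F 4F ≡ true × edges K5⁻ 1F 2F 3F ≡ true × edges K5⁻ 1F 2F 4F ≡ true × edges K5⁻ 1F 3F 4F ≡ true × edges K5⁻ 0F 1F 3F ≡ true × edges K5⁻ 0F 1F 4F ≡ true × edges K5⁻ 0F 2F 3F ≡ true × edges K5⁻ 0F 2F 4F ≡ true × edges K5⁻ 0F 3F 4F ≡ true
    K5⁻-edges = refl , refl , refl , refl , refl , refl , refl , refl , refl

  five-agrees : ∀ (p : Fin 5 → Bool) x → five (p 0F) (p 1F) (p 2F) (p 3F) (p 4F) x ≡ p x
  five-agrees p 0F = refl
  five-agrees p 1F = refl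
  five-agrees p 2F = refl
  five-agrees p 3F = refl
  five-agrees p 4F = refl

  no-semibipartite-K5⁻ : ∀ (p : Fin 5 → Bool) → (∀ x y z → edges K5⁻ x y z ≡ true → exactlyOne (p x) (p y) (p z) ≡ true) → ⊥
  no-semibipartite-K5⁻ p h = let (x , h₁) = ∃ᵇ-sound bad ; (y , h₂) = ∃ᵇ-sound h₁ ; (z , h₃) = ∃ᵇ-sound h₂ ; (e , b) = ∧-true {edges K5⁻ x y z} h₃ in
      true≢false (trans (sym (trans (cong₂ (λ u v → exactlyOne u v (q z)) (five-agrees p x) (five-agrees p y)) (trans (cong (exactlyOne (p x) (p y)) (five-agrees p z)) (h x y z e)))) (not-true b))
    where
    q = five (p 0F) (p 1F) (p 2F) (p 3F) (p 4F)
    bad : K5⁻-bad q ≡ true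
    bad = ∀ᵇ²-sound (λ e → K5⁻-bad (five (p 0F) (p 1F) (p 2F) (p 3F) e))
      (∀ᵇ²-sound (λ d → ∀ᵇ² λ e → K5⁻-bad (five (p 0F) (p 1F) (p 2F) d e))
      (∀ᵇ²-sound (λ c → ∀ᵇ² λ d → ∀ᵇ² λ e → K5⁻-bad (five (p 0F) (p 1F) c d e))
      (∀ᵇ²-sound (λ b → ∀ᵇ² λ c → ∀ᵇ² λ d → ∀ᵇ² λ e → K5⁻-bad (five (p 0F) b c d e))
      (∀ᵇ²-sound (λ a → ∀ᵇ² λ b → ∀ᵇ² λ c → ∀ᵇ² λ d → ∀ᵇ² λ e → K5⁻-bad (five a b c d e)) K5⁻-not-semibipartite (p 0F)) (p 1F)) (p 2F)) (p 3F)) (p 4F)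

  no-G26-K5⁻ : ∀ (φ : Fin 5 → Fin 6) → (∀ x y z → edges K5⁻ x y z ≡ true → P₆ (φ x) (φ y) (φ z) ≡ true) → ⊥
  no-G26-K5⁻ φ h = let (e₁ , e₂ , e₃ , e₄ , e₅ , e₆ , e₇ , e₈ , e₉) = K5⁻-edges in
    true≢false (trans (sym (∀ᵇ-sound {p = k5-a (φ 2F) (φ 3F) (φ 4F) (φ 1F)}
      (∨-elim-false (∀ᵇ-sound {p = k5-b (φ 2F) (φ 3F) (φ 4F)} (∨-elim-false (∀³ᵇ-sound k5 K5⁻-not-G26 (φ 2F) (φ 3F) (φ 4F)) (n (h _ _ _ e₁))) (φ 1F)) (v (n (h _ _ _ e₂)) (v (n (h _ _ _ e₃)) (n (h _ _ _ e₄))))) (φ 0F)))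
      (v (n (h _ _ _ e₅)) (v (n (h _ _ _ e₆)) (v (n (h _ _ _ e₇)) (v (n (h _ _ _ e₈)) (n (h _ _ _ e₉)))))))
    where
    v : ∀ {a b} → a ≡ false → b ≡ false → (a ∨ b) ≡ false
    v = ∨-intro-false
    n : ∀ {a} → a ≡ true → not a ≡ false
    n = cong not

  M₁-only : ∀ m (F : Graph3 m) → M₁ m F → Σ (m ≡ 5) λ e → ∀ a b c → edge? (subst Graph3 e F) a b c ≡ edge? K5⁻ a b c
  M₁-only 5 F h = refl , h
  M₁-only 0 F ()
  M₁-only 1 F ()
  M₁-only 2 F ()
  M₁-only 3 F ()
  M₁-only 4 F ()
  M₁-only (suc (suc (suc (suc (suc (suc m)))))) F ()

  record Maps {m N : ℕ} (F : Graph3 m) (K : Graph3 N) : Set where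
    field
      f : Fin m → Fin N
      hom : ∀ a b c → edges F a b c ≡ true → edges K (f a) (f b) (f c) ≡ true

  maps : ∀ {m N} {F : Graph3 m} {K : Graph3 N} → F ⊂G K → Maps F K
  maps {F = F} {K} (f , _ , h) = record { f = f ; hom = λ a b c e → trans (edges≡ K _ _ _) (h a b c (trans (sym (edges≡ F a b c)) e)) }

  core-cover : ∀ {m ℓ} {F : Graph3 m} {s : Fin (suc ℓ) → Fin m} → IsCore ℓ F s → ∀ i j → i ≢ j → ∃ λ z → edges F (s i) (s j) z ≡ true
  core-cover {F = F} (_ , cov) i j p = let (z , e) = cov i j p in z , trans (edges≡ F _ _ _) e

  star⇒¬τ≥2 : ∀ {m k} (F : Graph3 m) (s : Fin k → Fin m) x → (∀ a b c → edges F (s a) (s b) (s c) ≡ true → x ∈₃ a , b , c) → ¬ τ≥2 (pull F s)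
  star⇒¬τ≥2 {m} {k} F s x star τ = <⇒≱ (s≤s (≤-reflexive (trans (sumFin≡∑ k _) (∑-⟦⟧ x)))) (τ (x ==_) tr)
    where
    pick : ∀ a b c → x ∈₃ a , b , c → ((x == a) ∨ (x == b) ∨ (x == c)) ≡ true
    pick a b c (inj₁ refl) = ∨-introˡ _ (==-refl x)
    pick a b c (inj₂ (inj₁ refl)) = ∨-introʳ (x == a) (∨-introˡ _ (==-refl x))
    pick a b c (inj₂ (inj₂ refl)) = ∨-introʳ (x == a) (∨-introʳ (x == b) (==-refl x))
    tr : Transversal (pull F s) (x ==_)
    tr a b c e = pick a b c (star a b c (trans (edges≡ F _ _ _) (edge?⇒ (pull F s) (symmetric₃-∘ s (edge?-symmetric F)) a b c e)))

-- `K5⁻` has no semibipartition, by checking its 32 vertex partitions. A covered core has at most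
-- one vertex in A and hence a one-vertex transversal. Members of `M₃` are excluded by definition.
G1-free : ∀ n → Free 𝓜 (G1 n)
G1-free n m F (inj₁ m₁) emb = go m F m₁ emb
  where
  go : ∀ m F → M₁ m F → ¬ (F ⊂G G1 n)
  go m F m₁ emb with M₁-only m F m₁
  ... | refl , eq = no-semibipartite-K5⁻ (λ x → inA n (Maps.f φ x)) λ x y z e → trans (sym (P₂-col₂ n _ _ _)) (edges-G1⇒ n _ _ _ (Maps.hom φ x y z (trans (edges≡ F x y z) (trans (eq x y z) (trans (sym (edges≡ K5⁻ x y z)) e)))))
    where φ = maps emb
G1-free n m F (inj₂ (inj₁ (_ , s , core , τ))) emb = star⇒¬τ≥2 F s (proj₁ star) (proj₂ star) τ
  where
  φ = maps emb
  p : Fin 7 → Bool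
  p i = inA n (Maps.f φ (s i))
  up : ∀ a b c → edges F a b c ≡ true → exactlyOne (inA n (Maps.f φ a)) (inA n (Maps.f φ b)) (inA n (Maps.f φ c)) ≡ true
  up a b c e = trans (sym (P₂-col₂ n _ _ _)) (edges-G1⇒ n _ _ _ (Maps.hom φ a b c e))
  sep : ∀ i j → i ≢ j → p i ≡ true → p j ≡ true → ⊥
  sep i j i≢j x y = let (z , e) = core-cover {F = F} core i j i≢j in
    exactlyOne-¬both (inA n (Maps.f φ z)) (trans (cong₂ (λ u v → exactlyOne u v (inA n (Maps.f φ z))) (sym x) (sym y)) (up _ _ _ e))
  star = covered-semibipartite⇒star (λ a b c → edges F (s a) (s b) (s c)) p sep (λ a b c → up (s a) (s b) (s c))
G1-free n m F (inj₂ (inj₂ (_ , not-G1 , _))) emb = not-G1 n emb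

-- For n = 6k the balanced blowup attains the Lagrangian bound 4n³/54 exactly, so no blowup has more
-- edges.
col₆-maximal : ∀ k → 1 ≤ k → MaxBlow (col₆ (k * 6))
col₆-maximal (suc k) _ = surj , λ ρ _ → *-cancelˡ-≤ 54 (≤-trans (Blow-bound ρ) (≤-reflexive (trans (e (suc k)) (cong (54 *_) (sym (Balanced-count (suc k)))))))
  where
  e : ∀ k → 4 * (k * 6 * (k * 6) * (k * 6)) ≡ 54 * (16 * (k * k * k))
  e = solve-∀
  surj : Surjective6 (col₆ (suc k * 6))
  surj 0F = 0F , refl
  surj 1F = 1F , refl
  surj 2F = 2F , refl
  surj 3F = 3F , refl
  surj 4F = 4F , refl
  surj 5F = 5F , refl

-- Multiples of 6 make this a maximum blowup, which is what `M₃` forbids its members to embed in;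
-- arbitrarily large such n are enough for the lower bound on ξ. A 7-core is excluded by the
-- pigeonhole principle: covered vertices have distinct colours.
Balanced-free : ∀ k → 1 ≤ k → Free 𝓜 (Balanced (k * 6))
Balanced-free k k≥1 m F member emb = go member
  where
  n = k * 6
  φ = maps emb
  π : Fin m → Fin 6
  π x = col₆ n (Maps.f φ x)
  up : ∀ a b c → edges F a b c ≡ true → P₆ (π a) (π b) (π c) ≡ true
  up a b c e = trans (sym (edges-Blow (col₆ n) _ _ _)) (Maps.hom φ a b c e)
  P₆-irr : ∀ i j → P₆ i i j ≡ false
  P₆-irr i j = trans (P₆≡ i i j) (edge?-irreflexive G26 i j)
  K5-case : ∀ m (F : Graph3 m) (π : Fin m → Fin 6) → (∀ a b c → edges F a b c ≡ true → P₆ (π a) (π b) (π c) ≡ true) → M₁ m F → ⊥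
  K5-case m F π up m₁ with M₁-only m F m₁
  ... | refl , eq = no-G26-K5⁻ π λ x y z e → up x y z (trans (edges≡ F x y z) (trans (eq x y z) (trans (sym (edges≡ K5⁻ x y z)) e)))
  go : 𝓜 m F → ⊥
  go (inj₁ m₁) = K5-case m F π up m₁
  go (inj₂ (inj₁ (_ , s , core , _))) = <⇒≱ (≤-by {7} {7} refl) (Finₚ.injective⇒≤ {f = π ∘ s} inj)
    where
    inj : Injective _≡_ _≡_ (π ∘ s)
    inj {i} {j} p with i ≟ j
    ... | yes q = q
    ... | no q = let (z , e) = core-cover {F = F} core i j q in ⊥-elim (true≢false (trans (sym (up _ _ _ e)) (trans (cong (λ y → P₆ (π (s i)) y (π z)) (sym p)) (P₆-irr _ _))))
  go (inj₂ (inj₂ (_ , _ , not-G2))) = not-G2 n (col₆ n) (≤-trans (≤-reflexive (sym (*-identityˡ 6))) (*-monoˡ-≤ 6 k≥1)) (col₆-maximal k k≥1) emb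

-- Matching two colourings by a permutation

∑-permute : ∀ {n} (σ : Permutation′ n) (f : Fin n → ℕ) → ∑ (λ x → f (σ ⟨$⟩ʳ x)) ≡ ∑ f
∑-permute σ f = begin
  ∑ (λ x → f (σ ⟨$⟩ʳ x)) ≡⟨ ∑-cong (λ x → sym (∑-δ (σ ⟨$⟩ʳ x) f)) ⟩
  ∑ (λ x → ∑ (λ y → ⟦ σ ⟨$⟩ʳ x ⟧ y * f y)) ≡⟨ ∑-swap _ ⟩
  ∑ (λ y → ∑ (λ x → ⟦ σ ⟨$⟩ʳ x ⟧ y * f y)) ≡⟨ ∑-cong (λ y → trans (∑-*ʳ _ (f y)) (trans (cong (_* f y) (trans (∑-cong λ x → cong b2n (flip x y)) (∑-⟦⟧ (σ ⟨$⟩ˡ y)))) (*-identityˡ (f y)))) ⟩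
  ∑ f ∎
  where
  open ≡-Reasoning
  flip : ∀ x y → (σ ⟨$⟩ʳ x == y) ≡ (σ ⟨$⟩ˡ y == x)
  flip x y = bool-ext (λ h → subst (λ z → (σ ⟨$⟩ˡ z == x) ≡ true) (==⇒≡ {x = σ ⟨$⟩ʳ x} {y} h) (subst (λ w → (w == x) ≡ true) (sym (inverseˡ σ)) (==-refl x)))
    (λ h → subst (λ z → (σ ⟨$⟩ʳ z == y) ≡ true) (==⇒≡ {x = σ ⟨$⟩ˡ y} {x} h) (subst (λ w → (w == y) ≡ true) (sym (inverseʳ σ)) (==-refl y)))

module _ {n r : ℕ} (c t : Fin n → Fin r) where
  mismatch : Permutation′ n → Fin n → Bool
  mismatch σ x = not (c x == t (σ ⟨$⟩ʳ x))

  private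
    mis : Permutation′ n → ℕ
    mis σ = ∑ (b2n ∘ mismatch σ)

    swappable : Permutation′ n → Fin n → Fin n → Bool
    swappable σ x y = mismatch σ x ∧ (mismatch σ y ∧ (c x == t (σ ⟨$⟩ʳ y)))

    -- The exchange repairs x, and y was mismatched already, so nothing can get worse there.
    swap-better : ∀ σ x y → swappable σ x y ≡ true → mis (transpose x y ∘ₚ σ) < mis σ
    swap-better σ x y h = ≤-trans (≤-reflexive (cong (_+ mis σ′) (sym (∑-⟦⟧ x)))) (≤-trans (≤-reflexive (sym (∑-+ ⟦ x ⟧ (b2n ∘ mismatch σ′)))) (∑-mono pt))
      where
      σ′ = transpose x y ∘ₚ σ
      mx = proj₁ (∧-true {mismatch σ x} h)
      my = proj₁ (∧-true {mismatch σ y} (proj₂ (∧-true {mismatch σ x} h)))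
      cx = proj₂ (∧-true {mismatch σ y} (proj₂ (∧-true {mismatch σ x} h)))
      x≢y : x ≢ y
      x≢y refl = true≢false (trans (sym cx) (not-true mx))
      at-x : transpose x y ⟨$⟩ʳ x ≡ y
      at-x with x ≟ x
      ... | yes _ = refl
      ... | no p = ⊥-elim (p refl)
      off : ∀ z → x ≢ z → y ≢ z → transpose x y ⟨$⟩ʳ z ≡ z
      off z p q with z ≟ x
      ... | yes e = ⊥-elim (p (sym e))
      ... | no _ with z ≟ y
      ...   | yes e = ⊥-elim (q (sym e))
      ...   | no _ = refl
      pt : ∀ z → ⟦ x ⟧ z + b2n (mismatch σ′ z) ≤ b2n (mismatch σ z)
      pt z = cases (x ≟ z) (y ≟ z)
        where
        cases : Dec (x ≡ z) → Dec (y ≡ z) → ⟦ x ⟧ z + b2n (mismatch σ′ z) ≤ b2n (mismatch σ z)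
        cases (yes refl) _ = ≤-reflexive (trans (cong₂ _+_ (⟦⟧-self x) (cong b2n (cong not (trans (cong (λ w → c x == t (σ ⟨$⟩ʳ w)) at-x) cx)))) (sym (cong b2n mx)))
        cases (no p) (yes refl) = ≤-trans (≤-reflexive (cong (_+ b2n (mismatch σ′ y)) (⟦⟧-other p))) (≤-trans (b2n≤1 _) (≤-reflexive (sym (cong b2n my))))
        cases (no p) (no q) = ≤-reflexive (cong₂ _+_ (⟦⟧-other p) (cong (λ w → b2n (not (c z == t (σ ⟨$⟩ʳ w)))) (off z p q)))

    Stuck : Permutation′ n → Set
    Stuck σ = ∀ x y → swappable σ x y ≡ false

    improve : ∀ m σ → mis σ ≤ m → Σ (Permutation′ n) Stuck
    improve m σ h = decide m h (true? (∃ᵇ λ x → ∃ᵇ λ y → swappable σ x y))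
      where
      decide : ∀ m → mis σ ≤ m → (∃ᵇ (λ x → ∃ᵇ λ y → swappable σ x y) ≡ true) ⊎ (∃ᵇ (λ x → ∃ᵇ λ y → swappable σ x y) ≡ false) → Σ (Permutation′ n) Stuck
      decide m h (inj₂ none) = σ , λ x y → ¬true λ s → true≢false (trans (sym (∃ᵇ-complete (λ x → ∃ᵇ λ y → swappable σ x y) x (∃ᵇ-complete (swappable σ x) y s))) none)
      decide m h (inj₁ some) = let (x , p) = ∃ᵇ-sound {p = λ x → ∃ᵇ λ y → swappable σ x y} some ; (y , q) = ∃ᵇ-sound {p = swappable σ x} p in next m h x y q
        where
        next : ∀ m → mis σ ≤ m → ∀ x y → swappable σ x y ≡ true → Σ (Permutation′ n) Stuck
        next zero h x y q = ⊥-elim (n≮0 (≤-trans (swap-better σ x y q) h))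
        next (suc m) h x y q = improve m (transpose x y ∘ₚ σ) (≤-pred (≤-trans (swap-better σ x y q) h))

    -- If a vertex of colour i is mismatched, no mismatched vertex has target colour i. All targets
    -- of colour i are then hit by matched vertices, so the mismatched ones are the excess of class
    -- i; other classes contribute nothing.
    stuck-bound : ∀ σ → Stuck σ → mis σ ≤ ∑ (λ i → weight c one i ∸ weight t one i)
    stuck-bound σ stuck = ≤-trans (≤-reflexive by-colour) (∑-mono class)
      where
      m : Fin r → ℕ
      m i = ∑ λ x → b2n (mismatch σ x) * b2n (c x == i)
      by-colour : mis σ ≡ ∑ m
      by-colour = trans (sym (∑-weight c (b2n ∘ mismatch σ))) refl
      tσ : ∀ i → weight t one i ≡ ∑ (λ x → b2n (t (σ ⟨$⟩ʳ x) == i))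
      tσ i = trans (∑-cong λ x → *-identityˡ _) (sym (∑-permute σ (λ x → b2n (t x == i))))
      class : ∀ i → m i ≤ weight c one i ∸ weight t one i
      class i = decide (true? (∃ᵇ λ x → mismatch σ x ∧ (c x == i)))
        where
        decide : (∃ᵇ (λ x → mismatch σ x ∧ (c x == i)) ≡ true) ⊎ (∃ᵇ (λ x → mismatch σ x ∧ (c x == i)) ≡ false) → m i ≤ weight c one i ∸ weight t one i
        decide (inj₂ none) = ≤-trans (≤-reflexive (trans (∑-cong λ x → zero-at (mismatch σ x) (c x == i) (¬true λ h → true≢false (trans (sym (∃ᵇ-complete (λ x → mismatch σ x ∧ (c x == i)) x h)) none))) (∑-zero {n}))) z≤n
          where zero-at : ∀ a b → (a ∧ b) ≡ false → b2n a * b2n b ≡ 0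
                zero-at true false _ = refl
                zero-at false _ _ = refl
        decide (inj₁ some) = let (x , h) = ∃ᵇ-sound {p = λ x → mismatch σ x ∧ (c x == i)} some in
            m+n≤o⇒m≤o∸n (m i) (≤-trans (≤-reflexive (cong (m i +_) (tσ i))) (≤-trans (≤-reflexive (sym (∑-+ _ _))) (∑-mono (pt x (proj₁ (∧-true {mismatch σ x} h)) (==⇒≡ {x = c x} {i} (proj₂ (∧-true {mismatch σ x} h)))))))
          where
          bits : ∀ a p q → (q ≡ true → a ≡ true → ⊥) → (a ≡ false → p ≡ q) → b2n a * b2n p + b2n q ≤ 1 * b2n p
          bits true p true f _ = ⊥-elim (f refl refl)
          bits true true false _ _ = ≤-refl
          bits true false false _ _ = ≤-refl
          bits false p q _ g rewrite g refl = ≤-reflexive (sym (*-identityˡ (b2n q)))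
          pt : ∀ x → mismatch σ x ≡ true → c x ≡ i → ∀ y → b2n (mismatch σ y) * b2n (c y == i) + b2n (t (σ ⟨$⟩ʳ y) == i) ≤ one y * b2n (c y == i)
          pt x mx cx y = bits (mismatch σ y) (c y == i) (t (σ ⟨$⟩ʳ y) == i)
            (λ ty my → true≢false (trans (sym (∧-intro mx (∧-intro my (subst₂ (λ a b → (a == b) ≡ true) (sym cx) (sym (==⇒≡ {x = t (σ ⟨$⟩ʳ y)} {i} ty)) (==-refl i))))) (stuck x y)))
            (λ ok → cong (_== i) (==⇒≡ {x = c y} (trans (sym (notnot (c y == t (σ ⟨$⟩ʳ y)))) (cong not ok))))
            where notnot : ∀ b → not (not b) ≡ b
                  notnot true = refl
                  notnot false = refl

  matching : Σ (Permutation′ n) λ σ → ∑ (b2n ∘ mismatch σ) ≤ ∑ (λ i → weight c one i ∸ weight t one i)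
  matching = let (σ , stuck) = improve (mis idₚ) idₚ ≤-refl in σ , stuck-bound σ stuck

-- Edit distance to the two constructions

6*editDist : ∀ {n} (H K : Graph3 n) (σ : Permutation′ n) → 6 * editDist H K σ ≡ ∑³ (λ a b d → b2n (edges H a b d xor edges K (σ ⟨$⟩ʳ a) (σ ⟨$⟩ʳ b) (σ ⟨$⟩ʳ d)))
6*editDist {n} H K σ = trans (6*countTriples X X-sym X-irr) (∑³-cong λ a b d → cong b2n (cong₂ _xor_ (sym (edges≡ H a b d)) (sym (edges≡ K (σ ⟨$⟩ʳ a) (σ ⟨$⟩ʳ b) (σ ⟨$⟩ʳ d)))))
  where
  X : Fin n → Fin n → Fin n → Bool
  X a b d = edge? H a b d xor edge? K (σ ⟨$⟩ʳ a) (σ ⟨$⟩ʳ b) (σ ⟨$⟩ʳ d)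
  X-sym : Symmetric₃ X
  X-sym .swap₁₂ a b d = cong₂ _xor_ (swap₁₂ (edge?-symmetric H) a b d) (swap₁₂ (edge?-symmetric K) (σ ⟨$⟩ʳ a) (σ ⟨$⟩ʳ b) (σ ⟨$⟩ʳ d))
  X-sym .swap₂₃ a b d = cong₂ _xor_ (swap₂₃ (edge?-symmetric H) a b d) (swap₂₃ (edge?-symmetric K) (σ ⟨$⟩ʳ a) (σ ⟨$⟩ʳ b) (σ ⟨$⟩ʳ d))
  X-irr : Irreflexive₃ X
  X-irr a d = cong₂ _xor_ (edge?-irreflexive H a d) (edge?-irreflexive K (σ ⟨$⟩ʳ a) (σ ⟨$⟩ʳ d))

cube-∑³ : ∀ {n} (k : Kernel n) f → cube k f ≡ ∑³ (λ a b d → f a * (f b * (f d * k a b d)))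
cube-∑³ k f = trans (form≡ k f f f) (∑-cong λ a → trans (cong (f a *_) (trans (deg≡ k f f a) (∑-cong λ b → trans (cong (f b *_) (codeg≡ k f a b)) (sym (∑-*ˡ (f b) _))))) (trans (sym (∑-*ˡ (f a) _)) (∑-cong λ b → sym (∑-*ˡ (f a) _))))

∑³-corners : ∀ {n} (g : Fin n → ℕ) → ∑³ (λ a b d → g a + g b + g d) ≡ 3 * ∑ g * (n * n)
∑³-corners {n} g = trans (∑³-+ _ _) (trans (cong₂ _+_ (trans (∑³-+ _ _) (cong₂ _+_ c₁ c₂)) c₃) (e (∑ g) n))
  where
  e : ∀ s n → n * (n * s) + n * (n * s) + n * (n * s) ≡ 3 * s * (n * n)
  e = solve-∀
  c₁ : ∑³ {n} (λ a b d → g a) ≡ n * (n * ∑ g)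
  c₁ = trans (∑-cong λ a → trans (∑-cong {n} λ b → ∑-const {n} (g a)) (∑-const {n} (n * g a))) (trans (∑-*ˡ n _) (cong (n *_) (∑-*ˡ n g)))
  c₂ : ∑³ {n} (λ a b d → g b) ≡ n * (n * ∑ g)
  c₂ = trans (∑-cong {n} λ a → trans (∑-cong λ b → ∑-const {n} (g b)) (∑-*ˡ n g)) (∑-const {n} (n * ∑ g))
  c₃ : ∑³ {n} (λ a b d → g d) ≡ n * (n * ∑ g)
  c₃ = trans (∑-cong {n} λ a → ∑-const {n} (∑ g)) (∑-const {n} (n * ∑ g))

private
  bump : ∀ {x} y {a b} → x ≤ 1 → 1 ≤ y → a ≤ b → x + 1 * (1 * (1 * a)) ≤ y + 1 * (1 * (1 * b))
  bump y p q r = +-mono-≤ (≤-trans p q) (*-monoʳ-≤ 1 (*-monoʳ-≤ 1 (*-monoʳ-≤ 1 r)))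

  -- One triple: g marks vertices of the coloured set, m mismatched ones; e, k, p are the edge, the target edge and the pattern.
  bits : ∀ ga gb gd ma mb md e k p → (ga ≡ true → gb ≡ true → gd ≡ true → e ≡ true → p ≡ true) →
    (ma ≡ false → mb ≡ false → md ≡ false → k ≡ true → p ≡ true) → (ma ≡ false → mb ≡ false → md ≡ false → e ≡ true → p ≡ true → k ≡ true) →
    b2n (e xor k) + b2n ga * (b2n gb * (b2n gd * b2n e)) ≤ (b2n (not ga) + b2n ma) + (b2n (not gb) + b2n mb) + (b2n (not gd) + b2n md) + b2n ga * (b2n gb * (b2n gd * b2n p))
  bits false gb gd ma mb md e k p _ _ _ = ≤-trans (≤-reflexive (+-identityʳ _)) (≤-trans (b2n≤1 (e xor k)) (s≤s z≤n))
  bits true false gd ma mb md e k p _ _ _ = ≤-trans (≤-reflexive (+-identityʳ _)) (≤-trans (b2n≤1 (e xor k)) (≤-trans (m≤n+m 1 (b2n ma)) (≤-trans (+-monoʳ-≤ (b2n ma) (s≤s z≤n)) (≤-trans (m≤m+n _ (b2n (not gd) + b2n md)) (m≤m+n _ _)))))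
  bits true true false ma mb md e k p _ _ _ = ≤-trans (≤-reflexive (+-identityʳ _)) (≤-trans (b2n≤1 (e xor k)) (≤-trans (≤-trans (s≤s z≤n) (m≤n+m (1 + b2n md) (b2n ma + b2n mb))) (m≤m+n _ _)))
  bits true true true true mb md e k p h _ _ = bump (1 + b2n mb + b2n md) (b2n≤1 (e xor k)) (s≤s z≤n) (b2n-mono (h refl refl refl))
  bits true true true false true md e k p h _ _ = bump (1 + b2n md) (b2n≤1 (e xor k)) (s≤s z≤n) (b2n-mono (h refl refl refl))
  bits true true true false false true e k p h _ _ = bump 1 (b2n≤1 (e xor k)) ≤-refl (b2n-mono (h refl refl refl))
  bits true true true false false false true k p h _ h′ with h refl refl refl refl
  ... | refl rewrite h′ refl refl refl refl refl = ≤-refl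
  bits true true true false false false false false p _ _ _ = z≤n
  bits true true true false false false false true p _ h _ rewrite h refl refl refl refl = ≤-refl

  loss-bits : ∀ ga gb gd e → b2n e ≤ b2n ga * (b2n gb * (b2n gd * b2n e)) + (b2n (not ga) + b2n (not gb) + b2n (not gd))
  loss-bits true true true e = ≤-trans (≤-reflexive (sym (trans (*-identityˡ _) (trans (*-identityˡ _) (*-identityˡ _))))) (m≤m+n _ 0)
  loss-bits false gb gd e = ≤-trans (b2n≤1 e) (s≤s z≤n)
  loss-bits true false gd e = ≤-trans (b2n≤1 e) (s≤s z≤n)
  loss-bits true true false e = b2n≤1 e

module Edit {n r : ℕ} (H K : Graph3 n) (P : Pattern r) (t : Fin n → Fin r)
  (K⇒P : ∀ a b d → edges K a b d ≡ true → P (t a) (t b) (t d) ≡ true)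
  (P⇒K : ∀ a b d → a ≢ b → b ≢ d → a ≢ d → P (t a) (t b) (t d) ≡ true → edges K a b d ≡ true)
  (G : Fin n → Bool) (c : Fin n → Fin r) (col : Colouring P (edges H) G c) where

  E = edges H

  u : Fin n → ℕ
  u x = b2n (G x)

  z : ℕ
  z = ∑ λ x → b2n (not (G x))

  size-u : ∑ u + z ≡ n
  size-u = trans (sym (∑-+ u _)) (trans (∑-cong λ x → lem (G x)) (∑-one {n}))
    where lem : ∀ b → b2n b + b2n (not b) ≡ 1
          lem true = refl
          lem false = refl

  class-split : ∀ i → weight c one i ≤ weight c u i + z
  class-split i = ≤-trans (∑-mono λ x → lem (G x) (c x == i)) (≤-reflexive (∑-+ _ _))
    where lem : ∀ g b → 1 * b2n b ≤ b2n g * b2n b + b2n (not g)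
          lem true b = m≤m+n _ 0
          lem false b = ≤-trans (≤-reflexive (*-identityˡ _)) (b2n≤1 b)

  loss : cube (kern E) one ≤ cube (kern E) u + 3 * z * (n * n)
  loss = ≤-trans (≤-reflexive (cube-one (kern E))) (≤-trans (∑³-mono λ a b d → loss-bits (G a) (G b) (G d) (E a b d)) (≤-reflexive (trans (∑³-+ _ _) (cong₂ _+_ (sym (cube-∑³ (kern E) u)) (∑³-corners _)))))

  cube-u : cube (kern E) u ≤ cube (kern P) (weight c u)
  cube-u = coloured-cube E P G c col u λ x p → in-G (G x) p
    where in-G : ∀ b → b2n b ≢ 0 → b ≡ true
          in-G true _ = refl
          in-G false p = ⊥-elim (p refl)

  module _ (σ : Permutation′ n) where
    private
      Kσ : Fin n → Fin n → Fin n → Bool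
      Kσ a b d = edges K (σ ⟨$⟩ʳ a) (σ ⟨$⟩ʳ b) (σ ⟨$⟩ʳ d)

      bad : Fin n → ℕ
      bad x = b2n (not (G x)) + b2n (mismatch c t σ x)

      σ-injective : ∀ {x y} → σ ⟨$⟩ʳ x ≡ σ ⟨$⟩ʳ y → x ≡ y
      σ-injective {x} {y} p = trans (sym (inverseˡ σ)) (trans (cong (σ ⟨$⟩ˡ_) p) (inverseˡ σ))

      matched : ∀ {x} → mismatch c t σ x ≡ false → c x ≡ t (σ ⟨$⟩ʳ x)
      matched {x} h = ==⇒≡ {x = c x} (notnot (c x == t (σ ⟨$⟩ʳ x)) h)
        where notnot : ∀ b → not b ≡ false → b ≡ true
              notnot true _ = refl

      E-distinct : ∀ {a b d} → E a b d ≡ true → a ≢ b × b ≢ d × a ≢ d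
      E-distinct {a} {b} {d} e = (λ { refl → true≢false (trans (sym e) (edges-irreflexive H a d)) }) , (λ { refl → true≢false (trans (sym e) (trans (rot (edges-symmetric H) a b b) (edges-irreflexive H b a))) }) , (λ { refl → true≢false (trans (sym e) (trans (swap₂₃ (edges-symmetric H) a b a) (edges-irreflexive H a b))) })

      pt : ∀ a b d → b2n (E a b d xor Kσ a b d) + u a * (u b * (u d * kern E a b d)) ≤ bad a + bad b + bad d + u a * (u b * (u d * kern P (c a) (c b) (c d)))
      pt a b d = bits (G a) (G b) (G d) (mismatch c t σ a) (mismatch c t σ b) (mismatch c t σ d) (E a b d) (Kσ a b d) (P (c a) (c b) (c d))
        (λ p q s e → col a b d p q s e)
        (λ p q s k → trans (pattern≡ p q s) (K⇒P _ _ _ k))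
        (λ p q s e pp → let (x , y , w) = E-distinct e in P⇒K _ _ _ (x ∘ σ-injective) (y ∘ σ-injective) (w ∘ σ-injective) (trans (sym (pattern≡ p q s)) pp))
        where
        pattern≡ : mismatch c t σ a ≡ false → mismatch c t σ b ≡ false → mismatch c t σ d ≡ false → P (c a) (c b) (c d) ≡ P (t (σ ⟨$⟩ʳ a)) (t (σ ⟨$⟩ʳ b)) (t (σ ⟨$⟩ʳ d))
        pattern≡ p q s = trans (cong₂ (λ x y → P x y (c d)) (matched p) (matched q)) (cong (P (t (σ ⟨$⟩ʳ a)) (t (σ ⟨$⟩ʳ b))) (matched s))

    -- Among coloured and matched vertices E is contained in the pattern, which there agrees with
    -- the relabelled K on distinct vertices; differing triples are thus paid for by the pattern
    -- count minus T(u). Every other triple is charged to a bad vertex.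
    edit-bound : 6 * editDist H K σ + cube (kern E) u ≤ 3 * (z + ∑ (b2n ∘ mismatch c t σ)) * (n * n) + cube (kern P) (weight c u)
    edit-bound = begin
      6 * editDist H K σ + cube (kern E) u ≡⟨ cong₂ _+_ (6*editDist H K σ) (cube-∑³ (kern E) u) ⟩
      ∑³ (λ a b d → b2n (E a b d xor Kσ a b d)) + ∑³ (λ a b d → u a * (u b * (u d * kern E a b d))) ≡⟨ sym (∑³-+ _ _) ⟩
      ∑³ (λ a b d → b2n (E a b d xor Kσ a b d) + u a * (u b * (u d * kern E a b d))) ≤⟨ ∑³-mono pt ⟩
      ∑³ (λ a b d → bad a + bad b + bad d + u a * (u b * (u d * kern P (c a) (c b) (c d)))) ≡⟨ ∑³-+ _ _ ⟩
      ∑³ (λ a b d → bad a + bad b + bad d) + ∑³ (λ a b d → u a * (u b * (u d * kern P (c a) (c b) (c d)))) ≡⟨ cong₂ _+_ (trans (∑³-corners bad) (cong (λ s → 3 * s * (n * n)) (∑-+ _ _))) (trans (sym (cube-∑³ (pullback c (kern P)) u)) (cube-push c (kern P) u)) ⟩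
      3 * (z + ∑ (b2n ∘ mismatch c t σ)) * (n * n) + cube (kern P) (weight c u) ∎
      where open ≤-Reasoning

private
  defect-arith : ∀ n M z Y K T Te Tp → 1 ≤ Y → M + z ≡ n → 108 * K * z ≤ n → 108 * z ≤ n → 4 * K ≤ Y → 4 * Y * (n * n * n) ≤ 9 * Y * T + n * n * n → T ≤ Te + 3 * z * (n * n) → Te ≤ Tp →
    4 * K * (M * M * M) ≤ 9 * K * Tp + M * M * M
  defect-arith .(M + z) M z Y K T Te Tp Y≥1 refl hK hz hY def hT hp = *-cancelˡ-≤ 4 (≤-cert (16 * K * (3 * M * M * z + 3 * M * z * z + z * z * z)) (s₁ ⊕ (36 * K) ⊛ hT ⊕ (36 * K) ⊛ hp ⊕ ((M + z) * (M + z)) ⊛ hK ⊕ two) (e K M z T Te Tp))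
    where
    m = M + z
    s₁ : 16 * K * ((M + z) * (M + z) * (M + z)) ≤ 36 * K * T + (M + z) * (M + z) * (M + z)
    s₁ = *-cancel-pos Y≥1 _ _ (≤-cert 0 ((4 * K) ⊛ def ⊕ (m * m * m) ⊛ hY) (e₁ Y K T (m * m * m)))
      where e₁ : ∀ Y K T m → Y * (36 * K * T + m) + (4 * K * (4 * Y * m) + m * (4 * K)) ≡ Y * (16 * K * m) + (4 * K * (9 * Y * T + m) + m * Y) + 0
            e₁ = solve-∀
    107z≤M : 107 * z ≤ M
    107z≤M = ≤-cert 0 hz (e₂ M z)
      where e₂ : ∀ M z → M + 108 * z ≡ 107 * z + (M + z) + 0
            e₂ = solve-∀
    two : 2 * ((M + z) * (M + z) * (M + z)) ≤ 4 * (M * M * M)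
    two = ≤-cert (M * M * M + 100 * (M * M * z) + 100 * (M * z * z) + 105 * (z * z * z)) ((M * M) ⊛ 107z≤M ⊕ (M * z) ⊛ 107z≤M ⊕ (z * z) ⊛ 107z≤M) (e₃ M z)
      where e₃ : ∀ M z → 4 * (M * M * M) + (M * M * (107 * z) + (M * z * (107 * z) + z * z * (107 * z))) ≡ 2 * ((M + z) * (M + z) * (M + z)) + (M * M * M + (M * z * M + z * z * M)) + (M * M * M + 100 * (M * M * z) + 100 * (M * z * z) + 105 * (z * z * z))
            e₃ = solve-∀
    e : ∀ K M z T Te Tp → 4 * (9 * K * Tp + M * M * M) + (16 * K * ((M + z) * (M + z) * (M + z)) + (36 * K * T + (36 * K * Te + ((M + z) * (M + z) * (108 * K * z) + 2 * ((M + z) * (M + z) * (M + z))))))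
      ≡ 4 * (4 * K * (M * M * M)) + (36 * K * T + (M + z) * (M + z) * (M + z) + (36 * K * (Te + 3 * z * ((M + z) * (M + z))) + (36 * K * Tp + ((M + z) * (M + z) * (M + z) + 4 * (M * M * M))))) + 16 * K * (3 * M * M * z + 3 * M * z * z + z * z * z)
    e = solve-∀

  edit-arith : ∀ d n z mis Y e h T Te Tp → 1 ≤ Y → 288 * d * z ≤ n → 216 * d ≤ n → 2 * d ≤ Y → 180 * d * mis ≤ 5 * n + 6 * (180 * d) * z + 6 * (180 * d) →
    4 * Y * (n * n * n) ≤ 9 * Y * T + n * n * n → 9 * T ≡ 54 * h → T ≤ Te + 3 * z * (n * n) → 9 * Tp ≤ 4 * (n * n * n) → 6 * e + Te ≤ 3 * (z + mis) * (n * n) + Tp → d * e ≤ h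
  edit-arith d n z mis Y e h T Te Tp Y≥1 hz hn hY hm def Th hT hp hE = *-cancelˡ-≤ 18 (≤-trans lhs rhs)
    where
    m = n * n * n
    rhs : m ≤ 18 * h
    rhs = *-cancelˡ-≤ 3 (*-cancel-pos Y≥1 _ _ (≤-cert 0 (def ⊕ m ⊛ Y≥1 ⊕ Y ⊛ ≤-reflexive Th) (e₁ Y m T h)))
      where e₁ : ∀ Y m T h → Y * (3 * (18 * h)) + (4 * Y * m + (m * 1 + Y * (9 * T))) ≡ Y * (3 * m) + (9 * Y * T + m + (m * Y + Y * (54 * h))) + 0
            e₁ = solve-∀
    edit₁ : 54 * Y * e ≤ 27 * Y * (2 * z + mis) * (n * n) + m
    edit₁ = ≤-cert 0 (def ⊕ (9 * Y) ⊛ hT ⊕ Y ⊛ hp ⊕ (9 * Y) ⊛ hE) (e₁ Y n z mis e T Te Tp)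
      where e₁ : ∀ Y n z mis e T Te Tp → 27 * Y * (2 * z + mis) * (n * n) + n * n * n + (4 * Y * (n * n * n) + (9 * Y * T + (Y * (9 * Tp) + 9 * Y * (6 * e + Te))))
              ≡ 54 * Y * e + (9 * Y * T + n * n * n + (9 * Y * (Te + 3 * z * (n * n)) + (Y * (4 * (n * n * n)) + 9 * Y * (3 * (z + mis) * (n * n) + Tp)))) + 0
            e₁ = solve-∀
    lhs : 18 * (d * e) ≤ m
    lhs = *-cancelˡ-≤ 540 (*-cancel-pos Y≥1 _ _ (≤-cert (45 * (Y * m)) ((180 * d) ⊛ edit₁ ⊕ (27 * Y * (n * n)) ⊛ hm ⊕ (135 * Y * (n * n)) ⊛ hz ⊕ (135 * Y * (n * n)) ⊛ hn ⊕ (90 * m) ⊛ hY) (e₂ d n z mis Y e)))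
      where e₂ : ∀ d n z mis Y e → Y * (540 * (n * n * n)) + (180 * d * (54 * Y * e) + (27 * Y * (n * n) * (180 * d * mis) + (135 * Y * (n * n) * (288 * d * z) + (135 * Y * (n * n) * (216 * d) + 90 * (n * n * n) * (2 * d)))))
              ≡ Y * (540 * (18 * (d * e))) + (180 * d * (27 * Y * (2 * z + mis) * (n * n) + n * n * n) + (27 * Y * (n * n) * (5 * n + 6 * (180 * d) * z + 6 * (180 * d)) + (135 * Y * (n * n) * n + (135 * Y * (n * n) * n + 90 * (n * n * n) * Y)))) + 45 * (Y * (n * n * n))
            e₂ = solve-∀

  -- `matching` charges only the excess of a class over its target, so an upper bound on the class
  -- weight suffices. The last 6A is the rounding in the target.
  class-arith : ∀ A X s M n q t z → A * (6 * X) ≤ A * (s * M) + 5 * M → M ≤ n → s * n ≤ 6 * t + 6 → q ≤ X + z → 6 * A * (q ∸ t) ≤ 5 * n + 6 * A * z + 6 * A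
  class-arith A X s M n q t z h₁ h₂ h₃ h₄ = ≤-trans (≤-reflexive (*-distribˡ-∸ (6 * A) q t)) (m≤n+o⇒m∸n≤o (6 * A * q) (6 * A * t) (≤-cert 0 ((6 * A) ⊛ h₄ ⊕ h₁ ⊕ (A * s + 5) ⊛ h₂ ⊕ A ⊛ h₃) (e A X s M n q t z)))
    where e : ∀ A X s M n q t z → 6 * A * t + (5 * n + 6 * A * z + 6 * A) + (6 * A * q + (A * (6 * X) + ((A * s + 5) * M + A * (s * n)))) ≡ 6 * A * q + (6 * A * (X + z) + (A * (s * M) + 5 * M + ((A * s + 5) * n + A * (6 * t + 6)))) + 0
          e = solve-∀

low-multiple : ∀ {n} (E : Fin n → Fin n → Fin n → Bool) (rules : Rules E) a → 432 * L ≤ n → let open Structure E rules in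
  Defect (Yτ * a) (cube (kern E) one) (∑ {n} one) → a * ∑ (λ x → b2n (not (high? one Kτ x))) ≤ n
low-multiple {n} E rules a n≥ def = *-cancel-pos Yτ≥1 _ _ (≤-trans (≤-reflexive (sym (*-assoc Yτ a z))) (≤-trans (≤-trans (≤-reflexive (cong (Yτ * a *_) (sym (∑-cong λ x → *-identityˡ (b2n (not (high? one Kτ x))))))) (low-weight one Kτ (Yτ * a) (≤-trans L≥1 (m≤n*m L 4)) (subst (1 ≤_) (sym N≡) n≥1) def)) (≤-trans (≤-reflexive (cong (6 * (Kτ * Kτ) *_) N≡)) (*-monoˡ-≤ n (≤-trans (≤-reflexive (e L)) (m≤m*n (96 * (L * L)) (144 * L) {{>-nonZero (*-mono-≤ {1} {144} (s≤s z≤n) L≥1)}}))))))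
  where
  open Structure E rules
  z = ∑ λ x → b2n (not (high? one Kτ x))
  N≡ : ∑ {n} one ≡ n
  N≡ = ∑-one {n}
  e : ∀ l → 6 * (4 * l * (4 * l)) ≡ 96 * (l * l)
  e = solve-∀
  n≥1 : 1 ≤ n
  n≥1 = ≤-trans L≥1 (≤-trans (m≤n*m L 432) n≥)

target : Fin 2 → ∀ m → Graph3 m
target 0F = G1
target 1F = Balanced

-- The accuracy needed for edit distance at most |H| / d.
accuracy : ℕ → ℕ
accuracy d = 216 * (180 * d * (180 * d))

module TwoStable (d : ℕ) (d≥1 : 1 ≤ d) {n : ℕ} (H : Graph3 n) (free : Free 𝓜 H) where
  private
    E = edges H
    rules = free-rules H free
    open Structure E rules

    A K Y : ℕ
    -- A = 180d is the accuracy of the class weights that edit distance |H|/d calls for, K = 2A² is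
    -- the defect accuracy required by `stable₆`, and `accuracy d` equals 108K.
    A = 180 * d
    K = 2 * A * A
    Y = Yτ * accuracy d

    A≥1 : 1 ≤ A
    A≥1 = *-mono-≤ {1} {180} (s≤s z≤n) d≥1

    accuracy≡ : accuracy d ≡ 108 * K
    accuracy≡ = e A
      where e : ∀ a → 216 * (a * a) ≡ 108 * (2 * a * a)
            e = solve-∀

    K≥1 : 1 ≤ K
    K≥1 = *-mono-≤ {1} {2 * A} (≤-trans A≥1 (m≤n*m A 2)) A≥1

    acc≤Y : accuracy d ≤ Y
    acc≤Y = ≤-trans (≤-reflexive (sym (*-identityˡ _))) (*-monoˡ-≤ (accuracy d) Yτ≥1)

    108K≤Y : 108 * K ≤ Y
    108K≤Y = ≤-trans (≤-reflexive (sym accuracy≡)) acc≤Y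

    A≤K : A ≤ K
    A≤K = ≤-trans (≤-reflexive (sym (*-identityˡ A))) (*-monoˡ-≤ A (≤-trans A≥1 (m≤n*m A 2)))

  module _ (n≥ : 432 * L ≤ n) (n≥′ : 216 * d ≤ n) (def : Defect (Yτ * accuracy d) (cube (kern E) one) n) where
    private
      N≡ : ∑ {n} one ≡ n
      N≡ = ∑-one {n}

      G : Fin n → Bool
      G = high? one Kτ

      def-one : Defect Y (cube (kern E) one) (∑ {n} one)
      def-one = subst (Defect Y (cube (kern E) one)) (sym N≡) def

      Y≥1 : 1 ≤ Y
      Y≥1 = ≤-trans (≤-trans K≥1 (m≤n*m K 108)) 108K≤Y

      good : Good E G
      good = near-extremal one (subst (432 * L ≤_) (sym N≡) n≥) (weaken Yτ (accuracy d) (cube (kern E) one) (∑ {n} one * ∑ {n} one * ∑ {n} one) (≤-trans (≤-trans K≥1 (m≤n*m K 108)) (≤-reflexive (sym accuracy≡))) def-one)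

      z : ℕ
      z = ∑ λ x → b2n (not (G x))

      z-small : accuracy d * z ≤ n
      z-small = low-multiple E rules (accuracy d) n≥ def-one

      108Kz : 108 * K * z ≤ n
      108Kz = subst (λ a → a * z ≤ n) accuracy≡ z-small

      108z : 108 * z ≤ n
      108z = ≤-trans (*-monoˡ-≤ z (m≤m*n 108 K {{>-nonZero K≥1}})) 108Kz

      288dz : 288 * d * z ≤ n
      288dz = ≤-trans (*-monoˡ-≤ z (≤-trans (≤-cert {288 * d} {108 * (180 * d)} (19152 * d) (≤-refl {0}) (e d)) (*-monoʳ-≤ 108 A≤K))) 108Kz
        where e : ∀ d → 108 * (180 * d) + 0 ≡ 288 * d + 0 + 19152 * d
              e = solve-∀

      2d≤Y : 2 * d ≤ Y
      2d≤Y = ≤-trans (≤-trans (*-monoˡ-≤ d (≤-by {2} {180} refl)) (≤-trans A≤K (m≤n*m K 108))) 108K≤Y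

      module Finish {r : ℕ} (r≤6 : r ≤ 6) (Kt : Graph3 n) (P : Pattern r) (t : Fin n → Fin r)
        (K⇒P : ∀ a b d → edges Kt a b d ≡ true → P (t a) (t b) (t d) ≡ true)
        (P⇒K : ∀ a b d → a ≢ b → b ≢ d → a ≢ d → P (t a) (t b) (t d) ≡ true → edges Kt a b d ≡ true)
        (c : Fin n → Fin r) (col : Colouring P E G c) (s : Fin r → ℕ)
        (bound : ∀ X → 9 * cube (kern P) X ≤ 4 * (∑ X * ∑ X * ∑ X))
        (stable : ∀ X → 1 ≤ ∑ X → Defect K (cube (kern P) X) (∑ X) → ∀ i → A * (6 * X i) ≤ A * (s i * ∑ X) + 5 * ∑ X)
        (shares : ∀ i → s i * n ≤ 6 * weight t one i + 6) where
        module D = Edit H Kt P t K⇒P P⇒K G c col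

        X : Fin r → ℕ
        X = weight c D.u

        M : ℕ
        M = ∑ X

        M≡ : M + z ≡ n
        M≡ = trans (cong (_+ z) (∑-weight c D.u)) D.size-u

        M≤n : M ≤ n
        M≤n = ≤-trans (m≤m+n M z) (≤-reflexive M≡)

        M≥1 : 1 ≤ M
        M≥1 = pos M z n M≡ 108z (≤-trans L≥1 (≤-trans (m≤n*m L 432) n≥))
          where
          pos : ∀ M z n → M + z ≡ n → 108 * z ≤ n → 1 ≤ n → 1 ≤ M
          pos (suc M) _ _ _ _ _ = s≤s z≤n
          pos zero z .z refl h p = ⊥-elim (<⇒≱ p (*-cancelˡ-≤ 107 (≤-cert 0 h (e z))))
            where e : ∀ z → 107 * 0 + 108 * z ≡ 107 * z + z + 0
                  e = solve-∀

        defX : Defect K (cube (kern P) X) M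
        defX = defect-arith n M z Y K (cube (kern E) one) (cube (kern E) D.u) (cube (kern P) X) Y≥1 M≡ 108Kz 108z (≤-trans (*-monoˡ-≤ K (≤-by {4} {108} refl)) 108K≤Y) def D.loss D.cube-u

        σ : Permutation′ n
        σ = proj₁ (matching c t)

        mis : ℕ
        mis = ∑ (b2n ∘ mismatch c t σ)

        mis-bound : 180 * d * mis ≤ 5 * n + 6 * (180 * d) * z + 6 * (180 * d)
        mis-bound = *-cancelˡ-≤ 6 (begin
          6 * (A * mis) ≡⟨ sym (*-assoc 6 A mis) ⟩
          6 * A * mis ≤⟨ *-monoʳ-≤ (6 * A) (proj₂ (matching c t)) ⟩
          6 * A * ∑ (λ i → weight c one i ∸ weight t one i) ≡⟨ sym (∑-*ˡ (6 * A) _) ⟩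
          ∑ (λ i → 6 * A * (weight c one i ∸ weight t one i)) ≤⟨ ∑-mono (λ i → class-arith A (X i) (s i) M n (weight c one i) (weight t one i) z (stable X M≥1 defX i) M≤n (shares i) (D.class-split i)) ⟩
          ∑ {r} (λ _ → 5 * n + 6 * A * z + 6 * A) ≡⟨ ∑-const {r} _ ⟩
          r * (5 * n + 6 * A * z + 6 * A) ≤⟨ *-monoˡ-≤ (5 * n + 6 * A * z + 6 * A) r≤6 ⟩
          6 * (5 * n + 6 * A * z + 6 * A) ∎)
          where open ≤-Reasoning

        close : Σ (Permutation′ n) λ σ → d * editDist H Kt σ ≤ ∣ H ∣E
        close = σ , edit-arith d n z mis Y (editDist H Kt σ) ∣ H ∣E (cube (kern E) one) (cube (kern E) D.u) (cube (kern P) X) Y≥1 288dz n≥′ 2d≤Y mis-bound def (sym (54*edges H)) D.loss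
          (≤-trans (bound X) (*-monoʳ-≤ 4 (*-mono-≤ (*-mono-≤ M≤n M≤n) M≤n))) (D.edit-bound σ)

    near-target : Σ (Fin 2) λ i → Σ (Permutation′ n) λ σ → d * editDist H (target i n) σ ≤ ∣ H ∣E
    near-target = by good
      where
      -- Six times the ideal shares 1/3 and 2/3, for a common normalisation with the six equal
      -- classes.
      s₂ : Fin 2 → ℕ
      s₂ 0F = 2
      s₂ 1F = 4
      stab₂ : ∀ X → 1 ≤ ∑ X → Defect K (cube (kern P₂) X) (∑ X) → ∀ i → A * (6 * X i) ≤ A * (s₂ i * ∑ X) + 5 * ∑ X
      stab₂ X M≥1 df = go
        where
        st = stable₂ {A} {K} X M≥1 (*-monoˡ-≤ A (m≤n*m A 2)) df
        l₀ : ∀ A x m → A * (3 * x) ≤ A * m + m → A * (6 * x) ≤ A * (2 * m) + 5 * m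
        l₀ A x m h = ≤-cert (3 * m) (2 ⊛ h) (e A x m)
          where e : ∀ A x m → A * (2 * m) + 5 * m + 2 * (A * (3 * x)) ≡ A * (6 * x) + 2 * (A * m + m) + 3 * m
                e = solve-∀
        l₁ : ∀ A x m → A * (3 * x) ≤ A * (2 * m) + m → A * (6 * x) ≤ A * (4 * m) + 5 * m
        l₁ A x m h = ≤-cert (3 * m) (2 ⊛ h) (e A x m)
          where e : ∀ A x m → A * (4 * m) + 5 * m + 2 * (A * (3 * x)) ≡ A * (6 * x) + 2 * (A * (2 * m) + m) + 3 * m
                e = solve-∀
        go : ∀ i → A * (6 * X i) ≤ A * (s₂ i * ∑ X) + 5 * ∑ X
        go 0F = l₀ A (X 0F) (∑ X) (proj₁ (proj₁ st))
        go 1F = l₁ A (X 1F) (∑ X) (proj₁ (proj₂ st))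
      shares₂ : ∀ i → s₂ i * n ≤ 6 * weight (col₂ n) one i + 6
      shares₂ 0F = subst (λ w → 2 * n ≤ 6 * w + 6) (sym (weight-A n)) (≤-cert 2 (2 ⊛ proj₁ (3*⌊n/3⌋ n)) (e n (n / 3)))
        where e : ∀ n q → 6 * q + 6 + 2 * n ≡ 2 * n + 2 * (3 * q + 2) + 2
              e = solve-∀
      shares₂ 1F = l n (n / 3) (weight (col₂ n) one 1F) (subst (λ w → w + weight (col₂ n) one 1F ≡ n) (weight-A n) (weight-AB n)) (proj₂ (3*⌊n/3⌋ n))
        where
        l : ∀ n q w → q + w ≡ n → 3 * q ≤ n → 4 * n ≤ 6 * w + 6
        l .(q + w) q w refl h = ≤-cert 6 (2 ⊛ h) (e q w)
          where e : ∀ q w → 6 * w + 6 + 2 * (3 * q) ≡ 4 * (q + w) + 2 * (q + w) + 6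
                e = solve-∀
      stab₆ : ∀ X → 1 ≤ ∑ X → Defect K (cube (kern P₆) X) (∑ X) → ∀ i → A * (6 * X i) ≤ A * (1 * ∑ X) + 5 * ∑ X
      stab₆ X M≥1 df i = subst (λ m → A * (6 * X i) ≤ A * m + 5 * ∑ X) (sym (*-identityˡ (∑ X))) (proj₁ (stable₆ {A} {K} X M≥1 (≤-trans (≤-by {10} {180} refl) (m≤m*n 180 d {{>-nonZero d≥1}})) ≤-refl df i))
      by : Good E G → Σ (Fin 2) λ i → Σ (Permutation′ n) λ σ → d * editDist H (target i n) σ ≤ ∣ H ∣E
      by (inj₁ (c , col)) = 0F , Finish.close (≤-by {2} {6} refl) (G1 n) P₂ (col₂ n) (edges-G1⇒ n) (⇒edges-G1 n) c col s₂ cube-bound₂ stab₂ shares₂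
      by (inj₂ (c , col)) = 1F , Finish.close ≤-refl (Balanced n) P₆ (col₆ n) (λ a b e h → trans (sym (edges-Blow (col₆ n) a b e)) h) (λ a b e _ _ _ h → trans (edges-Blow (col₆ n) a b e) h) c col (λ _ → 1) cube-bound₆ stab₆
        (λ i → ≤-trans (≤-reflexive (*-identityˡ n)) (weight-col₆-lower n i))

-- The two constructions are far apart

private
  six : Bool → Bool → Bool → Bool → Bool → Bool → Fin 6 → Bool
  six a b c d e f 0F = a
  six a b c d e f 1F = b
  six a b c d e f 2F = c
  six a b c d e f 3F = d
  six a b c d e f 4F = e
  six a b c d e f 5F = f

  six-agrees : ∀ (p : Fin 6 → Bool) x → six (p 0F) (p 1F) (p 2F) (p 3F) (p 4F) (p 5F) x ≡ p x
  six-agrees p 0F = refl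
  six-agrees p 1F = refl
  six-agrees p 2F = refl
  six-agrees p 3F = refl
  six-agrees p 4F = refl
  six-agrees p 5F = refl

  G26-bad : (Fin 6 → Bool) → Bool
  G26-bad p = ∃ᵇ λ x → ∃ᵇ λ y → ∃ᵇ λ z → P₆ x y z ∧ not (exactlyOne (p x) (p y) (p z))

  b₅ : Bool → Bool → Bool → Bool → Bool → Bool
  b₅ a b c d e = ∀ᵇ² λ f → G26-bad (six a b c d e f)
  b₄ : Bool → Bool → Bool → Bool → Bool
  b₄ a b c d = ∀ᵇ² (b₅ a b c d)
  b₃ : Bool → Bool → Bool → Bool
  b₃ a b c = ∀ᵇ² (b₄ a b c)
  b₂ : Bool → Bool → Bool
  b₂ a b = ∀ᵇ² (b₃ a b)

  opaque
    unfolding ∀ᵇ P₆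
    G26-checked : (∀ᵇ² λ a → ∀ᵇ² (b₂ a)) ≡ true
    G26-checked = refl

G26-not-semibipartite : ∀ (p : Fin 6 → Bool) → ∃ λ x → ∃ λ y → ∃ λ z → P₆ x y z ≡ true × exactlyOne (p x) (p y) (p z) ≡ false
G26-not-semibipartite p = let (x , h₁) = ∃ᵇ-sound bad ; (y , h₂) = ∃ᵇ-sound h₁ ; (z , h₃) = ∃ᵇ-sound h₂ ; (e , b) = ∧-true {P₆ x y z} h₃ in
    x , y , z , e , trans (sym (trans (cong₂ (λ u v → exactlyOne u v (q z)) (six-agrees p x) (six-agrees p y)) (cong (exactlyOne (p x) (p y)) (six-agrees p z)))) (not-true b)
  where
  q = six (p 0F) (p 1F) (p 2F) (p 3F) (p 4F) (p 5F)
  bad : G26-bad q ≡ true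
  bad = ∀ᵇ²-sound (λ f → G26-bad (six (p 0F) (p 1F) (p 2F) (p 3F) (p 4F) f))
    (∀ᵇ²-sound (b₅ (p 0F) (p 1F) (p 2F) (p 3F)) (∀ᵇ²-sound (b₄ (p 0F) (p 1F) (p 2F)) (∀ᵇ²-sound (b₃ (p 0F) (p 1F)) (∀ᵇ²-sound (b₂ (p 0F)) (∀ᵇ²-sound (λ a → ∀ᵇ² (b₂ a)) G26-checked (p 0F)) (p 1F)) (p 2F)) (p 3F)) (p 4F)) (p 5F)

∑³-product : ∀ {n} (f g h : Fin n → ℕ) → ∑³ (λ a b d → f a * (g b * h d)) ≡ ∑ f * (∑ g * ∑ h)
∑³-product f g h = trans (∑-cong λ a → trans (∑-cong λ b → trans (∑-*ˡ (f a) _) (cong (f a *_) (∑-*ˡ (g b) h))) (trans (∑-*ˡ (f a) _) (cong (f a *_) (∑-*ʳ g (∑ h))))) (∑-*ʳ f _)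

∑³-permute : ∀ {n} (σ : Permutation′ n) (f : Fin n → Fin n → Fin n → ℕ) → ∑³ (λ a b d → f (σ ⟨$⟩ʳ a) (σ ⟨$⟩ʳ b) (σ ⟨$⟩ʳ d)) ≡ ∑³ f
∑³-permute σ f = trans (∑-cong λ a → trans (∑-cong λ b → ∑-permute σ (f (σ ⟨$⟩ʳ a) (σ ⟨$⟩ʳ b))) (∑-permute σ (λ b → ∑ (f (σ ⟨$⟩ʳ a) b)))) (∑-permute σ (λ a → ∑ λ b → ∑ (f a b)))

opaque
  -- Any number above 48 · (16 + 16) = 1536 would do: the distances sum to at least k³/48, while
  -- each graph has at most 16k³ edges.
  gap : ℕ
  gap = 2000

  gap≥ : 2000 ≤ gap
  gap≥ = ≤-refl

-- Some pattern edge of G26 violates the majority sides of its three classes, and a positive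
-- proportion of the triples of these classes then distinguishes the two graphs.
module FarApart (k : ℕ) (k≥1 : 1 ≤ k) (K : Graph3 (k * 6)) (σ σ′ : Permutation′ (k * 6)) where
  private
    n = k * 6
    B A : Graph3 n
    B = Balanced n
    A = G1 n

    -- First σ, then the inverse of σ′: this relabels `G1` so that both constructions are compared
    -- with the same relabelling of K.
    ρ : Permutation′ n
    ρ = σ ∘ₚ invₚ σ′

    σ′ρ : ∀ x → σ′ ⟨$⟩ʳ (ρ ⟨$⟩ʳ x) ≡ σ ⟨$⟩ʳ x
    σ′ρ x = inverseʳ σ′

    side : Fin n → Bool
    side x = inA n (ρ ⟨$⟩ʳ x)

    c = col₆ n

    agree : Fin 6 → Bool → Fin n → ℕ
    agree i s x = b2n (c x == i) * b2n (if s then side x else not (side x))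

    halves : ∀ i → ∑ (agree i true) + ∑ (agree i false) ≡ k
    halves i = trans (sym (∑-+ _ _)) (trans (∑-cong λ x → lem (b2n (c x == i)) (side x)) (weight-col₆-exact k i))
      where lem : ∀ m s → m * b2n s + m * b2n (not s) ≡ 1 * m
            lem m true = e m
              where e : ∀ m → m * 1 + m * 0 ≡ 1 * m
                    e = solve-∀
            lem m false = e m
              where e : ∀ m → m * 0 + m * 1 ≡ 1 * m
                    e = solve-∀

    majority : Fin 6 → Bool
    majority i = ∑ (agree i false) ≤ᵇ ∑ (agree i true)

    half : ∀ i → k ≤ 2 * ∑ (agree i (majority i))
    half i = go (majority i) refl
      where
      go : ∀ b → majority i ≡ b → k ≤ 2 * ∑ (agree i b)
      go true h = l (∑ (agree i true)) (∑ (agree i false)) k (halves i) (≤-by h)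
        where l : ∀ x y k → x + y ≡ k → y ≤ x → k ≤ 2 * x
              l x y .(x + y) refl h = ≤-trans (+-monoʳ-≤ x h) (≤-reflexive (cong (x +_) (sym (+-identityʳ x))))
      go false h = l (∑ (agree i true)) (∑ (agree i false)) k (halves i) (<⇒≤ (≰⇒> λ q → subst T h (≤⇒≤ᵇ q)))
        where l : ∀ x y k → x + y ≡ k → x ≤ y → k ≤ 2 * y
              l x y .(x + y) refl h = ≤-trans (+-monoˡ-≤ y h) (≤-reflexive (cong (y +_) (sym (+-identityʳ y))))

    diff : Fin n → Fin n → Fin n → Bool
    diff a b d = edges B a b d xor edges A (ρ ⟨$⟩ʳ a) (ρ ⟨$⟩ʳ b) (ρ ⟨$⟩ʳ d)

    -- Such a triple is an edge of the blowup because ijl is a pattern edge, but its sides do not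
    -- have exactly one vertex in A, so it is no edge of the relabelled `G1`.
    differs : ∀ i j l → P₆ i j l ≡ true → exactlyOne (majority i) (majority j) (majority l) ≡ false → ∀ a b d →
      agree i (majority i) a * (agree j (majority j) b * agree l (majority l) d) ≤ b2n (diff a b d)
    differs i j l p q a b d = all-true (c a == i) (sd i a) (c b == j) (sd j b) (c d == l) (sd l d) (diff a b d) λ x₁ y₁ x₂ y₂ x₃ y₃ →
        cong₂ _xor_ (trans (edges-Blow c a b d) (trans (cong₂ (λ u v → P₆ u v (c d)) (==⇒≡ {x = c a} {i} x₁) (==⇒≡ {x = c b} {j} x₂)) (trans (cong (P₆ i j) (==⇒≡ {x = c d} {l} x₃)) p)))
          (¬true λ e → true≢false (trans (sym (trans (sym (P₂-col₂ n _ _ _)) (edges-G1⇒ n _ _ _ e))) (trans (cong₂ (λ u v → exactlyOne u v (side d)) (side≡ i a y₁) (side≡ j b y₂)) (trans (cong (exactlyOne (majority i) (majority j)) (side≡ l d y₃)) q))))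
      where
      sd : Fin 6 → Fin n → Bool
      sd i x = if majority i then side x else not (side x)
      choice : ∀ m s → (if m then s else not s) ≡ true → s ≡ m
      choice true s h = h
      choice false s h = not-true h
      side≡ : ∀ i x → sd i x ≡ true → side x ≡ majority i
      side≡ i x = choice (majority i) (side x)
      all-true : ∀ x₁ y₁ x₂ y₂ x₃ y₃ z → (x₁ ≡ true → y₁ ≡ true → x₂ ≡ true → y₂ ≡ true → x₃ ≡ true → y₃ ≡ true → z ≡ true) → b2n x₁ * b2n y₁ * (b2n x₂ * b2n y₂ * (b2n x₃ * b2n y₃)) ≤ b2n z
      all-true false y₁ x₂ y₂ x₃ y₃ z h = z≤n
      all-true true false x₂ y₂ x₃ y₃ z h = z≤n
      all-true true true false y₂ x₃ y₃ z h = z≤n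
      all-true true true true false x₃ y₃ z h = z≤n
      all-true true true true true false y₃ z h = z≤n
      all-true true true true true true false z h = z≤n
      all-true true true true true true true z h rewrite h refl refl refl refl refl refl = ≤-refl

    triangle : ∑³ (λ a b d → b2n (diff a b d)) ≤ 6 * editDist B K σ + 6 * editDist A K σ′
    triangle = begin
      ∑³ (λ a b d → b2n (diff a b d)) ≤⟨ ∑³-mono (λ a b d → xor-triangle (edges B a b d) _ (edges K (σ ⟨$⟩ʳ a) (σ ⟨$⟩ʳ b) (σ ⟨$⟩ʳ d))) ⟩
      ∑³ (λ a b d → b2n (edges B a b d xor edges K (σ ⟨$⟩ʳ a) (σ ⟨$⟩ʳ b) (σ ⟨$⟩ʳ d)) + b2n (edges A (ρ ⟨$⟩ʳ a) (ρ ⟨$⟩ʳ b) (ρ ⟨$⟩ʳ d) xor edges K (σ ⟨$⟩ʳ a) (σ ⟨$⟩ʳ b) (σ ⟨$⟩ʳ d))) ≡⟨ ∑³-+ _ _ ⟩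
      ∑³ (λ a b d → b2n (edges B a b d xor edges K (σ ⟨$⟩ʳ a) (σ ⟨$⟩ʳ b) (σ ⟨$⟩ʳ d))) + ∑³ (λ a b d → b2n (edges A (ρ ⟨$⟩ʳ a) (ρ ⟨$⟩ʳ b) (ρ ⟨$⟩ʳ d) xor edges K (σ ⟨$⟩ʳ a) (σ ⟨$⟩ʳ b) (σ ⟨$⟩ʳ d))) ≡⟨ cong₂ _+_ (sym (6*editDist B K σ)) second ⟩
      6 * editDist B K σ + 6 * editDist A K σ′ ∎
      where
      open ≤-Reasoning
      xor-triangle : ∀ x y z → b2n (x xor y) ≤ b2n (x xor z) + b2n (y xor z)
      xor-triangle true true z = z≤n
      xor-triangle true false true = ≤-refl
      xor-triangle true false false = ≤-refl
      xor-triangle false true true = ≤-refl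
      xor-triangle false true false = ≤-refl
      xor-triangle false false z = z≤n
      g : Fin n → Fin n → Fin n → ℕ
      g a b d = b2n (edges A a b d xor edges K (σ′ ⟨$⟩ʳ a) (σ′ ⟨$⟩ʳ b) (σ′ ⟨$⟩ʳ d))
      second : ∑³ (λ a b d → b2n (edges A (ρ ⟨$⟩ʳ a) (ρ ⟨$⟩ʳ b) (ρ ⟨$⟩ʳ d) xor edges K (σ ⟨$⟩ʳ a) (σ ⟨$⟩ʳ b) (σ ⟨$⟩ʳ d))) ≡ 6 * editDist A K σ′
      second = trans (∑³-cong λ a b d → cong (λ e → b2n (edges A (ρ ⟨$⟩ʳ a) (ρ ⟨$⟩ʳ b) (ρ ⟨$⟩ʳ d) xor e)) (trans (cong₂ (λ x y → edges K x y (σ ⟨$⟩ʳ d)) (sym (σ′ρ a)) (sym (σ′ρ b))) (cong (edges K (σ′ ⟨$⟩ʳ (ρ ⟨$⟩ʳ a)) (σ′ ⟨$⟩ʳ (ρ ⟨$⟩ʳ b))) (sym (σ′ρ d))))) (trans (∑³-permute ρ g) (sym (6*editDist A K σ′)))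

    -- Each majority holds at least k/2 of its class, which gives k³/8 ordered differing triples;
    -- the edit distances count unordered ones, and 8 · 6 = 48.
    lower : k * k * k ≤ 48 * (editDist B K σ + editDist A K σ′)
    lower = let (i , j , l , p , q) = G26-not-semibipartite majority in at i j l p q
      where
      at : ∀ i j l → P₆ i j l ≡ true → exactlyOne (majority i) (majority j) (majority l) ≡ false → k * k * k ≤ 48 * (editDist B K σ + editDist A K σ′)
      at i j l p q = begin
        k * k * k ≤⟨ *-mono-≤ (*-mono-≤ (half i) (half j)) (half l) ⟩
        2 * x * (2 * y) * (2 * w) ≡⟨ e x y w ⟩
        8 * (x * (y * w)) ≡⟨ cong (8 *_) (sym (∑³-product (agree i (majority i)) (agree j (majority j)) (agree l (majority l)))) ⟩
        8 * ∑³ (λ a b d → agree i (majority i) a * (agree j (majority j) b * agree l (majority l) d)) ≤⟨ *-monoʳ-≤ 8 (≤-trans (∑³-mono (differs i j l p q)) triangle) ⟩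
        8 * (6 * editDist B K σ + 6 * editDist A K σ′) ≡⟨ e′ (editDist B K σ) (editDist A K σ′) ⟩
        48 * (editDist B K σ + editDist A K σ′) ∎
        where
        open ≤-Reasoning
        x = ∑ (agree i (majority i))
        y = ∑ (agree j (majority j))
        w = ∑ (agree l (majority l))
        e : ∀ x y z → 2 * x * (2 * y) * (2 * z) ≡ 8 * (x * (y * z))
        e = solve-∀
        e′ : ∀ x y → 8 * (6 * x + 6 * y) ≡ 48 * (x + y)
        e′ = solve-∀

  far-apart : gap * editDist B K σ ≤ ∣ B ∣E → gap * editDist A K σ′ ≤ ∣ A ∣E → ⊥
  far-apart h₁ h₂ = arith (k * k * k) (editDist B K σ) (editDist A K σ′) ∣ B ∣E ∣ A ∣E (*-mono-≤ (*-mono-≤ k≥1 k≥1) k≥1) lower (≤-trans (*-monoˡ-≤ (editDist B K σ) gap≥) h₁) (≤-trans (*-monoˡ-≤ (editDist A K σ′) gap≥) h₂) (≤-reflexive (Balanced-count k)) A≤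
    where
    A≤ : ∣ A ∣E ≤ 16 * (k * k * k)
    A≤ = *-cancelˡ-≤ 54 (≤-trans (≤-reflexive (54*edges A)) (≤-trans (Structure.cube-bound (edges A) (free-rules A (G1-free n)) one) (≤-reflexive (trans (cong (λ m → 4 * (m * m * m)) (∑-one {n})) (e k)))))
      where e : ∀ k → 4 * (k * 6 * (k * 6) * (k * 6)) ≡ 54 * (16 * (k * k * k))
            e = solve-∀
    arith : ∀ m x y b a → 1 ≤ m → m ≤ 48 * (x + y) → 2000 * x ≤ b → 2000 * y ≤ a → b ≤ 16 * m → a ≤ 16 * m → ⊥
    arith m x y b a m≥1 h h₁ h₂ h₃ h₄ = <⇒≱ m≥1 (*-cancelˡ-≤ 29 (≤-cert 0 (125 ⊛ h ⊕ 3 ⊛ (h₁ ⊕ h₂ ⊕ h₃ ⊕ h₄)) (e m x y b a)))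
      where e : ∀ m x y b a → 29 * 0 + (125 * m + 3 * (2000 * x + (2000 * y + (b + a)))) ≡ 29 * m + (125 * (48 * (x + y)) + 3 * (b + (a + (16 * m + 16 * m)))) + 0
            e = solve-∀

-- Natural numbers inside ℚ

private
  ιᵘ : ∀ n → toℚᵘ (ℕ→ℚ n) ℚᵘ.≃ ℚᵘ.mkℚᵘ (ℤ.+ n) 0
  ιᵘ n = ℚₚ.toℚᵘ-fromℚᵘ (ℚᵘ.mkℚᵘ (ℤ.+ n) 0)

ι-mono-≤ : ∀ {m n} → m ≤ n → ℕ→ℚ m ℚ.≤ ℕ→ℚ n
ι-mono-≤ {m} {n} h = ℚₚ.toℚᵘ-cancel-≤ (ℚᵘₚ.≤-respˡ-≃ (ℚᵘₚ.≃-sym (ιᵘ m)) (ℚᵘₚ.≤-respʳ-≃ (ℚᵘₚ.≃-sym (ιᵘ n)) (ℚᵘ.*≤* (ℤₚ.*-monoʳ-≤-nonNeg (ℤ.+ 1) (ℤ.+≤+ h)))))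

ι-cancel-≤ : ∀ {m n} → ℕ→ℚ m ℚ.≤ ℕ→ℚ n → m ≤ n
ι-cancel-≤ {m} {n} h = go (ℚᵘₚ.≤-respˡ-≃ (ιᵘ m) (ℚᵘₚ.≤-respʳ-≃ (ιᵘ n) (ℚₚ.toℚᵘ-mono-≤ h)))
  where
  go : ℚᵘ.mkℚᵘ (ℤ.+ m) 0 ℚᵘ.≤ ℚᵘ.mkℚᵘ (ℤ.+ n) 0 → m ≤ n
  go (ℚᵘ.*≤* q) = ℤₚ.drop‿+≤+ (subst₂ ℤ._≤_ (ℤₚ.*-identityʳ (ℤ.+ m)) (ℤₚ.*-identityʳ (ℤ.+ n)) q)

ι-mono-< : ∀ {m n} → m < n → ℕ→ℚ m ℚ.< ℕ→ℚ n
ι-mono-< {m} {n} h = ℚₚ.≰⇒> λ q → <⇒≱ h (ι-cancel-≤ q)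

ι-+ : ∀ m n → ℕ→ℚ (m + n) ≡ ℕ→ℚ m ℚ.+ ℕ→ℚ n
ι-+ m n = ℚₚ.toℚᵘ-injective (ℚᵘₚ.≃-trans (ιᵘ (m + n)) (ℚᵘₚ.≃-sym (ℚᵘₚ.≃-trans (ℚₚ.toℚᵘ-homo-+ (ℕ→ℚ m) (ℕ→ℚ n)) (ℚᵘₚ.≃-trans (ℚᵘₚ.+-cong (ιᵘ m) (ιᵘ n)) (ℚᵘ.*≡* (cong (ℤ._* ℤ.+ 1) (cong₂ ℤ._+_ (ℤₚ.*-identityʳ (ℤ.+ m)) (ℤₚ.*-identityʳ (ℤ.+ n)))))))))

ι-* : ∀ m n → ℕ→ℚ (m * n) ≡ ℕ→ℚ m ℚ.* ℕ→ℚ n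
ι-* m n = ℚₚ.toℚᵘ-injective (ℚᵘₚ.≃-trans (ιᵘ (m * n)) (ℚᵘₚ.≃-sym (ℚᵘₚ.≃-trans (ℚₚ.toℚᵘ-homo-* (ℕ→ℚ m) (ℕ→ℚ n)) (ℚᵘₚ.≃-trans (ℚᵘₚ.*-cong (ιᵘ m) (ιᵘ n)) (ℚᵘ.*≡* (cong (ℤ._* ℤ.+ 1) (sym (ℤₚ.pos-* m n))))))))

ι-nonNeg : ∀ n → ℚ.NonNegative (ℕ→ℚ n)
ι-nonNeg n = ℚ.nonNegative (ι-mono-≤ {0} {n} z≤n)

opaque
  recip : ∀ q → 1 ≤ q → ℚ
  recip (suc q) _ = ℤ.+ 1 ℚ./ suc q

  recip-inverse : ∀ q (h : 1 ≤ q) → ℕ→ℚ q ℚ.* recip q h ≡ 1ℚ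
  recip-inverse (suc q) h = ℚₚ.toℚᵘ-injective (ℚᵘₚ.≃-trans (ℚₚ.toℚᵘ-homo-* (ℕ→ℚ (suc q)) (ℤ.+ 1 ℚ./ suc q)) (ℚᵘₚ.≃-trans (ℚᵘₚ.*-cong (ιᵘ (suc q)) (ℚₚ.toℚᵘ-fromℚᵘ (ℚᵘ.mkℚᵘ (ℤ.+ 1) q))) (ℚᵘ.*≡* (trans (cong (ℤ._* ℤ.+ 1) (ℤₚ.*-identityʳ (ℤ.+ suc q))) (trans (ℤₚ.*-identityʳ (ℤ.+ suc q)) (cong ℤ.+_ (sym (trans (*-identityˡ _) (*-identityˡ (suc q))))))))))

  recip-positive : ∀ q h → 0ℚ ℚ.< recip q h
  recip-positive (suc q) h = ℚₚ.positive⁻¹ (ℤ.+ 1 ℚ./ suc q) {{ℚₚ.normalize-pos 1 (suc q)}}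

-- The denominator of δ serves as d, since the numerator is at least 1.
archimedes : ∀ δ → 0ℚ ℚ.< δ → Σ ℕ λ d → 1 ≤ d × 1ℚ ℚ.≤ ℕ→ℚ d ℚ.* δ
archimedes δ@(ℚ.mkℚ (ℤ.+ zero) d-1 c) (ℚ.*<* (ℤ.+<+ ()))
archimedes δ@(ℚ.mkℚ ℤ.-[1+ p ] d-1 c) (ℚ.*<* ())
archimedes δ@(ℚ.mkℚ (ℤ.+ suc p) d-1 c) _ = suc d-1 , s≤s z≤n , ℚₚ.toℚᵘ-cancel-≤ (ℚᵘₚ.≤-respʳ-≃ (ℚᵘₚ.≃-sym (ℚᵘₚ.≃-trans (ℚₚ.toℚᵘ-homo-* (ℕ→ℚ (suc d-1)) δ) (ℚᵘₚ.*-cong (ιᵘ (suc d-1)) ℚᵘₚ.≃-refl))) (ℚᵘ.*≤* (ℤ.+≤+ le)))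
  where
  le : 1 * (1 * suc d-1) ≤ suc d-1 * suc p * 1
  le = ≤-trans (≤-reflexive (trans (*-identityˡ _) (*-identityˡ _))) (≤-trans (m≤m*n (suc d-1) (suc p)) (≤-reflexive (sym (*-identityʳ _))))

scaled-≤ : ∀ {d δ z n} → 0ℚ ℚ.< δ → 1ℚ ℚ.≤ ℕ→ℚ d ℚ.* δ → d * z ≤ n → ℕ→ℚ z ℚ.≤ δ ℚ.* ℕ→ℚ n
scaled-≤ {d} {δ} {z} {n} δ>0 h dz≤n = begin
  ℕ→ℚ z ≡⟨ sym (ℚₚ.*-identityˡ (ℕ→ℚ z)) ⟩
  1ℚ ℚ.* ℕ→ℚ z ≤⟨ ℚₚ.*-monoʳ-≤-nonNeg (ℕ→ℚ z) {{ι-nonNeg z}} h ⟩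
  ℕ→ℚ d ℚ.* δ ℚ.* ℕ→ℚ z ≡⟨ trans (cong (ℚ._* ℕ→ℚ z) (ℚₚ.*-comm (ℕ→ℚ d) δ)) (trans (ℚₚ.*-assoc δ (ℕ→ℚ d) (ℕ→ℚ z)) (cong (δ ℚ.*_) (sym (ι-* d z)))) ⟩
  δ ℚ.* ℕ→ℚ (d * z) ≤⟨ ℚₚ.*-monoˡ-≤-nonNeg δ {{ℚ.nonNegative (ℚₚ.<⇒≤ δ>0)}} (ι-mono-≤ dz≤n) ⟩
  δ ℚ.* ℕ→ℚ n ∎
  where open ℚₚ.≤-Reasoning

unscaled-≤ : ∀ {q} h {x y} → ℕ→ℚ x ℚ.≤ recip q h ℚ.* ℕ→ℚ y → q * x ≤ y
unscaled-≤ {q} h {x} {y} le = ι-cancel-≤ (begin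
  ℕ→ℚ (q * x) ≡⟨ ι-* q x ⟩
  ℕ→ℚ q ℚ.* ℕ→ℚ x ≤⟨ ℚₚ.*-monoˡ-≤-nonNeg (ℕ→ℚ q) {{ι-nonNeg q}} le ⟩
  ℕ→ℚ q ℚ.* (recip q h ℚ.* ℕ→ℚ y) ≡⟨ trans (sym (ℚₚ.*-assoc (ℕ→ℚ q) (recip q h) (ℕ→ℚ y))) (trans (cong (ℚ._* ℕ→ℚ y) (recip-inverse q h)) (ℚₚ.*-identityˡ (ℕ→ℚ y))) ⟩
  ℕ→ℚ y ∎)
  where open ℚₚ.≤-Reasoning

private
  move : ∀ a b c → a ℚ.- b ℚ.≤ c → a ℚ.≤ c ℚ.+ b
  move a b c h = subst (ℚ._≤ c ℚ.+ b) (solve 2 (λ a b → a :- b :+ b := a) refl a b) (ℚₚ.+-monoˡ-≤ b h)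
    where open +-*-Solver

density-≤ : ∀ {q} h N m → (ℤ.+ 2 ℚ./ 27) ℚ.* ℕ→ℚ N ℚ.- recip q h ℚ.* ℕ→ℚ N ℚ.≤ ℕ→ℚ m → 2 * q * N ≤ 27 * q * m + 27 * N
density-≤ {q} h N m le = ι-cancel-≤ (subst₂ ℚ._≤_ lhs rhs (move (W ℚ.* (t ℚ.* n)) (W ℚ.* (ε ℚ.* n)) (W ℚ.* ℕ→ℚ m) (subst (ℚ._≤ W ℚ.* ℕ→ℚ m) (expand W (t ℚ.* n) (ε ℚ.* n)) (ℚₚ.*-monoˡ-≤-nonNeg W {{ι-nonNeg (27 * q)}} le))))
  where
  Q = ℕ→ℚ q
  ε = recip q h
  n = ℕ→ℚ N
  t = ℤ.+ 2 ℚ./ 27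
  W = ℕ→ℚ (27 * q)
  W≡ : W ≡ ℕ→ℚ 27 ℚ.* Q
  W≡ = ι-* 27 q
  open +-*-Solver
  expand : ∀ w a b → w ℚ.* (a ℚ.- b) ≡ w ℚ.* a ℚ.- w ℚ.* b
  expand = solve 3 (λ w a b → w :* (a :- b) := w :* a :- w :* b) refl
  lhs : W ℚ.* (t ℚ.* n) ≡ ℕ→ℚ (2 * q * N)
  lhs = trans (cong (ℚ._* (t ℚ.* n)) W≡) (trans (solve 4 (λ a q t n → a :* q :* (t :* n) := a :* t :* q :* n) refl (ℕ→ℚ 27) Q t n) (sym (trans (ι-* (2 * q) N) (cong (ℚ._* n) (ι-* 2 q)))))
  rhs : W ℚ.* ℕ→ℚ m ℚ.+ W ℚ.* (ε ℚ.* n) ≡ ℕ→ℚ (27 * q * m + 27 * N)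
  rhs = sym (trans (ι-+ (27 * q * m) (27 * N)) (cong₂ ℚ._+_ (ι-* (27 * q) m) (trans (ι-* 27 N) (trans (sym (cong (ℕ→ℚ 27 ℚ.*_) (trans (cong (ℚ._* n) (recip-inverse q h)) (ℚₚ.*-identityˡ n)))) (trans (solve 4 (λ a q e n → a :* (q :* e :* n) := a :* q :* (e :* n)) refl (ℕ→ℚ 27) Q ε n) (cong (ℚ._* (ε ℚ.* n)) (sym W≡)))))))

private
  factor : ∀ q ε e → q ℚ.* ((1ℚ ℚ.- ε) ℚ.* e) ≡ q ℚ.* e ℚ.- q ℚ.* ε ℚ.* e
  factor = solve 3 (λ q ε e → q :* ((con 1ℚ :- ε) :* e) := q :* e :- q :* ε :* e) refl
    where open +-*-Solver

fraction-≤ : ∀ {q} h e m → (1ℚ ℚ.- recip q h) ℚ.* ℕ→ℚ e ℚ.< ℕ→ℚ m → q * e ≤ q * m + e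
fraction-≤ {q} h e m lt = ι-cancel-≤ (subst₂ ℚ._≤_ (sym (ι-* q e)) (sym (trans (ι-+ (q * m) e) (cong (ℚ._+ ℕ→ℚ e) (ι-* q m)))) (move (Q ℚ.* ℕ→ℚ e) (ℕ→ℚ e) (Q ℚ.* ℕ→ℚ m) (subst (ℚ._≤ Q ℚ.* ℕ→ℚ m) eq (ℚₚ.*-monoˡ-≤-nonNeg Q {{ι-nonNeg q}} (ℚₚ.<⇒≤ lt)))))
  where
  Q = ℕ→ℚ q
  eq : Q ℚ.* ((1ℚ ℚ.- recip q h) ℚ.* ℕ→ℚ e) ≡ Q ℚ.* ℕ→ℚ e ℚ.- ℕ→ℚ e
  eq = trans (factor Q (recip q h) (ℕ→ℚ e)) (cong (λ x → Q ℚ.* ℕ→ℚ e ℚ.- x) (trans (cong (ℚ._* ℕ→ℚ e) (recip-inverse q h)) (ℚₚ.*-identityˡ (ℕ→ℚ e))))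

⇒fraction-< : ∀ {q ε} e m → 1ℚ ℚ.≤ ℕ→ℚ q ℚ.* ε → q * e < q * m + e → (1ℚ ℚ.- ε) ℚ.* ℕ→ℚ e ℚ.< ℕ→ℚ m
⇒fraction-< {q} {ε} e m h lt = ℚₚ.*-cancelˡ-<-nonNeg Q {{ι-nonNeg q}} (ℚₚ.≤-<-trans upper (subst (λ x → Q ℚ.* ℕ→ℚ e ℚ.- ℕ→ℚ e ℚ.< x) cancel (ℚₚ.+-monoˡ-< (ℚ.- ℕ→ℚ e) strict)))
  where
  open +-*-Solver
  Q = ℕ→ℚ q
  upper : Q ℚ.* ((1ℚ ℚ.- ε) ℚ.* ℕ→ℚ e) ℚ.≤ Q ℚ.* ℕ→ℚ e ℚ.- ℕ→ℚ e
  upper = ℚₚ.≤-trans (ℚₚ.≤-reflexive (factor Q ε (ℕ→ℚ e))) (ℚₚ.+-monoʳ-≤ (Q ℚ.* ℕ→ℚ e) (ℚₚ.neg-antimono-≤ (ℚₚ.≤-trans (ℚₚ.≤-reflexive (sym (ℚₚ.*-identityˡ (ℕ→ℚ e)))) (ℚₚ.*-monoʳ-≤-nonNeg (ℕ→ℚ e) {{ι-nonNeg e}} h))))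
  strict : Q ℚ.* ℕ→ℚ e ℚ.< Q ℚ.* ℕ→ℚ m ℚ.+ ℕ→ℚ e
  strict = subst₂ ℚ._<_ (ι-* q e) (trans (ι-+ (q * m) e) (cong (ℚ._+ ℕ→ℚ e) (ι-* q m))) (ι-mono-< lt)
  cancel : Q ℚ.* ℕ→ℚ m ℚ.+ ℕ→ℚ e ℚ.- ℕ→ℚ e ≡ Q ℚ.* ℕ→ℚ m
  cancel = solve 2 (λ a e → a :+ e :- e := a) refl (Q ℚ.* ℕ→ℚ m) (ℕ→ℚ e)

-- Vertex stability, 2-stability, and failure of stability with fewer targets

private
  cube-power : ∀ n → n ^ 3 ≡ n * n * n
  cube-power n = e n
    where e : ∀ n → n * (n * (n * 1)) ≡ n * n * n
          e = solve-∀

  Good⇒coloured : ∀ {n} (H : Graph3 n) U → Good (edges H) U → (en : Enumeration U) →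
    Semibipartite (pull H (Enumeration.elem en)) ⊎ G26Colorable (pull H (Enumeration.elem en))
  Good⇒coloured {n} H U good en = by good
    where
    open Enumeration en
    F = pull H elem
    F-edge : ∀ a b d → edge? F a b d ≡ true → edges H (elem a) (elem b) (elem d) ≡ true
    F-edge a b d e = trans (edges≡ H _ _ _) (edge?⇒ F (symmetric₃-∘ elem (edge?-symmetric H)) a b d e)
    by : Good (edges H) U → Semibipartite F ⊎ G26Colorable F
    by (inj₁ (c , col)) = inj₁ ((λ x → c (elem x) == 0F) , λ a b d e → trans (sym (P₂≡ _ _ _)) (col _ _ _ (elem-∈ a) (elem-∈ b) (elem-∈ d) (F-edge a b d e)))
    -- A blowup needs nonempty parts; six additional vertices, one of each colour, make π
    -- surjective.
    by (inj₂ (c , col)) = inj₂ (6 + size , π , surj , emb , (λ p → Finₚ.↑ʳ-injective 6 _ _ p) , hom)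
      where
      π : Fin (6 + size) → Fin 6
      π 0F = 0F
      π 1F = 1F
      π 2F = 2F
      π 3F = 3F
      π 4F = 4F
      π 5F = 5F
      π (suc (suc (suc (suc (suc (suc x)))))) = c (elem x)
      surj : Surjective6 π
      surj 0F = 0F , refl
      surj 1F = 1F , refl
      surj 2F = 2F , refl
      surj 3F = 3F , refl
      surj 4F = 4F , refl
      surj 5F = 5F , refl
      emb : Fin size → Fin (6 + size)
      emb = 6 ↑ʳ_
      hom : ∀ a b d → edge? F a b d ≡ true → edge? (Blow π) (emb a) (emb b) (emb d) ≡ true
      hom a b d e = trans (sym (edges≡ (Blow π) _ _ _)) (trans (edges-Blow π (emb a) (emb b) (emb d)) (col _ _ _ (elem-∈ a) (elem-∈ b) (elem-∈ d) (F-edge a b d e)))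

vertex-stability : ∀ (δ : ℚ) → 0ℚ ℚ.< δ → Σ ℚ λ ε → 0ℚ ℚ.< ε × Σ ℕ λ n₀ →
  ∀ n → n₀ ≤ n → ∀ (H : Graph3 n) → Free 𝓜 H →
    ((ℤ.+ 2 ℚ./ 27) ℚ.* ℕ→ℚ (n ^ 3) ℚ.- ε ℚ.* ℕ→ℚ (n ^ 3)) ℚ.≤ ℕ→ℚ ∣ H ∣E →
    Σ ℕ λ m → Σ (Fin m → Fin n) λ ι → Injective _≡_ _≡_ ι × (ℕ→ℚ (n ∸ m) ℚ.≤ δ ℚ.* ℕ→ℚ n) × (Semibipartite (pull H ι) ⊎ G26Colorable (pull H ι))
vertex-stability δ δ>0 = recip q q≥1 , recip-positive q q≥1 , 432 * L , main
  where
  d = proj₁ (archimedes δ δ>0)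
  d≥1 = proj₁ (proj₂ (archimedes δ δ>0))
  Y q : ℕ
  Y = Yτ * d
  -- With ε = 1/q, a deficit of n³/54Y edges is a deficit of n³/9Y in T = 6|H|, which is precisely
  -- `Defect Y`.
  q = 54 * Y
  Y≥1 : 1 ≤ Y
  Y≥1 = *-mono-≤ Yτ≥1 d≥1
  q≥1 : 1 ≤ q
  q≥1 = ≤-trans Y≥1 (m≤n*m Y 54)
  main : ∀ n → 432 * L ≤ n → ∀ (H : Graph3 n) → Free 𝓜 H →
    ((ℤ.+ 2 ℚ./ 27) ℚ.* ℕ→ℚ (n ^ 3) ℚ.- recip q q≥1 ℚ.* ℕ→ℚ (n ^ 3)) ℚ.≤ ℕ→ℚ ∣ H ∣E →
    Σ ℕ λ m → Σ (Fin m → Fin n) λ ι → Injective _≡_ _≡_ ι × (ℕ→ℚ (n ∸ m) ℚ.≤ δ ℚ.* ℕ→ℚ n) × (Semibipartite (pull H ι) ⊎ G26Colorable (pull H ι))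
  main n n≥ H free dense = size , elem , elem-injective , scaled-≤ {d} {δ} {n ∸ size} {n} δ>0 (proj₂ (proj₂ (archimedes δ δ>0))) dz≤n , Good⇒coloured H G good (enumerate G)
    where
    E = edges H
    open Structure E (free-rules H free)
    G : Fin n → Bool
    G = high? one Kτ
    open Enumeration (enumerate G)
    N≡ : ∑ {n} one ≡ n
    N≡ = ∑-one {n}
    def : Defect Y (cube (kern E) one) (∑ {n} one)
    def = subst (λ m → 4 * Y * (m * m * m) ≤ 9 * Y * cube (kern E) one + m * m * m) (sym N≡)
      (arith Y (n * n * n) ∣ H ∣E (cube (kern E) one) (54*edges H) (subst (λ m → 2 * q * m ≤ 27 * q * ∣ H ∣E + 27 * m) (cube-power n) (density-≤ {q} q≥1 (n ^ 3) ∣ H ∣E dense)))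
      where
      arith : ∀ Y m h t → 54 * h ≡ 9 * t → 2 * (54 * Y) * m ≤ 27 * (54 * Y) * h + 27 * m → 4 * Y * m ≤ 9 * Y * t + m
      arith Y m h t eq le = *-cancelˡ-≤ 27 (≤-cert 0 (le ⊕ (27 * Y) ⊛ ≤-reflexive eq) (e Y m h t))
        where e : ∀ Y m h t → 27 * (9 * Y * t + m) + (2 * (54 * Y) * m + 27 * Y * (54 * h)) ≡ 27 * (4 * Y * m) + (27 * (54 * Y) * h + 27 * m + 27 * Y * (9 * t)) + 0
              e = solve-∀
    good : Good E G
    good = near-extremal one (subst (432 * L ≤_) (sym N≡) n≥) (weaken Yτ d (cube (kern E) one) (∑ {n} one * ∑ {n} one * ∑ {n} one) d≥1 def)
    z : ℕ
    z = ∑ λ x → b2n (not (G x))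
    n∸size : n ∸ size ≡ z
    n∸size = trans (cong₂ _∸_ split size≡) (m+n∸m≡n (∑ (b2n ∘ G)) z)
      where
      split : n ≡ ∑ (b2n ∘ G) + z
      split = trans (sym N≡) (trans (∑-cong λ x → lem (G x)) (∑-+ _ _))
        where lem : ∀ b → 1 ≡ b2n b + b2n (not b)
              lem true = refl
              lem false = refl
    dz≤n : d * (n ∸ size) ≤ n
    dz≤n = subst (λ x → d * x ≤ n) (sym n∸size) (low-multiple E (free-rules H free) d n≥ def)

stable-2 : Stable 𝓜 2
stable-2 = 0 , target , λ δ δ>0 → let (d , d≥1 , dδ) = archimedes δ δ>0 in recip (8 * Y d) (q≥1 d d≥1) , recip-positive (8 * Y d) (q≥1 d d≥1) , 86 * Y d + 432 * L + 216 * d ,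
    λ n n≥ _ e ex H free big → let (i , σ , le) = close d d≥1 n n≥ e ex H free big in i , σ , scaled-≤ {d} {δ} {editDist H (target i n) σ} {∣ H ∣E} δ>0 dδ le
  where
  Y : ℕ → ℕ
  Y d = Yτ * accuracy d
  acc≥1 : ∀ d → 1 ≤ d → 1 ≤ accuracy d
  acc≥1 d h = *-mono-≤ {1} {216} (s≤s z≤n) (*-mono-≤ A≥1 A≥1)
    where A≥1 : 1 ≤ 180 * d
          A≥1 = *-mono-≤ {1} {180} (s≤s z≤n) h
  Y≥1 : ∀ d → 1 ≤ d → 1 ≤ Y d
  Y≥1 d h = *-mono-≤ Yτ≥1 (acc≥1 d h)
  q≥1 : ∀ d → 1 ≤ d → 1 ≤ 8 * Y d
  q≥1 d h = ≤-trans (Y≥1 d h) (m≤n*m (Y d) 8)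
  close : ∀ d (d≥1 : 1 ≤ d) n → 86 * Y d + 432 * L + 216 * d ≤ n → ∀ e → IsEx 𝓜 n e → ∀ (H : Graph3 n) → Free 𝓜 H →
    (1ℚ ℚ.- recip (8 * Y d) (q≥1 d d≥1)) ℚ.* ℕ→ℚ e ℚ.< ℕ→ℚ ∣ H ∣E → Σ (Fin 2) λ i → Σ (Permutation′ n) λ σ → d * editDist H (target i n) σ ≤ ∣ H ∣E
  close d d≥1 n n≥ e ((X , X-free , X≡e) , max) H free big = TwoStable.near-target d d≥1 H free (≤-trans (≤-trans (m≤n+m (432 * L) (86 * Y d)) (m≤m+n _ (216 * d))) n≥) (≤-trans (m≤n+m (216 * d) (86 * Y d + 432 * L)) n≥)
    (arith n (Y d) ∣ G1 n ∣E e ∣ H ∣E (cube (kern (edges H)) one) (≤-trans (≤-trans (m≤m+n (86 * Y d) (432 * L)) (m≤m+n _ (216 * d))) n≥) (G1-lower n) (max (G1 n) (G1-free n)) (fraction-≤ {8 * Y d} (q≥1 d d≥1) e ∣ H ∣E big) (54*edges H) ex-upper)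
    where
    -- Half of the permitted defect pays for the term 43n² in `G1-lower`, hence 86Y ≤ n; the other
    -- half pays for ε = 1/8Y.
    arith : ∀ n Y g e h t → 86 * Y ≤ n → 4 * (n * n * n) ≤ 54 * g + 43 * (n * n) → g ≤ e → 8 * Y * e ≤ 8 * Y * h + e → 54 * h ≡ 9 * t → 54 * e ≤ 4 * (n * n * n) → 4 * Y * (n * n * n) ≤ 9 * Y * t + n * n * n
    arith n Y g e h t hn hg ge he ht hu = *-cancelˡ-≤ 8 (≤-cert 0 ((8 * Y) ⊛ hg ⊕ (432 * Y) ⊛ ge ⊕ 54 ⊛ he ⊕ hu ⊕ (4 * (n * n)) ⊛ hn ⊕ (8 * Y) ⊛ ≤-reflexive ht) (eq n Y g e h t))
      where eq : ∀ n Y g e h t → 8 * (9 * Y * t + n * n * n) + (8 * Y * (4 * (n * n * n)) + (432 * Y * g + (54 * (8 * Y * e) + (54 * e + (4 * (n * n) * (86 * Y) + 8 * Y * (54 * h))))))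
              ≡ 8 * (4 * Y * (n * n * n)) + (8 * Y * (54 * g + 43 * (n * n)) + (432 * Y * e + (54 * (8 * Y * h + e) + (4 * (n * n * n) + (4 * (n * n) * n + 8 * Y * (9 * t)))))) + 0
            eq = solve-∀
    ex-upper : 54 * e ≤ 4 * (n * n * n)
    ex-upper = subst (λ x → 54 * x ≤ 4 * (n * n * n)) X≡e (≤-trans (≤-reflexive (54*edges X)) (≤-trans (Structure.cube-bound (edges X) (free-rules X X-free) one) (≤-reflexive (cong (λ m → 4 * (m * m * m)) (∑-one {n})))))

-- With at most one target, the balanced blowup and `G1` on n = 6k vertices, both free and nearly
-- extremal, would be close to the same graph, against `far-apart`.
¬stable-<2 : ∀ s → s < 2 → ¬ Stable 𝓜 s
¬stable-<2 s s<2 (m₀ , 𝓗 , st) = contradict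
  where
  gap≥1 : 1 ≤ gap
  gap≥1 = ≤-trans (s≤s z≤n) gap≥
  δ = recip gap gap≥1
  same : ∀ {s} → s < 2 → (i j : Fin s) → i ≡ j
  same {1} _ zero zero = refl
  same {suc (suc _)} (s≤s (s≤s ()))
  contradict : ⊥
  contradict = let (ε , ε>0 , n₀ , close) = st δ (recip-positive gap gap≥1) ; (q , _ , qε) = archimedes ε ε>0 in refute ε n₀ close q qε
   where
   refute : ∀ ε n₀ → (∀ n → n₀ ≤ n → m₀ ≤ n → ∀ e → IsEx 𝓜 n e → ∀ (H : Graph3 n) → Free 𝓜 H → (1ℚ ℚ.- ε) ℚ.* ℕ→ℚ e ℚ.< ℕ→ℚ ∣ H ∣E →
      Σ (Fin s) λ i → Σ (Permutation′ n) λ σ → ℕ→ℚ (editDist H (𝓗 i n) σ) ℚ.≤ δ ℚ.* ℕ→ℚ ∣ H ∣E) → ∀ q → 1ℚ ℚ.≤ ℕ→ℚ q ℚ.* ε → ⊥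
   refute ε n₀ close q qε = fail (close n n₀≤n m₀≤n ∣ B ∣E ex B B-free (⇒fraction-< {q} {ε} ∣ B ∣E ∣ B ∣E qε big-B)) (close n n₀≤n m₀≤n ∣ B ∣E ex (G1 n) (G1-free n) (⇒fraction-< {q} {ε} ∣ B ∣E ∣ G1 n ∣E qε big-A))
    where
    -- The summand 2q makes the deficit of `G1` against the extremal number, of order n², smaller
    -- than a fraction 1/q of the edges; the 1 keeps k positive.
    k = n₀ + m₀ + 2 * q + 1
    n = k * 6
    B : Graph3 n
    B = Balanced n
    k≥1 : 1 ≤ k
    k≥1 = m≤n+m 1 (n₀ + m₀ + 2 * q)
    k≤n : k ≤ n
    k≤n = m≤m*n k 6
    n₀≤n : n₀ ≤ n
    n₀≤n = ≤-trans (≤-trans (m≤m+n n₀ m₀) (≤-trans (m≤m+n _ (2 * q)) (m≤m+n _ 1))) k≤n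
    m₀≤n : m₀ ≤ n
    m₀≤n = ≤-trans (≤-trans (m≤n+m m₀ n₀) (≤-trans (m≤m+n _ (2 * q)) (m≤m+n _ 1))) k≤n
    2q≤k : 2 * q ≤ k
    2q≤k = ≤-trans (m≤n+m (2 * q) (n₀ + m₀)) (m≤m+n _ 1)
    B-free : Free 𝓜 B
    B-free = Balanced-free k k≥1
    ex : IsEx 𝓜 n ∣ B ∣E
    ex = (B , B-free , refl) , λ H free → *-cancelˡ-≤ 54 (≤-trans (≤-reflexive (54*edges H)) (≤-trans (Structure.cube-bound (edges H) (free-rules H free) one) (≤-reflexive (trans (cong (λ m → 4 * (m * m * m)) (∑-one {n})) (trans (e k) (cong (54 *_) (sym (Balanced-count k))))))))
      where e : ∀ k → 4 * (k * 6 * (k * 6) * (k * 6)) ≡ 54 * (16 * (k * k * k))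
            e = solve-∀
    B≥1 : 1 ≤ ∣ B ∣E
    B≥1 = ≤-trans (*-mono-≤ {1} {16} (s≤s z≤n) (*-mono-≤ (*-mono-≤ k≥1 k≥1) k≥1)) (≤-reflexive (sym (Balanced-count k)))
    big-B : q * ∣ B ∣E < q * ∣ B ∣E + ∣ B ∣E
    big-B = ≤-trans (≤-reflexive (+-comm 1 _)) (+-monoʳ-≤ (q * ∣ B ∣E) B≥1)
    big-A : q * ∣ B ∣E < q * ∣ G1 n ∣E + ∣ B ∣E
    big-A = subst (λ b → q * b < q * ∣ G1 n ∣E + b) (sym (Balanced-count k)) (arith k q ∣ G1 n ∣E k≥1 2q≤k (G1-lower n))
      where
      arith : ∀ k q g → 1 ≤ k → 2 * q ≤ k → 4 * (k * 6 * (k * 6) * (k * 6)) ≤ 54 * g + 43 * (k * 6 * (k * 6)) → q * (16 * (k * k * k)) < q * g + 16 * (k * k * k)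
      arith k q g k≥1 hq hg = *-cancelˡ-≤ 54 (≤-cert 36 (q ⊛ hg ⊕ (774 * (k * k)) ⊛ hq ⊕ 90 ⊛ *-mono-≤ (*-mono-≤ k≥1 k≥1) k≥1) (e k q g))
        where e : ∀ k q g → 54 * (q * g + 16 * (k * k * k)) + (q * (4 * (k * 6 * (k * 6) * (k * 6))) + (774 * (k * k) * (2 * q) + 90))
                ≡ 54 * suc (q * (16 * (k * k * k))) + (q * (54 * g + 43 * (k * 6 * (k * 6))) + (774 * (k * k) * k + 90 * (k * k * k))) + 36
              e = solve-∀
    fail : (Σ (Fin s) λ i → Σ (Permutation′ n) λ σ → ℕ→ℚ (editDist B (𝓗 i n) σ) ℚ.≤ δ ℚ.* ℕ→ℚ ∣ B ∣E) → (Σ (Fin s) λ i → Σ (Permutation′ n) λ σ → ℕ→ℚ (editDist (G1 n) (𝓗 i n) σ) ℚ.≤ δ ℚ.* ℕ→ℚ ∣ G1 n ∣E) → ⊥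
    fail (i , σ , h) (j , σ′ , h′) = meet i j σ σ′ (same s<2 i j) h h′
     where
     meet : ∀ i j σ σ′ → i ≡ j → ℕ→ℚ (editDist B (𝓗 i n) σ) ℚ.≤ δ ℚ.* ℕ→ℚ ∣ B ∣E → ℕ→ℚ (editDist (G1 n) (𝓗 j n) σ′) ℚ.≤ δ ℚ.* ℕ→ℚ ∣ G1 n ∣E → ⊥
     meet i .i σ σ′ refl h h′ = FarApart.far-apart k k≥1 (𝓗 i n) σ σ′ (unscaled-≤ {gap} gap≥1 {editDist B (𝓗 i n) σ} {∣ B ∣E} h) (unscaled-≤ {gap} gap≥1 {editDist (G1 n) (𝓗 i n) σ′} {∣ G1 n ∣E} h′)

theorem1p13 : (∀ (δ : ℚ) → 0ℚ ℚ.< δ → Σ ℚ λ ε → 0ℚ ℚ.< ε × Σ ℕ λ n₀ →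
    ∀ n → n₀ ≤ n → ∀ (H : Graph3 n) → Free 𝓜 H →
    ((ℤ.+ 2 ℚ./ 27) ℚ.* ℕ→ℚ (n ^ 3) ℚ.- ε ℚ.* ℕ→ℚ (n ^ 3)) ℚ.≤ ℕ→ℚ ∣ H ∣E →
    Σ ℕ λ m → Σ (Fin m → Fin n) λ ι → Injective _≡_ _≡_ ι ×
    (ℕ→ℚ (n ∸ m) ℚ.≤ δ ℚ.* ℕ→ℚ n) ×
    (Semibipartite (pull H ι) ⊎ G26Colorable (pull H ι)))
    × ξ≡ 𝓜 2
theorem1p13 = vertex-stability , stable-2 , ¬stable-<2
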